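{- Let $r \ge 2$ be a fixed integer and let $m, d, k \ge 1$ be integers such that $k \in o(\sqrt m)$. Let $\epsilon_r = (1 - 2^{ -1/r})^r$. Let $\Psi$ be an $m$-variable $(d,k)$-CSP with variable frequency at most $r$. Then the algorithm $\mathsf{CSP\text{ - }SAT}(\Psi)$ (described in the context) correctly decides the satisfiability of $\Psi$. Moreover, if $d \ge 3$ then it runs deterministically in time $d^{(1-\epsilon_r)m + o(m)}$; if $d = 2$ then it runs in expected time $2^{(1-\epsilon_r)m + o(m)}$ if the separator $R$ used by the algorithm is found randomly, and in deterministic time $2^{(1-2\epsilon_r^2)m + o(m)}$ if $R$ is found deterministically.
   Context: A $(d,k)$-CSP $\Psi = (X,\mathcal C)$ consists of a set $X$ of variables taking values in an alphabet $\Sigma$ of size $d$ and a set $\mathcal C$ of constraints, each on at most $k$ of the variables; it is given by the truth tables of its constraints. An assignment satisfies $\Psi$ if it satisfies every constraint. The variable frequency of $\Psi$ is the largest number of constraints that any variable appears in. For a partial assignment $\rho$, $\Psi|_\rho$ is the CSP on the remaining variables obtained by fixing in every constraint the values given by $\rho$. The hypergraph $H_\Psi = (V,E)$ has vertex set $V = \mathcal C$ and, for each variable $x \in X$, a hyperedge $e_x$ consisting of all constraints containing $x$. It thus has $m$ hyperedges of size at most $r$ and maximum vertex degree at most $k$. A balanced separator of a hypergraph $(V,E)$ is a set $R \subseteq E$ such that every connected component of $(V, E\setminus R)$ is incident to at most $|E|/2$ edges of $E \setminus R$. Algorithm $\mathsf{CSP\text{ - }SAT}(\Psi)$: Construct $H_\Psi$.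 Find a balanced separator $R$ of $H_\Psi$ of size at most $(\frac12 - \epsilon_r)m + o(m)$, in one of two ways. Randomly: after padding hyperedges with new vertices so that all have size $r$ (keeping maximum degree at most $k$) and discarding isolated vertices, repeatedly choose a random vertex set $S$, including each vertex independently with probability $2^{ -1/r}$, until the number of hyperedges inside $S$ is $m/2 \pm o(m)$ and the number of hyperedges meeting both $S$ and its complement $\overline S$ is at most $(\frac12-\epsilon_r)m + o(m)$; take $R$ to be the latter hyperedges together with $o(m)$ further hyperedges chosen so that at most $m/2$ remain inside each of $S$ and $\overline S$ (expected polynomial time). Deterministically: exhaustively check all sets of at most $(\frac12-\epsilon_r)m+o(m)$ hyperedges. Then, for every assignment $\rho \in \Sigma^R$ to the variables corresponding to the hyperedges of $R$: write $\Psi|_\rho = \bigwedge_{i=1}^t \Psi_i$, where the $\Psi_i$ correspond to the connected components of $H_{\Psi|_\rho}$ (which is $H_\Psi$ with the hyperedges of $R$ removed); for each $i$ exhaustively check whether $\Psi_i$ is satisfiable; if all $\Psi_i$ are satisfiable, return "satisfiable". If no $\rho$ leads to this, return "unsatisfiable". Asymptotic notation is as $m \to \infty$ with $r$ fixed. -}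

module Defs where

open import Data.Bool.Base using (Bool; true; false; if_then_else_; _∧_)
open import Data.Fin.Base using (Fin; zero; suc)
open import Data.Fin.Properties using (_≟_)
open import Data.Integer.Base using (+_)
import Data.Integer.Base as ℤ
import Data.Integer.Properties as ℤₚ
open import Data.List.Base using (List; []; _∷_; allFin)
import Data.List.Base as List
open import Data.List.Extrema.Nat using (max)
open import Data.Maybe.Base using (Maybe; just; nothing; is-nothing)
open import Data.Nat.Base as ℕ using (ℕ; zero; suc; z≤n; s≤s)
import Data.Nat.Properties as ℕₚ
import Data.Nat.Tactic.RingSolver as ℕ-Solver
open import Data.Product.Base using (∃; _×_; _,_)
open import Data.Rational.Base as ℚ using (ℚ; 0ℚ; 1ℚ; ½)
import Data.Rational.Properties as ℚₚ
open import Data.Rational.Solver using (module +-*-Solver)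
import Data.Rational.Unnormalised.Base as ℚᵘ
import Data.Rational.Unnormalised.Properties as ℚᵘₚ
open import Data.Sum.Base using (_⊎_; inj₁; inj₂)
open import Data.Vec.Base as Vec using (Vec; []; _∷_; count)
open import Data.Vec.Membership.DecPropositional using (_∈?_)
open import Data.Vec.Relation.Unary.All using (All)
open import Data.Vec.Relation.Unary.Unique.Propositional using (Unique)
open import Relation.Binary.PropositionalEquality
  using (_≡_; refl; sym; trans; cong; cong₂; subst; subst₂)
open import Relation.Nullary using (yes; no; contradiction; Reflects)

private
  variable
    A B V : Set
    d m n : ℕ

-- Real numbers as Cauchy sequences of rationals with pointwise operations;
-- two of them denote the same number when _≤ᴿ_ holds in both directions.

record ℝ : Set where
  field
    seq    : ℕ → ℚ
    cauchy : ∀ ε → 0ℚ ℚ.< ε → ∃ λ N → ∀ i j → N ℕ.≤ i → N ℕ.≤ j →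
             ℚ.∣ seq i ℚ.- seq j ∣ ℚ.≤ ε

open ℝ public

infix  4 _≤ᴿ_
infixl 6 _+ᴿ_ _-ᴿ_
infixl 7 _*ᴿ_
infixr 8 _^ᴿ_

_≤ᴿ_ : ℝ → ℝ → Set
x ≤ᴿ y = ∀ ε → 0ℚ ℚ.< ε → ∃ λ N → ∀ i → N ℕ.≤ i →
         seq x i ℚ.≤ seq y i ℚ.+ ε

fromℚ : ℚ → ℝ
fromℚ q .seq _ = q
fromℚ q .cauchy ε 0<ε = 0 , λ _ _ _ _ →
  subst (λ z → ℚ.∣ z ∣ ℚ.≤ ε) (sym (ℚₚ.+-inverseʳ q)) (ℚₚ.<⇒≤ 0<ε)

fromℕ : ℕ → ℝ
fromℕ n = fromℚ (+ n ℚ./ 1)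

open +-*-Solver

half-pos : ∀ {ε} → 0ℚ ℚ.< ε → 0ℚ ℚ.< ½ ℚ.* ε
half-pos {ε} 0<ε =
  subst (ℚ._< ½ ℚ.* ε) (ℚₚ.*-zeroʳ ½) (ℚₚ.*-monoʳ-<-pos ½ 0<ε)

half+half : ∀ ε → ½ ℚ.* ε ℚ.+ ½ ℚ.* ε ≡ ε
half+half ε = solve 1 (λ e → con ½ :* e :+ con ½ :* e := e) refl ε

diff-+ : ∀ x y x′ y′ →
         (x ℚ.+ y) ℚ.- (x′ ℚ.+ y′) ≡ (x ℚ.- x′) ℚ.+ (y ℚ.- y′)
diff-+ = solve 4 (λ x y x′ y′ →
  (x :+ y) :- (x′ :+ y′) := (x :- x′) :+ (y :- y′)) refl

diff-neg : ∀ x x′ → (ℚ.- x) ℚ.- (ℚ.- x′) ≡ ℚ.- (x ℚ.- x′)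
diff-neg = solve 2 (λ x x′ → (:- x) :- (:- x′) := :- (x :- x′)) refl

diff-* : ∀ x y x′ y′ →
         x ℚ.* y ℚ.- x′ ℚ.* y′ ≡ x ℚ.* (y ℚ.- y′) ℚ.+ y′ ℚ.* (x ℚ.- x′)
diff-* = solve 4 (λ x y x′ y′ →
  x :* y :- x′ :* y′ := x :* (y :- y′) :+ y′ :* (x :- x′)) refl

recover : ∀ x y → (x ℚ.- y) ℚ.+ y ≡ x
recover = solve 2 (λ x y → (x :- y) :+ y := x) refl

_+ᴿ_ : ℝ → ℝ → ℝ
(x +ᴿ y) .seq i = seq x i ℚ.+ seq y i
(x +ᴿ y) .cauchy ε 0<ε
  with Nx , px ← cauchy x (½ ℚ.* ε) (half-pos 0<ε)
     | Ny , py ← cauchy y (½ ℚ.* ε) (half-pos 0<ε)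
  = Nx ℕ.⊔ Ny , λ i j N≤i N≤j → begin
    ℚ.∣ (seq x i ℚ.+ seq y i) ℚ.- (seq x j ℚ.+ seq y j) ∣
      ≡⟨ cong ℚ.∣_∣ (diff-+ (seq x i) (seq y i) (seq x j) (seq y j)) ⟩
    ℚ.∣ (seq x i ℚ.- seq x j) ℚ.+ (seq y i ℚ.- seq y j) ∣
      ≤⟨ ℚₚ.∣p+q∣≤∣p∣+∣q∣ (seq x i ℚ.- seq x j) (seq y i ℚ.- seq y j) ⟩
    ℚ.∣ seq x i ℚ.- seq x j ∣ ℚ.+ ℚ.∣ seq y i ℚ.- seq y j ∣
      ≤⟨ ℚₚ.+-mono-≤
           (px i j (ℕₚ.m⊔n≤o⇒m≤o Nx Ny N≤i) (ℕₚ.m⊔n≤o⇒m≤o Nx Ny N≤j))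
           (py i j (ℕₚ.m⊔n≤o⇒n≤o Nx Ny N≤i) (ℕₚ.m⊔n≤o⇒n≤o Nx Ny N≤j)) ⟩
    ½ ℚ.* ε ℚ.+ ½ ℚ.* ε
      ≡⟨ half+half ε ⟩
    ε ∎
  where open ℚₚ.≤-Reasoning

-ᴿ_ : ℝ → ℝ
(-ᴿ x) .seq i = ℚ.- seq x i
(-ᴿ x) .cauchy ε 0<ε with N , p ← cauchy x ε 0<ε
  = N , λ i j N≤i N≤j → subst (ℚ._≤ ε)
      (trans (sym (ℚₚ.∣-p∣≡∣p∣ (seq x i ℚ.- seq x j)))
             (cong ℚ.∣_∣ (sym (diff-neg (seq x i) (seq x j)))))
      (p i j N≤i N≤j)

_-ᴿ_ : ℝ → ℝ → ℝ
x -ᴿ y = x +ᴿ (-ᴿ y)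

0<1ℚ : 0ℚ ℚ.< 1ℚ
0<1ℚ = ℚₚ.positive⁻¹ 1ℚ

bounded : ∀ x → ∃ λ N → ∃ λ b →
          0ℚ ℚ.< b × (∀ i → N ℕ.≤ i → ℚ.∣ seq x i ∣ ℚ.≤ b)
bounded x with N , p ← cauchy x 1ℚ 0<1ℚ
  = N , 1ℚ ℚ.+ ℚ.∣ seq x N ∣
  , ℚₚ.+-mono-<-≤ 0<1ℚ (ℚₚ.0≤∣p∣ (seq x N))
  , λ i N≤i → begin
    ℚ.∣ seq x i ∣
      ≡⟨ cong ℚ.∣_∣ (sym (recover (seq x i) (seq x N))) ⟩
    ℚ.∣ (seq x i ℚ.- seq x N) ℚ.+ seq x N ∣
      ≤⟨ ℚₚ.∣p+q∣≤∣p∣+∣q∣ (seq x i ℚ.- seq x N) (seq x N) ⟩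
    ℚ.∣ seq x i ℚ.- seq x N ∣ ℚ.+ ℚ.∣ seq x N ∣
      ≤⟨ ℚₚ.+-monoˡ-≤ ℚ.∣ seq x N ∣ (p i N N≤i ℕₚ.≤-refl) ⟩
    1ℚ ℚ.+ ℚ.∣ seq x N ∣ ∎
  where open ℚₚ.≤-Reasoning

*-mono : ∀ {p q u v} → 0ℚ ℚ.< u → p ℚ.≤ u → 0ℚ ℚ.≤ q → q ℚ.≤ v →
         p ℚ.* q ℚ.≤ u ℚ.* v
*-mono {p} {q} {u} {v} 0<u p≤u 0≤q q≤v = ℚₚ.≤-trans
  (ℚₚ.*-monoʳ-≤-nonNeg q {{ℚ.nonNegative 0≤q}} p≤u)
  (ℚₚ.*-monoˡ-≤-nonNeg u {{ℚ.nonNegative (ℚₚ.<⇒≤ 0<u)}} q≤v)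

scale : ∀ b ε → 0ℚ ℚ.< b → 0ℚ ℚ.< ε → ∃ λ δ → 0ℚ ℚ.< δ × b ℚ.* δ ≡ ε
scale b ε 0<b 0<ε = (ℚ.1/ b) ℚ.* ε
  , subst (ℚ._< (ℚ.1/ b) ℚ.* ε) (ℚₚ.*-zeroʳ (ℚ.1/ b))
      (ℚₚ.*-monoʳ-<-pos (ℚ.1/ b) {{ℚₚ.1/pos⇒pos b}} 0<ε)
  , trans (sym (ℚₚ.*-assoc b (ℚ.1/ b) ε))
      (trans (cong (ℚ._* ε) (ℚₚ.*-inverseʳ b)) (ℚₚ.*-identityˡ ε))
  where instance
    b>0 = ℚ.positive 0<b
    b≢0 = ℚₚ.pos⇒nonZero b

*-close : ∀ x y x′ y′ bx by δ → 0ℚ ℚ.< bx → 0ℚ ℚ.< by →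
          ℚ.∣ x ∣ ℚ.≤ bx → ℚ.∣ y′ ∣ ℚ.≤ by →
          ℚ.∣ x ℚ.- x′ ∣ ℚ.≤ δ → ℚ.∣ y ℚ.- y′ ∣ ℚ.≤ δ →
          ℚ.∣ x ℚ.* y ℚ.- x′ ℚ.* y′ ∣ ℚ.≤ (bx ℚ.+ by) ℚ.* δ
*-close x y x′ y′ bx by δ 0<bx 0<by x≤ y′≤ dx≤ dy≤ = begin
  ℚ.∣ x ℚ.* y ℚ.- x′ ℚ.* y′ ∣
    ≡⟨ cong ℚ.∣_∣ (diff-* x y x′ y′) ⟩
  ℚ.∣ x ℚ.* (y ℚ.- y′) ℚ.+ y′ ℚ.* (x ℚ.- x′) ∣
    ≤⟨ ℚₚ.∣p+q∣≤∣p∣+∣q∣ (x ℚ.* (y ℚ.- y′)) (y′ ℚ.* (x ℚ.- x′)) ⟩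
  ℚ.∣ x ℚ.* (y ℚ.- y′) ∣ ℚ.+ ℚ.∣ y′ ℚ.* (x ℚ.- x′) ∣
    ≡⟨ cong₂ ℚ._+_ (ℚₚ.∣p*q∣≡∣p∣*∣q∣ x (y ℚ.- y′))
                   (ℚₚ.∣p*q∣≡∣p∣*∣q∣ y′ (x ℚ.- x′)) ⟩
  ℚ.∣ x ∣ ℚ.* ℚ.∣ y ℚ.- y′ ∣ ℚ.+ ℚ.∣ y′ ∣ ℚ.* ℚ.∣ x ℚ.- x′ ∣
    ≤⟨ ℚₚ.+-mono-≤
         (*-mono {ℚ.∣ x ∣} {ℚ.∣ y ℚ.- y′ ∣} {bx} {δ}
           0<bx x≤ (ℚₚ.0≤∣p∣ (y ℚ.- y′)) dy≤)
         (*-mono {ℚ.∣ y′ ∣} {ℚ.∣ x ℚ.- x′ ∣} {by} {δ}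
           0<by y′≤ (ℚₚ.0≤∣p∣ (x ℚ.- x′)) dx≤) ⟩
  bx ℚ.* δ ℚ.+ by ℚ.* δ
    ≡⟨ sym (ℚₚ.*-distribʳ-+ δ bx by) ⟩
  (bx ℚ.+ by) ℚ.* δ ∎
  where open ℚₚ.≤-Reasoning

_*ᴿ_ : ℝ → ℝ → ℝ
(x *ᴿ y) .seq i = seq x i ℚ.* seq y i
(x *ᴿ y) .cauchy ε 0<ε =
  let Mx , bx , 0<bx , qx = bounded x
      My , by , 0<by , qy = bounded y
      δ , 0<δ , eq = scale (bx ℚ.+ by) ε (ℚₚ.+-mono-< 0<bx 0<by) 0<ε
      Nx , px = cauchy x δ 0<δ
      Ny , py = cauchy y δ 0<δ
      M = Mx ℕ.⊔ My
      N = Nx ℕ.⊔ Ny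
  in M ℕ.⊔ N , λ i j ≤i ≤j →
    subst (ℚ.∣ seq x i ℚ.* seq y i ℚ.- seq x j ℚ.* seq y j ∣ ℚ.≤_) eq
      (*-close (seq x i) (seq y i) (seq x j) (seq y j) bx by δ 0<bx 0<by
        (qx i (ℕₚ.m⊔n≤o⇒m≤o Mx My (ℕₚ.m⊔n≤o⇒m≤o M N ≤i)))
        (qy j (ℕₚ.m⊔n≤o⇒n≤o Mx My (ℕₚ.m⊔n≤o⇒m≤o M N ≤j)))
        (px i j (ℕₚ.m⊔n≤o⇒m≤o Nx Ny (ℕₚ.m⊔n≤o⇒n≤o M N ≤i))
                (ℕₚ.m⊔n≤o⇒m≤o Nx Ny (ℕₚ.m⊔n≤o⇒n≤o M N ≤j)))
        (py i j (ℕₚ.m⊔n≤o⇒n≤o Nx Ny (ℕₚ.m⊔n≤o⇒n≤o M N ≤i))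
                (ℕₚ.m⊔n≤o⇒n≤o Nx Ny (ℕₚ.m⊔n≤o⇒n≤o M N ≤j))))

_^ᴿ_ : ℝ → ℕ → ℝ
x ^ᴿ zero  = fromℕ 1
x ^ᴿ suc n = x *ᴿ (x ^ᴿ n)

-- y ≤ d ^ x for a real exponent x ≥ 0 and y ≥ 0, where d ^ x is the infimum
-- of the rational powers d ^ (a / (b + 1)) with x ≤ a / (b + 1).

_≤_^^_ : ℝ → ℕ → ℝ → Set
y ≤ d ^^ x = ∀ a b → x ≤ᴿ fromℚ (+ a ℚ./ suc b) →
             y ^ᴿ suc b ≤ᴿ fromℕ (d ℕ.^ a)

-- The largest j ≤ i with 2 · jʳ ≤ Nʳ, so that, for N = n + 1 and r ≥ 1,
-- j / N is the multiple of 1 / N just below 2^(-1/r).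

scaledRoot : (r N i : ℕ) → ℕ
scaledRoot r N zero    = 0
scaledRoot r N (suc i) with 2 ℕ.* suc i ℕ.^ r ℕₚ.≤? N ℕ.^ r
... | yes _ = suc i
... | no  _ = scaledRoot r N i

approxRoot : ℕ → ℕ → ℚ
approxRoot r n = + scaledRoot r (suc n) (suc n) ℚ./ suc n

root-lower : ∀ r N i → 2 ℕ.* scaledRoot (suc r) N i ℕ.^ suc r ℕ.≤ N ℕ.^ suc r
root-lower r N zero    = z≤n
root-lower r N (suc i) with 2 ℕ.* suc i ℕ.^ suc r ℕₚ.≤? N ℕ.^ suc r
... | yes p = p
... | no  _ = root-lower r N i

root-upper : ∀ r N i j → scaledRoot r N i ℕ.< j → j ℕ.≤ i →
             N ℕ.^ r ℕ.< 2 ℕ.* j ℕ.^ r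
root-upper r N zero    (suc j) _ ()
root-upper r N (suc i) j l<j j≤i with 2 ℕ.* suc i ℕ.^ r ℕₚ.≤? N ℕ.^ r
... | yes _ = contradiction j≤i (ℕₚ.<⇒≱ l<j)
... | no ¬p with ℕₚ.m≤n⇒m<n∨m≡n j≤i
...   | inj₁ j<i  = root-upper r N i j l<j (ℕₚ.≤-pred j<i)
...   | inj₂ refl = ℕₚ.≰⇒> ¬p

root-gap : ∀ r M → suc M ℕ.^ r ℕ.< 2 ℕ.* suc (scaledRoot r (suc M) (suc M)) ℕ.^ r
root-gap r M with suc (scaledRoot r (suc M) (suc M)) ℕₚ.≤? suc M
... | yes p = root-upper r (suc M) (suc M) _ ℕₚ.≤-refl p
... | no ¬p = ℕₚ.≤-<-trans (ℕₚ.^-monoˡ-≤ r (ℕₚ.<⇒≤ (ℕₚ.≰⇒> ¬p)))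
  (subst (ℕ._< 2 ℕ.* b) (ℕₚ.*-identityˡ b)
    (ℕₚ.*-monoˡ-< b {{ℕₚ.m^n≢0 l r}} (ℕₚ.n<1+n 1)))
  where
  l = suc (scaledRoot r (suc M) (suc M))
  b = l ℕ.^ r

^-distribʳ-* : ∀ r x y → (x ℕ.* y) ℕ.^ r ≡ x ℕ.^ r ℕ.* y ℕ.^ r
^-distribʳ-* zero    x y = refl
^-distribʳ-* (suc r) x y = trans (cong (x ℕ.* y ℕ.*_) (^-distribʳ-* r x y))
  (ℕₚ.[m*n]*[o*p]≡[m*o]*[n*p] x y (x ℕ.^ r) (y ℕ.^ r))

fraction-≤ : ∀ a b i j → a ℕ.* suc j ℕ.≤ suc b ℕ.* suc i →
  + a ℚ./ suc i ℚ.≤ + b ℚ./ suc j ℚ.+ + 1 ℚ./ suc j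
fraction-≤ a b i j a*M≤ = ℚₚ.toℚᵘ-cancel-≤ (begin
  ℚ.toℚᵘ (+ a ℚ./ suc i)
    ≃⟨ ℚₚ.toℚᵘ-fromℚᵘ (ℚᵘ.mkℚᵘ (+ a) i) ⟩
  ℚᵘ.mkℚᵘ (+ a) i
    ≤⟨ ℚᵘ.*≤* (subst₂ ℤ._≤_ (ℤₚ.pos-* a (suc j)) (ℤₚ.pos-* (suc b) (suc i)) (ℤ.+≤+ a*M≤)) ⟩
  ℚᵘ.mkℚᵘ (+ suc b) j
    ≃⟨ ℚᵘ.*≡* step ⟩
  ℚᵘ.mkℚᵘ (+ b) j ℚᵘ.+ ℚᵘ.mkℚᵘ (+ 1) j
    ≃⟨ ℚᵘₚ.+-cong (ℚₚ.toℚᵘ-fromℚᵘ (ℚᵘ.mkℚᵘ (+ b) j)) (ℚₚ.toℚᵘ-fromℚᵘ (ℚᵘ.mkℚᵘ (+ 1) j)) ⟨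
  ℚ.toℚᵘ (+ b ℚ./ suc j) ℚᵘ.+ ℚ.toℚᵘ (+ 1 ℚ./ suc j)
    ≃⟨ ℚₚ.toℚᵘ-homo-+ (+ b ℚ./ suc j) (+ 1 ℚ./ suc j) ⟨
  ℚ.toℚᵘ (+ b ℚ./ suc j ℚ.+ + 1 ℚ./ suc j) ∎)
  where
  open ℚᵘₚ.≤-Reasoning
  M = suc j

  reassoc : ∀ b M → suc b ℕ.* (M ℕ.* M) ≡ (b ℕ.* M ℕ.+ 1 ℕ.* M) ℕ.* M
  reassoc = ℕ-Solver.solve-∀

  step : + suc b ℤ.* + (M ℕ.* M) ≡ (+ b ℤ.* + M ℤ.+ + 1 ℤ.* + M) ℤ.* + M
  step = trans (sym (ℤₚ.pos-* (suc b) (M ℕ.* M)))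
    (trans (cong +_ (reassoc b M))
    (trans (ℤₚ.pos-* (b ℕ.* M ℕ.+ 1 ℕ.* M) M)
           (cong (ℤ._* + M) (cong₂ ℤ._+_ (ℤₚ.pos-* b M) (ℤₚ.pos-* 1 M)))))

approxRoot-close : ∀ r i j →
  approxRoot (suc r) i ℚ.≤ approxRoot (suc r) j ℚ.+ + 1 ℚ./ suc j
approxRoot-close r′ i j = fraction-≤ a b i j (ℕₚ.≮⇒≥ λ p →
  ℕₚ.<-irrefl refl (begin-strict
    N ℕ.^ r ℕ.* M ℕ.^ r               ≡⟨ ℕₚ.*-comm (N ℕ.^ r) (M ℕ.^ r) ⟩
    M ℕ.^ r ℕ.* N ℕ.^ r               <⟨ ℕₚ.*-monoˡ-< (N ℕ.^ r) {{ℕₚ.m^n≢0 N r}} (root-gap r j) ⟩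
    2 ℕ.* suc b ℕ.^ r ℕ.* N ℕ.^ r     ≡⟨ ℕₚ.*-assoc 2 (suc b ℕ.^ r) (N ℕ.^ r) ⟩
    2 ℕ.* (suc b ℕ.^ r ℕ.* N ℕ.^ r)   ≡⟨ cong (2 ℕ.*_) (^-distribʳ-* r (suc b) N) ⟨
    2 ℕ.* (suc b ℕ.* N) ℕ.^ r         ≤⟨ ℕₚ.*-monoʳ-≤ 2 (ℕₚ.^-monoˡ-≤ r (ℕₚ.<⇒≤ p)) ⟩
    2 ℕ.* (a ℕ.* M) ℕ.^ r             ≡⟨ cong (2 ℕ.*_) (^-distribʳ-* r a M) ⟩
    2 ℕ.* (a ℕ.^ r ℕ.* M ℕ.^ r)       ≡⟨ ℕₚ.*-assoc 2 (a ℕ.^ r) (M ℕ.^ r) ⟨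
    2 ℕ.* a ℕ.^ r ℕ.* M ℕ.^ r         ≤⟨ ℕₚ.*-monoˡ-≤ (M ℕ.^ r) (root-lower r′ N N) ⟩
    N ℕ.^ r ℕ.* M ℕ.^ r               ∎))
  where
  open ℕₚ.≤-Reasoning
  r = suc r′
  N = suc i
  M = suc j
  a = scaledRoot r N N
  b = scaledRoot r M M

1/N-mono : ∀ {i N} → N ℕ.≤ i → + 1 ℚ./ suc i ℚ.≤ + 1 ℚ./ suc N
1/N-mono {i} {N} N≤i = ℚₚ.toℚᵘ-cancel-≤ (begin
  ℚ.toℚᵘ (+ 1 ℚ./ suc i) ≃⟨ ℚₚ.toℚᵘ-fromℚᵘ (ℚᵘ.mkℚᵘ (+ 1) i) ⟩
  ℚᵘ.mkℚᵘ (+ 1) i        ≤⟨ ℚᵘ.*≤* (ℤₚ.*-monoˡ-≤-nonNeg (+ 1) (ℤ.+≤+ (s≤s N≤i))) ⟩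
  ℚᵘ.mkℚᵘ (+ 1) N        ≃⟨ ℚₚ.toℚᵘ-fromℚᵘ (ℚᵘ.mkℚᵘ (+ 1) N) ⟨
  ℚ.toℚᵘ (+ 1 ℚ./ suc N) ∎)
  where open ℚᵘₚ.≤-Reasoning

archimedean : ∀ ε → 0ℚ ℚ.< ε → ∃ λ N → + 1 ℚ./ suc N ℚ.≤ ε
archimedean (ℚ.mkℚ (+ suc n) N c) _ = N , ℚₚ.toℚᵘ-cancel-≤ (begin
  ℚ.toℚᵘ (+ 1 ℚ./ suc N) ≃⟨ ℚₚ.toℚᵘ-fromℚᵘ (ℚᵘ.mkℚᵘ (+ 1) N) ⟩
  ℚᵘ.mkℚᵘ (+ 1) N        ≤⟨ ℚᵘ.*≤* (ℤₚ.*-monoʳ-≤-nonNeg (+ suc N) (ℤ.+≤+ (s≤s (z≤n {n})))) ⟩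
  ℚᵘ.mkℚᵘ (+ suc n) N    ∎)
  where open ℚᵘₚ.≤-Reasoning
archimedean (ℚ.mkℚ (+ 0) N c) (ℚ.*<* (ℤ.+<+ ()))
archimedean (ℚ.mkℚ ℤ.-[1+ n ] N c) (ℚ.*<* ())

∣p-q∣≤ : ∀ {p q ε} → p ℚ.≤ q ℚ.+ ε → q ℚ.≤ p ℚ.+ ε → ℚ.∣ p ℚ.- q ∣ ℚ.≤ ε
∣p-q∣≤ {p} {q} {ε} p≤ q≤ with ℚₚ.∣p∣≡p∨∣p∣≡-p (p ℚ.- q)
... | inj₁ eq = subst (ℚ._≤ ε) (sym eq)
      (subst (p ℚ.- q ℚ.≤_) (shift ε q) (ℚₚ.+-monoˡ-≤ (ℚ.- q) p≤))
  where
  shift : ∀ ε q → (q ℚ.+ ε) ℚ.- q ≡ ε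
  shift = solve 2 (λ ε q → (q :+ ε) :- q := ε) refl
... | inj₂ eq = subst (ℚ._≤ ε) (sym (trans eq (swap p q)))
      (subst (q ℚ.- p ℚ.≤_) (shift ε p) (ℚₚ.+-monoˡ-≤ (ℚ.- p) q≤))
  where
  shift : ∀ ε p → (p ℚ.+ ε) ℚ.- p ≡ ε
  shift = solve 2 (λ ε p → (p :+ ε) :- p := ε) refl
  swap : ∀ p q → ℚ.- (p ℚ.- q) ≡ q ℚ.- p
  swap = solve 2 (λ p q → :- (p :- q) := q :- p) refl

-- The real number 2^(-1/r); the value at r = 0 is a dummy.

2^-1/ : ℕ → ℝ
2^-1/ zero            = fromℕ 0
2^-1/ (suc r) .seq    = approxRoot (suc r)
2^-1/ (suc r) .cauchy ε 0<ε with N , 1/N≤ε ← archimedean ε 0<ε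
  = N , λ i j N≤i N≤j → ∣p-q∣≤
      (ℚₚ.≤-trans (approxRoot-close r i j) (ℚₚ.+-monoʳ-≤ (approxRoot (suc r) j)
        (ℚₚ.≤-trans (1/N-mono N≤j) 1/N≤ε)))
      (ℚₚ.≤-trans (approxRoot-close r j i) (ℚₚ.+-monoʳ-≤ (approxRoot (suc r) i)
        (ℚₚ.≤-trans (1/N-mono N≤i) 1/N≤ε)))

ε : ℕ → ℝ
ε r = (fromℕ 1 -ᴿ 2^-1/ r) ^ᴿ r

_∈o[m] : (ℕ → ℕ) → Set
f ∈o[m] = ∀ c → ∃ λ N → ∀ m → N ℕ.≤ m → c ℕ.* f m ℕ.≤ m

-- c · f(m) ≤ √m, squared.

_∈o[√m] : (ℕ → ℕ) → Set
f ∈o[√m] = ∀ c → ∃ λ N → ∀ m → N ℕ.≤ m → (c ℕ.* f m) ℕ.^ 2 ℕ.≤ m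

-- The variables are Fin m and the alphabet is Fin d.  A truth table with
-- a inputs is a complete d-ary tree of depth a.

Table : ℕ → ℕ → Set
Table d zero    = Bool
Table d (suc a) = Vec (Table d a) d

record Constraint (X : Set) (d : ℕ) : Set where
  constructor constraint
  field
    {arity} : ℕ
    scope   : Vec X arity
    table   : Table d arity

open Constraint public

CSP : (m d n : ℕ) → Set
CSP m d n = Vec (Constraint (Fin m) d) n

evaluate : ∀ {a} → Table d a → Vec (Fin d) a → Bool
evaluate b []       = b
evaluate t (v ∷ vs) = evaluate (Vec.lookup t v) vs

Assignment : (m d : ℕ) → Set
Assignment m d = Fin m → Fin d

_⊨_ : Assignment m d → Constraint (Fin m) d → Set
σ ⊨ c = evaluate (table c) (Vec.map σ (scope c)) ≡ true

Satisfiable : CSP m d n → Set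
Satisfiable {m} {d} Ψ = ∃ λ (σ : Assignment m d) → All (σ ⊨_) Ψ

record IsCSP (k : ℕ) (Ψ : CSP m d n) : Set where
  field
    constraints-distinct : Unique Ψ
    scopes-distinct      : All (λ c → Unique (scope c)) Ψ
    arity≤k              : All (λ c → arity c ℕ.≤ k) Ψ

occurrences : CSP m d n → Fin m → ℕ
occurrences Ψ x = count (λ c → _∈?_ _≟_ x (scope c)) Ψ

variableFrequency : CSP m d n → ℕ
variableFrequency {m} Ψ = max 0 (List.map (occurrences Ψ) (allFin m))

-- Cost model.  Every function below that performs part of the algorithm has
-- a result in Timed (or Rand), and each of its clauses charges one step (✓)
-- per call.  Within a clause only constructors, matching on constructors,
-- Boolean connectives and further such functions are used, so that the time
-- counts the steps of call-by-value evaluation.  Numbers and elements of Fin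
-- are unary.

record Timed (A : Set) : Set where
  constructor _costing_
  field
    value : A
    time  : ℕ

open Timed public

infixl 1 _>>=_

return : A → Timed A
return x = x costing 0

_>>=_ : Timed A → (A → Timed B) → Timed B
(x costing s) >>= f = value (f x) costing (s ℕ.+ time (f x))

infix 0 ✓_

✓_ : Timed A → Timed A
✓ (x costing s) = x costing suc s

addᵗ : ℕ → ℕ → Timed ℕ
addᵗ zero    n = ✓ return n
addᵗ (suc m) n = ✓ do
  s ← addᵗ m n
  return (suc s)

halfᵗ : ℕ → Timed ℕ
halfᵗ zero          = ✓ return 0
halfᵗ (suc zero)    = ✓ return 0
halfᵗ (suc (suc n)) = ✓ do
  h ← halfᵗ n
  return (suc h)

leqᵗ : ℕ → ℕ → Timed Bool
leqᵗ zero    n       = ✓ return true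
leqᵗ (suc m) zero    = ✓ return false
leqᵗ (suc m) (suc n) = ✓ leqᵗ m n

eqℕᵗ : ℕ → ℕ → Timed Bool
eqℕᵗ zero    zero    = ✓ return true
eqℕᵗ zero    (suc n) = ✓ return false
eqℕᵗ (suc m) zero    = ✓ return false
eqℕᵗ (suc m) (suc n) = ✓ eqℕᵗ m n

eqFinᵗ : Fin n → Fin n → Timed Bool
eqFinᵗ zero    zero    = ✓ return true
eqFinᵗ zero    (suc j) = ✓ return false
eqFinᵗ (suc i) zero    = ✓ return false
eqFinᵗ (suc i) (suc j) = ✓ eqFinᵗ i j

lengthᵗ : List A → Timed ℕ
lengthᵗ []       = ✓ return 0
lengthᵗ (x ∷ xs) = ✓ do
  l ← lengthᵗ xs
  return (suc l)

appendᵗ : List A → List A → Timed (List A)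
appendᵗ []       ys = ✓ return ys
appendᵗ (x ∷ xs) ys = ✓ do
  zs ← appendᵗ xs ys
  return (x ∷ zs)

concatᵗ : List (List A) → Timed (List A)
concatᵗ []         = ✓ return []
concatᵗ (xs ∷ xss) = ✓ do
  ys ← concatᵗ xss
  appendᵗ xs ys

mapᵗ : (A → Timed B) → List A → Timed (List B)
mapᵗ f []       = ✓ return []
mapᵗ f (x ∷ xs) = ✓ do
  y  ← f x
  ys ← mapᵗ f xs
  return (y ∷ ys)

mapVecᵗ : (A → Timed B) → Vec A n → Timed (Vec B n)
mapVecᵗ f []       = ✓ return []
mapVecᵗ f (x ∷ xs) = ✓ do
  y  ← f x
  ys ← mapVecᵗ f xs
  return (y ∷ ys)

anyᵗ : (A → Timed Bool) → List A → Timed Bool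
anyᵗ p []       = ✓ return false
anyᵗ p (x ∷ xs) = ✓ do
  b ← p x
  if b then return true else anyᵗ p xs

anyVecᵗ : (A → Timed Bool) → Vec A n → Timed Bool
anyVecᵗ p []       = ✓ return false
anyVecᵗ p (x ∷ xs) = ✓ do
  b ← p x
  if b then return true else anyVecᵗ p xs

allᵗ : (A → Timed Bool) → List A → Timed Bool
allᵗ p []       = ✓ return true
allᵗ p (x ∷ xs) = ✓ do
  b ← p x
  if b then allᵗ p xs else return false

partitionᵗ : (A → Timed Bool) → List A → Timed (List A × List A)
partitionᵗ p []       = ✓ return ([] , [])
partitionᵗ p (x ∷ xs) = ✓ do
  b         ← p x
  (ys , zs) ← partitionᵗ p xs
  return (if b then (x ∷ ys , zs) else (ys , x ∷ zs))

filterᵗ : (A → Timed Bool) → List A → Timed (List A)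
filterᵗ p xs = ✓ do
  (ys , _) ← partitionᵗ p xs
  return ys

-- Splits off the first h elements.

splitAtᵗ : ℕ → List A → Timed (List A × List A)
splitAtᵗ zero    xs       = ✓ return ([] , xs)
splitAtᵗ (suc h) []       = ✓ return ([] , [])
splitAtᵗ (suc h) (x ∷ xs) = ✓ do
  (ys , zs) ← splitAtᵗ h xs
  return (x ∷ ys , zs)

indexᵗ : Vec A n → Fin n → Timed A
indexᵗ (x ∷ xs) zero    = ✓ return x
indexᵗ (x ∷ xs) (suc i) = ✓ indexᵗ xs i

allFinᵗ : ∀ n → Timed (List (Fin n))
allFinᵗ zero    = ✓ return []
allFinᵗ (suc n) = ✓ do
  is ← allFinᵗ n
  js ← mapᵗ (λ i → return (suc i)) is
  return (zero ∷ js)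

elemᵗ : (A → A → Timed Bool) → A → List A → Timed Bool
elemᵗ eq x xs = ✓ anyᵗ (eq x) xs

nubᵗ : (A → A → Timed Bool) → List A → Timed (List A)
nubᵗ eq []       = ✓ return []
nubᵗ eq (x ∷ xs) = ✓ do
  ys ← nubᵗ eq xs
  b  ← elemᵗ eq x ys
  return (if b then ys else x ∷ ys)

-- The vertices of H_Ψ are the indices Fin n of the constraints; the hyperedge
-- e_x is stored with its variable x.

Hyperedge : (m n : ℕ) → Set
Hyperedge m n = Fin m × List (Fin n)

hypergraphᵗ : CSP m d n → Timed (List (Hyperedge m n))
hypergraphᵗ {m} {n = n} Ψ = ✓ do
  xs ← allFinᵗ m
  vs ← allFinᵗ n
  mapᵗ (λ x → do
    e ← filterᵗ (λ v → do
      c ← indexᵗ Ψ v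
      anyVecᵗ (eqFinᵗ x) (scope c)) vs
    return (x , e)) xs

meetsᵗ : List (Fin n) → Hyperedge m n → Timed Bool
meetsᵗ block (_ , e) = ✓ anyᵗ (λ v → elemᵗ eqFinᵗ v block) e

-- Adding a hyperedge to a hypergraph merges the components that it meets.

mergeᵗ : Hyperedge m n → List (List (Fin n)) → Timed (List (List (Fin n)))
mergeᵗ e blocks = ✓ do
  (hit , rest) ← partitionᵗ (λ block → meetsᵗ block e) blocks
  block        ← concatᵗ hit
  return (consNonempty block rest)
  where
  consNonempty : List A → List (List A) → List (List A)
  consNonempty []       xss = xss
  consNonempty (x ∷ xs) xss = (x ∷ xs) ∷ xss

mergeAllᵗ : List (Hyperedge m n) → List (List (Fin n)) →
            Timed (List (List (Fin n)))
mergeAllᵗ []       blocks = ✓ return blocks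
mergeAllᵗ (e ∷ es) blocks = ✓ do
  blocks′ ← mergeᵗ e blocks
  mergeAllᵗ es blocks′

componentsᵗ : List (Hyperedge m n) → Timed (List (List (Fin n)))
componentsᵗ {n = n} es = ✓ do
  vs     ← allFinᵗ n
  blocks ← mapᵗ (λ v → return (v ∷ [])) vs
  mergeAllᵗ es blocks

-- A pair (R , K) of complementary sets of hyperedges.

Separation : (m n : ℕ) → Set
Separation m n = List (Hyperedge m n) × List (Hyperedge m n)

isBalancedᵗ : List (Hyperedge m n) → Timed Bool
isBalancedᵗ {m} K = ✓ do
  h      ← halfᵗ m
  blocks ← componentsᵗ K
  allᵗ (λ block → do
    incident ← filterᵗ (meetsᵗ block) K
    l        ← lengthᵗ incident
    leqᵗ l h) blocks

-- Tries all ways to add at most s of the remaining hyperedges to R and the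
-- others to K.

searchSeparatorᵗ : ℕ → List (Hyperedge m n) → Separation m n →
                   Timed (Maybe (Separation m n))
searchSeparatorᵗ s [] (R , K) = ✓ do
  b ← isBalancedᵗ K
  return (if b then just (R , K) else nothing)
searchSeparatorᵗ zero    (e ∷ es) (R , K) = ✓ searchSeparatorᵗ zero es (R , e ∷ K)
searchSeparatorᵗ (suc s) (e ∷ es) (R , K) = ✓ do
  just RK ← searchSeparatorᵗ s es (e ∷ R , K)
    where nothing → searchSeparatorᵗ (suc s) es (R , e ∷ K)
  return (just RK)

PartialAssignment : (m d : ℕ) → Set
PartialAssignment m d = List (Fin m × Fin d)

lookupᵗ : PartialAssignment m d → Fin m → Timed (Maybe (Fin d))
lookupᵗ []            x = ✓ return nothing
lookupᵗ ((y , a) ∷ ρ) x = ✓ do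
  b ← eqFinᵗ x y
  if b then return (just a) else lookupᵗ ρ x

-- In Ψ|ρ each argument of a constraint is a remaining variable or a value.

restrictᵗ : CSP m d n → PartialAssignment m d →
            Timed (Vec (Constraint (Fin m ⊎ Fin d) d) n)
restrictᵗ Ψ ρ = ✓ mapVecᵗ (λ c → do
    args ← mapVecᵗ (λ x → do
      just a ← lookupᵗ ρ x
        where nothing → return (inj₁ x)
      return (inj₂ a)) (scope c)
    return (constraint args (table c))) Ψ

evaluateᵗ : ∀ {a} → PartialAssignment m d → Table d a → Vec (Fin m ⊎ Fin d) a →
            Timed Bool
evaluateᵗ τ b []            = ✓ return b
evaluateᵗ τ t (inj₂ v ∷ xs) = ✓ do
  t′ ← indexᵗ t v
  evaluateᵗ τ t′ xs
evaluateᵗ τ t (inj₁ x ∷ xs) = ✓ do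
  just v ← lookupᵗ τ x
    where nothing → return false
  t′ ← indexᵗ t v
  evaluateᵗ τ t′ xs

-- Is there an extension of τ to the given variables that passes the test?

someAssignmentᵗ : List (Fin m) → PartialAssignment m d →
                  (PartialAssignment m d → Timed Bool) → Timed Bool
someAssignmentᵗ         []       τ test = ✓ test τ
someAssignmentᵗ {d = d} (x ∷ xs) τ test = ✓ do
  as ← allFinᵗ d
  anyᵗ (λ a → someAssignmentᵗ xs ((x , a) ∷ τ) test) as

variablesᵗ : List (Hyperedge m n) → Timed (List (Fin m))
variablesᵗ es = ✓ mapᵗ (λ { (x , _) → return x }) es

componentSatisfiableᵗ : Vec (Constraint (Fin m ⊎ Fin d) d) n →
                        List (Hyperedge m n) → List (Fin n) → Timed Bool
componentSatisfiableᵗ Ψρ K block = ✓ do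
  incident ← filterᵗ (meetsᵗ block) K
  xs       ← variablesᵗ incident
  someAssignmentᵗ xs [] (λ τ →
    allᵗ (λ v → do
      c ← indexᵗ Ψρ v
      evaluateᵗ τ (table c) (scope c)) block)

solveᵗ : CSP m d n → Separation m n → Timed Bool
solveᵗ Ψ (R , K) = ✓ do
  xs ← variablesᵗ R
  someAssignmentᵗ xs [] (λ ρ → do
    Ψρ     ← restrictᵗ Ψ ρ
    blocks ← componentsᵗ K
    allᵗ (componentSatisfiableᵗ Ψρ K) blocks)

-- CSP-SAT with the separator of size at most s found by exhaustive search.
-- The result is nothing if there is no such separator.

CSP-SAT-deterministic : ℕ → CSP m d n → Timed (Maybe Bool)
CSP-SAT-deterministic s Ψ = ✓ do
  H       ← hypergraphᵗ Ψ
  just RK ← searchSeparatorᵗ s H ([] , [])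
    where nothing → return nothing
  answer ← solveᵗ Ψ RK
  return (just answer)

-- Computations that may toss a biased coin, true having probability p.

data Rand (A : Set) : Set where
  done  : A → Rand A
  steps : ℕ → Rand A → Rand A
  toss  : (Bool → Rand A) → Rand A

infixl 1 _>>=ᴿ_

_>>=ᴿ_ : Rand A → (A → Rand B) → Rand B
done x    >>=ᴿ f = f x
steps s c >>=ᴿ f = steps s (c >>=ᴿ f)
toss c    >>=ᴿ f = toss (λ b → c b >>=ᴿ f)

run : Timed A → Rand A
run (x costing s) = steps s (done x)

expectedTime : ℝ → Rand A → ℝ
expectedTime p (done _)    = fromℕ 0
expectedTime p (steps s c) = fromℕ s +ᴿ expectedTime p c
expectedTime p (toss c)    = fromℕ 1 +ᴿ
  (p *ᴿ expectedTime p (c true) +ᴿ (fromℕ 1 -ᴿ p) *ᴿ expectedTime p (c false))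

probability : ℝ → (A → Bool) → Rand A → ℝ
probability p Q (done x)    = if Q x then fromℕ 1 else fromℕ 0
probability p Q (steps _ c) = probability p Q c
probability p Q (toss c)    =
  p *ᴿ probability p Q (c true) +ᴿ (fromℕ 1 -ᴿ p) *ᴿ probability p Q (c false)

AllOutcomes : (A → Set) → Rand A → Set
AllOutcomes Q (done x)    = Q x
AllOutcomes Q (steps _ c) = AllOutcomes Q c
AllOutcomes Q (toss c)    = ∀ b → AllOutcomes Q (c b)

-- The padding vertices of the hyperedge e_x are the inj₂ (x , i).

PaddedVertex : (m n : ℕ) → Set
PaddedVertex m n = Fin n ⊎ (Fin m × ℕ)

PaddedHyperedge : (m n : ℕ) → Set
PaddedHyperedge m n = Hyperedge m n × List (PaddedVertex m n)

eqVertexᵗ : PaddedVertex m n → PaddedVertex m n → Timed Bool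
eqVertexᵗ (inj₁ u)       (inj₁ v)       = ✓ eqFinᵗ u v
eqVertexᵗ (inj₁ u)       (inj₂ _)       = ✓ return false
eqVertexᵗ (inj₂ _)       (inj₁ v)       = ✓ return false
eqVertexᵗ (inj₂ (x , i)) (inj₂ (y , j)) = ✓ do
  b ← eqFinᵗ x y
  if b then eqℕᵗ i j else return false

padᵗ : ℕ → Fin m → List (Fin n) → Timed (List (PaddedVertex m n))
padᵗ zero    x []       = ✓ return []
padᵗ zero    x (v ∷ vs) = ✓ do
  us ← padᵗ zero x vs
  return (inj₁ v ∷ us)
padᵗ (suc r) x []       = ✓ do
  us ← padᵗ r x []
  return (inj₂ (x , r) ∷ us)
padᵗ (suc r) x (v ∷ vs) = ✓ do
  us ← padᵗ r x vs
  return (inj₁ v ∷ us)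

padAllᵗ : ℕ → List (Hyperedge m n) → Timed (List (PaddedHyperedge m n))
padAllᵗ r H = ✓ mapᵗ (λ { (x , e) → do
  us ← padᵗ r x e
  return ((x , e) , us) }) H

-- Collecting the vertices from the hyperedges discards the isolated ones.

verticesᵗ : List (PaddedHyperedge m n) → Timed (List (PaddedVertex m n))
verticesᵗ es = ✓ do
  uss ← mapᵗ (λ { (_ , us) → return us }) es
  us  ← concatᵗ uss
  nubᵗ eqVertexᵗ us

randomSubset : List V → Rand (List V)
randomSubset []       = run (✓ return [])
randomSubset (v ∷ vs) =
  randomSubset vs >>=ᴿ λ S →
  toss λ b →
  run (✓ return (if b then v ∷ S else S))

-- The hyperedges inside S, inside the complement of S, and meeting both.

classifyᵗ : List (PaddedVertex m n) → List (PaddedHyperedge m n) →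
            Timed (List (Hyperedge m n) × List (Hyperedge m n) × List (Hyperedge m n))
classifyᵗ S []              = ✓ return ([] , [] , [])
classifyᵗ S ((e , us) ∷ es) = ✓ do
  (inside , outside , crossing) ← classifyᵗ S es
  all  ← allᵗ (λ u → elemᵗ eqVertexᵗ u S) us
  some ← anyᵗ (λ u → elemᵗ eqVertexᵗ u S) us
  return (if all then (e ∷ inside , outside , crossing)
          else if some then (inside , outside , e ∷ crossing)
          else (inside , e ∷ outside , crossing))

-- Accepts S if the number of hyperedges inside S is within b of m / 2 and at
-- most s hyperedges cross.  All but m / 2 of the hyperedges on each side are
-- then moved to R.

separationᵗ : (s b : ℕ) → List (PaddedHyperedge m n) → List (PaddedVertex m n) →
              Timed (Maybe (Separation m n))
separationᵗ {m} s b es S = ✓ do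
  (inside , outside , crossing) ← classifyᵗ S es
  h    ← halfᵗ m
  i    ← lengthᵗ inside
  c    ← lengthᵗ crossing
  h+b  ← addᵗ h b
  i+b  ← addᵗ i b
  i≤   ← leqᵗ i h+b
  h≤   ← leqᵗ h i+b
  c≤   ← leqᵗ c s
  (K₁ , R₁) ← splitAtᵗ h inside
  (K₂ , R₂) ← splitAtᵗ h outside
  R₁₂  ← appendᵗ R₁ R₂
  R    ← appendᵗ crossing R₁₂
  K    ← appendᵗ K₁ K₂
  return (if i≤ ∧ h≤ ∧ c≤ then just (R , K) else nothing)

-- At most f samples are drawn; nothing means that all of them were rejected.

sampleSeparator : (s b f : ℕ) → List (PaddedHyperedge m n) →
                  List (PaddedVertex m n) → Rand (Maybe (Separation m n))
sampleSeparator s b zero    es vs = done nothing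
sampleSeparator s b (suc f) es vs =
  randomSubset vs >>=ᴿ λ S →
  run (✓ separationᵗ s b es S) >>=ᴿ λ
    { nothing   → sampleSeparator s b f es vs
    ; (just RK) → done (just RK)
    }

-- CSP-SAT with the separator found randomly, cut off after f samples.  The
-- unbounded algorithm is the limit f → ∞: its expected time is the supremum
-- over f of the expected times of the cut-off versions.

CSP-SAT-random : (r s b f : ℕ) → CSP m d n → Rand (Maybe Bool)
CSP-SAT-random r s b f Ψ =
  run (✓ hypergraphᵗ Ψ) >>=ᴿ λ H →
  run (padAllᵗ r H) >>=ᴿ λ es →
  run (verticesᵗ es) >>=ᴿ λ vs →
  sampleSeparator s b f es vs >>=ᴿ λ
    { nothing   → done nothing
    ; (just RK) → run (solveᵗ Ψ RK) >>=ᴿ λ answer → done (just answer)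
    }

DeterministicallyDecides : ℕ → CSP m d n → Set
DeterministicallyDecides s Ψ = ∃ λ answer →
  value (CSP-SAT-deterministic s Ψ) ≡ just answer ×
  Reflects (Satisfiable Ψ) answer

-- Every run that halts gives the right answer, and the algorithm halts with
-- probability 1.

RandomlyDecides : (r s b : ℕ) → CSP m d n → Set
RandomlyDecides r s b Ψ =
  (∀ f → AllOutcomes (λ o → ∀ answer → o ≡ just answer →
                            Reflects (Satisfiable Ψ) answer)
                     (CSP-SAT-random r s b f Ψ)) ×
  (∀ η → 0ℚ ℚ.< η → ∃ λ f →
    probability (2^-1/ r) is-nothing (CSP-SAT-random r s b f Ψ) ≤ᴿ fromℚ η)

{-# OPTIONS --safe #-}

-- Pad the hyperedges to size r with distinct vertices and put each vertex into S with probability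
-- p = 2^(-1/r).  The expected number of hyperedges inside S is p^r m = m/2 and inside the complement (1-p)^r m = ε m,
-- so about (1/2 - ε) m hyperedges are expected to cross.  A vertex lies on at most k hyperedges and there are at most
-- r m vertices, so by Efron–Stein both counts have variance at most r m k², and by Chebyshev they are within
-- O(k √(r m)) = o(m) of their means with probability at least 1/2.  Hence a sample is accepted with probability at
-- least 1/2, and a separator of the required size exists.  No component of what is kept meets both S and its
-- complement, so each of the d^|R| assignments costs at most d^(m/2) up to polynomial factors, which gives
-- d^((1-ε) m).  The exhaustive search visits as many subsets as there are of size at most (1/2 - ε) m: at most
-- 2^m ≤ 3^((1-ε) m), because ε ≤ 1/6, and at most 2^(m - 2 ε² m) by Chernoff's bound.
--
-- The real 2^(-1/r) enters only through its rational approximations p_i: all operations on ℝ are pointwise, so it is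
-- enough to bound everything for p_i with i large.

module Submission where

open import Defs
open import Data.Nat.Base using (ℕ; _≤_)
open import Data.Product.Base using (∃; _×_)
open import Data.Rational.Base using (½)
open import Relation.Binary.PropositionalEquality using (_≡_)
open import Data.Bool.Base using (Bool; true; false; if_then_else_; _∧_; not; T)
open import Data.Empty using (⊥)
open import Data.Fin.Base using (Fin; zero; suc; fromℕ<)
import Data.Fin.Properties as Finₚ
import Data.Integer.Base as ℤ
import Data.Integer.Properties as ℤₚ
open import Data.List.Base as List using (List; []; _∷_; _++_; length; map; concat; allFin; take; drop)
import Data.List.Properties as Listₚ
open import Data.List.Membership.Propositional using (_∈_; _∉_)
import Data.List.Membership.Propositional.Properties as ∈ₚ
open import Data.List.Relation.Unary.Any using (here; there)
open import Data.List.Relation.Unary.All as All using (All; []; _∷_)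
import Data.List.Relation.Unary.All.Properties as Allₚ
open import Data.List.Relation.Unary.AllPairs as AllPairs using (AllPairs; []; _∷_)
import Data.List.Relation.Unary.AllPairs.Properties as AllPairsₚ
open import Data.List.Relation.Binary.Permutation.Propositional using (_↭_; ↭-refl; ↭-sym; ↭-trans; prep; ↭-reflexive; module PermutationReasoning)
import Data.List.Relation.Binary.Permutation.Propositional.Properties as ↭ₚ
open import Data.Maybe.Base using (Maybe; just; nothing; is-nothing)
open import Data.Nat.Base as ℕ using (zero; suc; _+_; _*_; _∸_; _^_; _<_; z≤n; s≤s; NonZero)
open import Data.Nat.DivMod using (_/_; _%_; m≡m%n+[m/n]*n; m%n<n; m/n*n≤m)
import Data.Nat.Properties as ℕₚ
open ℕₚ using (≤-trans; ≤-refl; ≤-reflexive; m≤m+n; m≤n+m; n≤1+n; +-mono-≤; +-monoˡ-≤; +-monoʳ-≤; *-mono-≤; *-monoˡ-≤; *-monoʳ-≤; m^n≢0; ^-*-assoc; ^-monoˡ-≤; ^-monoʳ-≤; ^-distribˡ-+-*; m*n≢0; m∸n+n≡m)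
open import Data.Nat.Tactic.RingSolver using (solve-∀)
open import Data.Product.Base using (_,_; proj₁; proj₂)
open import Data.Rational.Base as ℚ using (ℚ; 0ℚ; 1ℚ)
import Data.Rational.Properties as ℚₚ
import Data.Rational.Unnormalised.Base as ℚᵘ
import Data.Rational.Unnormalised.Properties as ℚᵘₚ
import Data.Rational.Solver as ℚ-Solver
open import Data.Sum.Base using (_⊎_; inj₁; inj₂)
open import Data.Unit.Base using (⊤; tt)
open import Data.Vec.Base as Vec using (Vec; []; _∷_)
import Data.Vec.Membership.Propositional as Vec∈
import Data.Vec.Membership.Propositional.Properties as Vec∈ₚ
import Data.Vec.Properties as Vecₚ
import Data.Vec.Relation.Unary.All.Properties as VecAllₚ
import Data.Vec.Relation.Unary.All as VecAll
import Data.Vec.Relation.Unary.Any as VecAny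
import Data.Bool.Properties as Boolₚ
import Data.List.Relation.Unary.Unique.Propositional as Unique
import Data.List.Relation.Unary.Unique.Propositional.Properties as Uniqueₚ
open import Function.Base using (_∘_; id)
open import Relation.Binary.PropositionalEquality using (refl; sym; trans; cong; cong₂; subst; subst₂; module ≡-Reasoning)
open import Relation.Nullary using (¬_; ¬?; Dec; yes; no; does; contradiction; Reflects; ofʸ; ofⁿ)
import Data.List.Extrema.Nat as Extrema
import Data.Vec.Membership.DecPropositional as Vec∈?
import Data.Vec.Relation.Unary.AllPairs as VecAllPairs
import Data.Vec.Relation.Unary.Unique.Propositional as VecUnique
open import Data.Nat.ListAction using (sum)
import Relation.Binary.Reasoning.Setoid as SetoidReasoning
open ℚ-Solver.+-*-Solver using (solve; _:+_; _:*_; _:-_; :-_; _:=_; con)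

-- Only natural exponents are available, so ε_r m is replaced by an integer below it that is off by
-- O(r), and all errors are collected in one function of order o(m). Factors polynomial in m, n, k
-- and d go there as well: n ≤ r m + 2 since the constraints are distinct, k = o(m) makes even 2^k
-- harmless, and a power of d adds a constant to the exponent however large d is. With D = m - 2 s,
-- about 2 ε_r m, the usual bound on the number of sets of size at most s is 2^m e^(-D²/(2m)). Only
-- 2^(-D²/(2m)) is needed, and the slack log₂ e ≈ 1.44 pays for a proof in integers: a rational tilt
-- in place of the optimal one costs less than that once D ≤ m/3. The two versions treat the surplus
-- differently. A random separator may exceed the crossing bound by the hyperedges moved into it,
-- which costs o(m) in the exponent; the exhaustive search has a fixed budget, so existence is shown
-- for a stricter crossing bound that leaves room for the surplus.

module _ where

  open ℕₚ.≤-Reasoning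

  -- Square roots, sublinear functions and binomial sums

  m≤m^2 : ∀ m → m ≤ m ^ 2
  m≤m^2 zero    = z≤n
  m≤m^2 (suc m) = subst (suc m ≤_) (cong (suc m *_) (sym (ℕₚ.*-identityʳ (suc m)))) (ℕₚ.m≤m*n (suc m) (suc m))

  n<2^n : ∀ n → suc n ≤ 2 ^ n
  n<2^n zero    = ≤-refl
  n<2^n (suc n) = begin
    suc (suc n)     ≤⟨ +-mono-≤ (s≤s (z≤n {n})) (n<2^n n) ⟩
    suc n + 2 ^ n   ≤⟨ +-monoˡ-≤ (2 ^ n) (n<2^n n) ⟩
    2 ^ n + 2 ^ n   ≡⟨ cong (2 ^ n +_) (sym (ℕₚ.+-identityʳ (2 ^ n))) ⟩
    2 ^ suc n       ∎

  1≤m^n : ∀ {m} n → 1 ≤ m → 1 ≤ m ^ n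
  1≤m^n {suc m} n _ = ℕₚ.m^n>0 (suc m) n

  ^-cancel-≤ : ∀ {a b} n → .{{_ : NonZero n}} → a ^ n ≤ b ^ n → a ≤ b
  ^-cancel-≤ n aⁿ≤bⁿ = ℕₚ.≮⇒≥ λ b<a → ℕₚ.<⇒≱ (ℕₚ.^-monoˡ-< n b<a) aⁿ≤bⁿ

  -- √ n = ⌈√n⌉.

  √ : ℕ → ℕ
  √ zero = 0
  √ (suc n) with suc n ℕₚ.≤? √ n * √ n
  ... | yes _ = √ n
  ... | no  _ = suc (√ n)

  √-lower : ∀ n → n ≤ √ n * √ n
  √-lower zero = z≤n
  √-lower (suc n) with suc n ℕₚ.≤? √ n * √ n
  ... | yes p = p
  ... | no  _ = s≤s (begin
    n                           ≤⟨ √-lower n ⟩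
    √ n * √ n                   ≤⟨ *-monoʳ-≤ (√ n) (n≤1+n (√ n)) ⟩
    √ n * suc (√ n)             ≤⟨ m≤n+m (√ n * suc (√ n)) (√ n) ⟩
    √ n + √ n * suc (√ n)       ∎)

  -- The constant is crude but harmless. When the root steps from q to q + 1, both q² and q are at
  -- most n, so (q + 1)² ≤ 3 n + 1.
  √-upper : ∀ n → √ n * √ n ≤ 4 * n
  √-upper zero = z≤n
  √-upper (suc n) with suc n ℕₚ.≤? √ n * √ n
  ... | yes _ = ≤-trans (√-upper n) (*-monoʳ-≤ 4 (n≤1+n n))
  ... | no ¬p = begin
    suc q * suc q                 ≡⟨ expand q ⟩
    q * q + (q + q) + 1           ≤⟨ +-monoˡ-≤ 1 (+-monoʳ-≤ (q * q) (+-mono-≤ q≤n q≤n)) ⟩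
    q * q + (n + n) + 1           ≤⟨ +-mono-≤ (+-monoˡ-≤ (n + n) qq≤n) (m≤m+n 1 (n + 3)) ⟩
    n + (n + n) + (1 + (n + 3))   ≡⟨ collect n ⟩
    4 * suc n                     ∎
    where
    q = √ n
    qq≤n : q * q ≤ n
    qq≤n = ℕₚ.≤-pred (ℕₚ.≰⇒> ¬p)
    q≤n : q ≤ n
    q≤n = ≤-trans (m≤m^2 q) (subst (_≤ n) (cong (q *_) (sym (ℕₚ.*-identityʳ q))) qq≤n)
    expand : ∀ q → suc q * suc q ≡ q * q + (q + q) + 1
    expand = solve-∀
    collect : ∀ n → n + (n + n) + (1 + (n + 3)) ≡ 4 * suc n
    collect = solve-∀

  ^2-≡ : ∀ x → x ^ 2 ≡ x * x
  ^2-≡ x = cong (x *_) (ℕₚ.*-identityʳ x)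

  ^2-mono-≤ : ∀ {x y} → x * x ≤ y * y → x ≤ y
  ^2-mono-≤ {x} {y} p = ^-cancel-≤ 2 (subst₂ _≤_ (sym (^2-≡ x)) (sym (^2-≡ y)) p)

  o-const : ∀ a → (λ _ → a) ∈o[m]
  o-const a c = c * a , λ m p → p

  o-+ : ∀ {f g} → f ∈o[m] → g ∈o[m] → (λ m → f m + g m) ∈o[m]
  o-+ {f} {g} of og c with of (2 * c) | og (2 * c)
  ... | N₁ , p₁ | N₂ , p₂ = N₁ ℕ.⊔ N₂ , λ m N≤m → ℕₚ.*-cancelˡ-≤ 2 (begin
    2 * (c * (f m + g m))          ≡⟨ lem c (f m) (g m) ⟩
    2 * c * f m + 2 * c * g m      ≤⟨ +-mono-≤ (p₁ m (ℕₚ.m⊔n≤o⇒m≤o N₁ N₂ N≤m)) (p₂ m (ℕₚ.m⊔n≤o⇒n≤o N₁ N₂ N≤m)) ⟩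
    m + m                          ≡⟨ cong (m +_) (sym (ℕₚ.+-identityʳ m)) ⟩
    2 * m                          ∎)
    where
    lem : ∀ c x y → 2 * (c * (x + y)) ≡ 2 * c * x + 2 * c * y
    lem = solve-∀

  o-* : ∀ a {f} → f ∈o[m] → (λ m → a * f m) ∈o[m]
  o-* a {f} of c with of (c * a)
  ... | N , p = N , λ m N≤m → subst (_≤ m) (ℕₚ.*-assoc c a (f m)) (p m N≤m)

  o-√ : √ ∈o[m]
  o-√ c = 4 * (c * c) , λ m N≤m → ^2-mono-≤ (begin
    (c * √ m) * (c * √ m)      ≡⟨ ℕₚ.[m*n]*[o*p]≡[m*o]*[n*p] c (√ m) c (√ m) ⟩
    (c * c) * (√ m * √ m)      ≤⟨ *-monoʳ-≤ (c * c) (√-upper m) ⟩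
    (c * c) * (4 * m)          ≡⟨ ℕₚ.*-assoc (c * c) 4 m ⟨
    (c * c) * 4 * m            ≡⟨ cong (_* m) (ℕₚ.*-comm (c * c) 4) ⟩
    4 * (c * c) * m            ≤⟨ *-monoˡ-≤ m N≤m ⟩
    m * m                      ∎)

  o[√m]⇒o[m] : ∀ {f} → f ∈o[√m] → f ∈o[m]
  o[√m]⇒o[m] of c with of c
  ... | N , p = N , λ m N≤m → ≤-trans (m≤m^2 _) (p m N≤m)

  -- This is where sublinearity of f alone would not do: squared, the claim asks for c² f(m)² · 4 a
  -- m ≤ m². The hypothesis is taken at 4 a c, which is enough because 4 a ≤ (4 a)².
  o-*√ : ∀ {f} a → f ∈o[√m] → (λ m → f m * √ (a * m)) ∈o[m]
  o-*√ {f} a of c with of (4 * a * c)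
  ... | N , p = N , λ m N≤m → ^2-mono-≤ (begin
    (c * (f m * √ (a * m))) * (c * (f m * √ (a * m)))  ≡⟨ lem c (f m) (√ (a * m)) ⟩
    (c * f m) * (c * f m) * (√ (a * m) * √ (a * m))    ≤⟨ *-monoʳ-≤ ((c * f m) * (c * f m)) (√-upper (a * m)) ⟩
    (c * f m) * (c * f m) * (4 * (a * m))              ≡⟨ lem₂ a (c * f m) m ⟩
    4 * a * ((c * f m) * (c * f m)) * m                ≤⟨ *-monoˡ-≤ m (*-monoˡ-≤ ((c * f m) * (c * f m)) (subst (4 * a ≤_) (^2-≡ (4 * a)) (m≤m^2 (4 * a)))) ⟩
    (4 * a) * (4 * a) * ((c * f m) * (c * f m)) * m    ≡⟨ lem₃ (4 * a) c (f m) m ⟩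
    (4 * a * c * f m) * (4 * a * c * f m) * m          ≤⟨ *-monoˡ-≤ m (subst (_≤ m) (^2-≡ (4 * a * c * f m)) (p m N≤m)) ⟩
    m * m                                              ∎)
    where
    lem : ∀ c f q → (c * (f * q)) * (c * (f * q)) ≡ (c * f) * (c * f) * (q * q)
    lem = solve-∀
    lem₂ : ∀ a x m → x * x * (4 * (a * m)) ≡ 4 * a * (x * x) * m
    lem₂ = solve-∀
    lem₃ : ∀ a c f m → a * a * ((c * f) * (c * f)) * m ≡ (a * c * f) * (a * c * f) * m
    lem₃ = solve-∀

  -- The number of subsets of at most `s` out of `l` elements. The recursion branches exactly as
  -- `searchSeparatorᵗ` does, so the value bounds the number of leaves of the search.
  binomialSum : ℕ → ℕ → ℕ
  binomialSum zero    s       = 1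
  binomialSum (suc l) zero    = 1
  binomialSum (suc l) (suc s) = binomialSum l s + binomialSum l (suc s)

  1≤binomialSum : ∀ l s → 1 ≤ binomialSum l s
  1≤binomialSum zero    s       = ≤-refl
  1≤binomialSum (suc l) zero    = ≤-refl
  1≤binomialSum (suc l) (suc s) = ≤-trans (1≤binomialSum l s) (m≤m+n _ _)

  binomialSum-zero : ∀ l → binomialSum l 0 ≡ 1
  binomialSum-zero zero    = refl
  binomialSum-zero (suc l) = refl

  binomialSum≤2^ : ∀ l s → binomialSum l s ≤ 2 ^ l
  binomialSum≤2^ zero    s       = ≤-refl
  binomialSum≤2^ (suc l) zero    = 1≤m^n (suc l) (s≤s z≤n)
  binomialSum≤2^ (suc l) (suc s) = begin
    binomialSum l s + binomialSum l (suc s) ≤⟨ +-mono-≤ (binomialSum≤2^ l s) (binomialSum≤2^ l (suc s)) ⟩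
    2 ^ l + 2 ^ l                           ≡⟨ cong (2 ^ l +_) (sym (ℕₚ.+-identityʳ (2 ^ l))) ⟩
    2 ^ suc l                               ∎

  -- The exponential moment behind Chernoff's bound. Give each chosen element weight u and every
  -- other one weight v: the weights of all subsets sum to (u + v)^l, and as u ≤ v each subset of
  -- size at most s weighs at least u^s v^(l - s). Multiplying by v^s avoids the subtraction.
  binomialSum-weighted : ∀ {u v} → u ≤ v → ∀ l s →
    binomialSum l s * u ^ s * v ^ l ≤ (u + v) ^ l * v ^ s
  binomialSum-weighted {u} {v} u≤v zero s = begin
    1 * u ^ s * 1   ≡⟨ trans (ℕₚ.*-identityʳ (1 * u ^ s)) (ℕₚ.*-identityˡ (u ^ s)) ⟩
    u ^ s           ≤⟨ ^-monoˡ-≤ s u≤v ⟩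
    v ^ s           ≡⟨ ℕₚ.*-identityˡ (v ^ s) ⟨
    1 * v ^ s       ∎
  binomialSum-weighted {u} {v} u≤v (suc l) zero = begin
    1 * 1 * v ^ suc l     ≡⟨ ℕₚ.*-identityˡ (v ^ suc l) ⟩
    v ^ suc l             ≤⟨ ^-monoˡ-≤ (suc l) (m≤n+m v u) ⟩
    (u + v) ^ suc l       ≡⟨ ℕₚ.*-identityʳ ((u + v) ^ suc l) ⟨
    (u + v) ^ suc l * 1   ∎
  binomialSum-weighted {u} {v} u≤v (suc l) (suc s) = begin
    (F₁ + F₂) * (u * u ^ s) * (v * v ^ l)                          ≡⟨ split F₁ F₂ u (u ^ s) v (v ^ l) ⟩
    u * v * (F₁ * u ^ s * v ^ l) + v * (F₂ * (u * u ^ s) * v ^ l)  ≤⟨ +-mono-≤ (*-monoʳ-≤ (u * v) (binomialSum-weighted u≤v l s)) (*-monoʳ-≤ v (binomialSum-weighted u≤v l (suc s))) ⟩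
    u * v * (P * v ^ s) + v * (P * (v * v ^ s))                    ≡⟨ merge u v P (v ^ s) ⟩
    (u + v) * P * (v * v ^ s)                                      ∎
    where
    F₁ = binomialSum l s
    F₂ = binomialSum l (suc s)
    P = (u + v) ^ l
    split : ∀ F₁ F₂ u us v vl → (F₁ + F₂) * (u * us) * (v * vl) ≡ u * v * (F₁ * us * vl) + v * (F₂ * (u * us) * vl)
    split = solve-∀
    merge : ∀ u v P vs → u * v * (P * vs) + v * (P * (v * vs)) ≡ (u + v) * P * (v * vs)
    merge = solve-∀

  -- Bernoulli's inequality (1 - 1/(x + 1))^n ≥ 1 - n/(x + 1) with denominators cleared; z stands
  -- for x + 1 - n.
  bernoulli : ∀ x n z → n + z ≡ suc x → suc x ^ n * z ≤ x ^ n * suc x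
  bernoulli x zero    z refl = ≤-refl
  bernoulli x (suc n) z eq   = begin
    suc x * suc x ^ n * z         ≡⟨ lem₁ (suc x) (suc x ^ n) z ⟩
    suc x ^ n * (suc x * z)       ≤⟨ *-monoʳ-≤ (suc x ^ n) step ⟩
    suc x ^ n * (suc z * x)       ≡⟨ ℕₚ.*-assoc (suc x ^ n) (suc z) x ⟨
    suc x ^ n * suc z * x         ≤⟨ *-monoˡ-≤ x (bernoulli x n (suc z) (trans (ℕₚ.+-suc n z) eq)) ⟩
    x ^ n * suc x * x             ≡⟨ lem₂ (x ^ n) (suc x) x ⟩
    x * x ^ n * suc x             ∎
    where
    lem₁ : ∀ a b c → a * b * c ≡ b * (a * c)
    lem₁ = solve-∀
    lem₂ : ∀ a b c → a * b * c ≡ c * a * b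
    lem₂ = solve-∀
    z≤x : z ≤ x
    z≤x = ≤-trans (m≤n+m z n) (≤-reflexive (ℕₚ.suc-injective eq))
    step : suc x * z ≤ suc z * x
    step = +-mono-≤ z≤x (≤-reflexive (ℕₚ.*-comm x z))

-- Chernoff's bound in integers

module _ where

  open ℕₚ.≤-Reasoning

  -- From (1 + 1/L)^L ≥ 9/4 and 9⁶ ≥ 2⁷ 4⁶.

  compound-interest : ∀ l → 2 ^ 7 * suc (suc l) ^ (6 * suc (suc l)) ≤ suc (suc (suc l)) ^ (6 * suc (suc l))
  compound-interest l = ℕₚ.*-cancelˡ-≤ (4 ^ 6) (begin
    4 ^ 6 * (2 ^ 7 * L ^ (6 * L))   ≡⟨ ℕₚ.*-assoc (4 ^ 6) (2 ^ 7) (L ^ (6 * L)) ⟨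
    4 ^ 6 * 2 ^ 7 * L ^ (6 * L)     ≤⟨ *-monoˡ-≤ (L ^ (6 * L)) (ℕₚ.≤ᵇ⇒≤ (4 ^ 6 * 2 ^ 7) (9 ^ 6) tt) ⟩
    9 ^ 6 * L ^ (6 * L)             ≡⟨ cong (9 ^ 6 *_) (pow L) ⟩
    9 ^ 6 * (L ^ L) ^ 6             ≡⟨ ^-distribʳ-* 6 9 (L ^ L) ⟨
    (9 * L ^ L) ^ 6                 ≤⟨ ^-monoˡ-≤ 6 nine-fourths ⟩
    (4 * M ^ L) ^ 6                 ≡⟨ ^-distribʳ-* 6 4 (M ^ L) ⟩
    4 ^ 6 * (M ^ L) ^ 6             ≡⟨ cong (4 ^ 6 *_) (pow M) ⟨
    4 ^ 6 * M ^ (6 * L)             ∎)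
    where
    L = suc (suc l)
    M = suc L
    pow : ∀ a → a ^ (6 * L) ≡ (a ^ L) ^ 6
    pow a = trans (cong (a ^_) (ℕₚ.*-comm 6 L)) (sym (^-*-assoc a L 6))
    -- The first three terms of the binomial expansion of (L + 1)ʲ.
    binomial₂ : ∀ j → 2 * L ^ 2 * L ^ j + 2 * j * L * L ^ j + j * (j ∸ 1) * L ^ j ≤ 2 * L ^ 2 * M ^ j
    binomial₂ zero = ≤-reflexive (trans (ℕₚ.+-identityʳ _) (ℕₚ.+-identityʳ _))
    binomial₂ (suc j) = begin
      2 * L ^ 2 * (L * Lʲ) + 2 * suc j * L * (L * Lʲ) + suc j * j * (L * Lʲ)
        ≤⟨ m≤m+n _ (j * (j ∸ 1) * Lʲ) ⟩
      2 * L ^ 2 * (L * Lʲ) + 2 * suc j * L * (L * Lʲ) + suc j * j * (L * Lʲ) + j * (j ∸ 1) * Lʲ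
        ≡⟨ cong (λ z → 2 * L ^ 2 * (L * Lʲ) + 2 * suc j * L * (L * Lʲ) + z * (L * Lʲ) + j * (j ∸ 1) * Lʲ) (triangle j) ⟩
      2 * L ^ 2 * (L * Lʲ) + 2 * suc j * L * (L * Lʲ) + (2 * j + j * (j ∸ 1)) * (L * Lʲ) + j * (j ∸ 1) * Lʲ
        ≡⟨ regroup L Lʲ j (j * (j ∸ 1)) ⟩
      suc L * (2 * L ^ 2 * Lʲ + 2 * j * L * Lʲ + j * (j ∸ 1) * Lʲ)
        ≤⟨ *-monoʳ-≤ (suc L) (binomial₂ j) ⟩
      suc L * (2 * L ^ 2 * M ^ j)
        ≡⟨ swap (suc L) (2 * L ^ 2) (M ^ j) ⟩
      2 * L ^ 2 * (M * M ^ j) ∎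
      where
      Lʲ = L ^ j
      triangle : ∀ j → suc j * j ≡ 2 * j + j * (j ∸ 1)
      triangle zero    = refl
      triangle (suc j) = lem j
        where
        lem : ∀ j → suc (suc j) * suc j ≡ 2 * suc j + suc j * j
        lem = solve-∀
      regroup : ∀ L P j c → 2 * (L * (L * 1)) * (L * P) + 2 * suc j * L * (L * P) + (2 * j + c) * (L * P) + c * P
                          ≡ suc L * (2 * (L * (L * 1)) * P + 2 * j * L * P + c * P)
      regroup = solve-∀
      swap : ∀ a b c → a * (b * c) ≡ b * (a * c)
      swap = solve-∀
    -- At j = L the three terms give 1 + 1 + (L - 1)/(2 L), which is at least 9/4 as soon as L ≥ 2.
    nine-fourths : 9 * L ^ L ≤ 4 * M ^ L
    nine-fourths = ℕₚ.*-cancelˡ-≤ (L ^ 2) {{m^n≢0 L 2}} (begin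
      L ^ 2 * (9 * L ^ L)
        ≤⟨ m≤m+n _ (l * L * (L ^ L)) ⟩
      L ^ 2 * (9 * L ^ L) + l * L * (L ^ L)
        ≡⟨ lem l (L ^ L) ⟩
      2 * (2 * L ^ 2 * L ^ L + 2 * L * L * L ^ L + L * (L ∸ 1) * L ^ L)
        ≤⟨ *-monoʳ-≤ 2 (binomial₂ L) ⟩
      2 * (2 * L ^ 2 * M ^ L)
        ≡⟨ lem₂ (L ^ 2) (M ^ L) ⟩
      L ^ 2 * (4 * M ^ L) ∎)
      where
      lem : ∀ l P → (2 + l) * ((2 + l) * 1) * (9 * P) + l * (2 + l) * P
                  ≡ 2 * (2 * ((2 + l) * ((2 + l) * 1)) * P + 2 * (2 + l) * (2 + l) * P + (2 + l) * (1 + l) * P)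
      lem = solve-∀
      lem₂ : ∀ a b → 2 * (2 * a * b) ≡ a * (4 * b)
      lem₂ = solve-∀

  -- The weights (L/(L+1))² in binomialSum-weighted; 2LD = m + e with m = D + 2s.

  binomialSum-tilted : ∀ L D s e → .{{NonZero L}} → 2 * L * D ≡ D + 2 * s + e →
    binomialSum (D + 2 * s) s ^ (2 * L) * suc L ^ e ≤ 2 ^ (2 * L * (D + 2 * s)) * L ^ e
  binomialSum-tilted L D s e 2LD≡m+e =
    ℕₚ.*-cancelʳ-≤ (F ^ (2 * L) * M ^ e) (2 ^ (2 * L * m) * L ^ e) (L ^ m * M ^ m) {{nz₂}} (begin
      F ^ (2 * L) * M ^ e * (L ^ m * M ^ m)        ≡⟨ re₁ (F ^ (2 * L)) (M ^ e) (L ^ m) (M ^ m) ⟩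
      F ^ (2 * L) * (M ^ m * M ^ e) * L ^ m        ≡⟨ cong (λ z → F ^ (2 * L) * z * L ^ m) (split M) ⟨
      F ^ (2 * L) * M ^ E * L ^ m                  ≤⟨ cancelled ⟩
      2 ^ (2 * L * m) * L ^ E * M ^ m              ≡⟨ cong (λ z → 2 ^ (2 * L * m) * z * M ^ m) (split L) ⟩
      2 ^ (2 * L * m) * (L ^ m * L ^ e) * M ^ m    ≡⟨ re₂ (2 ^ (2 * L * m)) (L ^ m) (L ^ e) (M ^ m) ⟩
      2 ^ (2 * L * m) * L ^ e * (L ^ m * M ^ m)    ∎)
    where
    M = suc L
    m = D + 2 * s
    E = 2 * L * D
    F = binomialSum m s
    y = 2 * (L * M)
    W = (L * M) ^ (2 * s)
    split : ∀ a → a ^ E ≡ a ^ m * a ^ e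
    split a = trans (cong (a ^_) 2LD≡m+e) (^-distribˡ-+-* a m e)
    re₁ : ∀ a b c d → a * b * (c * d) ≡ a * (d * b) * c
    re₁ = solve-∀
    re₂ : ∀ a b c d → a * (b * c) * d ≡ a * c * (b * d)
    re₂ = solve-∀
    nzL : NonZero (L ^ m)
    nzL = m^n≢0 L m
    nz₂ : NonZero (L ^ m * M ^ m)
    nz₂ = m*n≢0 (L ^ m) (M ^ m) {{nzL}} {{m^n≢0 M m}}
    nzW : NonZero W
    nzW = m^n≢0 (L * M) (2 * s) {{m*n≢0 L M}}
    weighted : F * W * M ^ (2 * D) ≤ suc y ^ m
    weighted = ℕₚ.*-cancelʳ-≤ (F * W * M ^ (2 * D)) (suc y ^ m) ((M ^ 2) ^ s) {{m^n≢0 (M ^ 2) s {{m^n≢0 M 2}}}} (begin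
      F * W * M ^ (2 * D) * (M ^ 2) ^ s               ≡⟨ cong₂ (λ w z → F * w * z * (M ^ 2) ^ s) W≡ (sym (^-*-assoc M 2 D)) ⟩
      F * ((L ^ 2) ^ s * V) * (M ^ 2) ^ D * V         ≡⟨ re F ((L ^ 2) ^ s) V ((M ^ 2) ^ D) ⟩
      F * (L ^ 2) ^ s * ((M ^ 2) ^ D * (V * V))       ≡⟨ cong (λ z → F * (L ^ 2) ^ s * ((M ^ 2) ^ D * z)) (trans (cong (λ t → (M ^ 2) ^ (s + t)) (ℕₚ.+-identityʳ s)) (^-distribˡ-+-* (M ^ 2) s s)) ⟨
      F * (L ^ 2) ^ s * ((M ^ 2) ^ D * (M ^ 2) ^ (2 * s)) ≡⟨ cong (F * (L ^ 2) ^ s *_) (^-distribˡ-+-* (M ^ 2) D (2 * s)) ⟨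
      F * (L ^ 2) ^ s * (M ^ 2) ^ m                   ≤⟨ binomialSum-weighted {L ^ 2} {M ^ 2} (^-monoˡ-≤ 2 (n≤1+n L)) m s ⟩
      (L ^ 2 + M ^ 2) ^ m * (M ^ 2) ^ s               ≡⟨ cong (λ z → z ^ m * (M ^ 2) ^ s) (squares L) ⟩
      suc y ^ m * (M ^ 2) ^ s                         ∎)
      where
      V = (M ^ 2) ^ s
      W≡ : W ≡ (L ^ 2) ^ s * V
      W≡ = trans (^-distribʳ-* (2 * s) L M) (cong₂ _*_ (sym (^-*-assoc L 2 s)) (sym (^-*-assoc M 2 s)))
      re : ∀ F a V d → F * (a * V) * d * V ≡ F * a * (d * (V * V))
      re = solve-∀
      squares : ∀ L → L * (L * 1) + suc L * (suc L * 1) ≡ suc (2 * (L * suc L))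
      squares = solve-∀
    -- The weights sum to L² + M² = y + 1, so the tilt costs a factor 1 + 1/y per element. Over 2 L
    -- factors this is at most M/L by `bernoulli`: the products L (y + 1) and z M differ by exactly
    -- 1.
    bern : suc y ^ (2 * L) * L ≤ y ^ (2 * L) * M
    bern = ℕₚ.*-cancelʳ-≤ (suc y ^ (2 * L) * L) (y ^ (2 * L) * M) (suc y) (begin
      suc y ^ (2 * L) * L * suc y               ≡⟨ ℕₚ.*-assoc (suc y ^ (2 * L)) L (suc y) ⟩
      suc y ^ (2 * L) * (L * suc y)             ≤⟨ *-monoʳ-≤ (suc y ^ (2 * L)) (subst (L * suc y ≤_) (grow L) (m≤m+n _ 1)) ⟩
      suc y ^ (2 * L) * (z * M)                 ≡⟨ ℕₚ.*-assoc (suc y ^ (2 * L)) z M ⟨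
      suc y ^ (2 * L) * z * M                   ≤⟨ *-monoˡ-≤ M (bernoulli y (2 * L) z (complement L)) ⟩
      y ^ (2 * L) * suc y * M                   ≡⟨ ℕₚ.*-assoc (y ^ (2 * L)) (suc y) M ⟩
      y ^ (2 * L) * (suc y * M)                 ≡⟨ cong (y ^ (2 * L) *_) (ℕₚ.*-comm (suc y) M) ⟩
      y ^ (2 * L) * (M * suc y)                 ≡⟨ ℕₚ.*-assoc (y ^ (2 * L)) M (suc y) ⟨
      y ^ (2 * L) * M * suc y                   ∎)
      where
      z = 2 * (L * L) + 1
      grow : ∀ L → L * suc (2 * (L * suc L)) + 1 ≡ (2 * (L * L) + 1) * suc L
      grow = solve-∀
      complement : ∀ L → 2 * L + (2 * (L * L) + 1) ≡ suc (2 * (L * suc L))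
      complement = solve-∀
    powered : F ^ (2 * L) * W ^ (2 * L) * M ^ (2 * E) * L ^ m ≤ 2 ^ (2 * L * m) * W ^ (2 * L) * (L * M) ^ E * M ^ m
    powered = begin
      F ^ (2 * L) * W ^ (2 * L) * M ^ (2 * E) * L ^ m      ≡⟨ cong (λ z → F ^ (2 * L) * W ^ (2 * L) * z * L ^ m) (trans (cong (M ^_) (2E≡ L D)) (sym (^-*-assoc M (2 * D) (2 * L)))) ⟩
      F ^ (2 * L) * W ^ (2 * L) * (M ^ (2 * D)) ^ (2 * L) * L ^ m ≡⟨ cong (_* L ^ m) (trans (^-distribʳ-* (2 * L) (F * W) (M ^ (2 * D))) (cong (_* (M ^ (2 * D)) ^ (2 * L)) (^-distribʳ-* (2 * L) F W))) ⟨
      (F * W * M ^ (2 * D)) ^ (2 * L) * L ^ m              ≤⟨ *-monoˡ-≤ (L ^ m) (^-monoˡ-≤ (2 * L) weighted) ⟩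
      (suc y ^ m) ^ (2 * L) * L ^ m                        ≡⟨ cong (_* L ^ m) (swap (suc y) m (2 * L)) ⟩
      (suc y ^ (2 * L)) ^ m * L ^ m                        ≡⟨ ^-distribʳ-* m (suc y ^ (2 * L)) L ⟨
      (suc y ^ (2 * L) * L) ^ m                            ≤⟨ ^-monoˡ-≤ m bern ⟩
      (y ^ (2 * L) * M) ^ m                                ≡⟨ ^-distribʳ-* m (y ^ (2 * L)) M ⟩
      (y ^ (2 * L)) ^ m * M ^ m                            ≡⟨ cong (_* M ^ m) (^-*-assoc y (2 * L) m) ⟩
      y ^ (2 * L * m) * M ^ m                              ≡⟨ cong (_* M ^ m) (^-distribʳ-* (2 * L * m) 2 (L * M)) ⟩
      2 ^ (2 * L * m) * (L * M) ^ (2 * L * m) * M ^ m      ≡⟨ cong (λ z → 2 ^ (2 * L * m) * z * M ^ m) LM ⟩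
      2 ^ (2 * L * m) * (W ^ (2 * L) * (L * M) ^ E) * M ^ m ≡⟨ cong (_* M ^ m) (ℕₚ.*-assoc (2 ^ (2 * L * m)) (W ^ (2 * L)) ((L * M) ^ E)) ⟨
      2 ^ (2 * L * m) * W ^ (2 * L) * (L * M) ^ E * M ^ m  ∎
      where
      swap : ∀ a i j → (a ^ i) ^ j ≡ (a ^ j) ^ i
      swap a i j = trans (^-*-assoc a i j) (trans (cong (a ^_) (ℕₚ.*-comm i j)) (sym (^-*-assoc a j i)))
      2E≡ : ∀ L D → 2 * (2 * L * D) ≡ 2 * D * (2 * L)
      2E≡ = solve-∀
      exps : ∀ L D s → 2 * L * (D + 2 * s) ≡ 2 * s * (2 * L) + 2 * L * D
      exps = solve-∀
      LM : (L * M) ^ (2 * L * m) ≡ W ^ (2 * L) * (L * M) ^ E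
      LM = trans (cong ((L * M) ^_) (exps L D s)) (trans (^-distribˡ-+-* (L * M) (2 * s * (2 * L)) E)
             (cong (_* (L * M) ^ E) (sym (^-*-assoc (L * M) (2 * s) (2 * L)))))
    cancelled : F ^ (2 * L) * M ^ E * L ^ m ≤ 2 ^ (2 * L * m) * L ^ E * M ^ m
    cancelled = ℕₚ.*-cancelʳ-≤ _ _ (W ^ (2 * L) * M ^ E) {{m*n≢0 (W ^ (2 * L)) (M ^ E) {{m^n≢0 W (2 * L) {{nzW}}}} {{m^n≢0 M E}}}} (begin
      F ^ (2 * L) * M ^ E * L ^ m * (W ^ (2 * L) * M ^ E)     ≡⟨ re₃ (F ^ (2 * L)) (M ^ E) (L ^ m) (W ^ (2 * L)) ⟩
      F ^ (2 * L) * W ^ (2 * L) * (M ^ E * M ^ E) * L ^ m     ≡⟨ cong (λ z → F ^ (2 * L) * W ^ (2 * L) * z * L ^ m) (trans (cong (λ t → M ^ (E + t)) (ℕₚ.+-identityʳ E)) (^-distribˡ-+-* M E E)) ⟨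
      F ^ (2 * L) * W ^ (2 * L) * M ^ (2 * E) * L ^ m         ≤⟨ powered ⟩
      2 ^ (2 * L * m) * W ^ (2 * L) * (L * M) ^ E * M ^ m     ≡⟨ cong (λ z → 2 ^ (2 * L * m) * W ^ (2 * L) * z * M ^ m) (^-distribʳ-* E L M) ⟩
      2 ^ (2 * L * m) * W ^ (2 * L) * (L ^ E * M ^ E) * M ^ m ≡⟨ re₄ (2 ^ (2 * L * m)) (W ^ (2 * L)) (L ^ E) (M ^ E) (M ^ m) ⟩
      2 ^ (2 * L * m) * L ^ E * M ^ m * (W ^ (2 * L) * M ^ E) ∎)
      where
      re₃ : ∀ a b c d → a * b * c * (d * b) ≡ a * d * (b * b) * c
      re₃ = solve-∀
      re₄ : ∀ a b c d e → a * b * (c * d) * e ≡ a * c * e * (b * d)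
      re₄ = solve-∀

  -- The tilt is L = ⌊m/D⌋.

  binomialSum-chernoff : ∀ D s v → 1 ≤ D + 2 * s → 3 * D ≤ D + 2 * s → 2 * (D + 2 * s) * v ≤ D * D →
    binomialSum (D + 2 * s) s * 2 ^ v ≤ 2 ^ (D + 2 * s)
  -- D = 0 forces v = 0 because m ≥ 1, and then the trivial bound 2^m is enough.
  binomialSum-chernoff zero s v 1≤m _ 2mv≤0 with ℕₚ.m*n≡0⇒m≡0∨n≡0 (2 * (2 * s)) (ℕₚ.n≤0⇒n≡0 2mv≤0)
  ... | inj₂ refl = subst (_≤ 2 ^ (2 * s)) (sym (ℕₚ.*-identityʳ _)) (binomialSum≤2^ (2 * s) s)
  ... | inj₁ 4s≡0 = contradiction (ℕₚ.m*n≡0⇒m≡0∨n≡0 2 4s≡0) λ where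
    (inj₂ 2s≡0) → ℕₚ.<⇒≢ 1≤m (sym 2s≡0)
  binomialSum-chernoff D@(suc _) s v _ 3D≤m 2mv≤DD = ^-cancel-≤ P (begin
    (F * 2 ^ v) ^ P             ≡⟨ ^-distribʳ-* P F (2 ^ v) ⟩
    F ^ P * (2 ^ v) ^ P         ≡⟨ cong (F ^ P *_) (^-*-assoc 2 v P) ⟩
    F ^ P * 2 ^ (v * P)         ≤⟨ *-monoʳ-≤ (F ^ P) (^-monoʳ-≤ 2 vP≤7e) ⟩
    F ^ P * 2 ^ (7 * e)         ≤⟨ main ⟩
    2 ^ (P * m)                 ≡⟨ cong (2 ^_) (ℕₚ.*-comm P m) ⟩
    2 ^ (m * P)                 ≡⟨ ^-*-assoc 2 m P ⟨
    (2 ^ m) ^ P                 ∎)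
    where
    m = D + 2 * s
    L = m / D
    t = m % D
    F = binomialSum m s
    X = L * D
    m≡ : m ≡ t + X
    m≡ = m≡m%n+[m/n]*n m D
    t≤D : t ≤ D
    t≤D = ℕₚ.<⇒≤ (m%n<n m D)
    3≤L : 3 ≤ L
    3≤L = ℕₚ.≮⇒≥ λ L<3 → ℕₚ.<⇒≱ (m%n<n m D) (ℕₚ.+-cancelʳ-≤ (2 * D) D t (begin
      D + 2 * D   ≤⟨ 3D≤m ⟩
      m           ≡⟨ m≡ ⟩
      t + L * D   ≤⟨ +-monoʳ-≤ t (*-monoˡ-≤ D (ℕₚ.≤-pred L<3)) ⟩
      t + 2 * D   ∎))
    instance
      nzL : NonZero L
      nzL = ℕ.>-nonZero (≤-trans (s≤s z≤n) 3≤L)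
    -- The inequality is proved for its P-th power: `binomialSum-tilted` consumes the exponent 2 L
    -- and `compound-interest` the exponent 6 L.
    P = 6 * L * (2 * L)
    instance
      nzP : NonZero P
      nzP = m*n≢0 (6 * L) (2 * L) {{m*n≢0 6 L}} {{m*n≢0 2 L}}
    3t≤X : 3 * t ≤ X
    3t≤X = *-mono-≤ 3≤L t≤D
    t≤X : t ≤ X
    t≤X = ≤-trans (m≤m+n t (2 * t)) 3t≤X
    -- As 2 L D = 2 X and m = X + t, this is the `e` that `binomialSum-tilted` asks for.
    e = X ∸ t
    e+t : e + t ≡ X
    e+t = m∸n+n≡m t≤X
    2LD≡ : 2 * L * D ≡ m + e
    2LD≡ = begin-equality
      2 * L * D       ≡⟨ ℕₚ.*-assoc 2 L D ⟩
      2 * X           ≡⟨ cong (λ z → X + (z + 0)) e+t ⟨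
      X + (e + t + 0) ≡⟨ lem X e t ⟩
      t + X + e       ≡⟨ cong (_+ e) m≡ ⟨
      m + e           ∎
      where
      lem : ∀ X e t → X + (e + t + 0) ≡ t + X + e
      lem = solve-∀
    main : F ^ P * 2 ^ (7 * e) ≤ 2 ^ (P * m)
    main = ℕₚ.*-cancelʳ-≤ _ _ ((L ^ e) ^ (6 * L)) {{m^n≢0 (L ^ e) (6 * L) {{m^n≢0 L e}}}} (begin
      F ^ P * 2 ^ (7 * e) * (L ^ e) ^ (6 * L)                ≡⟨ ℕₚ.*-assoc (F ^ P) _ _ ⟩
      F ^ P * (2 ^ (7 * e) * (L ^ e) ^ (6 * L))              ≤⟨ *-monoʳ-≤ (F ^ P) interest ⟩
      F ^ P * (M ^ e) ^ (6 * L)                              ≡⟨ cong (_* (M ^ e) ^ (6 * L)) (trans (cong (F ^_) (ℕₚ.*-comm (6 * L) (2 * L))) (sym (^-*-assoc F (2 * L) (6 * L)))) ⟩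
      (F ^ (2 * L)) ^ (6 * L) * (M ^ e) ^ (6 * L)            ≡⟨ ^-distribʳ-* (6 * L) (F ^ (2 * L)) (M ^ e) ⟨
      (F ^ (2 * L) * M ^ e) ^ (6 * L)                        ≤⟨ ^-monoˡ-≤ (6 * L) (binomialSum-tilted L D s e 2LD≡) ⟩
      (2 ^ (2 * L * m) * L ^ e) ^ (6 * L)                    ≡⟨ ^-distribʳ-* (6 * L) (2 ^ (2 * L * m)) (L ^ e) ⟩
      (2 ^ (2 * L * m)) ^ (6 * L) * (L ^ e) ^ (6 * L)        ≡⟨ cong (_* (L ^ e) ^ (6 * L)) (trans (^-*-assoc 2 (2 * L * m) (6 * L)) (cong (2 ^_) (lem L m))) ⟩
      2 ^ (P * m) * (L ^ e) ^ (6 * L)                        ∎)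
      where
      M = suc L
      lem : ∀ L m → 2 * L * m * (6 * L) ≡ 6 * L * (2 * L) * m
      lem = solve-∀
      ex : ∀ a → (a ^ e) ^ (6 * L) ≡ (a ^ (6 * L)) ^ e
      ex a = trans (^-*-assoc a e (6 * L)) (trans (cong (a ^_) (ℕₚ.*-comm e (6 * L))) (sym (^-*-assoc a (6 * L) e)))
      compound : ∀ L → 3 ≤ L → 2 ^ 7 * L ^ (6 * L) ≤ suc L ^ (6 * L)
      compound (suc (suc l)) _ = compound-interest l
      compound (suc zero) (s≤s ())
      interest : 2 ^ (7 * e) * (L ^ e) ^ (6 * L) ≤ (M ^ e) ^ (6 * L)
      interest = begin
        2 ^ (7 * e) * (L ^ e) ^ (6 * L)      ≡⟨ cong₂ _*_ (sym (^-*-assoc 2 7 e)) (ex L) ⟩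
        (2 ^ 7) ^ e * (L ^ (6 * L)) ^ e      ≡⟨ ^-distribʳ-* e (2 ^ 7) (L ^ (6 * L)) ⟨
        (2 ^ 7 * L ^ (6 * L)) ^ e            ≤⟨ ^-monoˡ-≤ e (compound L 3≤L) ⟩
        (M ^ (6 * L)) ^ e                    ≡⟨ ex M ⟨
        (M ^ e) ^ (6 * L)                    ∎
    -- 7 e m = 7 (X - t)(X + t) ≥ 6 X² as 3 t ≤ X.
    6XX≤7em : 6 * (X * X) ≤ 7 * e * m
    6XX≤7em = ℕₚ.+-cancelʳ-≤ (X * X) _ _ (begin
      6 * (X * X) + X * X             ≡⟨ lem₁ X ⟩
      7 * (X * X)                     ≡⟨ cong (λ z → 7 * (z * z)) e+t ⟨
      7 * ((e + t) * (e + t))         ≡⟨ lem₂ e t ⟩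
      7 * e * (t + (e + t)) + 7 * (t * t) ≤⟨ +-monoʳ-≤ (7 * e * (t + (e + t))) 7tt ⟩
      7 * e * (t + (e + t)) + X * X   ≡⟨ cong (λ z → 7 * e * (t + z) + X * X) e+t ⟩
      7 * e * (t + X) + X * X         ≡⟨ cong (λ z → 7 * e * z + X * X) m≡ ⟨
      7 * e * m + X * X               ∎)
      where
      lem₁ : ∀ X → 6 * (X * X) + X * X ≡ 7 * (X * X)
      lem₁ = solve-∀
      lem₂ : ∀ e t → 7 * ((e + t) * (e + t)) ≡ 7 * e * (t + (e + t)) + 7 * (t * t)
      lem₂ = solve-∀
      lem₃ : ∀ t → 7 * (t * t) + 2 * (t * t) ≡ 3 * t * (3 * t)
      lem₃ = solve-∀
      7tt : 7 * (t * t) ≤ X * X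
      7tt = begin
        7 * (t * t)                 ≤⟨ m≤m+n _ (2 * (t * t)) ⟩
        7 * (t * t) + 2 * (t * t)   ≡⟨ lem₃ t ⟩
        3 * t * (3 * t)             ≤⟨ *-mono-≤ 3t≤X 3t≤X ⟩
        X * X                       ∎
    -- Multiplied by m, the left side is 6 L² · 2 m v ≤ 6 L² D² = 6 X². The 7 of `compound-interest`
    -- against this 6 is the part of log₂ e that is used.
    vP≤7e : v * P ≤ 7 * e
    vP≤7e = ℕₚ.*-cancelʳ-≤ (v * P) (7 * e) m (begin
      v * P * m                      ≡⟨ lem₁ v L m ⟩
      6 * (L * L) * (2 * m * v)      ≤⟨ *-monoʳ-≤ (6 * (L * L)) 2mv≤DD ⟩
      6 * (L * L) * (D * D)          ≡⟨ lem₂ L D ⟩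
      6 * (X * X)                    ≤⟨ 6XX≤7em ⟩
      7 * e * m                      ∎)
      where
      lem₁ : ∀ v L m → v * (6 * L * (2 * L)) * m ≡ 6 * (L * L) * (2 * m * v)
      lem₁ = solve-∀
      lem₂ : ∀ L D → 6 * (L * L) * (D * D) ≡ 6 * (L * D * (L * D))
      lem₂ = solve-∀

-- Values computed by the timed primitives

private
  variable
    A B V : Set
    d m n : ℕ

-- Presents a timed test as a decidable predicate, so that `partitionᵗ` and `filterᵗ` become the
-- standard `filter` and inherit its theory.
T-dec : (p : A → Timed Bool) → ∀ x → Dec (value (p x) ≡ true)
T-dec p x = value (p x) Boolₚ.≟ true

true≢false : ∀ {b} → b ≡ true → ¬ (b ≡ false)
true≢false refl ()

any⁺ : ∀ (p : A → Timed Bool) {x xs} → x ∈ xs → value (p x) ≡ true → value (anyᵗ p xs) ≡ true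
any⁺ p {xs = y ∷ ys} (here refl) px rewrite px = refl
any⁺ p {xs = y ∷ ys} (there x∈ys) px with value (p y)
... | true  = refl
... | false = any⁺ p x∈ys px

any⁻ : ∀ (p : A → Timed Bool) xs → value (anyᵗ p xs) ≡ true → ∃ λ x → x ∈ xs × value (p x) ≡ true
any⁻ p (x ∷ xs) eq with value (p x) in px
... | true  = x , here refl , px
... | false with y , y∈xs , py ← any⁻ p xs eq = y , there y∈xs , py

all⁺ : ∀ (p : A → Timed Bool) xs → (∀ {x} → x ∈ xs → value (p x) ≡ true) → value (allᵗ p xs) ≡ true
all⁺ p []       h = refl
all⁺ p (x ∷ xs) h rewrite h (here refl) = all⁺ p xs (h ∘ there)

all⁻ : ∀ (p : A → Timed Bool) {x xs} → value (allᵗ p xs) ≡ true → x ∈ xs → value (p x) ≡ true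
all⁻ p {xs = y ∷ ys} eq x∈ with value (p y) in py
all⁻ p {xs = y ∷ ys} eq (here refl)  | true = py
all⁻ p {xs = y ∷ ys} eq (there x∈ys) | true = all⁻ p eq x∈ys
all⁻ p {xs = y ∷ ys} () _            | false

map-value : ∀ (f : A → Timed B) xs → value (mapᵗ f xs) ≡ map (value ∘ f) xs
map-value f []       = refl
map-value f (x ∷ xs) = cong (value (f x) ∷_) (map-value f xs)

mapVec-value : ∀ (f : A → Timed B) (xs : Vec A n) → value (mapVecᵗ f xs) ≡ Vec.map (value ∘ f) xs
mapVec-value f []       = refl
mapVec-value f (x ∷ xs) = cong (value (f x) ∷_) (mapVec-value f xs)

partition-value : ∀ (p : A → Timed Bool) xs →
  value (partitionᵗ p xs) ≡ (List.filter (T-dec p) xs , List.filter (¬? ∘ T-dec p) xs)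
partition-value p []       = refl
partition-value p (x ∷ xs) with value (p x) | partition-value p xs
... | true  | eq = cong (λ { (ys , zs) → x ∷ ys , zs }) eq
... | false | eq = cong (λ { (ys , zs) → ys , x ∷ zs }) eq

filter-value : ∀ (p : A → Timed Bool) xs → value (filterᵗ p xs) ≡ List.filter (T-dec p) xs
filter-value p xs = cong proj₁ (partition-value p xs)

append-value : ∀ (xs ys : List A) → value (appendᵗ xs ys) ≡ xs ++ ys
append-value []       ys = refl
append-value (x ∷ xs) ys = cong (x ∷_) (append-value xs ys)

concat-value : ∀ (xss : List (List A)) → value (concatᵗ xss) ≡ concat xss
concat-value []         = refl
concat-value (xs ∷ xss) = trans (append-value xs _) (cong (xs ++_) (concat-value xss))

length-value : ∀ (xs : List A) → value (lengthᵗ xs) ≡ length xs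
length-value []       = refl
length-value (x ∷ xs) = cong suc (length-value xs)

splitAt-value : ∀ h (xs : List A) → value (splitAtᵗ h xs) ≡ (take h xs , drop h xs)
splitAt-value zero    xs       = refl
splitAt-value (suc h) []       = refl
splitAt-value (suc h) (x ∷ xs) = cong (λ { (ys , zs) → x ∷ ys , zs }) (splitAt-value h xs)

add-value : ∀ i j → value (addᵗ i j) ≡ i + j
add-value zero    j = refl
add-value (suc i) j = cong suc (add-value i j)

half-value : ∀ i → value (halfᵗ i) ≡ ℕ.⌊ i /2⌋
half-value zero          = refl
half-value (suc zero)    = refl
half-value (suc (suc i)) = cong suc (half-value i)

leq⁺ : ∀ {i j} → i ≤ j → value (leqᵗ i j) ≡ true
leq⁺ {zero}  _       = refl
leq⁺ {suc i} (s≤s p) = leq⁺ p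

leq⁻ : ∀ i j → value (leqᵗ i j) ≡ true → i ≤ j
leq⁻ zero    j       _  = z≤n
leq⁻ (suc i) (suc j) eq = s≤s (leq⁻ i j eq)

eqℕ-refl : ∀ i → value (eqℕᵗ i i) ≡ true
eqℕ-refl zero    = refl
eqℕ-refl (suc i) = eqℕ-refl i

eqℕ⁻ : ∀ i j → value (eqℕᵗ i j) ≡ true → i ≡ j
eqℕ⁻ zero    zero    _  = refl
eqℕ⁻ (suc i) (suc j) eq = cong suc (eqℕ⁻ i j eq)

eqFin-refl : ∀ (i : Fin n) → value (eqFinᵗ i i) ≡ true
eqFin-refl zero    = refl
eqFin-refl (suc i) = eqFin-refl i

eqFin⁻ : ∀ (i j : Fin n) → value (eqFinᵗ i j) ≡ true → i ≡ j
eqFin⁻ zero    zero    _  = refl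
eqFin⁻ (suc i) (suc j) eq = cong suc (eqFin⁻ i j eq)

elem⁺ : ∀ {eq : A → A → Timed Bool} → (∀ x → value (eq x x) ≡ true) → ∀ {x xs} →
  x ∈ xs → value (elemᵗ eq x xs) ≡ true
elem⁺ {eq = eq} eq-refl {x} x∈xs = any⁺ (eq x) x∈xs (eq-refl x)

elem⁻ : ∀ {eq : A → A → Timed Bool} → (∀ x y → value (eq x y) ≡ true → x ≡ y) → ∀ {x} xs →
  value (elemᵗ eq x xs) ≡ true → x ∈ xs
elem⁻ {eq = eq} eq⁻ {x} xs e with y , y∈xs , xy ← any⁻ (eq x) xs e rewrite eq⁻ x y xy = y∈xs

anyVec⁺ : ∀ (p : A → Timed Bool) {x} {xs : Vec A n} → x Vec∈.∈ xs → value (p x) ≡ true → value (anyVecᵗ p xs) ≡ true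
anyVec⁺ p {xs = y ∷ ys} (VecAny.here refl) px rewrite px = refl
anyVec⁺ p {xs = y ∷ ys} (VecAny.there x∈ys) px with value (p y)
... | true  = refl
... | false = anyVec⁺ p x∈ys px

anyVec⁻ : ∀ (p : A → Timed Bool) (xs : Vec A n) → value (anyVecᵗ p xs) ≡ true → ∃ λ x → x Vec∈.∈ xs × value (p x) ≡ true
anyVec⁻ p (x ∷ xs) eq with value (p x) in px
... | true  = x , VecAny.here refl , px
... | false with y , y∈xs , py ← anyVec⁻ p xs eq = y , VecAny.there y∈xs , py

index-value : ∀ (xs : Vec A n) i → value (indexᵗ xs i) ≡ Vec.lookup xs i
index-value (x ∷ xs) zero    = refl
index-value (x ∷ xs) (suc i) = index-value xs i

allFin-value : ∀ n → value (allFinᵗ n) ≡ allFin n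
allFin-value zero    = refl
allFin-value (suc n) = cong (zero ∷_)
  (trans (map-value _ (value (allFinᵗ n))) (trans (cong (map suc) (allFin-value n)) (Listₚ.map-tabulate id suc)))

-- The hypergraph and its components

edge : CSP m d n → Fin m → List (Fin n)
edge {n = n} Ψ x = List.filter (T-dec (λ v → anyVecᵗ (eqFinᵗ x) (scope (Vec.lookup Ψ v)))) (allFin n)

edge⁺ : ∀ (Ψ : CSP m d n) {x} v → x Vec∈.∈ scope (Vec.lookup Ψ v) → v ∈ edge Ψ x
edge⁺ Ψ {x} v x∈ = ∈ₚ.∈-filter⁺ _ (∈ₚ.∈-allFin v) (anyVec⁺ (eqFinᵗ x) x∈ (eqFin-refl x))

edge⁻ : ∀ (Ψ : CSP m d n) {x v} → v ∈ edge Ψ x → x Vec∈.∈ scope (Vec.lookup Ψ v)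
edge⁻ {n = n} Ψ {x} {v} v∈
  with y , y∈ , xy ← anyVec⁻ (eqFinᵗ x) (scope (Vec.lookup Ψ v)) (proj₂ (∈ₚ.∈-filter⁻ _ {xs = allFin n} v∈))
  rewrite eqFin⁻ x y xy = y∈

hypergraph : CSP m d n → List (Hyperedge m n)
hypergraph {m} Ψ = map (λ x → x , edge Ψ x) (allFin m)

hypergraph-value : ∀ (Ψ : CSP m d n) → value (hypergraphᵗ Ψ) ≡ hypergraph Ψ
hypergraph-value {m} {n = n} Ψ
  rewrite allFin-value m | allFin-value n
  = trans (map-value _ (allFin m)) (Listₚ.map-cong (λ x → cong (x ,_) (trans (filter-value _ (allFin n))
      (Listₚ.filter-≐ _ _ ((λ {v} → subst (λ c → value (anyVecᵗ (eqFinᵗ x) (scope c)) ≡ true) (index-value Ψ v))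
                         , (λ {v} → subst (λ c → value (anyVecᵗ (eqFinᵗ x) (scope c)) ≡ true) (sym (index-value Ψ v)))) (allFin n)))) (allFin m))

Meets : List (Fin n) → Hyperedge m n → Set
Meets block (_ , e) = ∃ λ v → v ∈ e × v ∈ block

meets⁺ : ∀ {block} (e : Hyperedge m n) → Meets block e → value (meetsᵗ block e) ≡ true
meets⁺ _ (v , v∈e , v∈block) = any⁺ _ v∈e (elem⁺ {eq = eqFinᵗ} eqFin-refl v∈block)

meets⁻ : ∀ block (e : Hyperedge m n) → value (meetsᵗ block e) ≡ true → Meets block e
meets⁻ block (_ , e) eq with v , v∈e , v∈ ← any⁻ _ e eq = v , v∈e , elem⁻ {eq = eqFinᵗ} eqFin⁻ block v∈

hit miss : Hyperedge m n → List (List (Fin n)) → List (List (Fin n))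
hit  e blocks = List.filter (T-dec (λ block → meetsᵗ block e)) blocks
miss e blocks = List.filter (¬? ∘ T-dec (λ block → meetsᵗ block e)) blocks

-- A copy of the function local to `mergeᵗ`, so that the result of merging can be named.
consNonempty : List A → List (List A) → List (List A)
consNonempty []       xss = xss
consNonempty (x ∷ xs) xss = (x ∷ xs) ∷ xss

merge-value : ∀ (e : Hyperedge m n) blocks → value (mergeᵗ e blocks) ≡ consNonempty (concat (hit e blocks)) (miss e blocks)
merge-value e blocks rewrite partition-value (λ block → meetsᵗ block e) blocks | concat-value (hit e blocks)
  with concat (hit e blocks)
... | []     = refl
... | _ ∷ _  = refl

consNonempty-All : ∀ {P : List A → Set} {xs xss} → P xs → All P xss → All P (consNonempty xs xss)
consNonempty-All {xs = []}    _ ps = ps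
consNonempty-All {xs = _ ∷ _} p ps = p ∷ ps

consNonempty-AllPairs : ∀ {R : List A → List A → Set} {xs xss} → All (R xs) xss → AllPairs R xss → AllPairs R (consNonempty xs xss)
consNonempty-AllPairs {xs = []}    _ ps = ps
consNonempty-AllPairs {xs = _ ∷ _} p ps = p ∷ ps

Apart : (Hyperedge m n → Set) → List (Fin n) → List (Fin n) → Set
Apart P B B′ = ∀ e → P e → Meets B e → ¬ Meets B′ e

-- The invariant of merging, with `P` for the hyperedges merged so far. It makes the blocks
-- independent subproblems; that they are not too large is the separate invariant `Monochromatic`.
Separated : (Hyperedge m n → Set) → List (List (Fin n)) → Set
Separated P = AllPairs (Apart P)

AllPairs-lookup : ∀ {R : A → A → Set} → (∀ {x y} → R x y → R y x) → ∀ {xs x y} →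
  AllPairs R xs → x ∈ xs → y ∈ xs → x ≡ y ⊎ R x y
AllPairs-lookup R-sym (_ ∷ _)   (here refl) (here refl) = inj₁ refl
AllPairs-lookup R-sym (r ∷ _)   (here refl) (there y∈)  = inj₂ (All.lookup r y∈)
AllPairs-lookup R-sym (r ∷ _)   (there x∈)  (here refl) = inj₂ (R-sym (All.lookup r x∈))
AllPairs-lookup R-sym (_ ∷ rs)  (there x∈)  (there y∈)  = AllPairs-lookup R-sym rs x∈ y∈

AllPairs-map-with : ∀ {R S : A → A → Set} {P : A → Set} → (∀ {x y} → P x → P y → R x y → S x y) → ∀ {xs} →
  All P xs → AllPairs R xs → AllPairs S xs
AllPairs-map-with f []       []       = []
AllPairs-map-with f (p ∷ ps) (r ∷ rs) =
  All.zipWith (λ (py , rxy) → f p py rxy) (ps , r) ∷ AllPairs-map-with f ps rs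

miss⁻ : ∀ (e : Hyperedge m n) {blocks} → All (λ B → ¬ Meets B e) (miss e blocks)
miss⁻ e {blocks} = All.map (λ ¬eq → ¬eq ∘ meets⁺ e) (Allₚ.all-filter (¬? ∘ T-dec (λ block → meetsᵗ block e)) blocks)

-- If an older hyperedge met both the merged block and a missed one, it would meet a hit block and
-- that missed block. These are different, since only one of them meets `e`, so the old invariant is
-- violated.
separated-merge : ∀ {P} (e : Hyperedge m n) {blocks} → Separated P blocks →
  Separated (λ f → f ≡ e ⊎ P f) (value (mergeᵗ e blocks))
separated-merge {m = m} {n} {P} e {blocks} sep rewrite merge-value e blocks =
  consNonempty-AllPairs {xss = miss e blocks}
    (All.tabulate λ {B} B∈ → λ where
      f (inj₁ refl) _ → All.lookup (miss⁻ e {blocks}) B∈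
      f (inj₂ Pf) (v , v∈f , v∈concat) meets → cross B∈ Pf v∈f v∈concat meets)
    (AllPairs-map-with combine (miss⁻ e {blocks}) (AllPairsₚ.filter⁺ _ sep))
  where
  combine : ∀ {B B′} → ¬ Meets B e → ¬ Meets B′ e →
    Apart P B B′ → Apart (λ f → f ≡ e ⊎ P f) B B′
  combine ¬m _ _ f (inj₁ refl) m = contradiction m ¬m
  combine _ _ h  f (inj₂ Pf)     = h f Pf
  cross : ∀ {B f v} → B ∈ miss e blocks → P f → v ∈ proj₂ f → v ∈ concat (hit e blocks) → ¬ Meets B f
  cross {B} {f} {v} B∈ Pf v∈f v∈concat meets
    with B₀ , v∈B₀ , B₀∈hit ← ∈ₚ.∈-concat⁻′ (hit e blocks) v∈concat
    with B₀∈ , B₀meets ← ∈ₚ.∈-filter⁻ (T-dec (λ block → meetsᵗ block e)) {xs = blocks} B₀∈hit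
       | B∈blocks , ¬Bmeets ← ∈ₚ.∈-filter⁻ (¬? ∘ T-dec (λ block → meetsᵗ block e)) {xs = blocks} B∈
    with AllPairs-lookup {R = Apart P} (λ h f Pf m m′ → h f Pf m′ m) sep B₀∈ B∈blocks
  ... | inj₁ refl = ¬Bmeets B₀meets
  ... | inj₂ h    = h _ Pf (v , v∈f , v∈B₀) meets

separated-mergeAll : ∀ {P} (es : List (Hyperedge m n)) {blocks} → Separated P blocks →
  Separated (λ f → f ∈ es ⊎ P f) (value (mergeAllᵗ es blocks))
separated-mergeAll []       sep = AllPairs.map (λ { h f (inj₂ Pf) → h f Pf }) sep
separated-mergeAll {m} {n} {P} (e ∷ es) sep = AllPairs.map
  (λ h f → h f ∘ shuffle) (separated-mergeAll es (separated-merge e sep))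
  where
  shuffle : ∀ {f : Hyperedge m n} → f ∈ e ∷ es ⊎ P f → f ∈ es ⊎ f ≡ e ⊎ P f
  shuffle (inj₁ (here f≡e))   = inj₂ (inj₁ f≡e)
  shuffle (inj₁ (there f∈es)) = inj₁ f∈es
  shuffle (inj₂ Pf)           = inj₂ (inj₂ Pf)

singletons : ∀ n → List (List (Fin n))
singletons n = map (_∷ []) (allFin n)

components-value : ∀ (es : List (Hyperedge m n)) → value (componentsᵗ es) ≡ value (mergeAllᵗ es (singletons n))
components-value {n = n} es = cong (λ bs → value (mergeAllᵗ es bs))
  (trans (map-value _ (value (allFinᵗ n))) (cong (map (_∷ [])) (allFin-value n)))

components-separated : ∀ (es : List (Hyperedge m n)) → Separated (_∈ es) (value (componentsᵗ es))
components-separated {m} {n} es rewrite components-value es = AllPairs.map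
  (λ h f → h f ∘ inj₁) (separated-mergeAll {P = λ _ → ⊥} es (trivial (singletons n)))
  where
  trivial : ∀ bs → Separated {m} {n} (λ _ → ⊥) bs
  trivial []       = []
  trivial (b ∷ bs) = All.tabulate (λ _ _ ()) ∷ trivial bs

Covers : List (List (Fin n)) → Set
Covers blocks = ∀ v → ∃ λ B → B ∈ blocks × v ∈ B

consNonempty-head : ∀ {v : A} {xs xss} → v ∈ xs → ∃ λ ys → ys ∈ consNonempty xs xss × v ∈ ys
consNonempty-head {xs = x ∷ xs} v∈xs = x ∷ xs , here refl , v∈xs

consNonempty-tail : ∀ {ys} (xs : List A) {xss} → ys ∈ xss → ys ∈ consNonempty xs xss
consNonempty-tail []      ys∈ = ys∈
consNonempty-tail (_ ∷ _) ys∈ = there ys∈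

covers-merge : ∀ (e : Hyperedge m n) {blocks} → Covers blocks → Covers (value (mergeᵗ e blocks))
covers-merge e {blocks} cov v rewrite merge-value e blocks with B , B∈ , v∈B ← cov v
  with T-dec (λ block → meetsᵗ block e) B
... | no ¬m = B , consNonempty-tail (concat (hit e blocks)) (∈ₚ.∈-filter⁺ _ B∈ ¬m) , v∈B
... | yes m = consNonempty-head (∈ₚ.∈-concat⁺′ v∈B (∈ₚ.∈-filter⁺ _ B∈ m))

covers-components : ∀ (es : List (Hyperedge m n)) → Covers (value (componentsᵗ es))
covers-components {n = n} es rewrite components-value es = go es λ v → v ∷ [] , ∈ₚ.∈-map⁺ _ (∈ₚ.∈-allFin v) , here refl
  where
  go : ∀ (es : List (Hyperedge m n)) {blocks} → Covers blocks → Covers (value (mergeAllᵗ es blocks))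
  go []       cov = cov
  go (e ∷ es) cov = go es (covers-merge e cov)

-- The exhaustive search and balance

search-sound : ∀ s (es : List (Hyperedge m n)) R K {R′ K′} →
  value (searchSeparatorᵗ s es (R , K)) ≡ just (R′ , K′) →
  R′ ++ K′ ↭ R ++ K ++ es × value (isBalancedᵗ K′) ≡ true × length R′ ≤ s + length R
search-sound s [] R K eq with value (isBalancedᵗ K) in bal
search-sound s [] R K refl | true =
  ↭-reflexive (cong (R ++_) (sym (Listₚ.++-identityʳ K))) , bal , m≤n+m (length R) s
search-sound zero (e ∷ es) R K eq
  with perm , bal , len ← search-sound zero es R (e ∷ K) eq
  = ↭-trans perm (↭ₚ.++⁺ˡ R (↭-sym (↭ₚ.shift e K es))) , bal , len
search-sound (suc s) (e ∷ es) R K eq with value (searchSeparatorᵗ s es (e ∷ R , K)) in found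
search-sound (suc s) (e ∷ es) R K refl | just _
  with perm , bal , len ← search-sound s es (e ∷ R) K found
  = ↭-trans perm (↭-trans (↭-sym (↭ₚ.shift e R (K ++ es))) (↭ₚ.++⁺ˡ R (↭-sym (↭ₚ.shift e K es))))
  , bal , ≤-trans len (≤-reflexive (ℕₚ.+-suc s (length R)))
search-sound (suc s) (e ∷ es) R K eq | nothing
  with perm , bal , len ← search-sound (suc s) es R (e ∷ K) eq
  = ↭-trans perm (↭ₚ.++⁺ˡ R (↭-sym (↭ₚ.shift e K es))) , bal , len

module _ {A : Set} where

  ↭-remove : ∀ {x : A} {xs ys} → x ∷ xs ↭ ys → ∃ λ ys₁ → ∃ λ ys₂ → ys ≡ ys₁ ++ x ∷ ys₂ × xs ↭ ys₁ ++ ys₂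
  ↭-remove {x} x∷xs↭ys with ys₁ , ys₂ , refl ← ∈ₚ.∈-∃++ (↭ₚ.∈-resp-↭ x∷xs↭ys (here refl))
    = ys₁ , ys₂ , refl , ↭ₚ.drop-∷ (↭-trans x∷xs↭ys (↭ₚ.shift x ys₁ ys₂))

  ↭-remove-++ : ∀ {x : A} {xs} ys zs → x ∷ xs ↭ ys ++ zs →
    (∃ λ ys₁ → ∃ λ ys₂ → ys ≡ ys₁ ++ x ∷ ys₂ × xs ↭ (ys₁ ++ ys₂) ++ zs) ⊎
    (∃ λ zs₁ → ∃ λ zs₂ → zs ≡ zs₁ ++ x ∷ zs₂ × xs ↭ ys ++ (zs₁ ++ zs₂))
  ↭-remove-++ {x} ys zs perm with ∈ₚ.∈-++⁻ ys (↭ₚ.∈-resp-↭ perm (here refl))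
  ... | inj₁ x∈ys with ys₁ , ys₂ , refl ← ∈ₚ.∈-∃++ x∈ys
    = inj₁ (ys₁ , ys₂ , refl , ↭ₚ.drop-∷ (↭-trans perm (↭ₚ.++⁺ʳ zs (↭ₚ.shift x ys₁ ys₂))))
  ... | inj₂ x∈zs with zs₁ , zs₂ , refl ← ∈ₚ.∈-∃++ x∈zs
    = inj₂ (zs₁ , zs₂ , refl , ↭ₚ.drop-∷ (↭-trans perm (↭-trans (↭ₚ.++⁺ˡ ys (↭ₚ.shift x zs₁ zs₂)) (↭ₚ.shift x ys (zs₁ ++ zs₂)))))

length-middle : ∀ (xs : List A) {x ys} → length (xs ++ x ∷ ys) ≡ suc (length (xs ++ ys))
length-middle []       = refl
length-middle (_ ∷ xs) = cong suc (length-middle xs)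

-- Only some result is promised, as the search may stop at another separator before it reaches R₀.
-- Balance is assumed for every permutation because the search accumulates the kept hyperedges in an
-- order of its own, on which the blocks depend as lists.
search-complete : ∀ s (es : List (Hyperedge m n)) R K R₀ K₀ → es ↭ R₀ ++ K₀ → length R₀ ≤ s →
  (∀ K* → K* ↭ K₀ ++ K → value (isBalancedᵗ K*) ≡ true) →
  ∃ λ RK → value (searchSeparatorᵗ s es (R , K)) ≡ just RK
search-complete s [] R K R₀ K₀ perm _ bal with Listₚ.++-conicalʳ R₀ K₀ (↭ₚ.↭-empty-inv (↭-sym perm))
... | refl rewrite bal K ↭-refl = (R , K) , refl
search-complete zero (e ∷ es) R K [] K₀ perm z≤n bal
  with K₁ , K₂ , refl , perm′ ← ↭-remove perm
  = search-complete zero es R (e ∷ K) [] (K₁ ++ K₂) perm′ z≤n λ K* p → bal K*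
      (↭-trans p (↭-trans (↭ₚ.shift e (K₁ ++ K₂) K) (↭ₚ.++⁺ʳ K (↭-sym (↭ₚ.shift e K₁ K₂)))))
search-complete (suc s) (e ∷ es) R K R₀ K₀ perm len bal
  with value (searchSeparatorᵗ s es (e ∷ R , K)) in found
... | just RK = RK , refl
... | nothing with ↭-remove-++ R₀ K₀ perm
-- Here `e` belongs to R₀, so the branch that has just failed was bound to succeed.
...   | inj₁ (R₁ , R₂ , refl , perm′)
        with _ , found′ ← search-complete s es (e ∷ R) K (R₁ ++ R₂) K₀ perm′
                            (ℕₚ.≤-pred (subst (_≤ suc s) (length-middle R₁) len)) bal
        = contradiction (trans (sym found) found′) λ ()
...   | inj₂ (K₁ , K₂ , refl , perm′) = search-complete (suc s) es R (e ∷ K) R₀ (K₁ ++ K₂) perm′ len λ K* p → bal K*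
      (↭-trans p (↭-trans (↭ₚ.shift e (K₁ ++ K₂) K) (↭ₚ.++⁺ʳ K (↭-sym (↭ₚ.shift e K₁ K₂)))))

-- Stands in for connectedness: a colouring that is constant on every hyperedge is constant on every
-- block, so a block cannot reach across the two sides of a sample.
Monochromatic : (Fin n → Bool) → List (Fin n) → Set
Monochromatic c vs = ∃ λ β → All (λ v → c v ≡ β) vs

monochromatic-merge : ∀ {c} (e : Hyperedge m n) {blocks} → Monochromatic c (proj₂ e) →
  All (Monochromatic c) blocks → All (Monochromatic c) (value (mergeᵗ e blocks))
monochromatic-merge {n = n} {c} e {blocks} (β , e-β) mono rewrite merge-value e blocks =
  consNonempty-All (β , Allₚ.concat⁺ (All.tabulate hit-β)) (Allₚ.filter⁺ _ mono)
  where
  hit-β : ∀ {B} → B ∈ hit e blocks → All (λ v → c v ≡ β) B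
  hit-β {B} B∈ with B∈blocks , meets ← ∈ₚ.∈-filter⁻ (T-dec (λ block → meetsᵗ block e)) {xs = blocks} B∈
    with v , v∈e , v∈B ← meets⁻ B e meets | β′ , B-β′ ← All.lookup mono B∈blocks
    = subst (λ z → All (λ v → c v ≡ z) B) (trans (sym (All.lookup B-β′ v∈B)) (All.lookup e-β v∈e)) B-β′

monochromatic-components : ∀ {c} (es : List (Hyperedge m n)) → All (Monochromatic c ∘ proj₂) es →
  All (Monochromatic c) (value (componentsᵗ es))
monochromatic-components {n = n} {c} es mono rewrite components-value es =
  go es mono (Allₚ.map⁺ (All.tabulate λ {v} _ → c v , refl ∷ []))
  where
  go : ∀ (es : List (Hyperedge _ n)) {blocks} → All (Monochromatic c ∘ proj₂) es → All (Monochromatic c) blocks →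
       All (Monochromatic c) (value (mergeAllᵗ es blocks))
  go []       _        mono = mono
  go (e ∷ es) (me ∷ mes) mono = go es mes (monochromatic-merge e me mono)

incident : List (Hyperedge m n) → List (Fin n) → List (Hyperedge m n)
incident K block = List.filter (T-dec (meetsᵗ block)) K

balanced-value : ∀ (K : List (Hyperedge m n)) block →
  value (leqᵗ (value (lengthᵗ (value (filterᵗ (meetsᵗ block) K)))) (value (halfᵗ m)))
    ≡ value (leqᵗ (length (incident K block)) ℕ.⌊ m /2⌋)
balanced-value {m} K block = cong₂ (λ l h → value (leqᵗ l h))
  (trans (length-value (value (filterᵗ (meetsᵗ block) K))) (cong length (filter-value (meetsᵗ block) K))) (half-value m)

-- A block of one colour meets no hyperedge of the other, since the common vertex would have both
-- colours. Its incident hyperedges therefore all lie in K₁ or all in K₂.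
isBalanced⁺ : ∀ {K : List (Hyperedge m n)} {K₁ K₂} (c : Fin n → Bool) → K ↭ K₁ ++ K₂ →
  All (λ e → All (λ v → c v ≡ true) (proj₂ e)) K₁ → All (λ e → All (λ v → c v ≡ false) (proj₂ e)) K₂ →
  length K₁ ≤ ℕ.⌊ m /2⌋ → length K₂ ≤ ℕ.⌊ m /2⌋ → value (isBalancedᵗ K) ≡ true
isBalanced⁺ {m} {n} {K} {K₁} {K₂} c perm in₁ in₂ len₁ len₂ = all⁺ _ (value (componentsᵗ K)) λ {B} B∈ →
  trans (balanced-value K B) (leq⁺ (bound B (All.lookup mono B∈)))
  where
  mono : All (Monochromatic c) (value (componentsᵗ K))
  mono = monochromatic-components K (↭ₚ.All-resp-↭ (↭-sym perm) (Allₚ.++⁺ (All.map (true ,_) in₁) (All.map (false ,_) in₂)))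
  length-incident : ∀ B → length (incident K B) ≡ length (incident K₁ B) + length (incident K₂ B)
  length-incident B = trans (↭ₚ.↭-length (↭ₚ.filter-↭ _ perm))
    (trans (cong length (Listₚ.filter-++ _ K₁ K₂)) (Listₚ.length-++ (incident K₁ B)))
  none : ∀ {β β′ B} (L : List (Hyperedge m n)) → ¬ (β ≡ β′) → All (λ v → c v ≡ β) B → All (λ e → All (λ v → c v ≡ β′) (proj₂ e)) L →
    length (incident L B) ≡ 0
  none {B = B} L β≢β′ B-β L-β′ = cong length (Listₚ.filter-none _ (All.map (λ {e} e-β′ eq →
    let v , v∈e , v∈B = meets⁻ B e eq in β≢β′ (trans (sym (All.lookup B-β v∈B)) (All.lookup e-β′ v∈e))) L-β′))
  bound : ∀ B → Monochromatic c B → length (incident K B) ≤ ℕ.⌊ m /2⌋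
  bound B (true , B-β) rewrite length-incident B | none {B = B} K₂ (λ ()) B-β in₂ | ℕₚ.+-identityʳ (length (incident K₁ B)) =
    ≤-trans (Listₚ.length-filter _ K₁) len₁
  bound B (false , B-β) rewrite length-incident B | none {B = B} K₁ (λ ()) B-β in₁ =
    ≤-trans (Listₚ.length-filter _ K₂) len₂

isBalanced⁻ : ∀ (K : List (Hyperedge m n)) → value (isBalancedᵗ K) ≡ true → ∀ {B} → B ∈ value (componentsᵗ K) →
  length (incident K B) ≤ ℕ.⌊ m /2⌋
isBalanced⁻ K bal {B} B∈ = leq⁻ _ _ (trans (sym (balanced-value K B)) (all⁻ _ bal B∈))

-- Correctness of solving the components separately

dom : PartialAssignment m d → List (Fin m)
dom = map proj₁

lookup-∈dom : ∀ (τ : PartialAssignment m d) {x} → x ∈ dom τ → ∃ λ a → value (lookupᵗ τ x) ≡ just a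
lookup-∈dom ((y , a) ∷ τ) {x} x∈ with value (eqFinᵗ x y) in xy
... | true  = a , refl
lookup-∈dom ((y , a) ∷ τ) (here refl) | false = contradiction xy (true≢false (eqFin-refl y))
lookup-∈dom ((y , a) ∷ τ) (there x∈)  | false = lookup-∈dom τ x∈

lookup-just : ∀ (τ : PartialAssignment m d) {x a} → value (lookupᵗ τ x) ≡ just a → (x , a) ∈ τ
lookup-just ((y , b) ∷ τ) {x} eq with value (eqFinᵗ x y) in xy
lookup-just ((y , b) ∷ τ) {x} refl | true rewrite eqFin⁻ x y xy = here refl
lookup-just ((y , b) ∷ τ) eq       | false = there (lookup-just τ eq)

lookup-just⇒∈dom : ∀ (τ : PartialAssignment m d) {x a} → value (lookupᵗ τ x) ≡ just a → x ∈ dom τ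
lookup-just⇒∈dom τ eq = ∈ₚ.∈-map⁺ proj₁ (lookup-just τ eq)

variables-value : ∀ (es : List (Hyperedge m n)) → value (variablesᵗ es) ≡ map proj₁ es
variables-value es = map-value _ es

ʳ++-↭ : ∀ (xs ys : List A) → xs List.ʳ++ ys ↭ xs ++ ys
ʳ++-↭ xs ys = ↭-trans (↭-reflexive (Listₚ.ʳ++-defn xs)) (↭ₚ.++⁺ʳ ys (↭ₚ.↭-reverse xs))

someAssignment⁻ : ∀ (xs : List (Fin m)) (τ : PartialAssignment m d) test →
  value (someAssignmentᵗ xs τ test) ≡ true →
  ∃ λ τ′ → dom τ′ ≡ xs List.ʳ++ dom τ × value (test τ′) ≡ true
someAssignment⁻ []       τ test eq = τ , refl , eq
someAssignment⁻ {d = d} (x ∷ xs) τ test eq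
  with a , _ , eq′ ← any⁻ (λ a → someAssignmentᵗ xs ((x , a) ∷ τ) test) (value (allFinᵗ d)) eq
  = someAssignment⁻ xs ((x , a) ∷ τ) test eq′

Agrees : Assignment m d → PartialAssignment m d → Set
Agrees σ = All (λ (x , a) → a ≡ σ x)

agrees-lookup : ∀ {σ : Assignment m d} {τ x} → Agrees σ τ → x ∈ dom τ → value (lookupᵗ τ x) ≡ just (σ x)
agrees-lookup {τ = τ} agr x∈ with a , eq ← lookup-∈dom τ x∈ = trans eq (cong just (All.lookup agr (lookup-just τ eq)))

someAssignment⁺ : ∀ (σ : Assignment m d) xs τ test → Agrees σ τ →
  (∀ τ′ → dom τ′ ≡ xs List.ʳ++ dom τ → Agrees σ τ′ → value (test τ′) ≡ true) →
  value (someAssignmentᵗ xs τ test) ≡ true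
someAssignment⁺ σ [] τ test agr ok = ok τ refl agr
someAssignment⁺ {d = d} σ (x ∷ xs) τ test agr ok =
  any⁺ _ (subst (σ x ∈_) (sym (allFin-value d)) (∈ₚ.∈-allFin (σ x)))
    (someAssignment⁺ σ xs ((x , σ x) ∷ τ) test (refl ∷ agr) ok)

-- Read off a unary constraint, since the function that restrictᵗ maps over the scopes has no name.

argument : PartialAssignment m d → Fin m → Fin m ⊎ Fin d
argument {d = d} ρ x = Vec.head (scope (Vec.head (value (restrictᵗ (constraint (x ∷ []) (Vec.replicate d false) ∷ []) ρ))))

argument-just : ∀ (ρ : PartialAssignment m d) {x a} → value (lookupᵗ ρ x) ≡ just a → argument ρ x ≡ inj₂ a
argument-just ρ eq rewrite eq = refl

argument-nothing : ∀ (ρ : PartialAssignment m d) {x} → value (lookupᵗ ρ x) ≡ nothing → argument ρ x ≡ inj₁ x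
argument-nothing ρ eq rewrite eq = refl

restriction : PartialAssignment m d → Constraint (Fin m) d → Constraint (Fin m ⊎ Fin d) d
restriction ρ c = constraint (Vec.map (argument ρ) (scope c)) (table c)

restrict-value : ∀ (Ψ : CSP m d n) ρ → value (restrictᵗ Ψ ρ) ≡ Vec.map (restriction ρ) Ψ
restrict-value Ψ ρ = trans (mapVec-value _ Ψ)
  (Vecₚ.map-cong (λ c → cong (λ args → constraint args (table c)) (mapVec-value _ (scope c))) Ψ)

Reads : PartialAssignment m d → PartialAssignment m d → Fin m → Fin d → Set
Reads ρ τ x a = value (lookupᵗ ρ x) ≡ just a ⊎ value (lookupᵗ ρ x) ≡ nothing × value (lookupᵗ τ x) ≡ just a

evaluate-value : ∀ (σ : Assignment m d) ρ τ {a} (t : Table d a) xs → (∀ {x} → x Vec∈.∈ xs → Reads ρ τ x (σ x)) →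
  value (evaluateᵗ τ t (Vec.map (argument ρ) xs)) ≡ evaluate t (Vec.map σ xs)
evaluate-value σ ρ τ b [] reads = refl
evaluate-value σ ρ τ t (x ∷ xs) reads with reads (VecAny.here refl)
... | inj₁ eq rewrite argument-just ρ eq | index-value t (σ x) = evaluate-value σ ρ τ _ xs (reads ∘ VecAny.there)
... | inj₂ (eqρ , eqτ) rewrite argument-nothing ρ eqρ | eqτ | index-value t (σ x) = evaluate-value σ ρ τ _ xs (reads ∘ VecAny.there)

-- This and `solveTest` name the tests that the algorithm passes to `someAssignmentᵗ`.
componentTest : Vec (Constraint (Fin m ⊎ Fin d) d) n → List (Fin n) → PartialAssignment m d → Timed Bool
componentTest Ψρ block τ = allᵗ (λ v → indexᵗ Ψρ v >>= λ c → evaluateᵗ τ (table c) (scope c)) block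

solveTest : CSP m d n → List (Hyperedge m n) → PartialAssignment m d → Timed Bool
solveTest Ψ K ρ = restrictᵗ Ψ ρ >>= λ Ψρ → componentsᵗ K >>= allᵗ (componentSatisfiableᵗ Ψρ K)

dom-variables : ∀ (es : List (Hyperedge m n)) {τ : PartialAssignment m d} →
  dom τ ≡ value (variablesᵗ es) List.ʳ++ [] → dom τ ↭ map proj₁ es
dom-variables es dom-τ = ↭-trans (↭-reflexive dom-τ) (↭-trans (ʳ++-↭ (value (variablesᵗ es)) [])
  (↭-reflexive (trans (Listₚ.++-identityʳ _) (variables-value es))))

module _ (Ψ : CSP m d n) (R K : List (Hyperedge m n)) (split : R ++ K ↭ hypergraph Ψ) where

  is-edge : ∀ {e} → e ∈ hypergraph Ψ → proj₂ e ≡ edge Ψ (proj₁ e)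
  is-edge e∈ with x , _ , refl ← ∈ₚ.∈-map⁻ _ e∈ = refl

  K-edge : ∀ {e} → e ∈ K → proj₂ e ≡ edge Ψ (proj₁ e)
  K-edge e∈K = is-edge (↭ₚ.∈-resp-↭ split (∈ₚ.∈-++⁺ʳ R e∈K))

  R-or-K : ∀ x → x ∈ map proj₁ R ⊎ (x , edge Ψ x) ∈ K
  R-or-K x with ∈ₚ.∈-++⁻ R (↭ₚ.∈-resp-↭ (↭-sym split) (∈ₚ.∈-map⁺ (λ x → x , edge Ψ x) (∈ₚ.∈-allFin x)))
  ... | inj₁ e∈R = inj₁ (∈ₚ.∈-map⁺ proj₁ e∈R)
  ... | inj₂ e∈K = inj₂ e∈K

  CheckedBy : PartialAssignment m d → PartialAssignment m d → List (Fin n) → Set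
  CheckedBy ρ τ block = ∀ {v} → v ∈ block →
    value (evaluateᵗ τ (table (Vec.lookup Ψ v)) (Vec.map (argument ρ) (scope (Vec.lookup Ψ v)))) ≡ true

  dom-incident : ∀ block {τ : PartialAssignment m d} →
    dom τ ≡ value (variablesᵗ (value (filterᵗ (meetsᵗ block) K))) List.ʳ++ [] → dom τ ↭ map proj₁ (incident K block)
  dom-incident block {τ} dom-τ = ↭-trans (dom-variables (value (filterᵗ (meetsᵗ block) K)) {τ} dom-τ)
    (↭-reflexive (cong (map proj₁) (filter-value (meetsᵗ block) K)))

  lookup-restrict : ∀ ρ v → value (indexᵗ (value (restrictᵗ Ψ ρ)) v) ≡ restriction ρ (Vec.lookup Ψ v)
  lookup-restrict ρ v = trans (index-value (value (restrictᵗ Ψ ρ)) v)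
    (trans (cong (λ Ψρ → Vec.lookup Ψρ v) (restrict-value Ψ ρ)) (Vecₚ.lookup-map v (restriction ρ) Ψ))

  checks : ∀ ρ τ v →
    value (indexᵗ (value (restrictᵗ Ψ ρ)) v >>= λ c → evaluateᵗ τ (table c) (scope c)) ≡
    value (evaluateᵗ τ (table (Vec.lookup Ψ v)) (Vec.map (argument ρ) (scope (Vec.lookup Ψ v))))
  checks ρ τ v = cong (λ c → value (evaluateᵗ τ (table c) (scope c))) (lookup-restrict ρ v)

  component⁻ : ∀ ρ block → value (componentSatisfiableᵗ (value (restrictᵗ Ψ ρ)) K block) ≡ true →
    ∃ λ τ → dom τ ↭ map proj₁ (incident K block) × CheckedBy ρ τ block
  component⁻ ρ block eq
    with τ , dom-τ , ok ← someAssignment⁻ (value (variablesᵗ (value (filterᵗ (meetsᵗ block) K)))) []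
                            (componentTest (value (restrictᵗ Ψ ρ)) block) eq
    = τ , dom-incident block {τ} dom-τ , λ {v} v∈ → trans (sym (checks ρ τ v)) (all⁻ _ ok v∈)

  component⁺ : ∀ σ ρ block →
    (∀ τ → Agrees σ τ → dom τ ↭ map proj₁ (incident K block) → CheckedBy ρ τ block) →
    value (componentSatisfiableᵗ (value (restrictᵗ Ψ ρ)) K block) ≡ true
  component⁺ σ ρ block ok = someAssignment⁺ σ (value (variablesᵗ (value (filterᵗ (meetsᵗ block) K)))) []
    (componentTest (value (restrictᵗ Ψ ρ)) block) [] λ τ dom-τ agr → all⁺ _ block λ {v} v∈ →
    trans (checks ρ τ v) (ok τ agr (dom-incident block {τ} dom-τ) v∈)

  module _ (ρ : PartialAssignment m d) (dom-ρ : dom ρ ↭ map proj₁ R) where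

    unassigned : ∀ {x} → value (lookupᵗ ρ x) ≡ nothing → (x , edge Ψ x) ∈ K
    unassigned {x} eq with R-or-K x
    ... | inj₂ e∈K = e∈K
    ... | inj₁ x∈R with _ , eq′ ← lookup-∈dom ρ (↭ₚ.∈-resp-↭ (↭-sym dom-ρ) x∈R) = contradiction (trans (sym eq) eq′) λ ()

    -- A variable that ρ leaves open has its hyperedge in K. That hyperedge contains the constraint
    -- v of the block, so it is incident to the block and τ assigns the variable.
    ∈-incident : ∀ {x v block} {τ : PartialAssignment m d} → dom τ ↭ map proj₁ (incident K block) → value (lookupᵗ ρ x) ≡ nothing →
      v ∈ block → x Vec∈.∈ scope (Vec.lookup Ψ v) → x ∈ dom τ
    ∈-incident {x} {v} dom-τ eq v∈ x∈ = ↭ₚ.∈-resp-↭ (↭-sym dom-τ)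
      (∈ₚ.∈-map⁺ proj₁ (∈ₚ.∈-filter⁺ _ (unassigned eq) (meets⁺ (x , edge Ψ x) (v , edge⁺ Ψ v x∈ , v∈))))

    override : Assignment m d → PartialAssignment m d → Assignment m d
    override σ τ x with value (lookupᵗ ρ x) | value (lookupᵗ τ x)
    ... | just a  | _       = a
    ... | nothing | just a  = a
    ... | nothing | nothing = σ x

    -- No hyperedge of K meets two blocks, so overriding on one block leaves the others satisfied.
    combine : Fin d → ∀ blocks → Separated (_∈ K) blocks →
      (∀ {B} → B ∈ blocks → ∃ λ τ → dom τ ↭ map proj₁ (incident K B) × CheckedBy ρ τ B) →
      ∃ λ σ → (∀ {x a} → value (lookupᵗ ρ x) ≡ just a → σ x ≡ a) × (∀ {B v} → B ∈ blocks → v ∈ B → σ ⊨ Vec.lookup Ψ v)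
    -- The letter `a₀`, available because d ≥ 1, is the final value of the variables that neither ρ
    -- nor any block assigns, such as a variable of K that occurs in no constraint.
    combine a₀ [] _ _ = override (λ _ → a₀) [] , by-ρ , λ ()
      where
      by-ρ : ∀ {x a} → value (lookupᵗ ρ x) ≡ just a → override (λ _ → a₀) [] x ≡ a
      by-ρ {x} eq with value (lookupᵗ ρ x)
      by-ρ {x} refl | just a = refl
    combine a₀ (B ∷ blocks) (apart ∷ sep) checked
      with σ , σ-ρ , σ-ok ← combine a₀ blocks sep (checked ∘ there) | τ , dom-τ , B-ok ← checked (here refl)
      = override σ τ , by-ρ , λ where
          (here refl) v∈B → trans (sym (evaluate-value (override σ τ) ρ τ _ (scope (Vec.lookup Ψ _)) (reads v∈B))) (B-ok v∈B)
          {B′} {v} (there B′∈) v∈B′ → trans (cong (evaluate (table (Vec.lookup Ψ v)))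
            (map-cong-∈ (scope (Vec.lookup Ψ v)) (unchanged B′∈ v∈B′))) (σ-ok B′∈ v∈B′)
      where
      map-cong-∈ : ∀ {X Y : Set} {a} {f g : X → Y} (xs : Vec X a) → (∀ {x} → x Vec∈.∈ xs → f x ≡ g x) → Vec.map f xs ≡ Vec.map g xs
      map-cong-∈ []       h = refl
      map-cong-∈ (x ∷ xs) h = cong₂ _∷_ (h (VecAny.here refl)) (map-cong-∈ xs (h ∘ VecAny.there))
      by-ρ : ∀ {x a} → value (lookupᵗ ρ x) ≡ just a → override σ τ x ≡ a
      by-ρ {x} eq with value (lookupᵗ ρ x) | value (lookupᵗ τ x)
      by-ρ {x} refl | just a | _ = refl
      reads : ∀ {v} → v ∈ B → ∀ {x} → x Vec∈.∈ scope (Vec.lookup Ψ v) → Reads ρ τ x (override σ τ x)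
      reads v∈B {x} x∈ with value (lookupᵗ ρ x) in eqρ | value (lookupᵗ τ x) in eqτ
      ... | just a  | _       = inj₁ refl
      ... | nothing | just a  = inj₂ (refl , refl)
      ... | nothing | nothing with _ , eq ← lookup-∈dom τ (∈-incident {block = B} {τ} dom-τ eqρ v∈B x∈) = contradiction (trans (sym eqτ) eq) λ ()
      unchanged : ∀ {B′ v} → B′ ∈ blocks → v ∈ B′ → ∀ {x} → x Vec∈.∈ scope (Vec.lookup Ψ v) → override σ τ x ≡ σ x
      unchanged {B′} {v} B′∈ v∈B′ {x} x∈ with value (lookupᵗ ρ x) in eqρ | value (lookupᵗ τ x) in eqτ
      ... | just a  | _       = sym (σ-ρ eqρ)
      ... | nothing | nothing = refl
      ... | nothing | just a
        with (_ , e) , e∈inc , refl ← ∈ₚ.∈-map⁻ proj₁ (↭ₚ.∈-resp-↭ dom-τ (lookup-just⇒∈dom τ eqτ))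
        with e∈K , e-meets ← ∈ₚ.∈-filter⁻ (T-dec (meetsᵗ B)) {xs = K} e∈inc
        = contradiction (v , subst (v ∈_) (sym (K-edge e∈K)) (edge⁺ Ψ v x∈) , v∈B′)
            (All.lookup apart B′∈ (x , e) e∈K (meets⁻ B (x , e) e-meets))

  solve-sound : Fin d → value (solveᵗ Ψ (R , K)) ≡ true → Satisfiable Ψ
  solve-sound a₀ eq
    with ρ , dom-ρ , ok ← someAssignment⁻ (value (variablesᵗ R)) [] (solveTest Ψ K) eq
    with σ , _ , σ-ok ← combine ρ (dom-variables R {ρ} dom-ρ) a₀ (value (componentsᵗ K)) (components-separated K)
                          (λ {B} B∈ → component⁻ ρ B (all⁻ _ ok B∈))
    = σ , VecAllₚ.lookup⁻ λ v → let B , B∈ , v∈B = covers-components K v in σ-ok B∈ v∈B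

  solve-complete : Satisfiable Ψ → value (solveᵗ Ψ (R , K)) ≡ true
  solve-complete (σ , sat) = someAssignment⁺ σ (value (variablesᵗ R)) [] (solveTest Ψ K) [] λ ρ dom-ρ agrρ →
    all⁺ _ (value (componentsᵗ K)) λ {B} _ →
    component⁺ σ ρ B λ τ agrτ dom-τ {v} v∈B → trans
      (evaluate-value σ ρ τ _ (scope (Vec.lookup Ψ v))
        (λ {x} x∈ → reads ρ (dom-variables R {ρ} dom-ρ) agrρ τ agrτ dom-τ v∈B x∈))
      (VecAllₚ.lookup⁺ sat v)
    where
    reads : ∀ ρ → dom ρ ↭ map proj₁ R → Agrees σ ρ → ∀ τ → Agrees σ τ → ∀ {B} → dom τ ↭ map proj₁ (incident K B) →
      ∀ {v} → v ∈ B → ∀ {x} → x Vec∈.∈ scope (Vec.lookup Ψ v) → Reads ρ τ x (σ x)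
    reads ρ dom-ρ agrρ τ agrτ {B} dom-τ v∈B {x} x∈ with value (lookupᵗ ρ x) in eqρ
    ... | just a  = inj₁ (trans (sym eqρ) (agrees-lookup agrρ (lookup-just⇒∈dom ρ eqρ)))
    ... | nothing = inj₂ (refl , agrees-lookup agrτ (∈-incident ρ dom-ρ {block = B} {τ} dom-τ eqρ v∈B x∈))

  solve-correct : Fin d → Reflects (Satisfiable Ψ) (value (solveᵗ Ψ (R , K)))
  solve-correct a₀ with value (solveᵗ Ψ (R , K)) in eq
  ... | true  = ofʸ (solve-sound a₀ eq)
  ... | false = ofⁿ λ sat → true≢false (solve-complete sat) eq

-- Counting occurrences and constraints

length-allFin : ∀ n → length (allFin n) ≡ n
length-allFin n = Listₚ.length-tabulate {n = n} (id {A = Fin n})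

length-filter-map : ∀ {P : B → Set} (P? : ∀ y → Dec (P y)) (f : A → B) xs →
  length (List.filter P? (map f xs)) ≡ length (List.filter (P? ∘ f) xs)
length-filter-map P? f []       = refl
length-filter-map P? f (x ∷ xs) with does (P? (f x))
... | true  = cong suc (length-filter-map P? f xs)
... | false = length-filter-map P? f xs

length-filter-suc : ∀ {P : Fin (suc n) → Set} (P? : ∀ i → Dec (P i)) →
  length (List.filter P? (List.tabulate suc)) ≡ length (List.filter (P? ∘ suc) (allFin n))
length-filter-suc {n} P? = trans (cong (length ∘ List.filter P?) (sym (Listₚ.map-tabulate id suc)))
  (length-filter-map P? suc (allFin n))

length-filter-lookup : ∀ {P Q : A → Set} (P? : ∀ x → Dec (P x)) (Q? : ∀ x → Dec (Q x)) →
  (∀ x → does (P? x) ≡ does (Q? x)) → ∀ {n} (xs : Vec A n) →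
  length (List.filter (P? ∘ Vec.lookup xs) (allFin n)) ≡ Vec.count Q? xs
length-filter-lookup P? Q? P≡Q [] = refl
length-filter-lookup P? Q? P≡Q (x ∷ xs) with does (P? x) | does (Q? x) | P≡Q x
... | true  | _ | refl = cong suc (trans (length-filter-suc (P? ∘ Vec.lookup (x ∷ xs))) (length-filter-lookup P? Q? P≡Q xs))
... | false | _ | refl = trans (length-filter-suc (P? ∘ Vec.lookup (x ∷ xs))) (length-filter-lookup P? Q? P≡Q xs)

does-⇔ : ∀ {P Q : Set} (P? : Dec P) (Q? : Dec Q) → (P → Q) → (Q → P) → does P? ≡ does Q?
does-⇔ (yes p) (yes q) f g = refl
does-⇔ (yes p) (no ¬q) f g = contradiction (f p) ¬q
does-⇔ (no ¬p) (yes q) f g = contradiction (g q) ¬p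
does-⇔ (no ¬p) (no ¬q) f g = refl

length-edge : ∀ (Ψ : CSP m d n) x → length (edge Ψ x) ≡ occurrences Ψ x
length-edge {m} {d} Ψ x = length-filter-lookup {P = λ c → value (contains c) ≡ true} {Q = λ c → x Vec∈.∈ scope c}
  (T-dec contains) (λ c → Vec∈?._∈?_ Finₚ._≟_ x (scope c))
  (λ c → does-⇔ (T-dec contains c) (Vec∈?._∈?_ Finₚ._≟_ x (scope c))
    (λ eq → let y , y∈ , xy = anyVec⁻ (eqFinᵗ x) (scope c) eq in subst (Vec∈._∈ scope c) (sym (eqFin⁻ x y xy)) y∈)
    (λ x∈ → anyVec⁺ (eqFinᵗ x) x∈ (eqFin-refl x))) Ψ
  where
  contains : Constraint (Fin m) d → Timed Bool
  contains c = anyVecᵗ (eqFinᵗ x) (scope c)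

occurrences≤ : ∀ {r} (Ψ : CSP m d n) → variableFrequency Ψ ≤ r → ∀ x → occurrences Ψ x ≤ r
occurrences≤ {m} Ψ freq x = ≤-trans
  (All.lookup (Extrema.xs≤max 0 (map (occurrences Ψ) (allFin m))) (∈ₚ.∈-map⁺ (occurrences Ψ) (∈ₚ.∈-allFin x))) freq

unique-⊆-length : ∀ {xs ys : List A} → Unique.Unique xs → (∀ {x} → x ∈ xs → x ∈ ys) → length xs ≤ length ys
unique-⊆-length {xs = []} _ _ = z≤n
unique-⊆-length {xs = x ∷ xs} (x∉ ∷ unique) xs⊆ys with ys₁ , ys₂ , refl ← ∈ₚ.∈-∃++ (xs⊆ys (here refl)) =
  subst (suc (length xs) ≤_) (sym (length-middle ys₁)) (s≤s (unique-⊆-length unique λ {y} y∈ →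
    keep ys₁ (λ y≡x → All.lookup x∉ y∈ (sym y≡x)) (xs⊆ys (there y∈))))
  where
  keep : ∀ {y} zs {zs′} → ¬ y ≡ x → y ∈ zs ++ x ∷ zs′ → y ∈ zs ++ zs′
  keep zs y≢x y∈ with ∈ₚ.∈-++⁻ zs y∈
  ... | inj₁ y∈zs         = ∈ₚ.∈-++⁺ˡ y∈zs
  ... | inj₂ (here y≡x)   = contradiction y≡x y≢x
  ... | inj₂ (there y∈zs) = ∈ₚ.∈-++⁺ʳ zs y∈zs

unique-filter-length : ∀ {P : Fin m → Set} (P? : ∀ x → Dec (P x)) ys → (∀ {x} → P x → x ∈ ys) →
  length (List.filter P? (allFin m)) ≤ length ys
unique-filter-length {m} P? ys P⊆ys = unique-⊆-length (Uniqueₚ.filter⁺ P? (Uniqueₚ.allFin⁺ m))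
  λ x∈ → P⊆ys (proj₂ (∈ₚ.∈-filter⁻ P? {xs = allFin m} x∈))

edge-unique : ∀ (Ψ : CSP m d n) x → Unique.Unique (edge Ψ x)
edge-unique {n = n} Ψ x = Uniqueₚ.filter⁺ _ (Uniqueₚ.allFin⁺ n)

sum-map-≤ : ∀ {f g : A → ℕ} xs → (∀ x → f x ≤ g x) → sum (map f xs) ≤ sum (map g xs)
sum-map-≤ []       f≤g = z≤n
sum-map-≤ (x ∷ xs) f≤g = +-mono-≤ (f≤g x) (sum-map-≤ xs f≤g)

sum-map-< : ∀ {f g : A → ℕ} {x xs} → (∀ x → f x ≤ g x) → x ∈ xs → f x < g x → sum (map f xs) < sum (map g xs)
sum-map-< {xs = x ∷ xs} f≤g (here refl) fx<gx = ℕₚ.+-mono-<-≤ fx<gx (sum-map-≤ xs f≤g)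
sum-map-< {xs = x ∷ xs} f≤g (there x∈)  fx<gx = ℕₚ.+-mono-≤-< (f≤g x) (sum-map-< f≤g x∈ fx<gx)

sum-map-const : ∀ {f : A → ℕ} {b} xs → (∀ x → f x ≤ b) → sum (map f xs) ≤ length xs * b
sum-map-const []       f≤b = z≤n
sum-map-const (x ∷ xs) f≤b = +-mono-≤ (f≤b x) (sum-map-const xs f≤b)

nullary? : ∀ (c : Constraint (Fin m) d) → Dec (arity c ≡ 0)
nullary? c = arity c ℕₚ.≟ 0

occurrences-mono : ∀ (c : Constraint (Fin m) d) (Ψ : CSP m d n) x → occurrences Ψ x ≤ occurrences (c ∷ Ψ) x
occurrences-mono c Ψ x with does (VecAny.any? (x Finₚ.≟_) (scope c))
... | true  = n≤1+n _
... | false = ≤-refl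

occurrences-here : ∀ {c : Constraint (Fin m) d} {x} (Ψ : CSP m d n) → x Vec∈.∈ scope c → occurrences Ψ x < occurrences (c ∷ Ψ) x
occurrences-here {c = c} {x} Ψ x∈ with VecAny.any? (x Finₚ.≟_) (scope c)
... | yes _  = ≤-refl
... | no  x∉ = contradiction x∈ x∉

-- Each constraint of positive arity is charged to the occurrence of its first variable; nullary
-- constraints have no variable to be charged to and are counted apart.
length≤occurrences : ∀ (Ψ : CSP m d n) →
  n ≤ sum (map (occurrences Ψ) (allFin m)) + length (List.filter nullary? (Vec.toList Ψ))
length≤occurrences [] = z≤n
length≤occurrences {m} {n = suc n} (constraint {zero} [] t ∷ Ψ) =
  subst (suc n ≤_) (sym (ℕₚ.+-suc _ _)) (s≤s (≤-trans (length≤occurrences Ψ)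
    (+-monoˡ-≤ _ (sum-map-≤ (allFin m) (occurrences-mono (constraint [] t) Ψ)))))
length≤occurrences {m} (c@(constraint {suc a} (x ∷ xs) t) ∷ Ψ) =
  ≤-trans (s≤s (length≤occurrences Ψ)) (+-monoˡ-≤ _
    (sum-map-< {f = occurrences Ψ} (occurrences-mono c Ψ) (∈ₚ.∈-allFin x) (occurrences-here {c = c} Ψ (VecAny.here refl))))

toList-unique : ∀ {xs : Vec A n} → VecUnique.Unique xs → Unique.Unique (Vec.toList xs)
toList-unique VecAllPairs.[] = []
toList-unique (x∉ VecAllPairs.∷ unique) = toList-All x∉ ∷ toList-unique unique
  where
  toList-All : ∀ {P : A → Set} {n} {xs : Vec A n} → VecAll.All P xs → All P (Vec.toList xs)
  toList-All VecAll.[]         = []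
  toList-All (p VecAll.∷ ps) = p ∷ toList-All ps

-- The running time is polynomial in `n`, which therefore has to be bounded through `m`. The 2
-- stands for the nullary constraints: being distinct, they are at most the constants `true` and
-- `false`.
number-of-constraints : ∀ {k r} (Ψ : CSP m d n) → IsCSP k Ψ → variableFrequency Ψ ≤ r → n ≤ m * r + 2
number-of-constraints {m} {d} {r = r} Ψ csp freq = ≤-trans (length≤occurrences Ψ)
  (+-mono-≤ (subst (λ l → sum (map (occurrences Ψ) (allFin m)) ≤ l * r) (length-allFin m)
                  (sum-map-const (allFin m) (occurrences≤ Ψ freq)))
    (unique-⊆-length (Uniqueₚ.filter⁺ nullary? (toList-unique (IsCSP.constraints-distinct csp)))
      λ {c} c∈ → nullary c (proj₂ (∈ₚ.∈-filter⁻ nullary? {xs = Vec.toList Ψ} c∈))))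
  where
  nullary : ∀ (c : Constraint (Fin m) d) → arity c ≡ 0 → c ∈ constraint [] true ∷ constraint [] false ∷ []
  nullary (constraint [] true)  refl = here refl
  nullary (constraint [] false) refl = there (here refl)

-- Padded hyperedges and their vertices

eqVertex-refl : ∀ (u : PaddedVertex m n) → value (eqVertexᵗ u u) ≡ true
eqVertex-refl (inj₁ v)       = eqFin-refl v
eqVertex-refl (inj₂ (x , i)) rewrite eqFin-refl x = eqℕ-refl i

eqVertex⁻ : ∀ (u v : PaddedVertex m n) → value (eqVertexᵗ u v) ≡ true → u ≡ v
eqVertex⁻ (inj₁ u) (inj₁ v) eq = cong inj₁ (eqFin⁻ u v eq)
eqVertex⁻ (inj₂ (x , i)) (inj₂ (y , j)) eq with value (eqFinᵗ x y) in xy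
... | true = cong₂ (λ x i → inj₂ (x , i)) (eqFin⁻ x y xy) (eqℕ⁻ i j eq)

pad : ℕ → Fin m → List (Fin n) → List (PaddedVertex m n)
pad r x e = value (padᵗ r x e)

length-pad : ∀ r (x : Fin m) (e : List (Fin n)) → length e ≤ r → length (pad r x e) ≡ r
length-pad zero    x []      _         = refl
length-pad (suc r) x []      _         = cong suc (length-pad r x [] z≤n)
length-pad (suc r) x (v ∷ e) (s≤s len) = cong suc (length-pad r x e len)

pad-∈⁻ : ∀ r {x : Fin m} {e : List (Fin n)} {u} → u ∈ pad r x e →
  (∃ λ v → u ≡ inj₁ v × v ∈ e) ⊎ (∃ λ i → u ≡ inj₂ (x , i) × i < r)
pad-∈⁻ zero    {e = v ∷ e} (here refl) = inj₁ (v , refl , here refl)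
pad-∈⁻ zero    {e = v ∷ e} (there u∈) with pad-∈⁻ zero {e = e} u∈
... | inj₁ (w , eq , w∈) = inj₁ (w , eq , there w∈)
... | inj₂ (_ , _ , ())
pad-∈⁻ (suc r) {e = []}    (here refl) = inj₂ (r , refl , ≤-refl)
pad-∈⁻ (suc r) {e = []}    (there u∈) with pad-∈⁻ r {e = []} u∈
... | inj₂ (i , eq , i<r) = inj₂ (i , eq , ℕₚ.m≤n⇒m≤1+n i<r)
pad-∈⁻ (suc r) {e = v ∷ e} (here refl) = inj₁ (v , refl , here refl)
pad-∈⁻ (suc r) {e = v ∷ e} (there u∈) with pad-∈⁻ r {e = e} u∈
... | inj₁ (w , eq , w∈)  = inj₁ (w , eq , there w∈)
... | inj₂ (i , eq , i<r) = inj₂ (i , eq , ℕₚ.m≤n⇒m≤1+n i<r)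

pad-∈⁺ : ∀ r {x : Fin m} {e : List (Fin n)} {v} → v ∈ e → inj₁ v ∈ pad r x e
pad-∈⁺ zero    {e = v ∷ e} (here refl) = here refl
pad-∈⁺ zero    {e = v ∷ e} (there v∈)  = there (pad-∈⁺ zero v∈)
pad-∈⁺ (suc r) {e = v ∷ e} (here refl) = here refl
pad-∈⁺ (suc r) {e = v ∷ e} (there v∈)  = there (pad-∈⁺ r v∈)

pad-unique : ∀ r (x : Fin m) {e : List (Fin n)} → Unique.Unique e → Unique.Unique (pad r x e)
pad-unique zero    x {[]}    _             = []
pad-unique zero    x {v ∷ e} (v∉ ∷ unique) = All.tabulate fresh ∷ pad-unique zero x unique
  where
  fresh : ∀ {u} → u ∈ pad zero x e → ¬ inj₁ v ≡ u
  fresh u∈ refl with pad-∈⁻ zero {e = e} u∈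
  ... | inj₁ (w , refl , w∈) = All.lookup v∉ w∈ refl
pad-unique (suc r) x {[]}    _             = All.tabulate fresh ∷ pad-unique r x []
  where
  fresh : ∀ {u} → u ∈ pad r x [] → ¬ inj₂ (x , r) ≡ u
  fresh u∈ refl with pad-∈⁻ r {e = []} u∈
  ... | inj₂ (i , refl , i<r) = ℕₚ.<-irrefl refl i<r
pad-unique (suc r) x {v ∷ e} (v∉ ∷ unique) = All.tabulate fresh ∷ pad-unique r x unique
  where
  fresh : ∀ {u} → u ∈ pad r x e → ¬ inj₁ v ≡ u
  fresh u∈ refl with pad-∈⁻ r {e = e} u∈
  ... | inj₁ (w , refl , w∈) = All.lookup v∉ w∈ refl

padded : ℕ → CSP m d n → List (PaddedHyperedge m n)
padded {m} r Ψ = map (λ x → (x , edge Ψ x) , pad r x (edge Ψ x)) (allFin m)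

padAll-value : ∀ r (Ψ : CSP m d n) → value (padAllᵗ r (hypergraph Ψ)) ≡ padded r Ψ
padAll-value {m} r Ψ = trans (map-value _ (hypergraph Ψ)) (sym (Listₚ.map-∘ (allFin m)))

touches : PaddedVertex m n → PaddedHyperedge m n → Timed Bool
touches u (_ , us) = elemᵗ eqVertexᵗ u us

degree : PaddedVertex m n → List (PaddedHyperedge m n) → ℕ
degree u es = length (List.filter (T-dec (touches u)) es)

-- A constraint lies only in the hyperedges of the variables in its scope, whose number is its
-- arity. A padding vertex lies only in the hyperedge it was made for, hence 1 ≤ k.
degree≤ : ∀ {k} r (Ψ : CSP m d n) → 1 ≤ k → IsCSP k Ψ → ∀ u → degree u (padded r Ψ) ≤ k
degree≤ {m} r Ψ 1≤k csp (inj₁ v) = ≤-trans (≤-reflexive (length-filter-map _ _ (allFin m)))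
  (≤-trans (unique-filter-length _ (Vec.toList (scope (Vec.lookup Ψ v))) member)
  (≤-trans (≤-reflexive (Vecₚ.length-toList (scope (Vec.lookup Ψ v)))) (VecAllₚ.lookup⁺ (IsCSP.arity≤k csp) v)))
  where
  member : ∀ {x} → value (elemᵗ eqVertexᵗ (inj₁ v) (pad r x (edge Ψ x))) ≡ true → x ∈ Vec.toList (scope (Vec.lookup Ψ v))
  member {x} eq with pad-∈⁻ r (elem⁻ {eq = eqVertexᵗ} eqVertex⁻ (pad r x (edge Ψ x)) eq)
  ... | inj₁ (w , refl , w∈) = Vec∈ₚ.∈-toList⁺ (edge⁻ Ψ w∈)
degree≤ {m} r Ψ 1≤k csp (inj₂ (y , i)) = ≤-trans (≤-reflexive (length-filter-map _ _ (allFin m)))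
  (≤-trans (unique-filter-length _ (y ∷ []) member) 1≤k)
  where
  member : ∀ {x} → value (elemᵗ eqVertexᵗ (inj₂ (y , i)) (pad r x (edge Ψ x))) ≡ true → x ∈ y ∷ []
  member {x} eq with pad-∈⁻ r (elem⁻ {eq = eqVertexᵗ} eqVertex⁻ (pad r x (edge Ψ x)) eq)
  ... | inj₂ (j , refl , _) = here refl

nub-∈⁺ : ∀ {eq : A → A → Timed Bool} → (∀ x y → value (eq x y) ≡ true → x ≡ y) → ∀ {x} xs → x ∈ xs → x ∈ value (nubᵗ eq xs)
nub-∈⁺ {eq = eq} eq⁻ (y ∷ ys) x∈ with value (elemᵗ eq y (value (nubᵗ eq ys))) in y∈
nub-∈⁺ {eq = eq} eq⁻ (y ∷ ys) (here refl) | true  = elem⁻ {eq = eq} eq⁻ _ y∈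
nub-∈⁺ {eq = eq} eq⁻ (y ∷ ys) (there x∈)  | true  = nub-∈⁺ {eq = eq} eq⁻ ys x∈
nub-∈⁺ {eq = eq} eq⁻ (y ∷ ys) (here refl) | false = here refl
nub-∈⁺ {eq = eq} eq⁻ (y ∷ ys) (there x∈)  | false = there (nub-∈⁺ {eq = eq} eq⁻ ys x∈)

nub-unique : ∀ {eq : A → A → Timed Bool} → (∀ x → value (eq x x) ≡ true) → ∀ xs → Unique.Unique (value (nubᵗ eq xs))
nub-unique eq-refl [] = []
nub-unique {eq = eq} eq-refl (y ∷ ys) with value (elemᵗ eq y (value (nubᵗ eq ys))) in y∈
... | true  = nub-unique {eq = eq} eq-refl ys
... | false = All.tabulate (λ x∈ y≡x → true≢false (elem⁺ {eq = eq} eq-refl (subst (_∈ value (nubᵗ eq ys)) (sym y≡x) x∈)) y∈) ∷ nub-unique {eq = eq} eq-refl ys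

nub-length : ∀ (eq : A → A → Timed Bool) xs → length (value (nubᵗ eq xs)) ≤ length xs
nub-length eq [] = z≤n
nub-length eq (y ∷ ys) with value (elemᵗ eq y (value (nubᵗ eq ys)))
... | true  = ℕₚ.m≤n⇒m≤1+n (nub-length eq ys)
... | false = s≤s (nub-length eq ys)

vertices : List (PaddedHyperedge m n) → List (PaddedVertex m n)
vertices es = value (verticesᵗ es)

vertices-defn : ∀ (es : List (PaddedHyperedge m n)) → vertices es ≡ value (nubᵗ eqVertexᵗ (concat (map proj₂ es)))
vertices-defn es = cong (λ us → value (nubᵗ eqVertexᵗ us)) (trans (concat-value (value (mapᵗ (λ { (_ , us) → return us }) es))) (cong concat (map-value _ es)))

vertices-unique : ∀ (es : List (PaddedHyperedge m n)) → Unique.Unique (vertices es)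
vertices-unique es rewrite vertices-defn es = nub-unique {eq = eqVertexᵗ} eqVertex-refl (concat (map proj₂ es))

vertices-∈ : ∀ {es : List (PaddedHyperedge m n)} {e u} → e ∈ es → u ∈ proj₂ e → u ∈ vertices es
vertices-∈ {es = es} e∈ u∈ rewrite vertices-defn es =
  nub-∈⁺ {eq = eqVertexᵗ} eqVertex⁻ (concat (map proj₂ es)) (∈ₚ.∈-concat⁺′ u∈ (∈ₚ.∈-map⁺ proj₂ e∈))

vertices-length : ∀ {r} (es : List (PaddedHyperedge m n)) → All (λ e → length (proj₂ e) ≡ r) es → length (vertices es) ≤ length es * r
vertices-length {r = r} es len rewrite vertices-defn es =
  ≤-trans (nub-length eqVertexᵗ (concat (map proj₂ es))) (go es len)
  where
  go : ∀ es → All (λ e → length (proj₂ e) ≡ r) es → length (concat (map proj₂ es)) ≤ length es * r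
  go []       _            = z≤n
  go (e ∷ es) (eq ∷ eqs) = ≤-trans (≤-reflexive (Listₚ.length-++ (proj₂ e))) (+-mono-≤ (≤-reflexive eq) (go es eqs))

-- Step counts of the primitives

time-any : ∀ (p : A → Timed Bool) {b} xs → (∀ {x} → x ∈ xs → time (p x) ≤ b) → time (anyᵗ p xs) ≤ suc (length xs * suc b)
time-any p []       h = s≤s z≤n
time-any p {b} (x ∷ xs) h with value (p x)
... | true  = s≤s (≤-trans (+-mono-≤ (h (here refl)) z≤n) (≤-trans (≤-reflexive (ℕₚ.+-identityʳ b)) (≤-trans (n≤1+n b) (m≤m+n (suc b) _))))
... | false = s≤s (≤-trans (+-mono-≤ (h (here refl)) (time-any p xs (h ∘ there))) (≤-reflexive (ℕₚ.+-suc b _)))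

time-all : ∀ (p : A → Timed Bool) {b} xs → (∀ {x} → x ∈ xs → time (p x) ≤ b) → time (allᵗ p xs) ≤ suc (length xs * suc b)
time-all p []       h = s≤s z≤n
time-all p {b} (x ∷ xs) h with value (p x)
... | false = s≤s (≤-trans (+-mono-≤ (h (here refl)) z≤n) (≤-trans (≤-reflexive (ℕₚ.+-identityʳ b)) (≤-trans (n≤1+n b) (m≤m+n (suc b) _))))
... | true  = s≤s (≤-trans (+-mono-≤ (h (here refl)) (time-all p xs (h ∘ there))) (≤-reflexive (ℕₚ.+-suc b _)))

time-anyVec : ∀ (p : A → Timed Bool) {b} (xs : Vec A n) → (∀ x → time (p x) ≤ b) → time (anyVecᵗ p xs) ≤ suc (n * suc b)
time-anyVec p []       h = s≤s z≤n
time-anyVec p {b} (x ∷ xs) h with value (p x)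
... | true  = s≤s (≤-trans (+-mono-≤ (h x) z≤n) (≤-trans (≤-reflexive (ℕₚ.+-identityʳ b)) (≤-trans (n≤1+n b) (m≤m+n (suc b) _))))
... | false = s≤s (≤-trans (+-mono-≤ (h x) (time-anyVec p xs h)) (≤-reflexive (ℕₚ.+-suc b _)))

loop-step : ∀ {x y b c} → x ≤ b → y ≤ suc c → x + (y + 0) ≤ suc b + c
loop-step {y = y} {b} {c} x≤b y≤ rewrite ℕₚ.+-identityʳ y = ≤-trans (+-mono-≤ x≤b y≤) (≤-reflexive (ℕₚ.+-suc b c))

time-map : ∀ (f : A → Timed B) {b} xs → (∀ {x} → x ∈ xs → time (f x) ≤ b) → time (mapᵗ f xs) ≤ suc (length xs * suc b)
time-map f []       h = s≤s z≤n
time-map f (x ∷ xs) h = s≤s (loop-step (h (here refl)) (time-map f xs (h ∘ there)))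

time-mapVec : ∀ (f : A → Timed B) {b} (xs : Vec A n) → VecAll.All (λ x → time (f x) ≤ b) xs → time (mapVecᵗ f xs) ≤ suc (n * suc b)
time-mapVec f []       h = s≤s z≤n
time-mapVec f (x ∷ xs) (p VecAll.∷ ps) = s≤s (loop-step p (time-mapVec f xs ps))

time-partition : ∀ (p : A → Timed Bool) {b} xs → (∀ {x} → x ∈ xs → time (p x) ≤ b) → time (partitionᵗ p xs) ≤ suc (length xs * suc b)
time-partition p []       h = s≤s z≤n
time-partition p (x ∷ xs) h = s≤s (loop-step (h (here refl)) (time-partition p xs (h ∘ there)))

time-eqFin : ∀ (i j : Fin n) → time (eqFinᵗ i j) ≤ n
time-eqFin zero    zero    = s≤s z≤n
time-eqFin zero    (suc j) = s≤s z≤n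
time-eqFin (suc i) zero    = s≤s z≤n
time-eqFin (suc i) (suc j) = s≤s (time-eqFin i j)

time-eqℕ : ∀ i j → time (eqℕᵗ i j) ≤ suc i
time-eqℕ zero    zero    = ≤-refl
time-eqℕ zero    (suc j) = ≤-refl
time-eqℕ (suc i) zero    = s≤s z≤n
time-eqℕ (suc i) (suc j) = s≤s (time-eqℕ i j)

time-leq : ∀ i j → time (leqᵗ i j) ≤ suc i
time-leq zero    j       = ≤-refl
time-leq (suc i) zero    = s≤s z≤n
time-leq (suc i) (suc j) = s≤s (time-leq i j)

time-add : ∀ i j → time (addᵗ i j) ≤ suc i
time-add zero    j = ≤-refl
time-add (suc i) j = s≤s (subst (_≤ suc i) (sym (ℕₚ.+-identityʳ _)) (time-add i j))

time-half : ∀ i → time (halfᵗ i) ≤ suc i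
time-half zero          = ≤-refl
time-half (suc zero)    = s≤s z≤n
time-half (suc (suc i)) = s≤s (ℕₚ.m≤n⇒m≤1+n (subst (_≤ suc i) (sym (ℕₚ.+-identityʳ _)) (time-half i)))

time-length : ∀ (xs : List A) → time (lengthᵗ xs) ≤ suc (length xs)
time-length []       = ≤-refl
time-length (x ∷ xs) = s≤s (subst (_≤ suc (length xs)) (sym (ℕₚ.+-identityʳ _)) (time-length xs))

time-append : ∀ (xs ys : List A) → time (appendᵗ xs ys) ≤ suc (length xs)
time-append []       ys = ≤-refl
time-append (x ∷ xs) ys = s≤s (subst (_≤ suc (length xs)) (sym (ℕₚ.+-identityʳ _)) (time-append xs ys))

time-concat : ∀ {b} (xss : List (List A)) → All (λ xs → length xs ≤ b) xss → time (concatᵗ xss) ≤ suc (length xss * suc (suc b))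
time-concat []         _        = ≤-refl
time-concat {b = b} (xs ∷ xss) (p ∷ ps) = s≤s (≤-trans (≤-reflexive (ℕₚ.+-comm (time (concatᵗ xss)) _))
  (≤-trans (+-mono-≤ (≤-trans (time-append xs _) (s≤s p)) (time-concat xss ps)) (≤-reflexive (ℕₚ.+-suc (suc b) _))))

time-splitAt : ∀ h (xs : List A) → time (splitAtᵗ h xs) ≤ suc h
time-splitAt zero    xs       = ≤-refl
time-splitAt (suc h) []       = s≤s z≤n
time-splitAt (suc h) (x ∷ xs) = s≤s (subst (_≤ suc h) (sym (ℕₚ.+-identityʳ _)) (time-splitAt h xs))

time-index : ∀ (xs : Vec A n) i → time (indexᵗ xs i) ≤ n
time-index (x ∷ xs) zero    = s≤s z≤n
time-index (x ∷ xs) (suc i) = s≤s (time-index xs i)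

time-allFin : ∀ n → time (allFinᵗ n) ≤ suc n * suc n
time-allFin zero    = ≤-refl
time-allFin (suc n) = s≤s (begin
  time (allFinᵗ n) + (time (mapᵗ (λ i → return (suc i)) (value (allFinᵗ n))) + 0)
    ≤⟨ +-mono-≤ (time-allFin n) (≤-reflexive (ℕₚ.+-identityʳ _)) ⟩
  suc n * suc n + time (mapᵗ (λ i → return (suc i)) (value (allFinᵗ n)))
    ≤⟨ +-monoʳ-≤ (suc n * suc n) (time-map _ {0} (value (allFinᵗ n)) (λ _ → z≤n)) ⟩
  suc n * suc n + suc (length (value (allFinᵗ n)) * 1)
    ≡⟨ cong (λ l → suc n * suc n + suc (l * 1)) (trans (cong length (allFin-value n)) (length-allFin n)) ⟩
  suc n * suc n + suc (n * 1)
    ≤⟨ m≤m+n _ (suc n) ⟩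
  suc n * suc n + suc (n * 1) + suc n
    ≡⟨ lem n ⟩
  suc n + suc n * suc (suc n) ∎)
  where
  open ℕₚ.≤-Reasoning
  lem : ∀ n → suc n * suc n + suc (n * 1) + suc n ≡ suc n + suc n * suc (suc n)
  lem = solve-∀

time-lookup : ∀ (τ : PartialAssignment m d) x → time (lookupᵗ τ x) ≤ suc (length τ * suc m)
time-lookup []            x = ≤-refl
time-lookup {m = m} ((y , a) ∷ τ) x with value (eqFinᵗ x y)
... | true  = s≤s (≤-trans (+-mono-≤ (time-eqFin x y) z≤n) (≤-trans (≤-reflexive (ℕₚ.+-identityʳ m)) (≤-trans (n≤1+n m) (m≤m+n (suc m) _))))
... | false = s≤s (≤-trans (+-mono-≤ (time-eqFin x y) (time-lookup τ x)) (≤-reflexive (ℕₚ.+-suc m _)))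

time-evaluate : ∀ (τ : PartialAssignment m d) {b} → (∀ x → time (lookupᵗ τ x) ≤ b) → ∀ {a} (t : Table d a) xs →
  time (evaluateᵗ τ t xs) ≤ suc (a * suc (b + d))
time-evaluate τ h b [] = ≤-refl
time-evaluate {d = d} τ {b} h {suc a} t (inj₂ v ∷ xs) = s≤s (begin
  time (indexᵗ t v) + time (evaluateᵗ τ (value (indexᵗ t v)) xs)  ≤⟨ +-mono-≤ (≤-trans (time-index t v) (m≤n+m d b)) (time-evaluate τ h _ xs) ⟩
  (b + d) + suc (a * suc (b + d))                                   ≡⟨ ℕₚ.+-suc (b + d) _ ⟩
  suc (b + d) + a * suc (b + d)                                     ∎)
  where open ℕₚ.≤-Reasoning
time-evaluate {d = d} τ {b} h {suc a} t (inj₁ x ∷ xs) with value (lookupᵗ τ x)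
... | nothing = s≤s (begin
  time (lookupᵗ τ x) + 0     ≡⟨ ℕₚ.+-identityʳ _ ⟩
  time (lookupᵗ τ x)         ≤⟨ h x ⟩
  b                          ≤⟨ ≤-trans (m≤m+n b d) (n≤1+n _) ⟩
  suc (b + d)                ≤⟨ m≤m+n _ _ ⟩
  suc (b + d) + a * suc (b + d) ∎)
  where open ℕₚ.≤-Reasoning
... | just v = s≤s (begin
  time (lookupᵗ τ x) + (time (indexᵗ t v) + time (evaluateᵗ τ (value (indexᵗ t v)) xs)) ≡⟨ ℕₚ.+-assoc (time (lookupᵗ τ x)) _ _ ⟨
  time (lookupᵗ τ x) + time (indexᵗ t v) + time (evaluateᵗ τ (value (indexᵗ t v)) xs)   ≤⟨ +-mono-≤ (+-mono-≤ (h x) (time-index t v)) (time-evaluate τ h _ xs) ⟩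
  (b + d) + suc (a * suc (b + d))                                   ≡⟨ ℕₚ.+-suc (b + d) _ ⟩
  suc (b + d) + a * suc (b + d)                                     ∎)
  where open ℕₚ.≤-Reasoning

-- There are d^l leaves, each running the test. The overhead of an inner node is charged at full
-- rate to every leaf, once per level, which is wasteful but gives a product in closed form.
time-someAssignment : .{{_ : NonZero d}} → ∀ xs (τ : PartialAssignment m d) test {b} →
  (∀ τ′ → length τ′ ≡ length xs + length τ → time (test τ′) ≤ b) →
  time (someAssignmentᵗ xs τ test) ≤ d ^ length xs * (suc b + length xs * (2 + (time (allFinᵗ d) + d)))
time-someAssignment [] τ test {b} h = s≤s (≤-trans (h τ refl) (≤-reflexive (sym (trans (ℕₚ.+-identityʳ (b + 0)) (ℕₚ.+-identityʳ b)))))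
time-someAssignment {d = d} (x ∷ xs) τ test {b} h = begin
  suc (time (allFinᵗ d) + time (anyᵗ branch (value (allFinᵗ d))))
    ≤⟨ s≤s (+-monoʳ-≤ (time (allFinᵗ d)) (time-any branch (value (allFinᵗ d)) λ {a} _ →
         time-someAssignment xs ((x , a) ∷ τ) test {b} λ τ′ eq → h τ′ (trans eq (ℕₚ.+-suc (length xs) (length τ))))) ⟩
  suc (time (allFinᵗ d) + suc (length (value (allFinᵗ d)) * suc U))
    ≡⟨ cong (λ l → suc (time (allFinᵗ d) + suc (l * suc U))) (trans (cong length (allFin-value d)) (length-allFin d)) ⟩
  suc (time (allFinᵗ d) + suc (d * suc U))
    ≡⟨ lem₁ (time (allFinᵗ d)) d U ⟩
  c + d * U
    ≤⟨ +-monoˡ-≤ (d * U) (ℕₚ.m≤n*m c (d ^ suc l) {{m^n≢0 d (suc l)}}) ⟩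
  d ^ suc l * c + d * U
    ≡⟨ lem₂ d (d ^ l) c (suc b) l ⟩
  d ^ suc l * (suc b + suc l * c) ∎
  where
  open ℕₚ.≤-Reasoning
  l = length xs
  c = 2 + (time (allFinᵗ d) + d)
  U = d ^ l * (suc b + l * c)
  branch : Fin d → Timed Bool
  branch a = someAssignmentᵗ xs ((x , a) ∷ τ) test
  lem₁ : ∀ A d U → suc (A + suc (d * suc U)) ≡ 2 + (A + d) + d * U
  lem₁ = solve-∀
  lem₂ : ∀ d P c b l → d * P * c + d * (P * (b + l * c)) ≡ d * P * (b + suc l * c)
  lem₂ = solve-∀

length-concat-filter : ∀ {P : List A → Set} (P? : ∀ x → Dec (P x)) xss →
  length (concat (List.filter P? xss)) + length (concat (List.filter (¬? ∘ P?) xss)) ≡ length (concat xss)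
length-concat-filter P? [] = refl
length-concat-filter P? (xs ∷ xss) with does (P? xs)
... | true  = begin
  length (xs ++ concat (List.filter P? xss)) + L  ≡⟨ cong (_+ L) (Listₚ.length-++ xs) ⟩
  length xs + l + L                               ≡⟨ ℕₚ.+-assoc (length xs) l L ⟩
  length xs + (l + L)                             ≡⟨ cong (length xs +_) (length-concat-filter P? xss) ⟩
  length xs + length (concat xss)                 ≡⟨ Listₚ.length-++ xs ⟨
  length (xs ++ concat xss)                       ∎
  where
  open ≡-Reasoning
  l = length (concat (List.filter P? xss))
  L = length (concat (List.filter (¬? ∘ P?) xss))
... | false = begin
  l + length (xs ++ concat (List.filter (¬? ∘ P?) xss)) ≡⟨ cong (l +_) (Listₚ.length-++ xs) ⟩
  l + (length xs + L)                             ≡⟨ ℕₚ.+-assoc l (length xs) L ⟨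
  l + length xs + L                               ≡⟨ cong (_+ L) (ℕₚ.+-comm l (length xs)) ⟩
  length xs + l + L                               ≡⟨ ℕₚ.+-assoc (length xs) l L ⟩
  length xs + (l + L)                             ≡⟨ cong (length xs +_) (length-concat-filter P? xss) ⟩
  length xs + length (concat xss)                 ≡⟨ Listₚ.length-++ xs ⟨
  length (xs ++ concat xss)                       ∎
  where
  open ≡-Reasoning
  l = length (concat (List.filter P? xss))
  L = length (concat (List.filter (¬? ∘ P?) xss))

length-filters : ∀ {P : A → Set} (P? : ∀ x → Dec (P x)) xs →
  length (List.filter P? xs) + length (List.filter (¬? ∘ P?) xs) ≡ length xs
length-filters P? [] = refl
length-filters P? (x ∷ xs) with does (P? x)
... | true  = cong suc (length-filters P? xs)
... | false = trans (ℕₚ.+-suc _ _) (cong suc (length-filters P? xs))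

length-consNonempty : ∀ (xs : List A) xss → length (consNonempty xs xss) ≤ suc (length xss)
length-consNonempty []      xss = n≤1+n _
length-consNonempty (_ ∷ _) xss = ≤-refl

length-merge : ∀ (e : Hyperedge m n) blocks → length (value (mergeᵗ e blocks)) ≤ length blocks
length-merge e blocks rewrite merge-value e blocks with hit e blocks | length-filters (T-dec (λ block → meetsᵗ block e)) blocks
... | []     | eq = ≤-reflexive eq
... | b ∷ bs | eq = ≤-trans (length-consNonempty (concat (b ∷ bs)) _) (≤-trans (s≤s (m≤n+m _ (length bs))) (≤-reflexive eq))

length-concat-merge : ∀ (e : Hyperedge m n) blocks → length (concat (value (mergeᵗ e blocks))) ≡ length (concat blocks)
length-concat-merge e blocks rewrite merge-value e blocks = trans (lem (concat (hit e blocks)) (miss e blocks))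
  (length-concat-filter (T-dec (λ block → meetsᵗ block e)) blocks)
  where
  lem : ∀ (xs : List A) xss → length (concat (consNonempty xs xss)) ≡ length xs + length (concat xss)
  lem []       xss = refl
  lem (x ∷ xs) xss = Listₚ.length-++ (x ∷ xs)

-- The invariant that keeps merging cheap: vertices are moved between blocks and never copied, so
-- the total size does not grow.
SmallBlocks : ℕ → List (List (Fin n)) → Set
SmallBlocks b blocks = length blocks ≤ b × length (concat blocks) ≤ b

small-∈ : ∀ {b} {blocks : List (List (Fin n))} → SmallBlocks b blocks → ∀ {B} → B ∈ blocks → length B ≤ b
small-∈ {blocks = blocks} (_ , total) B∈ = ≤-trans (go blocks B∈) total
  where
  go : ∀ {B} blocks → B ∈ blocks → length B ≤ length (concat blocks)
  go (B ∷ bs) (here refl) = subst (length B ≤_) (sym (Listₚ.length-++ B)) (m≤m+n _ _)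
  go (C ∷ bs) (there B∈)  = subst (_ ≤_) (sym (Listₚ.length-++ C)) (≤-trans (go bs B∈) (m≤n+m _ _))

small-merge : ∀ {b} (e : Hyperedge m n) {blocks} → SmallBlocks b blocks → SmallBlocks b (value (mergeᵗ e blocks))
small-merge e {blocks} (len , total) = ≤-trans (length-merge e blocks) len , ≤-trans (≤-reflexive (length-concat-merge e blocks)) total

small-singletons : ∀ n → SmallBlocks n (singletons n)
small-singletons n = ≤-reflexive (trans (Listₚ.length-map _ (allFin n)) (length-allFin n))
  , ≤-reflexive (trans (lem (allFin n)) (length-allFin n))
  where
  lem : ∀ (xs : List A) → length (concat (map (_∷ []) xs)) ≡ length xs
  lem []       = refl
  lem (x ∷ xs) = cong suc (lem xs)

small-components : ∀ (es : List (Hyperedge m n)) → SmallBlocks n (value (componentsᵗ es))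
small-components {n = n} es rewrite components-value es = go es {singletons n} (small-singletons n)
  where
  go : ∀ (es : List (Hyperedge _ n)) {blocks} → SmallBlocks n blocks → SmallBlocks n (value (mergeAllᵗ es blocks))
  go []       small = small
  go (e ∷ es) {blocks} small = go es {value (mergeᵗ e blocks)} (small-merge e {blocks} small)

-- `Z` is to exceed every size that occurs, `D` is the exponential factor and `j` an upper estimate
-- of the degree. Being a record instead of a bare inequality, it lets `D` and `j` be inferred.
record Within (Z D j t : ℕ) : Set where
  constructor within
  field bound : t ≤ D * Z ^ j

open Within

-- The step of the node itself is paid by the leaves of the first branch, of which there is at least
-- one.
both-branches : ∀ F₁ F₂ b l → 1 ≤ F₁ → suc (F₁ * (b + l) + F₂ * (b + l)) ≤ (F₁ + F₂) * (b + suc l)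
both-branches F₁ F₂ b l 1≤F₁ = begin
  suc (F₁ * (b + l) + F₂ * (b + l))           ≤⟨ +-mono-≤ 1≤F₁ (+-monoʳ-≤ (F₁ * (b + l)) (*-monoʳ-≤ F₂ (n≤1+n (b + l)))) ⟩
  F₁ + (F₁ * (b + l) + F₂ * suc (b + l))      ≡⟨ lem F₁ F₂ b l ⟩
  (F₁ + F₂) * (b + suc l)                     ∎
  where
  open ℕₚ.≤-Reasoning
  lem : ∀ F₁ F₂ b l → F₁ + (F₁ * (b + l) + F₂ * suc (b + l)) ≡ (F₁ + F₂) * (b + suc l)
  lem = solve-∀

time-deterministic : ∀ (Ψ : CSP m d n) s {b} →
  (∀ {R K} → value (searchSeparatorᵗ s (value (hypergraphᵗ Ψ)) ([] , [])) ≡ just (R , K) → time (solveᵗ Ψ (R , K)) ≤ b) →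
  time (CSP-SAT-deterministic s Ψ) ≤ suc (time (hypergraphᵗ Ψ) + (time (searchSeparatorᵗ s (value (hypergraphᵗ Ψ)) ([] , [])) + b))
time-deterministic Ψ s h with value (searchSeparatorᵗ s (value (hypergraphᵗ Ψ)) ([] , []))
... | just (R , K) = s≤s (+-monoʳ-≤ (time (hypergraphᵗ Ψ)) (+-monoʳ-≤ (time (searchSeparatorᵗ s (value (hypergraphᵗ Ψ)) ([] , [])))
  (≤-trans (≤-reflexive (ℕₚ.+-identityʳ _)) (h refl))))
... | nothing      = s≤s (+-monoʳ-≤ (time (hypergraphᵗ Ψ)) (+-monoʳ-≤ (time (searchSeparatorᵗ s (value (hypergraphᵗ Ψ)) ([] , []))) z≤n))

-- Time bounds up to polynomial factors, and the deterministic algorithm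

module _ {Z : ℕ} (8≤Z : 8 ≤ Z) where

  private
    variable
      i j t u D : ℕ

  private
    1≤Z : 1 ≤ Z
    1≤Z = ≤-trans (s≤s z≤n) 8≤Z
    2≤Z : 2 ≤ Z
    2≤Z = ≤-trans (s≤s (s≤s z≤n)) 8≤Z
    instance
      Z≢0 : NonZero Z
      Z≢0 = ℕ.>-nonZero 1≤Z

  -- The degrees are numerals in every use, so the comparison evaluates and its proof is found
  -- automatically.
  relax : {_ : T (i ℕ.≤ᵇ j)} → Within Z D i t → Within Z D j t
  relax {i} {j} {D} {_} {i≤j} (within p) = within (≤-trans p (*-monoʳ-≤ D (^-monoʳ-≤ Z (ℕₚ.≤ᵇ⇒≤ i j i≤j))))

  mono : t ≤ u → Within Z D j u → Within Z D j t
  mono t≤u (within p) = within (≤-trans t≤u p)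

  scale-by : ∀ D → .{{_ : NonZero D}} → Within Z 1 j t → Within Z D j t
  scale-by {j} D (within p) = within (≤-trans p (≤-trans (≤-reflexive (ℕₚ.*-identityˡ (Z ^ j))) (ℕₚ.m≤n*m (Z ^ j) D)))

  base : t ≤ Z → Within Z 1 1 t
  base {t} t≤Z = within (subst (t ≤_) (sym (trans (ℕₚ.*-identityˡ (Z * 1)) (ℕₚ.*-identityʳ Z))) t≤Z)

  free : Within Z D 0 0
  free = within z≤n

  -- Since 2 ≤ Z, a sum costs one degree, and no constant factor ever has to be tracked.
  double : ∀ x y → x ≤ D * Z ^ j → y ≤ D * Z ^ j → x + y ≤ D * Z ^ suc j
  double {D} {j} x y p q = begin
    x + y                    ≤⟨ +-mono-≤ p q ⟩
    D * Z ^ j + D * Z ^ j    ≡⟨ lem D (Z ^ j) ⟩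
    D * (2 * Z ^ j)          ≤⟨ *-monoʳ-≤ D (*-monoˡ-≤ (Z ^ j) 2≤Z) ⟩
    D * (Z * Z ^ j)          ∎
    where
    open ℕₚ.≤-Reasoning
    lem : ∀ D P → D * P + D * P ≡ D * (2 * P)
    lem = solve-∀

  plus : Within Z D i t → Within Z D j u → Within Z D (suc (i ℕ.⊔ j)) (t + u)
  plus {D} {i} {t} {j} {u} (within p) (within q) = within (double {D} {i ℕ.⊔ j} t u
    (≤-trans p (*-monoʳ-≤ D (^-monoʳ-≤ Z (ℕₚ.m≤m⊔n i j))))
    (≤-trans q (*-monoʳ-≤ D (^-monoʳ-≤ Z (ℕₚ.m≤n⊔m i j)))))

  step : .{{_ : NonZero D}} → Within Z D j t → Within Z D (suc j) (suc t)
  step {D} {j} {t} (within p) = within (double {D} {j} 1 t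
    (*-mono-≤ (ℕ.>-nonZero⁻¹ D) (ℕₚ.m^n>0 Z j)) p)

  times : Within Z 1 i t → Within Z D j u → Within Z D (i + j) (t * u)
  times {i} {t} {D} {j} {u} (within p) (within q) = within (begin
    t * u                    ≤⟨ *-mono-≤ p q ⟩
    1 * Z ^ i * (D * Z ^ j)  ≡⟨ lem (Z ^ i) D (Z ^ j) ⟩
    D * (Z ^ i * Z ^ j)      ≡⟨ cong (D *_) (^-distribˡ-+-* Z i j) ⟨
    D * Z ^ (i + j)          ∎)
    where
    open ℕₚ.≤-Reasoning
    lem : ∀ a b c → 1 * a * (b * c) ≡ b * (a * c)
    lem = solve-∀

  loop : .{{_ : NonZero D}} → t ≤ Z → Within Z D j u → Within Z D (3 + j) (suc (t * suc u))
  loop t≤Z w = step (times (base t≤Z) (step w))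

  any-within : .{{_ : NonZero D}} → ∀ (p : A → Timed Bool) xs → length xs ≤ Z →
    (∀ {x} → x ∈ xs → Within Z D j (time (p x))) → Within Z D (3 + j) (time (anyᵗ p xs))
  any-within p xs len h = mono (time-any p xs (bound ∘ h)) (loop len (within ≤-refl))

  all-within : .{{_ : NonZero D}} → ∀ (p : A → Timed Bool) xs → length xs ≤ Z →
    (∀ {x} → x ∈ xs → Within Z D j (time (p x))) → Within Z D (3 + j) (time (allᵗ p xs))
  all-within p xs len h = mono (time-all p xs (bound ∘ h)) (loop len (within ≤-refl))

  map-within : .{{_ : NonZero D}} → ∀ (f : A → Timed B) xs → length xs ≤ Z →
    (∀ {x} → x ∈ xs → Within Z D j (time (f x))) → Within Z D (3 + j) (time (mapᵗ f xs))
  map-within f xs len h = mono (time-map f xs (bound ∘ h)) (loop len (within ≤-refl))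

  filter-within : .{{_ : NonZero D}} → ∀ (p : A → Timed Bool) xs → length xs ≤ Z →
    (∀ {x} → x ∈ xs → Within Z D j (time (p x))) → Within Z D (4 + j) (time (filterᵗ p xs))
  filter-within p xs len h = step (mono (≤-trans (≤-reflexive (ℕₚ.+-identityʳ _)) (time-partition p xs (bound ∘ h))) (loop len (within ≤-refl)))

  anyVec-within : .{{_ : NonZero D}} → ∀ (p : A → Timed Bool) (xs : Vec A n) → n ≤ Z →
    (∀ x → Within Z D j (time (p x))) → Within Z D (3 + j) (time (anyVecᵗ p xs))
  anyVec-within p xs len h = mono (time-anyVec p xs (bound ∘ h)) (loop len (within ≤-refl))

  mapVec-within : .{{_ : NonZero D}} → ∀ (f : A → Timed B) (xs : Vec A n) → n ≤ Z →
    VecAll.All (λ x → Within Z D j (time (f x))) xs → Within Z D (3 + j) (time (mapVecᵗ f xs))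
  mapVec-within f xs len h = mono (time-mapVec f xs (VecAll.map bound h)) (loop len (within ≤-refl))

  allFin-within : n ≤ Z → Within Z 1 4 (time (allFinᵗ n))
  allFin-within {n} n≤Z = mono (time-allFin n) (times (step (base n≤Z)) (step (base n≤Z)))

  allFin-length : n ≤ Z → length (value (allFinᵗ n)) ≤ Z
  allFin-length {n} n≤Z = subst (_≤ Z) (sym (trans (cong length (allFin-value n)) (length-allFin n))) n≤Z

  eqFin-within : n ≤ Z → ∀ (i j : Fin n) → Within Z 1 1 (time (eqFinᵗ i j))
  eqFin-within n≤Z i j = base (≤-trans (time-eqFin i j) n≤Z)

  module _ (m≤Z : m ≤ Z) (n≤Z : n ≤ Z) where

    Small : Hyperedge m n → Set
    Small (_ , e) = length e ≤ Z

    edge-small : ∀ (Ψ : CSP m d n) x → length (edge Ψ x) ≤ Z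
    edge-small Ψ x = ≤-trans (Listₚ.length-filter _ (allFin n)) (≤-trans (≤-reflexive (length-allFin n)) n≤Z)

    hypergraph-small : ∀ (Ψ : CSP m d n) → All Small (hypergraph Ψ)
    hypergraph-small Ψ = Allₚ.map⁺ (All.tabulate λ {x} _ → edge-small Ψ x)

    hypergraph-length : ∀ (Ψ : CSP m d n) → length (hypergraph Ψ) ≡ m
    hypergraph-length Ψ = trans (Listₚ.length-map _ (allFin m)) (length-allFin m)

    hypergraph-within : ∀ (Ψ : CSP m d n) → VecAll.All (λ c → arity c ≤ Z) Ψ → Within Z 1 20 (time (hypergraphᵗ Ψ))
    hypergraph-within Ψ arity≤Z = relax (step (plus (allFin-within m≤Z) (plus (allFin-within n≤Z)
      (map-within _ (value (allFinᵗ m)) (allFin-length m≤Z) λ {x} _ → plus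
        (filter-within _ (value (allFinᵗ n)) (allFin-length n≤Z) λ {v} _ → plus
          (base (≤-trans (time-index Ψ v) n≤Z))
          (anyVec-within (eqFinᵗ x) (scope (value (indexᵗ Ψ v)))
            (subst (λ c → arity c ≤ Z) (sym (index-value Ψ v)) (VecAllₚ.lookup⁺ arity≤Z v)) (eqFin-within m≤Z x)))
        (free {D = 1})))))

    meets-within : ∀ block (e : Hyperedge m n) → length block ≤ Z → Small e → Within Z 1 9 (time (meetsᵗ block e))
    meets-within block (_ , e) block≤Z e≤Z = relax (step (any-within _ e e≤Z λ {v} _ → step (any-within (eqFinᵗ v) block block≤Z λ {w} _ → eqFin-within n≤Z v w)))

    merge-within : ∀ (e : Hyperedge m n) {blocks} → Small e → SmallBlocks n blocks → Within Z 1 16 (time (mergeᵗ e blocks))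
    merge-within e {blocks} e≤Z small@(len , _) = relax (step (plus
      (mono (time-partition _ blocks λ {B} B∈ → bound (meets-within B e (≤-trans (small-∈ {blocks = blocks} small B∈) n≤Z) e≤Z))
        (loop (≤-trans len n≤Z) (within {D = 1} {9} ≤-refl)))
      (plus {j = 0} (mono (time-concat {b = n} _ (subst (All (λ B → length B ≤ n)) (sym hit≡)
                        (All.tabulate λ {B} B∈ → small-∈ {blocks = blocks} small (proj₁ (∈ₚ.∈-filter⁻ _ {xs = blocks} B∈)))))
          (loop (≤-trans (≤-reflexive (cong length hit≡)) (≤-trans (Listₚ.length-filter _ blocks) (≤-trans len n≤Z)))
            (step (base n≤Z))))
        free)))
      where
      hit≡ : proj₁ (value (partitionᵗ (λ block → meetsᵗ block e) blocks)) ≡ hit e blocks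
      hit≡ = cong proj₁ (partition-value (λ block → meetsᵗ block e) blocks)

    time-mergeAll : ∀ (es : List (Hyperedge m n)) {blocks} → All Small es → SmallBlocks n blocks →
      time (mergeAllᵗ es blocks) ≤ suc (length es * suc (1 * Z ^ 16))
    time-mergeAll [] _ _ = ≤-refl
    time-mergeAll (e ∷ es) {blocks} (p ∷ ps) small = s≤s (≤-trans
      (+-mono-≤ (bound (merge-within e {blocks} p small)) (time-mergeAll es {value (mergeᵗ e blocks)} ps (small-merge e {blocks} small)))
      (≤-reflexive (ℕₚ.+-suc (1 * Z ^ 16) _)))

    components-within : ∀ (es : List (Hyperedge m n)) → length es ≤ Z → All Small es → Within Z 1 24 (time (componentsᵗ es))
    components-within es len small = relax (step (plus (allFin-within n≤Z) (plus
      (map-within _ (value (allFinᵗ n)) (allFin-length n≤Z) λ _ → free {D = 1})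
      (mono (time-mergeAll es small (subst (SmallBlocks n) (sym (trans (map-value _ (value (allFinᵗ n))) (cong (map (_∷ [])) (allFin-value n)))) (small-singletons n)))
        (loop len (within {D = 1} {16} ≤-refl))))))

    filter-length : ∀ {X : Set} (p : X → Timed Bool) xs → length (value (filterᵗ p xs)) ≤ length xs
    filter-length p xs = subst (λ l → length l ≤ length xs) (sym (filter-value p xs)) (Listₚ.length-filter _ xs)

    isBalanced-within : ∀ (K : List (Hyperedge m n)) → length K ≤ Z → All Small K → Within Z 1 30 (time (isBalancedᵗ K))
    isBalanced-within K len small = relax (step (plus (mono (time-half m) (step (base m≤Z))) (plus (components-within K len small)
      (all-within _ (value (componentsᵗ K)) (≤-trans (proj₁ (small-components K)) n≤Z) λ {B} B∈ → plus
        (filter-within (meetsᵗ B) K len λ {e} e∈ → meets-within B e (≤-trans (small-∈ {blocks = value (componentsᵗ K)} (small-components K) B∈) n≤Z) (All.lookup small e∈))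
        (plus (mono (time-length (value (filterᵗ (meetsᵗ B) K))) (step (base (≤-trans (filter-length (meetsᵗ B) K) len))))
              (mono (time-leq (value (lengthᵗ (value (filterᵗ (meetsᵗ B) K)))) _)
                (step (base (subst (_≤ Z) (sym (length-value (value (filterᵗ (meetsᵗ B) K)))) (≤-trans (filter-length (meetsᵗ B) K) len))))))))))

    lookup-within : ∀ (τ : PartialAssignment m d) → length τ ≤ Z → ∀ x → Within Z 1 5 (time (lookupᵗ τ x))
    lookup-within τ len x = relax (mono (time-lookup τ x) (loop len (base m≤Z)))

    -- The counterpart of `argument` for cost: the function applied to a scope entry is anonymous,
    -- so its time is read off the restriction of a unary constraint.
    argument-time : ∀ (ρ : PartialAssignment m d) x →
      time (restrictᵗ (constraint (x ∷ []) (Vec.replicate d false) ∷ []) ρ) ≤ 5 + time (lookupᵗ ρ x)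
    argument-time ρ x with value (lookupᵗ ρ x)
    ... | just _  = ≤-reflexive (lem (time (lookupᵗ ρ x)))
      where
      lem : ∀ t → suc (suc (suc (t + 0 + 1 + 0)) + 1) ≡ 5 + t
      lem = solve-∀
    ... | nothing = ≤-reflexive (lem (time (lookupᵗ ρ x)))
      where
      lem : ∀ t → suc (suc (suc (t + 0 + 1 + 0)) + 1) ≡ 5 + t
      lem = solve-∀

    restrict-within : ∀ (Ψ : CSP m d n) → VecAll.All (λ c → arity c ≤ Z) Ψ → ∀ ρ → length ρ ≤ Z → Within Z 1 18 (time (restrictᵗ Ψ ρ))
    restrict-within Ψ arity≤Z ρ len = relax (step (mapVec-within _ Ψ n≤Z (VecAll.map (λ {c} c≤Z → plus {j = 0}
      (mapVec-within _ (scope c) c≤Z (VecAll.universal (λ x → mono (dominate _) (mono (argument-time ρ x)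
        (step (step (step (step (step (lookup-within ρ len x)))))))) (scope c)))
      free) arity≤Z)))
      where
      -- The right side is the cost of restricting that unary constraint, with t for the single
      -- scope entry.
      dominate : ∀ t → t ≤ suc (suc (suc (t + 1 + 0)) + 1)
      dominate t = subst (t ≤_) (lem t) (m≤m+n t 5)
        where
        lem : ∀ t → t + 5 ≡ suc (suc (suc (t + 1 + 0)) + 1)
        lem = solve-∀

    evaluate-within : ∀ (τ : PartialAssignment m d) → length τ ≤ Z → d ≤ Z → ∀ {a} → a ≤ Z → (t : Table d a) → ∀ xs →
      Within Z 1 9 (time (evaluateᵗ τ t xs))
    evaluate-within τ len d≤Z a≤Z t xs = mono (time-evaluate τ (bound ∘ lookup-within τ len) t xs)
      (loop a≤Z (plus (within {D = 1} {5} ≤-refl) (base d≤Z)))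

    someAssignment-within : ∀ {h} .{{_ : NonZero d}} .{{_ : NonZero D}} → d ≤ Z → ∀ xs (test : PartialAssignment m d → Timed Bool) →
      length xs ≤ h → length xs ≤ Z → (∀ τ → length τ ≡ length xs → Within Z D j (time (test τ))) →
      Within Z (d ^ h * D) (suc (suc j ℕ.⊔ 8)) (time (someAssignmentᵗ xs [] test))
    someAssignment-within {d} {D} {j} {h} d≤Z xs test len≤h len≤Z ok = within (begin
      time (someAssignmentᵗ xs [] test)
        ≤⟨ time-someAssignment xs [] test (λ τ eq → bound (ok τ (trans eq (ℕₚ.+-identityʳ _)))) ⟩
      d ^ length xs * U
        ≤⟨ *-mono-≤ (^-monoʳ-≤ d len≤h) (bound (plus (step (within {D = D} {j} ≤-refl))
             (scale-by D (times (base len≤Z) (step (step (plus (allFin-within d≤Z) (base d≤Z)))))))) ⟩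
      d ^ h * (D * Z ^ suc (suc j ℕ.⊔ 8))
        ≡⟨ ℕₚ.*-assoc (d ^ h) D _ ⟨
      d ^ h * D * Z ^ suc (suc j ℕ.⊔ 8) ∎)
      where
      open ℕₚ.≤-Reasoning
      U = suc (D * Z ^ j) + length xs * (2 + (time (allFinᵗ d) + d))

    variables-length : ∀ (es : List (Hyperedge m n)) → length (value (variablesᵗ es)) ≡ length es
    variables-length es = trans (cong length (variables-value es)) (Listₚ.length-map proj₁ es)

    variables-within : ∀ (es : List (Hyperedge m n)) → length es ≤ Z → Within Z 1 4 (time (variablesᵗ es))
    variables-within es len = step (map-within _ es len λ _ → free {D = 1})

    component-within : .{{_ : NonZero d}} → d ≤ Z → ∀ (Ψρ : Vec (Constraint (Fin m ⊎ Fin d) d) n) →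
      (∀ v → arity (value (indexᵗ Ψρ v)) ≤ Z) → ∀ K block → length K ≤ Z → All Small K → length block ≤ Z →
      ∀ {h} → length (incident K block) ≤ h → Within Z (d ^ h) 23 (time (componentSatisfiableᵗ Ψρ K block))
    component-within {d} d≤Z Ψρ arity≤Z K block K≤Z small block≤Z {h} inc≤h =
      subst (λ D → Within Z D 23 (time (componentSatisfiableᵗ Ψρ K block))) (ℕₚ.*-identityʳ (d ^ h))
      (relax (step {{nz}} (plus (scale-by (d ^ h * 1) {{nz}} (filter-within (meetsᵗ block) K K≤Z λ {e} e∈ → meets-within block e block≤Z (All.lookup small e∈)))
        (plus (scale-by (d ^ h * 1) {{nz}} (variables-within (value (filterᵗ (meetsᵗ block) K)) (≤-trans (filter-length (meetsᵗ block) K) K≤Z)))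
          (someAssignment-within d≤Z (value (variablesᵗ (value (filterᵗ (meetsᵗ block) K)))) (componentTest Ψρ block)
            (subst (_≤ h) (sym (trans (variables-length (value (filterᵗ (meetsᵗ block) K))) (cong length (filter-value (meetsᵗ block) K)))) inc≤h)
            xs≤Z λ τ len → all-within _ block block≤Z λ {v} _ → plus
              (base (≤-trans (time-index Ψρ v) n≤Z))
              (evaluate-within τ (≤-trans (≤-reflexive len) xs≤Z) d≤Z (arity≤Z v) (table (value (indexᵗ Ψρ v))) (scope (value (indexᵗ Ψρ v)))))))))
      where
      nz : NonZero (d ^ h * 1)
      nz = m*n≢0 (d ^ h) 1 {{m^n≢0 d h}}
      xs≤Z : length (value (variablesᵗ (value (filterᵗ (meetsᵗ block) K)))) ≤ Z
      xs≤Z = ≤-trans (≤-reflexive (variables-length (value (filterᵗ (meetsᵗ block) K)))) (≤-trans (filter-length (meetsᵗ block) K) K≤Z)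

    -- For each assignment of R the blocks are tried one after another, not jointly, so only the
    -- largest of them enters the exponent; their number is absorbed by the power of Z.
    solve-within : .{{_ : NonZero d}} → d ≤ Z → ∀ (Ψ : CSP m d n) → VecAll.All (λ c → arity c ≤ Z) Ψ →
      ∀ R K {q h} → length R ≤ q → length R ≤ Z → length K ≤ Z → All Small K →
      (∀ {B} → B ∈ value (componentsᵗ K) → length (incident K B) ≤ h) → Within Z (d ^ q * d ^ h) 34 (time (solveᵗ Ψ (R , K)))
    solve-within {d} d≤Z Ψ arity≤Z R K {q} {h} R≤q R≤Z K≤Z small inc =
      relax (step (plus (scale-by (d ^ q * d ^ h) (variables-within R R≤Z))
        (someAssignment-within d≤Z (value (variablesᵗ R)) (solveTest Ψ K)
          (≤-trans (≤-reflexive (variables-length R)) R≤q) (≤-trans (≤-reflexive (variables-length R)) R≤Z) λ ρ len → plus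
            (scale-by (d ^ h) (restrict-within Ψ arity≤Z ρ (≤-trans (≤-reflexive (trans len (variables-length R))) R≤Z)))
            (plus (scale-by (d ^ h) (components-within K K≤Z small))
              (all-within _ (value (componentsᵗ K)) (≤-trans (proj₁ (small-components K)) n≤Z) λ {B} B∈ →
                component-within d≤Z (value (restrictᵗ Ψ ρ))
                  (λ v → subst (_≤ Z) (sym (cong arity (trans (index-value (value (restrictᵗ Ψ ρ)) v)
                    (trans (cong (λ Ψρ → Vec.lookup Ψρ v) (restrict-value Ψ ρ)) (Vecₚ.lookup-map v (restriction ρ) Ψ)))))
                    (VecAllₚ.lookup⁺ arity≤Z v))
                  K B K≤Z small (≤-trans (small-∈ {blocks = value (componentsᵗ K)} (small-components K) B∈) n≤Z) (inc B∈))))))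
      where
      instance
        dʰ≢0 : NonZero (d ^ h)
        dʰ≢0 = m^n≢0 d h
        d≢0 : NonZero (d ^ q * d ^ h)
        d≢0 = m*n≢0 (d ^ q) (d ^ h) {{m^n≢0 d q}}

    -- Every leaf pays for its balance test and for one step at each node on the path leading to it.
    time-search : ∀ s (es : List (Hyperedge m n)) R K → All Small es → All Small K → length K + length es ≤ Z →
      time (searchSeparatorᵗ s es (R , K)) ≤ binomialSum (length es) s * (suc (suc (1 * Z ^ 30)) + length es)
    time-search s [] R K _ small len = s≤s (≤-trans (≤-reflexive (ℕₚ.+-identityʳ _))
      (≤-trans (bound (isBalanced-within K (≤-trans (≤-reflexive (sym (ℕₚ.+-identityʳ _))) len) small))
        (≤-trans (n≤1+n _) (≤-reflexive (lem _)))))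
      where
      lem : ∀ b → suc b ≡ suc (b + 0 + 0)
      lem b = cong suc (sym (trans (ℕₚ.+-identityʳ (b + 0)) (ℕₚ.+-identityʳ b)))
    time-search zero (e ∷ es) R K (p ∷ ps) small len = begin
      suc (time (searchSeparatorᵗ zero es (R , e ∷ K)))   ≤⟨ s≤s (time-search zero es R (e ∷ K) ps (p ∷ small) (subst (_≤ Z) (ℕₚ.+-suc _ _) len)) ⟩
      suc (binomialSum (length es) 0 * X)                 ≡⟨ cong (λ z → suc (z * X)) (binomialSum-zero (length es)) ⟩
      suc (1 * X)                                         ≡⟨ lem (suc (suc (1 * Z ^ 30))) (length es) ⟩
      1 * (suc (suc (1 * Z ^ 30)) + suc (length es))      ∎
      where
      open ℕₚ.≤-Reasoning
      X = suc (suc (1 * Z ^ 30)) + length es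
      lem : ∀ b l → suc (1 * (b + l)) ≡ 1 * (b + suc l)
      lem = solve-∀
    time-search (suc s) (e ∷ es) R K (p ∷ ps) small len
      with value (searchSeparatorᵗ s es (e ∷ R , K)) | time-search s es (e ∷ R) K ps small (≤-trans (+-monoʳ-≤ (length K) (n≤1+n _)) len)
    ... | just _  | p₁ = ≤-trans (s≤s (+-mono-≤ p₁ (z≤n {binomialSum (length es) (suc s) * (suc (suc (1 * Z ^ 30)) + length es)})))
      (both-branches (binomialSum (length es) s) (binomialSum (length es) (suc s)) _ (length es) (1≤binomialSum (length es) s))
    ... | nothing | p₁ = ≤-trans
      (s≤s (+-mono-≤ p₁ (time-search (suc s) es R (e ∷ K) ps (p ∷ small) (subst (_≤ Z) (ℕₚ.+-suc _ _) len))))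
      (both-branches (binomialSum (length es) s) (binomialSum (length es) (suc s)) _ (length es) (1≤binomialSum (length es) s))

    -- Search and solving run in succession, so their exponential factors add. The bound on solving
    -- holds for whichever separator the search returns, because the search itself has tested its
    -- balance.
    deterministic-within : .{{_ : NonZero d}} → d ≤ Z → ∀ (Ψ : CSP m d n) → VecAll.All (λ c → arity c ≤ Z) Ψ → ∀ s →
      Within Z (binomialSum m s + d ^ s * d ^ ℕ.⌊ m /2⌋) 38 (time (CSP-SAT-deterministic s Ψ))
    deterministic-within {d} d≤Z Ψ arity≤Z s = relax (mono (time-deterministic Ψ s (λ {R} {K} eq → bound (solve-bound R K eq)))
      (step (plus (scale-by W (hypergraph-within Ψ arity≤Z)) (plus search-bound (within {D = W} {34} ≤-refl)))))
      where
      W = binomialSum m s + d ^ s * d ^ ℕ.⌊ m /2⌋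
      instance
        W≢0 : NonZero W
        W≢0 = ℕ.>-nonZero (≤-trans (1≤binomialSum m s) (m≤m+n _ _))
      weaken : ∀ {D′ j t} → D′ ≤ W → Within Z D′ j t → Within Z W j t
      weaken {j = j} D′≤W (within p) = within (≤-trans p (*-monoˡ-≤ (Z ^ j) D′≤W))
      H = value (hypergraphᵗ Ψ)
      H-small : All Small H
      H-small = subst (All Small) (sym (hypergraph-value Ψ)) (hypergraph-small Ψ)
      H-length : length H ≡ m
      H-length = trans (cong length (hypergraph-value Ψ)) (hypergraph-length Ψ)
      search-bound : Within Z W 33 (time (searchSeparatorᵗ s H ([] , [])))
      search-bound = weaken (m≤m+n (binomialSum m s) (d ^ s * d ^ ℕ.⌊ m /2⌋))
        (within (≤-trans (time-search s H [] [] H-small [] (≤-trans (≤-reflexive H-length) m≤Z))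
          (subst (λ l → binomialSum l s * (suc (suc (1 * Z ^ 30)) + l) ≤ binomialSum m s * Z ^ 33) (sym H-length)
            (*-monoʳ-≤ (binomialSum m s) (≤-trans (bound (plus (step (step (within {D = 1} {30} ≤-refl))) (base m≤Z)))
              (≤-reflexive (ℕₚ.*-identityˡ (Z ^ 33))))))))
      solve-bound : ∀ R K → value (searchSeparatorᵗ s H ([] , [])) ≡ just (R , K) → Within Z W 34 (time (solveᵗ Ψ (R , K)))
      solve-bound R K eq
        with perm , bal , R≤s ← search-sound s H [] [] eq
        = weaken (m≤n+m (d ^ s * d ^ ℕ.⌊ m /2⌋) (binomialSum m s))
            (solve-within d≤Z Ψ arity≤Z R K (≤-trans R≤s (≤-reflexive (ℕₚ.+-identityʳ s)))
              (≤-trans (m≤m+n _ _) RK≤Z) (≤-trans (m≤n+m _ _) RK≤Z)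
              (Allₚ.++⁻ʳ R (↭ₚ.All-resp-↭ (↭-sym perm) H-small)) (isBalanced⁻ K bal))
        where
        RK≤Z : length R + length K ≤ Z
        RK≤Z = ≤-trans (≤-reflexive (trans (sym (Listₚ.length-++ R)) (trans (↭ₚ.↭-length perm) H-length))) m≤Z

-- The separation defined by a set of vertices

_∈ᵇ_ : PaddedVertex m n → List (PaddedVertex m n) → Bool
u ∈ᵇ S = value (elemᵗ eqVertexᵗ u S)

∈ᵇ⁺ : ∀ {u : PaddedVertex m n} {S} → u ∈ S → u ∈ᵇ S ≡ true
∈ᵇ⁺ = elem⁺ {eq = eqVertexᵗ} eqVertex-refl

∈ᵇ⁻ : ∀ {u : PaddedVertex m n} S → u ∈ᵇ S ≡ true → u ∈ S
∈ᵇ⁻ = elem⁻ {eq = eqVertexᵗ} eqVertex⁻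

∉ᵇ⁺ : ∀ {u : PaddedVertex m n} {S} → u ∉ S → u ∈ᵇ S ≡ false
∉ᵇ⁺ {u = u} {S} u∉ with u ∈ᵇ S in eq
... | true  = contradiction (∈ᵇ⁻ S eq) u∉
... | false = refl

allIn someIn : List (PaddedVertex m n) → List (PaddedVertex m n) → Bool
allIn  S us = value (allᵗ (λ u → elemᵗ eqVertexᵗ u S) us)
someIn S us = value (anyᵗ (λ u → elemᵗ eqVertexᵗ u S) us)

inside outside crossing : List (PaddedVertex m n) → List (PaddedHyperedge m n) → List (Hyperedge m n)
inside   S es = proj₁ (value (classifyᵗ S es))
outside  S es = proj₁ (proj₂ (value (classifyᵗ S es)))
crossing S es = proj₂ (proj₂ (value (classifyᵗ S es)))

classify-↭ : ∀ S (es : List (PaddedHyperedge m n)) → inside S es ++ outside S es ++ crossing S es ↭ map proj₁ es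
classify-↭ S [] = ↭-refl
classify-↭ S ((e , us) ∷ es) with allIn S us | someIn S us | classify-↭ S es
... | true  | _     | perm = prep e perm
... | false | true  | perm = ↭-trans
  (↭-trans (↭ₚ.++⁺ˡ (inside S es) (↭ₚ.shift e (outside S es) (crossing S es))) (↭ₚ.shift e (inside S es) (outside S es ++ crossing S es)))
  (prep e perm)
... | false | false | perm = ↭-trans (↭ₚ.shift e (inside S es) (outside S es ++ crossing S es)) (prep e perm)

classify-length : ∀ S (es : List (PaddedHyperedge m n)) →
  length (inside S es) + (length (outside S es) + length (crossing S es)) ≡ length es
classify-length S es = trans (cong (length (inside S es) +_) (sym (Listₚ.length-++ (outside S es))))
  (trans (sym (Listₚ.length-++ (inside S es))) (trans (↭ₚ.↭-length (classify-↭ S es)) (Listₚ.length-map proj₁ es)))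

inside-∈ : ∀ S (es : List (PaddedHyperedge m n)) {e} → e ∈ inside S es → ∃ λ us → (e , us) ∈ es × allIn S us ≡ true
inside-∈ S ((e , us) ∷ es) e∈ with allIn S us in eqA | someIn S us
inside-∈ S ((e , us) ∷ es) (here refl) | true  | _ = us , here refl , eqA
inside-∈ S ((e , us) ∷ es) (there e∈)  | true  | _ with us′ , ∈es , eq ← inside-∈ S es e∈ = us′ , there ∈es , eq
inside-∈ S ((e , us) ∷ es) e∈ | false | true  with us′ , ∈es , eq ← inside-∈ S es e∈ = us′ , there ∈es , eq
inside-∈ S ((e , us) ∷ es) e∈ | false | false with us′ , ∈es , eq ← inside-∈ S es e∈ = us′ , there ∈es , eq

outside-∈ : ∀ S (es : List (PaddedHyperedge m n)) {e} → e ∈ outside S es → ∃ λ us → (e , us) ∈ es × someIn S us ≡ false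
outside-∈ S ((e , us) ∷ es) e∈ with allIn S us | someIn S us in eqS
outside-∈ S ((e , us) ∷ es) e∈ | true  | _ with us′ , ∈es , eq ← outside-∈ S es e∈ = us′ , there ∈es , eq
outside-∈ S ((e , us) ∷ es) e∈ | false | true  with us′ , ∈es , eq ← outside-∈ S es e∈ = us′ , there ∈es , eq
outside-∈ S ((e , us) ∷ es) (here refl) | false | false = us , here refl , eqS
outside-∈ S ((e , us) ∷ es) (there e∈)  | false | false with us′ , ∈es , eq ← outside-∈ S es e∈ = us′ , there ∈es , eq

Contains : PaddedHyperedge m n → Set
Contains ((_ , e) , us) = ∀ {v} → v ∈ e → inj₁ v ∈ us

-- The colouring to which `Monochromatic` is applied. It ignores padding vertices, as the components
-- are those of the hypergraph without padding.
colour : List (PaddedVertex m n) → Fin n → Bool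
colour {m = m} S v = _∈ᵇ_ {m = m} (inj₁ v) S

inside-colour : ∀ S {es : List (PaddedHyperedge m n)} → All Contains es →
  All (λ e → All (λ v → colour S v ≡ true) (proj₂ e)) (inside S es)
inside-colour S {es} contains = All.tabulate λ e∈ → All.tabulate λ v∈ →
  let us , ∈es , eq = inside-∈ S es e∈ in all⁻ (λ u → elemᵗ eqVertexᵗ u S) eq (All.lookup contains ∈es v∈)

outside-colour : ∀ S {es : List (PaddedHyperedge m n)} → All Contains es →
  All (λ e → All (λ v → colour S v ≡ false) (proj₂ e)) (outside S es)
outside-colour S {es} contains = All.tabulate λ e∈ → All.tabulate λ {v} v∈ →
  let us , ∈es , eq = outside-∈ S es e∈ in none us (All.lookup contains ∈es v∈) eq
  where
  none : ∀ {u} us → u ∈ us → someIn S us ≡ false → u ∈ᵇ S ≡ false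
  none {u} us u∈ eq with u ∈ᵇ S in eqᵤ
  ... | true  = contradiction eq (true≢false (any⁺ (λ u → elemᵗ eqVertexᵗ u S) u∈ eqᵤ))
  ... | false = refl

separator kept : List (PaddedVertex m n) → List (PaddedHyperedge m n) → List (Hyperedge m n)
separator {m} S es = crossing S es ++ drop ℕ.⌊ m /2⌋ (inside S es) ++ drop ℕ.⌊ m /2⌋ (outside S es)
kept      {m} S es = take ℕ.⌊ m /2⌋ (inside S es) ++ take ℕ.⌊ m /2⌋ (outside S es)

accepts : (s b : ℕ) → List (PaddedHyperedge m n) → List (PaddedVertex m n) → Bool
accepts {m} s b es S = value (leqᵗ (length (inside S es)) (ℕ.⌊ m /2⌋ + b)) ∧
  value (leqᵗ ℕ.⌊ m /2⌋ (length (inside S es) + b)) ∧ value (leqᵗ (length (crossing S es)) s)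

separation-value : ∀ s b (es : List (PaddedHyperedge m n)) S →
  value (separationᵗ s b es S) ≡ (if accepts s b es S then just (separator S es , kept S es) else nothing)
separation-value {m} s b es S
  rewrite half-value m | length-value (inside S es) | length-value (crossing S es)
        | add-value ℕ.⌊ m /2⌋ b | add-value (length (inside S es)) b
        | splitAt-value ℕ.⌊ m /2⌋ (inside S es) | splitAt-value ℕ.⌊ m /2⌋ (outside S es)
        | append-value (drop ℕ.⌊ m /2⌋ (inside S es)) (drop ℕ.⌊ m /2⌋ (outside S es))
        | append-value (crossing S es) (drop ℕ.⌊ m /2⌋ (inside S es) ++ drop ℕ.⌊ m /2⌋ (outside S es))
        | append-value (take ℕ.⌊ m /2⌋ (inside S es)) (take ℕ.⌊ m /2⌋ (outside S es)) = refl

accepts⁻ : ∀ s b (es : List (PaddedHyperedge m n)) S → accepts s b es S ≡ true →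
  length (inside S es) ≤ ℕ.⌊ m /2⌋ + b × ℕ.⌊ m /2⌋ ≤ length (inside S es) + b × length (crossing S es) ≤ s
accepts⁻ {m} s b es S eq
  with value (leqᵗ (length (inside S es)) (ℕ.⌊ m /2⌋ + b)) in eq₁
     | value (leqᵗ ℕ.⌊ m /2⌋ (length (inside S es) + b)) in eq₂
     | value (leqᵗ (length (crossing S es)) s) in eq₃
... | true | true | true = leq⁻ _ _ eq₁ , leq⁻ _ _ eq₂ , leq⁻ _ _ eq₃

accepts⁺ : ∀ s b (es : List (PaddedHyperedge m n)) S →
  length (inside S es) ≤ ℕ.⌊ m /2⌋ + b → ℕ.⌊ m /2⌋ ≤ length (inside S es) + b → length (crossing S es) ≤ s →
  accepts s b es S ≡ true
accepts⁺ s b es S p q r rewrite leq⁺ p | leq⁺ q | leq⁺ r = refl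

separation-↭ : ∀ S (es : List (PaddedHyperedge m n)) → separator S es ++ kept S es ↭ map proj₁ es
separation-↭ {m} S es = begin
  (X ++ D₁ ++ D₂) ++ (T₁ ++ T₂)   ↭⟨ ↭ₚ.++-comm (X ++ D₁ ++ D₂) (T₁ ++ T₂) ⟩
  (T₁ ++ T₂) ++ (X ++ D₁ ++ D₂)   ↭⟨ ↭ₚ.++⁺ˡ (T₁ ++ T₂) (↭ₚ.++-comm X (D₁ ++ D₂)) ⟩
  (T₁ ++ T₂) ++ ((D₁ ++ D₂) ++ X) ↭⟨ ↭ₚ.++-assoc (T₁ ++ T₂) (D₁ ++ D₂) X ⟨
  ((T₁ ++ T₂) ++ (D₁ ++ D₂)) ++ X ↭⟨ ↭ₚ.++⁺ʳ X middle ⟩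
  ((T₁ ++ D₁) ++ (T₂ ++ D₂)) ++ X ↭⟨ ↭-reflexive (cong₂ (λ a b → (a ++ b) ++ X) (Listₚ.take++drop≡id h (inside S es)) (Listₚ.take++drop≡id h (outside S es))) ⟩
  (inside S es ++ outside S es) ++ X ↭⟨ ↭ₚ.++-assoc (inside S es) (outside S es) X ⟩
  inside S es ++ outside S es ++ X   ↭⟨ classify-↭ S es ⟩
  map proj₁ es                       ∎
  where
  open PermutationReasoning
  h = ℕ.⌊ m /2⌋
  X = crossing S es
  T₁ = take h (inside S es)
  D₁ = drop h (inside S es)
  T₂ = take h (outside S es)
  D₂ = drop h (outside S es)
  middle : (T₁ ++ T₂) ++ (D₁ ++ D₂) ↭ (T₁ ++ D₁) ++ (T₂ ++ D₂)
  middle = begin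
    (T₁ ++ T₂) ++ (D₁ ++ D₂)   ↭⟨ ↭ₚ.++-assoc T₁ T₂ (D₁ ++ D₂) ⟩
    T₁ ++ (T₂ ++ (D₁ ++ D₂))   ↭⟨ ↭ₚ.++⁺ˡ T₁ (↭ₚ.++-assoc T₂ D₁ D₂) ⟨
    T₁ ++ ((T₂ ++ D₁) ++ D₂)   ↭⟨ ↭ₚ.++⁺ˡ T₁ (↭ₚ.++⁺ʳ D₂ (↭ₚ.++-comm T₂ D₁)) ⟩
    T₁ ++ ((D₁ ++ T₂) ++ D₂)   ↭⟨ ↭ₚ.++⁺ˡ T₁ (↭ₚ.++-assoc D₁ T₂ D₂) ⟩
    T₁ ++ (D₁ ++ (T₂ ++ D₂))   ↭⟨ ↭ₚ.++-assoc T₁ D₁ (T₂ ++ D₂) ⟨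
    (T₁ ++ D₁) ++ (T₂ ++ D₂)   ∎

2⌊m/2⌋≤m : ∀ m → 2 * ℕ.⌊ m /2⌋ ≤ m
2⌊m/2⌋≤m zero          = z≤n
2⌊m/2⌋≤m (suc zero)    = z≤n
2⌊m/2⌋≤m (suc (suc m)) = subst (_≤ suc (suc m)) (sym (ℕₚ.*-suc 2 ℕ.⌊ m /2⌋)) (s≤s (s≤s (2⌊m/2⌋≤m m)))

m≤1+⌊m/2⌋+⌊m/2⌋ : ∀ m → m ≤ suc (ℕ.⌊ m /2⌋ + ℕ.⌊ m /2⌋)
m≤1+⌊m/2⌋+⌊m/2⌋ zero          = z≤n
m≤1+⌊m/2⌋+⌊m/2⌋ (suc zero)    = s≤s z≤n
m≤1+⌊m/2⌋+⌊m/2⌋ (suc (suc m)) = s≤s (subst (suc m ≤_) (sym (ℕₚ.+-suc (suc ℕ.⌊ m /2⌋) ℕ.⌊ m /2⌋)) (s≤s (m≤1+⌊m/2⌋+⌊m/2⌋ m)))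

-- Acceptance bounds the surplus inside S by b directly. The surplus outside is bounded through the
-- total: at least h - b hyperedges are inside and m ≤ 2 h + 1, which leaves at most h + b + 1.
length-separator : ∀ {s b} {es : List (PaddedHyperedge m n)} S → length es ≡ m → accepts s b es S ≡ true →
  length (separator S es) ≤ s + (2 * b + 1)
length-separator {m} {s = s} {b} {es} S len acc with p , q , r ← accepts⁻ s b es S acc = begin
  length (separator S es)                                     ≡⟨ trans (Listₚ.length-++ (crossing S es)) (cong (length (crossing S es) +_) (Listₚ.length-++ (drop h (inside S es)))) ⟩
  length (crossing S es) + (length (drop h (inside S es)) + length (drop h (outside S es)))
    ≡⟨ cong₂ (λ x y → length (crossing S es) + (x + y)) (Listₚ.length-drop h (inside S es)) (Listₚ.length-drop h (outside S es)) ⟩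
  length (crossing S es) + ((i ∸ h) + (o ∸ h))                ≤⟨ +-mono-≤ r (+-mono-≤ (ℕₚ.m≤n+o⇒m∸n≤o i h p) (ℕₚ.m≤n+o⇒m∸n≤o o h o≤)) ⟩
  s + (b + (b + 1))                                           ≡⟨ cong (s +_) (lem b) ⟩
  s + (2 * b + 1)                                             ∎
  where
  open ℕₚ.≤-Reasoning
  h = ℕ.⌊ m /2⌋
  i = length (inside S es)
  o = length (outside S es)
  lem : ∀ b → b + (b + 1) ≡ 2 * b + 1
  lem = solve-∀
  o≤ : o ≤ h + (b + 1)
  o≤ = ℕₚ.+-cancelˡ-≤ i _ _ (begin
    i + o                             ≤⟨ +-monoʳ-≤ i (m≤m+n o (length (crossing S es))) ⟩
    i + (o + length (crossing S es))  ≡⟨ trans (classify-length S es) len ⟩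
    m                                 ≤⟨ m≤1+⌊m/2⌋+⌊m/2⌋ m ⟩
    suc (h + h)                       ≤⟨ s≤s (+-monoˡ-≤ h q) ⟩
    suc (i + b + h)                   ≡⟨ lem₂ i b h ⟩
    i + (h + (b + 1))                 ∎)
    where
    lem₂ : ∀ i b h → suc (i + b + h) ≡ i + (h + (b + 1))
    lem₂ = solve-∀

kept-balanced : ∀ S {es : List (PaddedHyperedge m n)} → All Contains es → ∀ K → K ↭ kept S es → value (isBalancedᵗ K) ≡ true
kept-balanced {m} S {es} contains K perm = isBalanced⁺ (colour S) perm
  (Allₚ.take⁺ h (inside-colour S contains)) (Allₚ.take⁺ h (outside-colour S contains))
  (≤-trans (≤-reflexive (Listₚ.length-take h (inside S es))) (ℕₚ.m⊓n≤m h _))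
  (≤-trans (≤-reflexive (Listₚ.length-take h (outside S es))) (ℕₚ.m⊓n≤m h _))
  where
  h = ℕ.⌊ m /2⌋

padded-contains : ∀ r (Ψ : CSP m d n) → All Contains (padded r Ψ)
padded-contains r Ψ = Allₚ.map⁺ (All.tabulate λ _ → pad-∈⁺ r)

padded-hyperedges : ∀ r (Ψ : CSP m d n) → map proj₁ (padded r Ψ) ≡ hypergraph Ψ
padded-hyperedges {m} r Ψ = sym (Listₚ.map-∘ (allFin m))

padded-length : ∀ r (Ψ : CSP m d n) → length (padded r Ψ) ≡ m
padded-length {m} r Ψ = trans (Listₚ.length-map _ (allFin m)) (length-allFin m)

-- Running time of the random search

-- Padding indices are unary numbers, so comparing vertices takes time that depends on their size.
IndexBelow : ℕ → PaddedVertex m n → Set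
IndexBelow r (inj₁ _)       = ⊤
IndexBelow r (inj₂ (_ , i)) = i < r

time-eqVertex : ∀ {r} (u v : PaddedVertex m n) → IndexBelow r u → time (eqVertexᵗ u v) ≤ suc (n + (m + r))
time-eqVertex (inj₁ u) (inj₁ v) _ = s≤s (≤-trans (time-eqFin u v) (m≤m+n _ _))
time-eqVertex (inj₁ u) (inj₂ _) _ = s≤s z≤n
time-eqVertex (inj₂ _) (inj₁ v) _ = s≤s z≤n
time-eqVertex {m} {n} (inj₂ (x , i)) (inj₂ (y , j)) i<r with value (eqFinᵗ x y)
... | true  = s≤s (≤-trans (+-mono-≤ (time-eqFin x y) (≤-trans (time-eqℕ i j) i<r)) (m≤n+m _ n))
... | false = s≤s (≤-trans (+-mono-≤ (time-eqFin x y) z≤n) (m≤n+m _ n))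

time-pad : ∀ r (x : Fin m) (e : List (Fin n)) → time (padᵗ r x e) ≤ suc (r + length e)
time-pad zero    x []      = ≤-refl
time-pad zero    x (v ∷ e) = s≤s (≤-trans (≤-reflexive (ℕₚ.+-identityʳ _)) (time-pad zero x e))
time-pad (suc r) x []      = s≤s (≤-trans (≤-reflexive (ℕₚ.+-identityʳ _)) (time-pad r x []))
time-pad (suc r) x (v ∷ e) = s≤s (≤-trans (≤-reflexive (ℕₚ.+-identityʳ _)) (≤-trans (time-pad r x e)
  (s≤s (+-monoʳ-≤ r (n≤1+n (length e))))))

time-nub : ∀ {eq : A → A → Timed Bool} {b} xs → (∀ {x} → x ∈ xs → ∀ ys → length ys ≤ length xs → time (elemᵗ eq x ys) ≤ b) →
  time (nubᵗ eq xs) ≤ suc (length xs * suc b)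
time-nub [] h = ≤-refl
time-nub {eq = eq} {b} (x ∷ xs) h = s≤s (≤-trans
  (+-mono-≤ (time-nub xs (λ x∈ ys len → h (there x∈) ys (ℕₚ.m≤n⇒m≤1+n len)))
    (≤-trans (≤-reflexive (ℕₚ.+-identityʳ _)) (h (here refl) (value (nubᵗ eq xs)) (ℕₚ.m≤n⇒m≤1+n (nub-length eq xs)))))
  (≤-reflexive (cong suc (ℕₚ.+-comm (length xs * suc b) b))))

time-classify : ∀ {b} S (es : List (PaddedHyperedge m n)) →
  All (λ (_ , us) → time (allᵗ (λ u → elemᵗ eqVertexᵗ u S) us) + (time (anyᵗ (λ u → elemᵗ eqVertexᵗ u S) us) + 0) ≤ b) es →
  time (classifyᵗ S es) ≤ suc (length es * suc b)
time-classify S [] _ = ≤-refl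
time-classify {b = b} S (e ∷ es) (p ∷ ps) = s≤s (≤-trans (+-mono-≤ (time-classify S es ps) p)
  (≤-reflexive (cong suc (ℕₚ.+-comm (length es * suc b) b))))

GoodPadding : ℕ → PaddedHyperedge m n → Set
GoodPadding r (_ , us) = length us ≡ r × All (IndexBelow r) us

padded-good : ∀ {r} (Ψ : CSP m d n) → variableFrequency Ψ ≤ r → All (GoodPadding r) (padded r Ψ)
padded-good {r = r} Ψ freq = Allₚ.map⁺ (All.tabulate λ {x} _ →
  length-pad r x (edge Ψ x) (≤-trans (≤-reflexive (length-edge Ψ x)) (occurrences≤ Ψ freq x)) , All.tabulate (below x))
  where
  below : ∀ x {u} → u ∈ pad r x (edge Ψ x) → IndexBelow r u
  below x u∈ with pad-∈⁻ r {e = edge Ψ x} u∈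
  ... | inj₁ (_ , refl , _)   = tt
  ... | inj₂ (_ , refl , i<r) = i<r

module _ {Z m n r : ℕ} (8≤Z : 8 ≤ Z) (m≤Z : m ≤ Z) (n≤Z : n ≤ Z) (r≤Z : r ≤ Z) where

  elem-within : ∀ {u : PaddedVertex m n} S → IndexBelow r u → length S ≤ Z → Within Z 1 8 (time (elemᵗ eqVertexᵗ u S))
  elem-within {u} S good len = step 8≤Z (any-within 8≤Z (eqVertexᵗ u) S len λ {v} _ →
    mono 8≤Z (time-eqVertex u v good) (step 8≤Z (plus 8≤Z (base 8≤Z n≤Z) (plus 8≤Z (base 8≤Z m≤Z) (base 8≤Z r≤Z)))))

  padAll-within : ∀ (Ψ : CSP m d n) → Within Z 1 10 (time (padAllᵗ r (value (hypergraphᵗ Ψ))))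
  padAll-within Ψ = relax 8≤Z (step 8≤Z (map-within 8≤Z _ (value (hypergraphᵗ Ψ)) (≤-trans (≤-reflexive H-length) m≤Z) λ {e} e∈ →
    plus 8≤Z {j = 0} (mono 8≤Z (time-pad r (proj₁ e) (proj₂ e)) (step 8≤Z (plus 8≤Z (base 8≤Z r≤Z) (base 8≤Z (All.lookup H-small e∈))))) (free 8≤Z)))
    where
    H-small : All (Small 8≤Z m≤Z n≤Z) (value (hypergraphᵗ Ψ))
    H-small = subst (All (Small 8≤Z m≤Z n≤Z)) (sym (hypergraph-value Ψ)) (hypergraph-small 8≤Z m≤Z n≤Z Ψ)
    H-length : length (value (hypergraphᵗ Ψ)) ≡ m
    H-length = trans (cong length (hypergraph-value Ψ)) (hypergraph-length 8≤Z m≤Z n≤Z Ψ)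

  module _ (es : List (PaddedHyperedge m n)) (len : length es ≡ m) (good : All (GoodPadding r) es) (mr≤Z : m * r ≤ Z) where

    private
      es≤Z : length es ≤ Z
      es≤Z = ≤-trans (≤-reflexive len) m≤Z

      all-good : All (IndexBelow r) (concat (map proj₂ es))
      all-good = Allₚ.concat⁺ (Allₚ.map⁺ (All.map proj₂ good))

      total : ∀ (fs : List (PaddedHyperedge m n)) → All (GoodPadding r) fs → length (concat (map proj₂ fs)) ≡ length fs * r
      total []       _            = refl
      total (f ∷ fs) ((eq , _) ∷ gs) = trans (Listₚ.length-++ (proj₂ f)) (cong₂ _+_ eq (total fs gs))

    vertices-within : Within Z 1 14 (time (verticesᵗ es))
    vertices-within = relax 8≤Z (step 8≤Z (plus 8≤Z (map-within 8≤Z _ es es≤Z λ _ → free 8≤Z {D = 1})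
      (plus 8≤Z (subst (λ uss → Within Z 1 7 (time (concatᵗ uss))) (sym uss≡)
                  (mono 8≤Z (time-concat {b = r} (map proj₂ es) (Allₚ.map⁺ (All.map (≤-reflexive ∘ proj₁) good)))
                    (loop 8≤Z (≤-trans (≤-reflexive (Listₚ.length-map proj₂ es)) es≤Z) (relax 8≤Z {j = 4} (step 8≤Z (base 8≤Z r≤Z))))))
        (subst (λ us → Within Z 1 11 (time (nubᵗ eqVertexᵗ us))) (sym us≡)
          (mono 8≤Z (time-nub (concat (map proj₂ es)) λ u∈ ys ys≤ → bound (elem-within ys (All.lookup all-good u∈) (≤-trans ys≤ us≤Z)))
            (loop 8≤Z us≤Z (within {D = 1} {8} ≤-refl)))))))
      where
      uss≡ : value (mapᵗ (λ { (_ , us) → return us }) es) ≡ map proj₂ es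
      uss≡ = map-value _ es
      us≡ : value (concatᵗ (value (mapᵗ (λ { (_ , us) → return us }) es))) ≡ concat (map proj₂ es)
      us≡ = trans (concat-value (value (mapᵗ (λ { (_ , us) → return us }) es))) (cong concat uss≡)
      us≤Z : length (concat (map proj₂ es)) ≤ Z
      us≤Z = ≤-trans (≤-reflexive (trans (total es good) (cong (_* r) len))) mr≤Z

    separation-within : ∀ s b S → length S ≤ Z → Within Z 1 32 (time (separationᵗ s b es S))
    separation-within s b S S≤Z = relax 8≤Z (step 8≤Z
      (plus 8≤Z {i = 16} (mono 8≤Z (time-classify S es (All.map (λ {e} (eq , below) → bound (plus 8≤Z
                  (all-within 8≤Z (λ u → elemᵗ eqVertexᵗ u S) (proj₂ e) (≤-trans (≤-reflexive eq) r≤Z) λ u∈ → elem-within S (All.lookup below u∈) S≤Z)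
                  (plus 8≤Z (any-within 8≤Z (λ u → elemᵗ eqVertexᵗ u S) (proj₂ e) (≤-trans (≤-reflexive eq) r≤Z) λ u∈ → elem-within S (All.lookup below u∈) S≤Z) (free 8≤Z)))) good))
                (loop 8≤Z es≤Z (within {D = 1} {13} ≤-refl)))
      (plus 8≤Z (mono 8≤Z (time-half m) (step 8≤Z (base 8≤Z m≤Z)))
      (plus 8≤Z (mono 8≤Z (time-length (inside S es)) (step 8≤Z (base 8≤Z i≤Z)))
      (plus 8≤Z (mono 8≤Z (time-length (crossing S es)) (step 8≤Z (base 8≤Z c≤Z)))
      (plus 8≤Z (mono 8≤Z (time-add (value (halfᵗ m)) b) (step 8≤Z (base 8≤Z h≤Z)))
      (plus 8≤Z (mono 8≤Z (time-add (value (lengthᵗ (inside S es))) b) (step 8≤Z (base 8≤Z i≤Z′)))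
      (plus 8≤Z (mono 8≤Z (time-leq (value (lengthᵗ (inside S es))) _) (step 8≤Z (base 8≤Z i≤Z′)))
      (plus 8≤Z (mono 8≤Z (time-leq (value (halfᵗ m)) _) (step 8≤Z (base 8≤Z h≤Z)))
      (plus 8≤Z (mono 8≤Z (time-leq (value (lengthᵗ (crossing S es))) s) (step 8≤Z (base 8≤Z c≤Z′)))
      (plus 8≤Z (mono 8≤Z (time-splitAt (value (halfᵗ m)) (inside S es)) (step 8≤Z (base 8≤Z h≤Z)))
      (plus 8≤Z (mono 8≤Z (time-splitAt (value (halfᵗ m)) (outside S es)) (step 8≤Z (base 8≤Z h≤Z)))
      (plus 8≤Z (mono 8≤Z (time-append D₁ D₂) (step 8≤Z (base 8≤Z (drop≤ (inside S es) i≤Z))))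
      (plus 8≤Z (mono 8≤Z (time-append (crossing S es) (value (appendᵗ D₁ D₂))) (step 8≤Z (base 8≤Z c≤Z)))
      (plus 8≤Z {j = 0} (mono 8≤Z (time-append T₁ T₂) (step 8≤Z (base 8≤Z (take≤ (inside S es) i≤Z)))) (free 8≤Z))))))))))))))))
      where
      D₁ D₂ T₁ T₂ : List (Hyperedge m n)
      D₁ = proj₂ (value (splitAtᵗ (value (halfᵗ m)) (inside S es)))
      D₂ = proj₂ (value (splitAtᵗ (value (halfᵗ m)) (outside S es)))
      T₁ = proj₁ (value (splitAtᵗ (value (halfᵗ m)) (inside S es)))
      T₂ = proj₁ (value (splitAtᵗ (value (halfᵗ m)) (outside S es)))
      i≤Z : length (inside S es) ≤ Z
      i≤Z = ≤-trans (m≤m+n _ _) (≤-trans (≤-reflexive (classify-length S es)) es≤Z)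
      c≤Z : length (crossing S es) ≤ Z
      c≤Z = ≤-trans (≤-trans (m≤n+m _ (length (outside S es))) (m≤n+m _ (length (inside S es)))) (≤-trans (≤-reflexive (classify-length S es)) es≤Z)
      i≤Z′ : value (lengthᵗ (inside S es)) ≤ Z
      i≤Z′ = subst (_≤ Z) (sym (length-value (inside S es))) i≤Z
      c≤Z′ : value (lengthᵗ (crossing S es)) ≤ Z
      c≤Z′ = subst (_≤ Z) (sym (length-value (crossing S es))) c≤Z
      h≤Z : value (halfᵗ m) ≤ Z
      h≤Z = subst (_≤ Z) (sym (half-value m)) (≤-trans (ℕₚ.⌊n/2⌋≤n m) m≤Z)
      drop≤ : ∀ (xs : List (Hyperedge m n)) → length xs ≤ Z → length (proj₂ (value (splitAtᵗ (value (halfᵗ m)) xs))) ≤ Z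
      drop≤ xs p rewrite splitAt-value (value (halfᵗ m)) xs = ≤-trans (≤-reflexive (Listₚ.length-drop (value (halfᵗ m)) xs)) (≤-trans (ℕₚ.m∸n≤m (length xs) (value (halfᵗ m))) p)
      take≤ : ∀ (xs : List (Hyperedge m n)) → length xs ≤ Z → length (proj₁ (value (splitAtᵗ (value (halfᵗ m)) xs))) ≤ Z
      take≤ xs p rewrite splitAt-value (value (halfᵗ m)) xs = ≤-trans (≤-reflexive (Listₚ.length-take (value (halfᵗ m)) xs)) (≤-trans (ℕₚ.m⊓n≤n (value (halfᵗ m)) (length xs)) p)

-- Rational numbers

ι : ℕ → ℚ
ι n = ℤ.+ n ℚ./ 1

toℚᵘ-ι : ∀ n → ℚ.toℚᵘ (ι n) ℚᵘ.≃ ℚᵘ.mkℚᵘ (ℤ.+ n) 0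
toℚᵘ-ι n = ℚₚ.toℚᵘ-fromℚᵘ (ℚᵘ.mkℚᵘ (ℤ.+ n) 0)

ι-+ : ∀ i j → ι (i + j) ≡ ι i ℚ.+ ι j
ι-+ i j = ℚₚ.toℚᵘ-injective (begin
  ℚ.toℚᵘ (ι (i + j))                     ≈⟨ toℚᵘ-ι (i + j) ⟩
  ℚᵘ.mkℚᵘ (ℤ.+ (i + j)) 0                ≈⟨ ℚᵘ.*≡* (cong (ℤ._* ℤ.+ 1) (cong₂ ℤ._+_ (sym (ℤₚ.*-identityʳ (ℤ.+ i))) (sym (ℤₚ.*-identityʳ (ℤ.+ j))))) ⟩
  ℚᵘ.mkℚᵘ (ℤ.+ i) 0 ℚᵘ.+ ℚᵘ.mkℚᵘ (ℤ.+ j) 0 ≈⟨ ℚᵘₚ.+-cong (ℚᵘₚ.≃-sym (toℚᵘ-ι i)) (ℚᵘₚ.≃-sym (toℚᵘ-ι j)) ⟩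
  ℚ.toℚᵘ (ι i) ℚᵘ.+ ℚ.toℚᵘ (ι j)         ≈⟨ ℚᵘₚ.≃-sym (ℚₚ.toℚᵘ-homo-+ (ι i) (ι j)) ⟩
  ℚ.toℚᵘ (ι i ℚ.+ ι j)                   ∎)
  where open SetoidReasoning ℚᵘₚ.≃-setoid

ι-* : ∀ i j → ι (i * j) ≡ ι i ℚ.* ι j
ι-* i j = ℚₚ.toℚᵘ-injective (begin
  ℚ.toℚᵘ (ι (i * j))                     ≈⟨ toℚᵘ-ι (i * j) ⟩
  ℚᵘ.mkℚᵘ (ℤ.+ (i * j)) 0                ≈⟨ ℚᵘ.*≡* (cong (ℤ._* ℤ.+ 1) (ℤₚ.pos-* i j)) ⟩
  ℚᵘ.mkℚᵘ (ℤ.+ i) 0 ℚᵘ.* ℚᵘ.mkℚᵘ (ℤ.+ j) 0 ≈⟨ ℚᵘₚ.*-cong (ℚᵘₚ.≃-sym (toℚᵘ-ι i)) (ℚᵘₚ.≃-sym (toℚᵘ-ι j)) ⟩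
  ℚ.toℚᵘ (ι i) ℚᵘ.* ℚ.toℚᵘ (ι j)         ≈⟨ ℚᵘₚ.≃-sym (ℚₚ.toℚᵘ-homo-* (ι i) (ι j)) ⟩
  ℚ.toℚᵘ (ι i ℚ.* ι j)                   ∎)
  where open SetoidReasoning ℚᵘₚ.≃-setoid

ι-mono : ∀ {i j} → i ≤ j → ι i ℚ.≤ ι j
ι-mono {i} {j} i≤j = ℚₚ.toℚᵘ-cancel-≤ (ℚᵘₚ.≤-respˡ-≃ (ℚᵘₚ.≃-sym (toℚᵘ-ι i)) (ℚᵘₚ.≤-respʳ-≃ (ℚᵘₚ.≃-sym (toℚᵘ-ι j))
  (ℚᵘ.*≤* (ℤₚ.*-monoʳ-≤-nonNeg (ℤ.+ 1) (ℤ.+≤+ i≤j)))))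

ι-cancel : ∀ {i j} → ι i ℚ.≤ ι j → i ≤ j
ι-cancel {i} {j} ιi≤ιj with ℚᵘₚ.≤-respˡ-≃ (toℚᵘ-ι i) (ℚᵘₚ.≤-respʳ-≃ (toℚᵘ-ι j) (ℚₚ.toℚᵘ-mono-≤ ιi≤ιj))
... | ℚᵘ.*≤* p = ℤₚ.drop‿+≤+ (subst₂ ℤ._≤_ (ℤₚ.*-identityʳ (ℤ.+ i)) (ℤₚ.*-identityʳ (ℤ.+ j)) p)

0≤ι : ∀ n → 0ℚ ℚ.≤ ι n
0≤ι n = ι-mono {0} {n} z≤n

ι-suc : ∀ n → ι (suc n) ≡ 1ℚ ℚ.+ ι n
ι-suc n = ι-+ 1 n

*-monoˡ : ∀ {c x y} → 0ℚ ℚ.≤ c → x ℚ.≤ y → c ℚ.* x ℚ.≤ c ℚ.* y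
*-monoˡ {c} 0≤c = ℚₚ.*-monoˡ-≤-nonNeg c {{ℚ.nonNegative 0≤c}}

*-monoʳ : ∀ {c x y} → 0ℚ ℚ.≤ c → x ℚ.≤ y → x ℚ.* c ℚ.≤ y ℚ.* c
*-monoʳ {c} 0≤c = ℚₚ.*-monoʳ-≤-nonNeg c {{ℚ.nonNegative 0≤c}}

*-nonneg : ∀ {x y} → 0ℚ ℚ.≤ x → 0ℚ ℚ.≤ y → 0ℚ ℚ.≤ x ℚ.* y
*-nonneg {x} {y} 0≤x 0≤y = subst (ℚ._≤ x ℚ.* y) (ℚₚ.*-zeroʳ x) (*-monoˡ 0≤x 0≤y)

+-nonneg : ∀ {x y} → 0ℚ ℚ.≤ x → 0ℚ ℚ.≤ y → 0ℚ ℚ.≤ x ℚ.+ y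
+-nonneg 0≤x 0≤y = ℚₚ.+-mono-≤ 0≤x 0≤y

≤⇒0≤- : ∀ {x y} → x ℚ.≤ y → 0ℚ ℚ.≤ y ℚ.- x
≤⇒0≤- {x} {y} x≤y = subst (ℚ._≤ y ℚ.- x) (ℚₚ.+-inverseʳ x) (ℚₚ.+-monoˡ-≤ (ℚ.- x) x≤y)

0≤-⇒≤ : ∀ {x y} → 0ℚ ℚ.≤ y ℚ.- x → x ℚ.≤ y
0≤-⇒≤ {x} {y} 0≤ = subst₂ ℚ._≤_ (ℚₚ.+-identityˡ x) (lem x y) (ℚₚ.+-monoˡ-≤ x 0≤)
  where
  lem : ∀ x y → y ℚ.- x ℚ.+ x ≡ y
  lem = solve 2 (λ x y → y :- x :+ x := y) refl

square-nonneg : ∀ x → 0ℚ ℚ.≤ x ℚ.* x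
square-nonneg x with ℚₚ.≤-total 0ℚ x
... | inj₁ 0≤x = *-nonneg 0≤x 0≤x
... | inj₂ x≤0 = subst (0ℚ ℚ.≤_) (lem x) (*-nonneg (≤⇒0≤- x≤0) (≤⇒0≤- x≤0))
  where
  lem : ∀ x → (0ℚ ℚ.- x) ℚ.* (0ℚ ℚ.- x) ≡ x ℚ.* x
  lem = solve 1 (λ x → (con 0ℚ :- x) :* (con 0ℚ :- x) := x :* x) refl

square-≤ : ∀ {x c} → x ℚ.≤ c → ℚ.- x ℚ.≤ c → x ℚ.* x ℚ.≤ c ℚ.* c
square-≤ {x} {c} x≤c -x≤c = 0≤-⇒≤ (subst (0ℚ ℚ.≤_) (lem x c) (*-nonneg (≤⇒0≤- x≤c) (≤⇒0≤- -x≤c)))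
  where
  lem : ∀ x c → (c ℚ.- x) ℚ.* (c ℚ.- ℚ.- x) ≡ c ℚ.* c ℚ.- x ℚ.* x
  lem = solve 2 (λ x c → (c :- x) :* (c :- :- x) := c :* c :- x :* x) refl

square-cancel-< : ∀ {x c} → 0ℚ ℚ.≤ c → x ℚ.* x ℚ.< c ℚ.* c → x ℚ.< c
square-cancel-< {x} {c} 0≤c xx<cc = ℚₚ.≰⇒> λ c≤x → ℚₚ.<-irrefl refl
  (ℚₚ.<-≤-trans xx<cc (ℚₚ.≤-trans (*-monoˡ 0≤c c≤x) (*-monoʳ (ℚₚ.≤-trans 0≤c c≤x) c≤x)))

-- Expectation over random subsets and the Efron-Stein inequality

infixr 8 _↑_
_↑_ : ℚ → ℕ → ℚ
x ↑ zero  = 1ℚ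
x ↑ suc n = x ℚ.* x ↑ n

-- The expectation of F over a random sublist in which each entry is kept with probability p. The
-- coin of the head is averaged innermost, matching `randomSubset`, which samples the tail first.
𝔼 : ℚ → List V → (List V → ℚ) → ℚ
𝔼 p []       F = F []
𝔼 p (v ∷ vs) F = 𝔼 p vs (λ S → p ℚ.* F (v ∷ S) ℚ.+ (1ℚ ℚ.- p) ℚ.* F S)

-- What is known of each outcome: membership yields the independence of the coins, and the length
-- bounds the time of an attempt.
Sample : List V → List V → Set
Sample vs S = All (_∈ vs) S × length S ≤ length vs

-- Squares spare absolute values and are what the variance calls for. The insertion is allowed at
-- any place because averaging out the coin of a vertex puts that vertex in front.
Lipschitz : ℚ → (List V → ℚ) → Set
Lipschitz κ F = ∀ u xs ys → (F (xs ++ u ∷ ys) ℚ.- F (xs ++ ys)) ℚ.* (F (xs ++ u ∷ ys) ℚ.- F (xs ++ ys)) ℚ.≤ κ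

module _ {p : ℚ} (0≤p : 0ℚ ℚ.≤ p) (p≤1 : p ℚ.≤ 1ℚ) where

  private
    q : ℚ
    q = 1ℚ ℚ.- p
    0≤q : 0ℚ ℚ.≤ q
    0≤q = ≤⇒0≤- p≤1

  convex : ∀ x → p ℚ.* x ℚ.+ q ℚ.* x ≡ x
  convex = solve 2 (λ p x → p :* x :+ (con 1ℚ :- p) :* x := x) refl p

  convex-mono : ∀ {x x′ y y′} → x ℚ.≤ x′ → y ℚ.≤ y′ → p ℚ.* x ℚ.+ q ℚ.* y ℚ.≤ p ℚ.* x′ ℚ.+ q ℚ.* y′
  convex-mono x≤ y≤ = ℚₚ.+-mono-≤ (*-monoˡ 0≤p x≤) (*-monoˡ 0≤q y≤)

  𝔼-mono : ∀ (vs : List V) {F G} → (∀ S → Sample vs S → F S ℚ.≤ G S) → 𝔼 p vs F ℚ.≤ 𝔼 p vs G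
  𝔼-mono []       F≤G = F≤G [] ([] , z≤n)
  𝔼-mono (v ∷ vs) F≤G = 𝔼-mono vs λ S (S⊆vs , len) → convex-mono
    (F≤G (v ∷ S) (here refl ∷ All.map there S⊆vs , s≤s len)) (F≤G S (All.map there S⊆vs , ℕₚ.m≤n⇒m≤1+n len))

  𝔼-cong : ∀ (vs : List V) {F G} → (∀ S → Sample vs S → F S ≡ G S) → 𝔼 p vs F ≡ 𝔼 p vs G
  𝔼-cong vs F≡G = ℚₚ.≤-antisym (𝔼-mono vs λ S s → ℚₚ.≤-reflexive (F≡G S s)) (𝔼-mono vs λ S s → ℚₚ.≤-reflexive (sym (F≡G S s)))

  𝔼-const : ∀ (vs : List V) c → 𝔼 p vs (λ _ → c) ≡ c
  𝔼-const []       c = refl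
  𝔼-const (v ∷ vs) c = trans (𝔼-cong vs λ _ _ → convex c) (𝔼-const vs c)

  𝔼-+ : ∀ (vs : List V) F G → 𝔼 p vs (λ S → F S ℚ.+ G S) ≡ 𝔼 p vs F ℚ.+ 𝔼 p vs G
  𝔼-+ []       F G = refl
  𝔼-+ (v ∷ vs) F G = trans (𝔼-cong vs λ S _ → lem p (F (v ∷ S)) (G (v ∷ S)) (F S) (G S)) (𝔼-+ vs _ _)
    where
    lem : ∀ p a b c d → p ℚ.* (a ℚ.+ b) ℚ.+ (1ℚ ℚ.- p) ℚ.* (c ℚ.+ d) ≡ (p ℚ.* a ℚ.+ (1ℚ ℚ.- p) ℚ.* c) ℚ.+ (p ℚ.* b ℚ.+ (1ℚ ℚ.- p) ℚ.* d)
    lem = solve 5 (λ p a b c d → p :* (a :+ b) :+ (con 1ℚ :- p) :* (c :+ d) := (p :* a :+ (con 1ℚ :- p) :* c) :+ (p :* b :+ (con 1ℚ :- p) :* d)) refl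

  𝔼-* : ∀ (vs : List V) c F → 𝔼 p vs (λ S → c ℚ.* F S) ≡ c ℚ.* 𝔼 p vs F
  𝔼-* []       c F = refl
  𝔼-* (v ∷ vs) c F = trans (𝔼-cong vs λ S _ → lem p c (F (v ∷ S)) (F S)) (𝔼-* vs c _)
    where
    lem : ∀ p c a b → p ℚ.* (c ℚ.* a) ℚ.+ (1ℚ ℚ.- p) ℚ.* (c ℚ.* b) ≡ c ℚ.* (p ℚ.* a ℚ.+ (1ℚ ℚ.- p) ℚ.* b)
    lem = solve 4 (λ p c a b → p :* (c :* a) :+ (con 1ℚ :- p) :* (c :* b) := c :* (p :* a :+ (con 1ℚ :- p) :* b)) refl

  -- The probabilistic method: this supplies the separator that the exhaustive search is sure to
  -- match.
  𝔼-witness : ∀ (vs : List V) F {c} → 𝔼 p vs F ℚ.< c → ∃ λ S → F S ℚ.< c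
  𝔼-witness []       F {c} lt = [] , lt
  𝔼-witness (v ∷ vs) F {c} lt with S , Ḡ<c ← 𝔼-witness vs _ lt | F (v ∷ S) ℚₚ.<? c
  ... | yes F<c = v ∷ S , F<c
  ... | no  F≮c = S , ℚₚ.≰⇒> λ c≤F → ℚₚ.<-irrefl refl (ℚₚ.<-≤-trans Ḡ<c
    (subst (ℚ._≤ p ℚ.* F (v ∷ S) ℚ.+ q ℚ.* F S) (convex c) (convex-mono (ℚₚ.≮⇒≥ F≮c) c≤F)))

  variance-split : ∀ x y → p ℚ.* (x ℚ.* x) ℚ.+ q ℚ.* (y ℚ.* y) ≡
    (p ℚ.* x ℚ.+ q ℚ.* y) ℚ.* (p ℚ.* x ℚ.+ q ℚ.* y) ℚ.+ p ℚ.* q ℚ.* ((x ℚ.- y) ℚ.* (x ℚ.- y))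
  variance-split = solve 3 (λ p x y → p :* (x :* x) :+ (con 1ℚ :- p) :* (y :* y) :=
    (p :* x :+ (con 1ℚ :- p) :* y) :* (p :* x :+ (con 1ℚ :- p) :* y) :+ p :* (con 1ℚ :- p) :* ((x :- y) :* (x :- y))) refl p

  pq≤1 : p ℚ.* q ℚ.≤ 1ℚ
  pq≤1 = ℚₚ.≤-trans (*-monoʳ 0≤q p≤1) (subst (ℚ._≤ 1ℚ) (sym (ℚₚ.*-identityˡ q)) (0≤-⇒≤ (subst (0ℚ ℚ.≤_) (lem p) 0≤p)))
    where
    lem : ∀ p → p ≡ 1ℚ ℚ.- (1ℚ ℚ.- p)
    lem = solve 1 (λ p → p := con 1ℚ :- (con 1ℚ :- p)) refl

  -- Serves to show that averaging out one coin preserves the Lipschitz bound. The square of the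
  -- mean is the mean of the squares minus the nonnegative variance.
  jensen : ∀ x y {κ} → x ℚ.* x ℚ.≤ κ → y ℚ.* y ℚ.≤ κ → (p ℚ.* x ℚ.+ q ℚ.* y) ℚ.* (p ℚ.* x ℚ.+ q ℚ.* y) ℚ.≤ κ
  jensen x y {κ} xx≤ yy≤ = ℚₚ.≤-trans (ℚₚ.≤-trans
    (subst (ℚ._≤ sq ℚ.+ p ℚ.* q ℚ.* ((x ℚ.- y) ℚ.* (x ℚ.- y))) (ℚₚ.+-identityʳ sq)
      (ℚₚ.+-monoʳ-≤ sq (*-nonneg (*-nonneg 0≤p 0≤q) (square-nonneg (x ℚ.- y)))))
    (ℚₚ.≤-reflexive (sym (variance-split x y))))
    (subst (p ℚ.* (x ℚ.* x) ℚ.+ q ℚ.* (y ℚ.* y) ℚ.≤_) (convex κ) (convex-mono xx≤ yy≤))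
    where
    sq = (p ℚ.* x ℚ.+ q ℚ.* y) ℚ.* (p ℚ.* x ℚ.+ q ℚ.* y)

  -- Averaging out the coin of the first vertex leaves a function of the others with the same
  -- Lipschitz bound, by `jensen`, and loses at most p q κ ≤ κ of the second moment, by
  -- `variance-split`. Induction adds up one κ per vertex.
  efron-stein : ∀ (vs : List V) F {κ} → Lipschitz κ F →
    𝔼 p vs (λ S → F S ℚ.* F S) ℚ.≤ 𝔼 p vs F ℚ.* 𝔼 p vs F ℚ.+ ι (length vs) ℚ.* κ
  efron-stein [] F {κ} lip = ℚₚ.≤-reflexive (lem (F []) κ)
    where
    lem : ∀ x κ → x ℚ.* x ≡ x ℚ.* x ℚ.+ 0ℚ ℚ.* κ
    lem = solve 2 (λ x κ → x :* x := x :* x :+ con 0ℚ :* κ) refl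
  efron-stein (v ∷ vs) F {κ} lip = begin
    𝔼 p vs (λ S → p ℚ.* (F (v ∷ S) ℚ.* F (v ∷ S)) ℚ.+ q ℚ.* (F S ℚ.* F S))
      ≤⟨ 𝔼-mono vs (λ S _ → ℚₚ.≤-trans (ℚₚ.≤-reflexive (variance-split (F (v ∷ S)) (F S)))
           (ℚₚ.+-monoʳ-≤ (G S ℚ.* G S) (scaled {F (v ∷ S) ℚ.- F S} (lip v [] S)))) ⟩
    𝔼 p vs (λ S → G S ℚ.* G S ℚ.+ κ)
      ≡⟨ trans (𝔼-+ vs (λ S → G S ℚ.* G S) (λ _ → κ)) (cong (𝔼 p vs (λ S → G S ℚ.* G S) ℚ.+_) (𝔼-const vs κ)) ⟩
    𝔼 p vs (λ S → G S ℚ.* G S) ℚ.+ κ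
      ≤⟨ ℚₚ.+-monoˡ-≤ κ (efron-stein vs G G-lip) ⟩
    μ ℚ.* μ ℚ.+ ι (length vs) ℚ.* κ ℚ.+ κ
      ≡⟨ lem (μ ℚ.* μ) (ι (length vs)) κ ⟩
    μ ℚ.* μ ℚ.+ (1ℚ ℚ.+ ι (length vs)) ℚ.* κ
      ≡⟨ cong (λ l → μ ℚ.* μ ℚ.+ l ℚ.* κ) (ι-suc (length vs)) ⟨
    μ ℚ.* μ ℚ.+ ι (suc (length vs)) ℚ.* κ ∎
    where
    open ℚₚ.≤-Reasoning
    G : List _ → ℚ
    G S = p ℚ.* F (v ∷ S) ℚ.+ q ℚ.* F S
    μ = 𝔼 p vs G
    lem : ∀ a l κ → a ℚ.+ l ℚ.* κ ℚ.+ κ ≡ a ℚ.+ (1ℚ ℚ.+ l) ℚ.* κ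
    lem = solve 3 (λ a l κ → a :+ l :* κ :+ κ := a :+ (con 1ℚ :+ l) :* κ) refl
    scaled : ∀ {x} → x ℚ.* x ℚ.≤ κ → p ℚ.* q ℚ.* (x ℚ.* x) ℚ.≤ κ
    scaled {x} xx≤ = ℚₚ.≤-trans (*-monoʳ (square-nonneg x) pq≤1) (subst (ℚ._≤ κ) (sym (ℚₚ.*-identityˡ (x ℚ.* x))) xx≤)
    diff : ∀ p a b c d → p ℚ.* (a ℚ.- b) ℚ.+ (1ℚ ℚ.- p) ℚ.* (c ℚ.- d) ≡ (p ℚ.* a ℚ.+ (1ℚ ℚ.- p) ℚ.* c) ℚ.- (p ℚ.* b ℚ.+ (1ℚ ℚ.- p) ℚ.* d)
    diff = solve 5 (λ p a b c d → p :* (a :- b) :+ (con 1ℚ :- p) :* (c :- d) := (p :* a :+ (con 1ℚ :- p) :* c) :- (p :* b :+ (con 1ℚ :- p) :* d)) refl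
    G-lip : Lipschitz κ G
    G-lip u xs ys = subst (λ z → z ℚ.* z ℚ.≤ κ) (diff p (F (v ∷ xs ++ u ∷ ys)) (F (v ∷ xs ++ ys)) (F (xs ++ u ∷ ys)) (F (xs ++ ys)))
      (jensen (F (v ∷ xs ++ u ∷ ys) ℚ.- F (v ∷ xs ++ ys)) (F (xs ++ u ∷ ys) ℚ.- F (xs ++ ys)) (lip u (v ∷ xs) ys) (lip u xs ys))

  variance : ∀ (vs : List V) F {κ μ} → Lipschitz κ F → 𝔼 p vs F ≡ μ →
    𝔼 p vs (λ S → (F S ℚ.- μ) ℚ.* (F S ℚ.- μ)) ℚ.≤ ι (length vs) ℚ.* κ
  variance vs F {κ} {μ} lip refl = subst (𝔼 p vs (λ S → (F S ℚ.- μ) ℚ.* (F S ℚ.- μ)) ℚ.≤_)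
    (trans (cong (λ z → z ℚ.* z ℚ.+ ι (length vs) ℚ.* κ) centred) (lem (ι (length vs) ℚ.* κ)))
    (efron-stein vs (λ S → F S ℚ.- μ) λ u xs ys → subst (λ z → z ℚ.* z ℚ.≤ κ) (shift (F (xs ++ u ∷ ys)) (F (xs ++ ys)) μ) (lip u xs ys))
    where
    centred : 𝔼 p vs (λ S → F S ℚ.- μ) ≡ 0ℚ
    centred = trans (𝔼-+ vs F (λ _ → ℚ.- μ)) (trans (cong (μ ℚ.+_) (𝔼-const vs (ℚ.- μ))) (ℚₚ.+-inverseʳ μ))
    lem : ∀ x → 0ℚ ℚ.* 0ℚ ℚ.+ x ≡ x
    lem = solve 1 (λ x → con 0ℚ :* con 0ℚ :+ x := x) refl
    shift : ∀ a b c → a ℚ.- b ≡ (a ℚ.- c) ℚ.- (b ℚ.- c)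
    shift = solve 3 (λ a b c → a :- b := (a :- c) :- (b :- c)) refl

-- Random subsets of the vertices

⟦_⟧ : Bool → ℚ
⟦ b ⟧ = if b then 1ℚ else 0ℚ

bool-≡ : ∀ {b c} → (b ≡ true → c ≡ true) → (c ≡ true → b ≡ true) → b ≡ c
bool-≡ {true}  {true}  _ _ = refl
bool-≡ {true}  {false} f _ = sym (f refl)
bool-≡ {false} {true}  _ g = g refl
bool-≡ {false} {false} _ _ = refl

∈ᵇ-insert : ∀ {u v : PaddedVertex m n} xs {ys} → ¬ u ≡ v → u ∈ᵇ (xs ++ v ∷ ys) ≡ u ∈ᵇ (xs ++ ys)
∈ᵇ-insert {u = u} {v} xs {ys} u≢v = bool-≡
  (λ eq → ∈ᵇ⁺ (keep xs (∈ᵇ⁻ (xs ++ v ∷ ys) eq)))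
  (λ eq → ∈ᵇ⁺ (weaken xs (∈ᵇ⁻ (xs ++ ys) eq)))
  where
  keep : ∀ xs → u ∈ xs ++ v ∷ ys → u ∈ xs ++ ys
  keep []       (here u≡v)  = contradiction u≡v u≢v
  keep []       (there u∈)  = u∈
  keep (x ∷ xs) (here u≡x)  = here u≡x
  keep (x ∷ xs) (there u∈)  = there (keep xs u∈)
  weaken : ∀ xs → u ∈ xs ++ ys → u ∈ xs ++ v ∷ ys
  weaken []       u∈         = there u∈
  weaken (x ∷ xs) (here u≡x) = here u≡x
  weaken (x ∷ xs) (there u∈) = there (weaken xs u∈)

-- One product serves both counts: with φ = `⟦_⟧` it indicates that the hyperedge lies inside S,
-- with φ = `⟦_⟧ ∘ not` that it lies inside the complement.
weight : (Bool → ℚ) → List (PaddedVertex m n) → List (PaddedVertex m n) → ℚ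
weight φ []       S = 1ℚ
weight φ (u ∷ us) S = φ (u ∈ᵇ S) ℚ.* weight φ us S

weight-insert : ∀ φ (us : List (PaddedVertex m n)) {v} xs {ys} → v ∉ us → weight φ us (xs ++ v ∷ ys) ≡ weight φ us (xs ++ ys)
weight-insert φ []       xs v∉ = refl
weight-insert φ (u ∷ us) xs v∉ = cong₂ (λ b w → φ b ℚ.* w) (∈ᵇ-insert xs λ u≡v → v∉ (here (sym u≡v))) (weight-insert φ us xs (v∉ ∘ there))

total : (Bool → ℚ) → List (PaddedHyperedge m n) → List (PaddedVertex m n) → ℚ
total φ []              S = 0ℚ
total φ ((_ , us) ∷ es) S = weight φ us S ℚ.+ total φ es S

module _ {p : ℚ} (0≤p : 0ℚ ℚ.≤ p) (p≤1 : p ℚ.≤ 1ℚ) (φ : Bool → ℚ) where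

  private
    q c : ℚ
    q = 1ℚ ℚ.- p
    c = p ℚ.* φ true ℚ.+ q ℚ.* φ false

  -- Independence in the only form required: the coin of u is independent of a G that inserting u
  -- does not change. As `vs` has no repetitions, u has a single coin.
  𝔼-independent : ∀ {vs : List (PaddedVertex m n)} {u} → Unique.Unique vs → u ∈ vs → ∀ G →
    (∀ xs ys → G (xs ++ u ∷ ys) ≡ G (xs ++ ys)) → 𝔼 p vs (λ S → φ (u ∈ᵇ S) ℚ.* G S) ≡ c ℚ.* 𝔼 p vs G
  𝔼-independent {vs = v ∷ vs} (v∉ ∷ unique) (here refl) G indep = begin
    𝔼 p vs (λ S → p ℚ.* (φ (v ∈ᵇ (v ∷ S)) ℚ.* G (v ∷ S)) ℚ.+ q ℚ.* (φ (v ∈ᵇ S) ℚ.* G S))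
      ≡⟨ 𝔼-cong 0≤p p≤1 vs (λ S (S⊆ , _) → trans (cong₂ (λ a b → p ℚ.* a ℚ.+ q ℚ.* b)
           (cong₂ (λ b g → φ b ℚ.* g) (∈ᵇ⁺ {u = v} {v ∷ S} (here refl)) (indep [] S))
           (cong (λ b → φ b ℚ.* G S) (∉ᵇ⁺ {u = v} {S} λ v∈S → All.lookup v∉ (All.lookup S⊆ v∈S) refl)))
           (lem p (φ true) (φ false) (G S))) ⟩
    𝔼 p vs (λ S → c ℚ.* G S)
      ≡⟨ 𝔼-* 0≤p p≤1 vs c G ⟩
    c ℚ.* 𝔼 p vs G
      ≡⟨ cong (c ℚ.*_) (𝔼-cong 0≤p p≤1 vs λ S _ → trans (sym (convex 0≤p p≤1 (G S))) (cong (λ g → p ℚ.* g ℚ.+ q ℚ.* G S) (sym (indep [] S)))) ⟩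
    c ℚ.* 𝔼 p vs (λ S → p ℚ.* G (v ∷ S) ℚ.+ q ℚ.* G S) ∎
    where
    open ≡-Reasoning
    lem : ∀ p a b g → p ℚ.* (a ℚ.* g) ℚ.+ (1ℚ ℚ.- p) ℚ.* (b ℚ.* g) ≡ (p ℚ.* a ℚ.+ (1ℚ ℚ.- p) ℚ.* b) ℚ.* g
    lem = solve 4 (λ p a b g → p :* (a :* g) :+ (con 1ℚ :- p) :* (b :* g) := (p :* a :+ (con 1ℚ :- p) :* b) :* g) refl
  𝔼-independent {vs = v ∷ vs} {u} (v∉ ∷ unique) (there u∈vs) G indep = trans
    (𝔼-cong 0≤p p≤1 vs λ S _ → trans
      (cong (λ b → p ℚ.* (φ b ℚ.* G (v ∷ S)) ℚ.+ q ℚ.* (φ (u ∈ᵇ S) ℚ.* G S)) (∈ᵇ-insert [] λ u≡v → All.lookup v∉ u∈vs (sym u≡v)))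
      (lem p (φ (u ∈ᵇ S)) (G (v ∷ S)) (G S)))
    (𝔼-independent unique u∈vs (λ S → p ℚ.* G (v ∷ S) ℚ.+ q ℚ.* G S)
      λ xs ys → cong₂ (λ a b → p ℚ.* a ℚ.+ q ℚ.* b) (indep (v ∷ xs) ys) (indep xs ys))
    where
    lem : ∀ p a g h → p ℚ.* (a ℚ.* g) ℚ.+ (1ℚ ℚ.- p) ℚ.* (a ℚ.* h) ≡ a ℚ.* (p ℚ.* g ℚ.+ (1ℚ ℚ.- p) ℚ.* h)
    lem = solve 4 (λ p a g h → p :* (a :* g) :+ (con 1ℚ :- p) :* (a :* h) := a :* (p :* g :+ (con 1ℚ :- p) :* h)) refl

  𝔼-weight : ∀ {vs us : List (PaddedVertex m n)} → Unique.Unique vs → Unique.Unique us → All (_∈ vs) us →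
    𝔼 p vs (weight φ us) ≡ c ↑ length us
  𝔼-weight {vs = vs} {[]} _ _ _ = 𝔼-const 0≤p p≤1 vs 1ℚ
  𝔼-weight {vs = vs} {u ∷ us} unique (u∉ ∷ unique′) (u∈ ∷ us⊆) = trans
    (𝔼-independent unique u∈ (weight φ us) λ xs ys → weight-insert φ us xs λ u∈us → All.lookup u∉ u∈us refl)
    (cong (c ℚ.*_) (𝔼-weight unique unique′ us⊆))

  𝔼-total : ∀ {r} {vs} (es : List (PaddedHyperedge m n)) → Unique.Unique vs →
    All (λ (_ , us) → Unique.Unique us × All (_∈ vs) us × length us ≡ r) es → 𝔼 p vs (total φ es) ≡ ι (length es) ℚ.* c ↑ r
  𝔼-total {r = r} {vs} [] _ _ = trans (𝔼-const 0≤p p≤1 vs 0ℚ) (sym (ℚₚ.*-zeroˡ (c ↑ r)))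
  𝔼-total {r = r} {vs} (e ∷ es) unique ((unique′ , us⊆ , refl) ∷ good) = begin
    𝔼 p vs (λ S → weight φ (proj₂ e) S ℚ.+ total φ es S)         ≡⟨ 𝔼-+ 0≤p p≤1 vs (weight φ (proj₂ e)) (total φ es) ⟩
    𝔼 p vs (weight φ (proj₂ e)) ℚ.+ 𝔼 p vs (total φ es)          ≡⟨ cong₂ ℚ._+_ (𝔼-weight unique unique′ us⊆) (𝔼-total es unique good) ⟩
    c ↑ r ℚ.+ ι (length es) ℚ.* c ↑ r                          ≡⟨ lem (c ↑ r) (ι (length es)) ⟩
    (1ℚ ℚ.+ ι (length es)) ℚ.* c ↑ r                           ≡⟨ cong (ℚ._* c ↑ r) (ι-suc (length es)) ⟨
    ι (suc (length es)) ℚ.* c ↑ r                              ∎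
    where
    open ≡-Reasoning
    lem : ∀ x l → x ℚ.+ l ℚ.* x ≡ (1ℚ ℚ.+ l) ℚ.* x
    lem = solve 2 (λ x l → x :+ l :* x := (con 1ℚ :+ l) :* x) refl

module _ (φ : Bool → ℚ) (0≤φ : ∀ b → 0ℚ ℚ.≤ φ b) (φ≤1 : ∀ b → φ b ℚ.≤ 1ℚ) where

  weight-bounds : ∀ (us : List (PaddedVertex m n)) S → 0ℚ ℚ.≤ weight φ us S × weight φ us S ℚ.≤ 1ℚ
  weight-bounds []       S = ℚₚ.<⇒≤ 0<1ℚ , ℚₚ.≤-refl
  weight-bounds (u ∷ us) S with 0≤w , w≤1 ← weight-bounds us S =
    *-nonneg (0≤φ (u ∈ᵇ S)) 0≤w , ℚₚ.≤-trans (*-monoʳ 0≤w (φ≤1 (u ∈ᵇ S))) (subst (ℚ._≤ 1ℚ) (sym (ℚₚ.*-identityˡ _)) w≤1)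

  -- Only the hyperedges through u notice the insertion, and each changes by at most 1 since weights
  -- lie between 0 and 1.
  total-insert : ∀ (es : List (PaddedHyperedge m n)) u xs ys →
    total φ es (xs ++ u ∷ ys) ℚ.- total φ es (xs ++ ys) ℚ.≤ ι (degree u es) ×
    ℚ.- (total φ es (xs ++ u ∷ ys) ℚ.- total φ es (xs ++ ys)) ℚ.≤ ι (degree u es)
  total-insert []       u xs ys = ℚₚ.≤-refl , ℚₚ.≤-refl
  total-insert {m} {n} (e ∷ es) u xs ys = step-insert (T-dec (touches u) e) (total-insert es u xs ys)
    where
    w w′ t t′ : ℚ
    w  = weight φ (proj₂ e) (xs ++ u ∷ ys)
    w′ = weight φ (proj₂ e) (xs ++ ys)
    t  = total φ es (xs ++ u ∷ ys)
    t′ = total φ es (xs ++ ys)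
    same : ∀ w a b → a ℚ.- b ≡ (w ℚ.+ a) ℚ.- (w ℚ.+ b)
    same = solve 3 (λ w a b → a :- b := (w :+ a) :- (w :+ b)) refl
    up-split : ∀ w w′ t t′ → (w ℚ.- w′) ℚ.+ (t ℚ.- t′) ≡ (w ℚ.+ t) ℚ.- (w′ ℚ.+ t′)
    up-split = solve 4 (λ w w′ t t′ → (w :- w′) :+ (t :- t′) := (w :+ t) :- (w′ :+ t′)) refl
    down-split : ∀ w w′ t t′ → (w′ ℚ.- w) ℚ.+ ℚ.- (t ℚ.- t′) ≡ ℚ.- ((w ℚ.+ t) ℚ.- (w′ ℚ.+ t′))
    down-split = solve 4 (λ w w′ t t′ → (w′ :- w) :+ :- (t :- t′) := :- ((w :+ t) :- (w′ :+ t′))) refl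
    diff≤1 : ∀ x y → x ℚ.≤ 1ℚ → 0ℚ ℚ.≤ y → x ℚ.- y ℚ.≤ 1ℚ
    diff≤1 x y x≤1 0≤y = subst (x ℚ.- y ℚ.≤_) (ℚₚ.+-identityʳ 1ℚ) (ℚₚ.+-mono-≤ x≤1 (ℚₚ.neg-antimono-≤ 0≤y))
    step-insert : Dec (value (touches u e) ≡ true) →
      t ℚ.- t′ ℚ.≤ ι (degree u es) × ℚ.- (t ℚ.- t′) ℚ.≤ ι (degree u es) →
      (w ℚ.+ t) ℚ.- (w′ ℚ.+ t′) ℚ.≤ ι (degree u (e ∷ es)) × ℚ.- ((w ℚ.+ t) ℚ.- (w′ ℚ.+ t′)) ℚ.≤ ι (degree u (e ∷ es))
    step-insert (no u∉) (up , down) =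
      subst₂ ℚ._≤_ (diff≡ t t′) deg≡ up , subst₂ ℚ._≤_ (cong ℚ.-_ (diff≡ t t′)) deg≡ down
      where
      w≡w′ : w ≡ w′
      w≡w′ = weight-insert φ (proj₂ e) xs {ys} (λ u∈ → u∉ (∈ᵇ⁺ {u = u} {proj₂ e} u∈))
      diff≡ : ∀ t t′ → t ℚ.- t′ ≡ (w ℚ.+ t) ℚ.- (w′ ℚ.+ t′)
      diff≡ t t′ = trans (same w t t′) (cong (λ z → (w ℚ.+ t) ℚ.- (z ℚ.+ t′)) w≡w′)
      deg≡ : ι (degree u es) ≡ ι (degree u (e ∷ es))
      deg≡ = cong (ι ∘ length) (sym (Listₚ.filter-reject (T-dec (touches u)) {x = e} {xs = es} u∉))
    step-insert (yes u∈) (up , down) =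
      subst₂ ℚ._≤_ (up-split w w′ t t′) deg≡
        (ℚₚ.+-mono-≤ (diff≤1 w w′ (proj₂ (weight-bounds (proj₂ e) (xs ++ u ∷ ys))) (proj₁ (weight-bounds (proj₂ e) (xs ++ ys)))) up) ,
      subst₂ ℚ._≤_ (down-split w w′ t t′) deg≡
        (ℚₚ.+-mono-≤ (diff≤1 w′ w (proj₂ (weight-bounds (proj₂ e) (xs ++ ys))) (proj₁ (weight-bounds (proj₂ e) (xs ++ u ∷ ys)))) down)
      where
      deg≡ : 1ℚ ℚ.+ ι (degree u es) ≡ ι (degree u (e ∷ es))
      deg≡ = trans (sym (ι-suc (degree u es))) (cong (ι ∘ length) (sym (Listₚ.filter-accept (T-dec (touches u)) {x = e} {xs = es} u∈)))

  total-lipschitz : ∀ {k} (es : List (PaddedHyperedge m n)) → (∀ u → degree u es ≤ k) → Lipschitz (ι k ℚ.* ι k) (total φ es)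
  total-lipschitz es deg≤k u xs ys with up , down ← total-insert es u xs ys =
    square-≤ (ℚₚ.≤-trans up (ι-mono (deg≤k u))) (ℚₚ.≤-trans down (ι-mono (deg≤k u)))

weight-all : ∀ (us S : List (PaddedVertex m n)) → weight ⟦_⟧ us S ≡ ⟦ allIn S us ⟧
weight-all []       S = refl
weight-all (u ∷ us) S = trans (cong (⟦ u ∈ᵇ S ⟧ ℚ.*_) (weight-all us S)) (both (u ∈ᵇ S) (allᵗ (λ u → elemᵗ eqVertexᵗ u S) us))
  where
  both : ∀ b (t : Timed Bool) → ⟦ b ⟧ ℚ.* ⟦ value t ⟧ ≡ ⟦ value (if b then t else return false) ⟧
  both true  t = ℚₚ.*-identityˡ ⟦ value t ⟧
  both false t = ℚₚ.*-zeroˡ ⟦ value t ⟧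

weight-none : ∀ (us S : List (PaddedVertex m n)) → weight (⟦_⟧ ∘ not) us S ≡ ⟦ not (someIn S us) ⟧
weight-none []       S = refl
weight-none (u ∷ us) S = trans (cong (⟦ not (u ∈ᵇ S) ⟧ ℚ.*_) (weight-none us S)) (neither (u ∈ᵇ S) (anyᵗ (λ u → elemᵗ eqVertexᵗ u S) us))
  where
  neither : ∀ b (t : Timed Bool) → ⟦ not b ⟧ ℚ.* ⟦ not (value t) ⟧ ≡ ⟦ not (value (if b then return true else t)) ⟧
  neither true  t = ℚₚ.*-zeroˡ ⟦ not (value t) ⟧
  neither false t = ℚₚ.*-identityˡ ⟦ not (value t) ⟧

total-inside : ∀ (es : List (PaddedHyperedge m n)) S → total ⟦_⟧ es S ≡ ι (length (inside S es))
total-inside []              S = refl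
total-inside ((e , us) ∷ es) S = trans (cong₂ ℚ._+_ (weight-all us S) (total-inside es S))
  (counted (allIn S us) (someIn S us) (inside S es) (outside S es) (crossing S es))
  where
  counted : ∀ a b (I O X : List (Hyperedge _ _)) → ⟦ a ⟧ ℚ.+ ι (length I) ≡
    ι (length (proj₁ (if a then (e ∷ I , O , X) else if b then (I , O , e ∷ X) else (I , e ∷ O , X))))
  counted true  _     I O X = sym (ι-suc (length I))
  counted false true  I O X = ℚₚ.+-identityˡ (ι (length I))
  counted false false I O X = ℚₚ.+-identityˡ (ι (length I))

allIn⇒someIn : ∀ S (us : List (PaddedVertex m n)) → 1 ≤ length us → allIn S us ≡ true → someIn S us ≡ true
allIn⇒someIn S (u ∷ us) _ all = any⁺ (λ u → elemᵗ eqVertexᵗ u S) {u} {u ∷ us} (here refl) (all⁻ (λ u → elemᵗ eqVertexᵗ u S) {u} {u ∷ us} all (here refl))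

-- An empty hyperedge would have weight 1 on both sides while `classifyᵗ` files it under inside;
-- after padding to size r ≥ 1 there is none.
total-outside : ∀ (es : List (PaddedHyperedge m n)) S → All (λ (_ , us) → 1 ≤ length us) es →
  total (⟦_⟧ ∘ not) es S ≡ ι (length (outside S es))
total-outside []              S _               = refl
total-outside ((e , us) ∷ es) S (nonempty ∷ ps) = trans (cong₂ ℚ._+_ (weight-none us S) (total-outside es S ps))
  (counted (allIn S us) (someIn S us) (inside S es) (outside S es) (crossing S es) (allIn⇒someIn S us nonempty))
  where
  counted : ∀ a b (I O X : List (Hyperedge _ _)) → (a ≡ true → b ≡ true) → ⟦ not b ⟧ ℚ.+ ι (length O) ≡
    ι (length (proj₁ (proj₂ (if a then (e ∷ I , O , X) else if b then (I , O , e ∷ X) else (I , e ∷ O , X)))))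
  counted true  true  I O X _ = ℚₚ.+-identityˡ (ι (length O))
  counted true  false I O X h = contradiction (h refl) λ ()
  counted false true  I O X _ = ℚₚ.+-identityˡ (ι (length O))
  counted false false I O X _ = sym (ι-suc (length O))

-- p is close enough to 2^(-1/r) for m hyperedges, and w bounds the expected number of hyperedges outside S from below.

record Near (r m w : ℕ) (p : ℚ) : Set where
  field
    0≤p           : 0ℚ ℚ.≤ p
    p≤1           : p ℚ.≤ 1ℚ
    inside-upper  : ι 2 ℚ.* (ι m ℚ.* p ↑ r) ℚ.≤ ι m
    inside-lower  : ι m ℚ.≤ ι 2 ℚ.* (ι m ℚ.* p ↑ r) ℚ.+ ι 2
    outside-lower : ι w ℚ.≤ ι m ℚ.* (1ℚ ℚ.- p) ↑ r

-- A sample is accepted with probability at least one half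

halve-≤ : ∀ {a b} → 2 * a ≤ 1 + 2 * b → a ≤ b
halve-≤ {a} {b} 2a≤ = ℕₚ.≮⇒≥ λ b<a → ℕₚ.<-irrefl refl (≤-trans (≤-trans (≤-reflexive (lem b)) (*-monoʳ-≤ 2 b<a)) 2a≤)
  where
  lem : ∀ b → suc (1 + 2 * b) ≡ 2 * suc b
  lem = solve-∀

-- T is the deviation allowed to both counts. A crossing hyperedge is one that is on neither side,
-- so there are at most (2 h + 1) - (h - T - 1) - (w - T) = h + 2 T + 2 - w of them. One unit of the
-- 2 comes from odd m, the other from the approximation of 2^(-1/r) from below.
accepts-close : ∀ {s b T w} (es : List (PaddedHyperedge m n)) S → length es ≡ m →
  T + 1 ≤ b → ℕ.⌊ m /2⌋ + (2 * T + 2) ≤ s + w →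
  2 * length (inside S es) ≤ m + 2 * T → m ≤ 2 * length (inside S es) + 2 * T + 2 → w ≤ length (outside S es) + T →
  accepts s b es S ≡ true
accepts-close {m} {s = s} {b} {T} {w} es S len T<b s-large i≤ ≤i w≤ = accepts⁺ s b es S
  (≤-trans i≤h+T (+-monoʳ-≤ h (≤-trans (m≤m+n T 1) T<b)))
  (≤-trans h≤ (≤-trans (≤-reflexive (ℕₚ.+-assoc i T 1)) (+-monoʳ-≤ i T<b)))
  (ℕₚ.+-cancelʳ-≤ w c s (begin
    c + w                     ≤⟨ +-monoʳ-≤ c w≤ ⟩
    c + (o + T)               ≤⟨ ℕₚ.+-cancelˡ-≤ i _ _ (begin
       i + (c + (o + T))        ≡⟨ lem₁ i c o T ⟩
       i + (o + c) + T          ≡⟨ cong (_+ T) (trans (classify-length S es) len) ⟩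
       m + T                    ≤⟨ +-monoˡ-≤ T (m≤1+⌊m/2⌋+⌊m/2⌋ m) ⟩
       suc (h + h) + T          ≤⟨ +-monoˡ-≤ T (s≤s (+-monoˡ-≤ h h≤)) ⟩
       suc (i + T + 1 + h) + T  ≡⟨ lem₂ i T h ⟩
       i + (h + (2 * T + 2))    ∎) ⟩
    h + (2 * T + 2)           ≤⟨ s-large ⟩
    s + w                     ∎))
  where
  open ℕₚ.≤-Reasoning
  h = ℕ.⌊ m /2⌋
  i = length (inside S es)
  o = length (outside S es)
  c = length (crossing S es)
  lem₁ : ∀ i c o T → i + (c + (o + T)) ≡ i + (o + c) + T
  lem₁ = solve-∀
  lem₂ : ∀ i T h → suc (i + T + 1 + h) + T ≡ i + (h + (2 * T + 2))
  lem₂ = solve-∀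
  lem₃ : ∀ h T → suc (h + h) + 2 * T ≡ 1 + 2 * (h + T)
  lem₃ = solve-∀
  lem₄ : ∀ i T → 2 * i + 2 * T + 2 ≡ 2 * (i + T + 1)
  lem₄ = solve-∀
  i≤h+T : i ≤ h + T
  i≤h+T = halve-≤ (≤-trans i≤ (≤-trans (+-monoˡ-≤ (2 * T) (m≤1+⌊m/2⌋+⌊m/2⌋ m)) (≤-reflexive (lem₃ h T))))
  h≤ : h ≤ i + T + 1
  h≤ = halve-≤ (≤-trans (2⌊m/2⌋≤m m) (≤-trans ≤i (≤-trans (≤-reflexive (lem₄ i T)) (n≤1+n _))))

module _ {r m n w : ℕ} {p : ℚ} (near : Near r m w p) (1≤r : 1 ≤ r) where

  open Near near

  module _ (es : List (PaddedHyperedge m n)) (len : length es ≡ m) {k T s b : ℕ}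
           (unique : All (λ (_ , us) → Unique.Unique us) es) (sizes : All (λ (_ , us) → length us ≡ r) es)
           (deg≤k : ∀ u → degree u es ≤ k) (1≤T : 1 ≤ T) (T-large : 4 * (m * r * (k * k)) ≤ T * T)
           (T<b : T + 1 ≤ b) (s-large : ℕ.⌊ m /2⌋ + (2 * T + 2) ≤ s + w) where

    private
      vs : List (PaddedVertex m n)
      vs = vertices es
      μ ν σ² : ℚ
      μ = ι m ℚ.* p ↑ r
      ν = ι m ℚ.* (1ℚ ℚ.- p) ↑ r
      σ² = ι (m * r) ℚ.* (ι k ℚ.* ι k)
      -- The sum of both squared deviations replaces a union bound: one application of Markov's
      -- inequality controls both counts.
      deviation : List (PaddedVertex m n) → ℚ
      deviation S = (total ⟦_⟧ es S ℚ.- μ) ℚ.* (total ⟦_⟧ es S ℚ.- μ) ℚ.+ (total (⟦_⟧ ∘ not) es S ℚ.- ν) ℚ.* (total (⟦_⟧ ∘ not) es S ℚ.- ν)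

    rejects : List (PaddedVertex m n) → ℚ
    rejects S = ⟦ not (accepts s b es S) ⟧

    private
      nonempty : All (λ (_ , us) → 1 ≤ length us) es
      nonempty = All.map (λ eq → ≤-trans 1≤r (≤-reflexive (sym eq))) sizes

      good : All (λ (_ , us) → Unique.Unique us × All (_∈ vs) us × length us ≡ r) es
      good = All.tabulate λ {e} e∈ → All.lookup unique e∈ , All.tabulate (λ u∈ → vertices-∈ {es = es} {e} e∈ u∈) , All.lookup sizes e∈

      mean : ∀ φ → 𝔼 p vs (total φ es) ≡ ι m ℚ.* (p ℚ.* φ true ℚ.+ (1ℚ ℚ.- p) ℚ.* φ false) ↑ r
      mean φ = trans (𝔼-total 0≤p p≤1 φ es (vertices-unique es) good) (cong (λ l → ι l ℚ.* (p ℚ.* φ true ℚ.+ (1ℚ ℚ.- p) ℚ.* φ false) ↑ r) len)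

      mean-inside : 𝔼 p vs (total ⟦_⟧ es) ≡ μ
      mean-inside = trans (mean ⟦_⟧) (cong (λ c → ι m ℚ.* c ↑ r) (lem p))
        where
        lem : ∀ p → p ℚ.* 1ℚ ℚ.+ (1ℚ ℚ.- p) ℚ.* 0ℚ ≡ p
        lem = solve 1 (λ p → p :* con 1ℚ :+ (con 1ℚ :- p) :* con 0ℚ := p) refl

      mean-outside : 𝔼 p vs (total (⟦_⟧ ∘ not) es) ≡ ν
      mean-outside = trans (mean (⟦_⟧ ∘ not)) (cong (λ c → ι m ℚ.* c ↑ r) (lem p))
        where
        lem : ∀ p → p ℚ.* 0ℚ ℚ.+ (1ℚ ℚ.- p) ℚ.* 1ℚ ≡ 1ℚ ℚ.- p
        lem = solve 1 (λ p → p :* con 0ℚ :+ (con 1ℚ :- p) :* con 1ℚ := con 1ℚ :- p) refl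

      spread : ∀ φ {c} → (∀ b → 0ℚ ℚ.≤ φ b) → (∀ b → φ b ℚ.≤ 1ℚ) → 𝔼 p vs (total φ es) ≡ c →
        𝔼 p vs (λ S → (total φ es S ℚ.- c) ℚ.* (total φ es S ℚ.- c)) ℚ.≤ σ²
      spread φ 0≤φ φ≤1 mean≡ = ℚₚ.≤-trans (variance 0≤p p≤1 vs (total φ es) (total-lipschitz φ 0≤φ φ≤1 es deg≤k) mean≡)
        (*-monoʳ (*-nonneg (0≤ι k) (0≤ι k)) (ι-mono (≤-trans (vertices-length es sizes) (≤-reflexive (cong (_* r) len)))))

      0≤⟦⟧ : ∀ b → 0ℚ ℚ.≤ ⟦ b ⟧
      0≤⟦⟧ true  = ℚₚ.<⇒≤ 0<1ℚ
      0≤⟦⟧ false = ℚₚ.≤-refl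

      ⟦⟧≤1 : ∀ b → ⟦ b ⟧ ℚ.≤ 1ℚ
      ⟦⟧≤1 true  = ℚₚ.≤-refl
      ⟦⟧≤1 false = ℚₚ.<⇒≤ 0<1ℚ

      close⇒accepts : ∀ S → deviation S ℚ.< ι T ℚ.* ι T → accepts s b es S ≡ true
      close⇒accepts S dev< = accepts-close es S len T<b s-large
        (ι-cancel (subst₂ ℚ._≤_ (sym (ι-* 2 i)) (trans (cong (ι m ℚ.+_) (sym (ι-* 2 T))) (sym (ι-+ m (2 * T))))
          (ℚₚ.≤-trans (*-monoˡ (0≤ι 2) (ℚₚ.<⇒≤ i<)) (subst (ℚ._≤ ι m ℚ.+ ι 2 ℚ.* ι T) (sym (ℚₚ.*-distribˡ-+ (ι 2) μ (ι T))) (ℚₚ.+-monoˡ-≤ (ι 2 ℚ.* ι T) inside-upper)))))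
        (ι-cancel (subst (ι m ℚ.≤_) (sym expand) (ℚₚ.≤-trans inside-lower (ℚₚ.+-monoˡ-≤ (ι 2)
          (ℚₚ.≤-trans (*-monoˡ (0≤ι 2) (ℚₚ.<⇒≤ <i)) (ℚₚ.≤-reflexive (ℚₚ.*-distribˡ-+ (ι 2) (ι i) (ι T))))))))
        (ι-cancel (subst (ι w ℚ.≤_) (sym (ι-+ o T)) (ℚₚ.≤-trans outside-lower (ℚₚ.<⇒≤ <o))))
        where
        i = length (inside S es)
        o = length (outside S es)
        x y : ℚ
        x = total ⟦_⟧ es S ℚ.- μ
        y = total (⟦_⟧ ∘ not) es S ℚ.- ν
        expand : ι (2 * i + 2 * T + 2) ≡ ι 2 ℚ.* ι i ℚ.+ ι 2 ℚ.* ι T ℚ.+ ι 2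
        expand = trans (ι-+ (2 * i + 2 * T) 2) (cong (ℚ._+ ι 2) (trans (ι-+ (2 * i) (2 * T)) (cong₂ ℚ._+_ (ι-* 2 i) (ι-* 2 T))))
        xx≤ : x ℚ.* x ℚ.≤ deviation S
        xx≤ = subst (ℚ._≤ deviation S) (ℚₚ.+-identityʳ (x ℚ.* x)) (ℚₚ.+-monoʳ-≤ (x ℚ.* x) (square-nonneg y))
        yy≤ : y ℚ.* y ℚ.≤ deviation S
        yy≤ = subst (ℚ._≤ deviation S) (ℚₚ.+-identityˡ (y ℚ.* y)) (ℚₚ.+-monoˡ-≤ (y ℚ.* y) (square-nonneg x))
        neg² : ∀ z → ℚ.- z ℚ.* ℚ.- z ≡ z ℚ.* z
        neg² = solve 1 (λ z → :- z :* :- z := z :* z) refl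
        add-back : ∀ a c {t} → a ℚ.- c ℚ.< t → a ℚ.< c ℚ.+ t
        add-back a c {t} a-c<t = subst (ℚ._< c ℚ.+ t) (lem a c) (ℚₚ.+-monoʳ-< c a-c<t)
          where
          lem : ∀ a c → c ℚ.+ (a ℚ.- c) ≡ a
          lem = solve 2 (λ a c → c :+ (a :- c) := a) refl
        add-back′ : ∀ a c {t} → ℚ.- (a ℚ.- c) ℚ.< t → c ℚ.< a ℚ.+ t
        add-back′ a c {t} lt = subst (ℚ._< a ℚ.+ t) (lem a c) (ℚₚ.+-monoʳ-< a lt)
          where
          lem : ∀ a c → a ℚ.+ ℚ.- (a ℚ.- c) ≡ c
          lem = solve 2 (λ a c → a :+ :- (a :- c) := c) refl
        i< : ι i ℚ.< μ ℚ.+ ι T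
        i< = subst (ℚ._< μ ℚ.+ ι T) (total-inside es S) (add-back (total ⟦_⟧ es S) μ (square-cancel-< (0≤ι T) (ℚₚ.≤-<-trans xx≤ dev<)))
        <i : μ ℚ.< ι i ℚ.+ ι T
        <i = subst (λ z → μ ℚ.< z ℚ.+ ι T) (total-inside es S) (add-back′ (total ⟦_⟧ es S) μ
          (square-cancel-< (0≤ι T) (ℚₚ.≤-<-trans (ℚₚ.≤-trans (ℚₚ.≤-reflexive (neg² x)) xx≤) dev<)))
        <o : ν ℚ.< ι o ℚ.+ ι T
        <o = subst (λ z → ν ℚ.< z ℚ.+ ι T) (total-outside es S nonempty) (add-back′ (total (⟦_⟧ ∘ not) es S) ν
          (square-cancel-< (0≤ι T) (ℚₚ.≤-<-trans (ℚₚ.≤-trans (ℚₚ.≤-reflexive (neg² y)) yy≤) dev<)))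

      0≤deviation : ∀ S → 0ℚ ℚ.≤ deviation S
      0≤deviation S = +-nonneg (square-nonneg (total ⟦_⟧ es S ℚ.- μ)) (square-nonneg (total (⟦_⟧ ∘ not) es S ℚ.- ν))

      markov : ∀ S → ι T ℚ.* ι T ℚ.* rejects S ℚ.≤ deviation S
      markov S with accepts s b es S in acc
      ... | true  = subst (ℚ._≤ deviation S) (sym (ℚₚ.*-zeroʳ (ι T ℚ.* ι T))) (0≤deviation S)
      ... | false = subst (ℚ._≤ deviation S) (sym (ℚₚ.*-identityʳ (ι T ℚ.* ι T)))
        (ℚₚ.≮⇒≥ λ dev< → true≢false (close⇒accepts S dev<) acc)

    -- Chebyshev's inequality.

    rejects-rarely : 𝔼 p vs rejects ℚ.≤ ½
    rejects-rarely = ℚₚ.*-cancelˡ-≤-pos (ι T ℚ.* ι T) {{ℚ.positive 0<TT}} (begin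
      ι T ℚ.* ι T ℚ.* 𝔼 p vs rejects              ≡⟨ 𝔼-* 0≤p p≤1 vs (ι T ℚ.* ι T) rejects ⟨
      𝔼 p vs (λ S → ι T ℚ.* ι T ℚ.* rejects S)    ≤⟨ 𝔼-mono 0≤p p≤1 vs (λ S _ → markov S) ⟩
      𝔼 p vs deviation                            ≡⟨ 𝔼-+ 0≤p p≤1 vs _ _ ⟩
      𝔼 p vs (λ S → (total ⟦_⟧ es S ℚ.- μ) ℚ.* (total ⟦_⟧ es S ℚ.- μ)) ℚ.+
        𝔼 p vs (λ S → (total (⟦_⟧ ∘ not) es S ℚ.- ν) ℚ.* (total (⟦_⟧ ∘ not) es S ℚ.- ν))
        ≤⟨ ℚₚ.+-mono-≤ (spread ⟦_⟧ 0≤⟦⟧ ⟦⟧≤1 mean-inside) (spread (⟦_⟧ ∘ not) (λ b → 0≤⟦⟧ (not b)) (λ b → ⟦⟧≤1 (not b)) mean-outside) ⟩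
      -- The factor 4 in `T-large` consists of a 2 for the two variances and a 2 for the target ½.
      σ² ℚ.+ σ²                                   ≡⟨ half-four σ² ⟩
      ½ ℚ.* (ι 4 ℚ.* σ²)                          ≡⟨ cong (½ ℚ.*_) (trans (ι-* 4 (m * r * (k * k))) (cong (ι 4 ℚ.*_) (trans (ι-* (m * r) (k * k)) (cong (ι (m * r) ℚ.*_) (ι-* k k))))) ⟨
      ½ ℚ.* ι (4 * (m * r * (k * k)))             ≤⟨ *-monoˡ (ℚₚ.<⇒≤ 0<½) (ι-mono T-large) ⟩
      ½ ℚ.* ι (T * T)                             ≡⟨ trans (cong (½ ℚ.*_) (ι-* T T)) (ℚₚ.*-comm ½ (ι T ℚ.* ι T)) ⟩
      ι T ℚ.* ι T ℚ.* ½                           ∎)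
      where
      open ℚₚ.≤-Reasoning
      0<½ : 0ℚ ℚ.< ½
      0<½ = ℚₚ.positive⁻¹ ½
      0<TT : 0ℚ ℚ.< ι T ℚ.* ι T
      0<TT = ℚₚ.<-≤-trans 0<1ℚ (ℚₚ.≤-trans (ι-mono {1} {T * T} (*-mono-≤ 1≤T 1≤T)) (ℚₚ.≤-reflexive (ι-* T T)))
      half-four : ∀ x → x ℚ.+ x ≡ ½ ℚ.* (ι 4 ℚ.* x)
      half-four = solve 1 (λ x → x :+ x := con ½ :* (con (ι 4) :* x)) refl

    accepted-exists : ∃ λ S → accepts s b es S ≡ true
    accepted-exists = let S , lt = 𝔼-witness 0≤p p≤1 vs rejects (ℚₚ.≤-<-trans rejects-rarely ½<1) in S , accepted S lt
      where
      ½<1 : ½ ℚ.< 1ℚ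
      ½<1 = ℚ.*<* (ℤ.+<+ (s≤s (s≤s z≤n)))
      accepted : ∀ S → rejects S ℚ.< 1ℚ → accepts s b es S ≡ true
      accepted S lt with accepts s b es S
      ... | true  = refl
      ... | false = contradiction refl (ℚₚ.<⇒≢ lt)

-- Probability and expected time of the random search

Pr : ℚ → (A → Bool) → Rand A → ℚ
Pr p Q (done x)    = if Q x then 1ℚ else 0ℚ
Pr p Q (steps _ c) = Pr p Q c
Pr p Q (toss c)    = p ℚ.* Pr p Q (c true) ℚ.+ (1ℚ ℚ.- p) ℚ.* Pr p Q (c false)

Time : ℚ → Rand A → ℚ
Time p (done _)    = 0ℚ
Time p (steps s c) = ι s ℚ.+ Time p c
Time p (toss c)    = 1ℚ ℚ.+ (p ℚ.* Time p (c true) ℚ.+ (1ℚ ℚ.- p) ℚ.* Time p (c false))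

seq-probability : ∀ x (Q : A → Bool) c i → seq (probability x Q c) i ≡ Pr (seq x i) Q c
seq-probability x Q (done y) i with Q y
... | true  = refl
... | false = refl
seq-probability x Q (steps _ c) i = seq-probability x Q c i
seq-probability x Q (toss c)    i = cong₂ (λ a b → seq x i ℚ.* a ℚ.+ (1ℚ ℚ.- seq x i) ℚ.* b)
  (seq-probability x Q (c true) i) (seq-probability x Q (c false) i)

seq-expectedTime : ∀ x (c : Rand A) i → seq (expectedTime x c) i ≡ Time (seq x i) c
seq-expectedTime x (done _)    i = refl
seq-expectedTime x (steps s c) i = cong (ι s ℚ.+_) (seq-expectedTime x c i)
seq-expectedTime x (toss c)    i = cong₂ (λ a b → 1ℚ ℚ.+ (seq x i ℚ.* a ℚ.+ (1ℚ ℚ.- seq x i) ℚ.* b))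
  (seq-expectedTime x (c true) i) (seq-expectedTime x (c false) i)

-- Stated under `Pr`, associativity needs no equation between the functions inside `toss`.
Pr-assoc : ∀ p Q (c : Rand V) (f : V → Rand A) (g : A → Rand B) → Pr p Q ((c >>=ᴿ f) >>=ᴿ g) ≡ Pr p Q (c >>=ᴿ λ x → f x >>=ᴿ g)
Pr-assoc p Q (done x)    f g = refl
Pr-assoc p Q (steps _ c) f g = Pr-assoc p Q c f g
Pr-assoc p Q (toss c)    f g = cong₂ (λ a b → p ℚ.* a ℚ.+ (1ℚ ℚ.- p) ℚ.* b) (Pr-assoc p Q (c true) f g) (Pr-assoc p Q (c false) f g)

Time-assoc : ∀ p (c : Rand V) (f : V → Rand A) (g : A → Rand B) → Time p ((c >>=ᴿ f) >>=ᴿ g) ≡ Time p (c >>=ᴿ λ x → f x >>=ᴿ g)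
Time-assoc p (done x)    f g = refl
Time-assoc p (steps s c) f g = cong (ι s ℚ.+_) (Time-assoc p c f g)
Time-assoc p (toss c)    f g = cong₂ (λ a b → 1ℚ ℚ.+ (p ℚ.* a ℚ.+ (1ℚ ℚ.- p) ℚ.* b)) (Time-assoc p (c true) f g) (Time-assoc p (c false) f g)

AllOutcomes-bind : ∀ {P : A → Set} {Q : B → Set} c {f : A → Rand B} → AllOutcomes P c → (∀ x → P x → AllOutcomes Q (f x)) → AllOutcomes Q (c >>=ᴿ f)
AllOutcomes-bind (done x)    Px   h = h x Px
AllOutcomes-bind (steps _ c) Pc   h = AllOutcomes-bind c Pc h
AllOutcomes-bind (toss c)    Pc   h = λ b → AllOutcomes-bind (c b) (Pc b) h

AllOutcomes-⊤ : ∀ (c : Rand A) → AllOutcomes (λ _ → ⊤) c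
AllOutcomes-⊤ (done x)    = tt
AllOutcomes-⊤ (steps _ c) = AllOutcomes-⊤ c
AllOutcomes-⊤ (toss c)    = λ b → AllOutcomes-⊤ (c b)

Pr-randomSubset : ∀ p Q (vs : List V) (k : List V → Rand A) → Pr p Q (randomSubset vs >>=ᴿ k) ≡ 𝔼 p vs (λ S → Pr p Q (k S))
Pr-randomSubset p Q []       k = refl
Pr-randomSubset p Q (v ∷ vs) k = trans (Pr-assoc p Q (randomSubset vs) _ k) (Pr-randomSubset p Q vs _)

module _ {p : ℚ} (0≤p : 0ℚ ℚ.≤ p) (p≤1 : p ℚ.≤ 1ℚ) where

  -- Each vertex costs a toss and a step, the empty list one step.
  Time-randomSubset : ∀ (vs : List V) (k : List V → Rand A) →
    Time p (randomSubset vs >>=ᴿ k) ≡ ι (suc (2 * length vs)) ℚ.+ 𝔼 p vs (λ S → Time p (k S))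
  Time-randomSubset []       k = refl
  Time-randomSubset (v ∷ vs) k = begin
    Time p ((randomSubset vs >>=ᴿ branch) >>=ᴿ k)
      ≡⟨ Time-assoc p (randomSubset vs) branch k ⟩
    Time p (randomSubset vs >>=ᴿ λ S → branch S >>=ᴿ k)
      ≡⟨ Time-randomSubset vs (λ S → branch S >>=ᴿ k) ⟩
    ι (suc (2 * l)) ℚ.+ 𝔼 p vs (λ S → 1ℚ ℚ.+ (p ℚ.* (1ℚ ℚ.+ Time p (k (v ∷ S))) ℚ.+ (1ℚ ℚ.- p) ℚ.* (1ℚ ℚ.+ Time p (k S))))
      ≡⟨ cong (ι (suc (2 * l)) ℚ.+_) (trans (𝔼-cong 0≤p p≤1 vs λ S _ → lem p (Time p (k (v ∷ S))) (Time p (k S)))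
           (trans (𝔼-+ 0≤p p≤1 vs (λ _ → ι 2) _) (cong (ℚ._+ 𝔼 p (v ∷ vs) (λ S → Time p (k S))) (𝔼-const 0≤p p≤1 vs (ι 2))))) ⟩
    ι (suc (2 * l)) ℚ.+ (ι 2 ℚ.+ 𝔼 p (v ∷ vs) (λ S → Time p (k S)))
      ≡⟨ ℚₚ.+-assoc (ι (suc (2 * l))) (ι 2) _ ⟨
    ι (suc (2 * l)) ℚ.+ ι 2 ℚ.+ 𝔼 p (v ∷ vs) (λ S → Time p (k S))
      ≡⟨ cong (ℚ._+ 𝔼 p (v ∷ vs) (λ S → Time p (k S))) (trans (sym (ι-+ (suc (2 * l)) 2)) (cong ι (count l))) ⟩
    ι (suc (2 * suc l)) ℚ.+ 𝔼 p (v ∷ vs) (λ S → Time p (k S)) ∎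
    where
    open ≡-Reasoning
    l = length vs
    branch : List _ → Rand (List _)
    branch S = toss λ b → run (✓ return (if b then v ∷ S else S))
    lem : ∀ p a b → 1ℚ ℚ.+ (p ℚ.* (1ℚ ℚ.+ a) ℚ.+ (1ℚ ℚ.- p) ℚ.* (1ℚ ℚ.+ b)) ≡ ι 2 ℚ.+ (p ℚ.* a ℚ.+ (1ℚ ℚ.- p) ℚ.* b)
    lem = solve 3 (λ p a b → con 1ℚ :+ (p :* (con 1ℚ :+ a) :+ (con 1ℚ :- p) :* (con 1ℚ :+ b)) := con (ι 2) :+ (p :* a :+ (con 1ℚ :- p) :* b)) refl
    count : ∀ l → suc (2 * l) + 2 ≡ suc (2 * suc l)
    count = solve-∀

-- The loop body of sampleSeparator, which has no name of its own.

sample-step : ∀ s b f (es : List (PaddedHyperedge m n)) vs → ∃ λ k → sampleSeparator s b (suc f) es vs ≡ (randomSubset vs >>=ᴿ k)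
sample-step s b f es vs = _ , refl

attempt : (s b f : ℕ) → List (PaddedHyperedge m n) → List (PaddedVertex m n) → List (PaddedVertex m n) → Rand (Maybe (Separation m n))
attempt s b f es vs = proj₁ (sample-step s b f es vs)

Pr-attempt : ∀ p Q s b f (es : List (PaddedHyperedge m n)) vs S (k : Maybe (Separation m n) → Rand A) →
  Pr p Q (attempt s b f es vs S >>=ᴿ k) ≡
  (if accepts s b es S then Pr p Q (k (just (separator S es , kept S es))) else Pr p Q (sampleSeparator s b f es vs >>=ᴿ k))
Pr-attempt p Q s b f es vs S k rewrite separation-value s b es S with accepts s b es S
... | true  = refl
... | false = refl

-- Removes the one charge of an attempt, so that `separation-value` can be rewritten in what remains
-- without touching the cost.
unstep : Rand A → Rand A
unstep (steps _ c) = c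
unstep c           = c

Time-attempt : ∀ p s b f (es : List (PaddedHyperedge m n)) vs S (k : Maybe (Separation m n) → Rand A) →
  Time p (attempt s b f es vs S >>=ᴿ k) ≡ ι (suc (time (separationᵗ s b es S))) ℚ.+
  (if accepts s b es S then Time p (k (just (separator S es , kept S es))) else Time p (sampleSeparator s b f es vs >>=ᴿ k))
Time-attempt {m} {n} {A} p s b f es vs S k = cong (ι (suc (time (separationᵗ s b es S))) ℚ.+_) continued
  where
  continued : Time p (unstep (attempt s b f es vs S) >>=ᴿ k) ≡
    (if accepts s b es S then Time p (k (just (separator S es , kept S es))) else Time p (sampleSeparator s b f es vs >>=ᴿ k))
  continued rewrite separation-value s b es S with accepts s b es S
  ... | true  = refl
  ... | false = refl

Outcomes-attempt : ∀ {P : Maybe (Separation m n) → Set} s b f (es : List (PaddedHyperedge m n)) vs S →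
  (accepts s b es S ≡ true → P (just (separator S es , kept S es))) → AllOutcomes P (sampleSeparator s b f es vs) →
  AllOutcomes P (attempt s b f es vs S)
Outcomes-attempt s b f es vs S accepted rejected rewrite separation-value s b es S with accepts s b es S
... | true  = accepted refl
... | false = rejected

sampleSeparator-outcomes : ∀ s b f (es : List (PaddedHyperedge m n)) vs →
  AllOutcomes (λ o → ∀ RK → o ≡ just RK → ∃ λ S → RK ≡ (separator S es , kept S es)) (sampleSeparator s b f es vs)
sampleSeparator-outcomes s b zero    es vs = λ _ ()
sampleSeparator-outcomes s b (suc f) es vs = AllOutcomes-bind (randomSubset vs) (AllOutcomes-⊤ (randomSubset vs)) λ S _ →
  Outcomes-attempt s b f es vs S (λ _ → λ { _ refl → S , refl }) (sampleSeparator-outcomes s b f es vs)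

module _ {p : ℚ} (0≤p : 0ℚ ℚ.≤ p) (p≤1 : p ℚ.≤ 1ℚ) {s b : ℕ} {es : List (PaddedHyperedge m n)} {vs : List (PaddedVertex m n)}
         (rarely : 𝔼 p vs (λ S → ⟦ not (accepts s b es S) ⟧) ℚ.≤ ½)
         {A : Set} (k : Maybe (Separation m n) → Rand A) where

  private
    0≤½ : 0ℚ ℚ.≤ ½
    0≤½ = ℚₚ.<⇒≤ (ℚₚ.positive⁻¹ ½)
    0≤½↑ : ∀ f → 0ℚ ℚ.≤ ½ ↑ f
    0≤½↑ zero    = ℚₚ.<⇒≤ 0<1ℚ
    0≤½↑ (suc f) = *-nonneg 0≤½ (0≤½↑ f)

  -- The event is reached only through f successive rejections, each contributing a factor of at
  -- most ½.
  Pr-sampleSeparator : ∀ Q → (∀ RK → Pr p Q (k (just RK)) ℚ.≤ 0ℚ) → Pr p Q (k nothing) ℚ.≤ 1ℚ → ∀ f →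
    Pr p Q (sampleSeparator s b f es vs >>=ᴿ k) ℚ.≤ ½ ↑ f
  Pr-sampleSeparator Q found ended zero    = ended
  Pr-sampleSeparator Q found ended (suc f) = begin
    Pr p Q (sampleSeparator s b (suc f) es vs >>=ᴿ k)
      ≡⟨ trans (Pr-assoc p Q (randomSubset vs) (attempt s b f es vs) k) (Pr-randomSubset p Q vs _) ⟩
    𝔼 p vs (λ S → Pr p Q (attempt s b f es vs S >>=ᴿ k))
      ≤⟨ 𝔼-mono 0≤p p≤1 vs (λ S _ → ℚₚ.≤-trans (ℚₚ.≤-reflexive (Pr-attempt p Q s b f es vs S k)) (case S)) ⟩
    𝔼 p vs (λ S → ½ ↑ f ℚ.* ⟦ not (accepts s b es S) ⟧)
      ≡⟨ 𝔼-* 0≤p p≤1 vs (½ ↑ f) (λ S → ⟦ not (accepts s b es S) ⟧) ⟩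
    ½ ↑ f ℚ.* 𝔼 p vs (λ S → ⟦ not (accepts s b es S) ⟧)
      ≤⟨ *-monoˡ (0≤½↑ f) rarely ⟩
    ½ ↑ f ℚ.* ½
      ≡⟨ ℚₚ.*-comm (½ ↑ f) ½ ⟩
    ½ ↑ suc f ∎
    where
    open ℚₚ.≤-Reasoning
    case : ∀ S → (if accepts s b es S then Pr p Q (k (just (separator S es , kept S es))) else Pr p Q (sampleSeparator s b f es vs >>=ᴿ k))
                   ℚ.≤ ½ ↑ f ℚ.* ⟦ not (accepts s b es S) ⟧
    case S with accepts s b es S
    ... | true  = ℚₚ.≤-trans (found _) (ℚₚ.≤-reflexive (sym (ℚₚ.*-zeroʳ (½ ↑ f))))
    ... | false = ℚₚ.≤-trans (Pr-sampleSeparator Q found ended f) (ℚₚ.≤-reflexive (sym (ℚₚ.*-identityʳ (½ ↑ f))))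

  -- An attempt costs c and is followed by the solver at cost u or, with probability at most ½, by
  -- another round. The value 2 (c + u) is the fixed point of t ↦ (c + u) + t/2, so it bounds the
  -- expected time for every cut-off f alike.
  Time-sampleSeparator : ∀ {c u} → (∀ S → Sample vs S → suc (2 * length vs) + suc (time (separationᵗ s b es S)) ≤ c) →
    (∀ S → accepts s b es S ≡ true → Time p (k (just (separator S es , kept S es))) ℚ.≤ ι u) → Time p (k nothing) ℚ.≤ 0ℚ → ∀ f →
    Time p (sampleSeparator s b f es vs >>=ᴿ k) ℚ.≤ ι (2 * (c + u))
  Time-sampleSeparator {c} {u} c-bound found ended zero    = ℚₚ.≤-trans ended (0≤ι (2 * (c + u)))
  Time-sampleSeparator {c} {u} c-bound found ended (suc f) = begin
    Time p (sampleSeparator s b (suc f) es vs >>=ᴿ k)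
      ≡⟨ trans (Time-assoc p (randomSubset vs) (attempt s b f es vs) k) (Time-randomSubset 0≤p p≤1 vs _) ⟩
    ι l ℚ.+ 𝔼 p vs (λ S → Time p (attempt s b f es vs S >>=ᴿ k))
      ≡⟨ cong (ℚ._+ 𝔼 p vs (λ S → Time p (attempt s b f es vs S >>=ᴿ k))) (𝔼-const 0≤p p≤1 vs (ι l)) ⟨
    𝔼 p vs (λ _ → ι l) ℚ.+ 𝔼 p vs (λ S → Time p (attempt s b f es vs S >>=ᴿ k))
      ≡⟨ 𝔼-+ 0≤p p≤1 vs (λ _ → ι l) (λ S → Time p (attempt s b f es vs S >>=ᴿ k)) ⟨
    𝔼 p vs (λ S → ι l ℚ.+ Time p (attempt s b f es vs S >>=ᴿ k))
      ≤⟨ 𝔼-mono 0≤p p≤1 vs (λ S sample → ℚₚ.≤-trans (ℚₚ.≤-reflexive (cong (ι l ℚ.+_) (Time-attempt p s b f es vs S k))) (attempt-bound S sample)) ⟩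
    𝔼 p vs (λ S → ι (c + u) ℚ.+ ι (2 * (c + u)) ℚ.* ⟦ not (accepts s b es S) ⟧)
      ≡⟨ trans (𝔼-+ 0≤p p≤1 vs (λ _ → ι (c + u)) _) (cong₂ ℚ._+_ (𝔼-const 0≤p p≤1 vs (ι (c + u))) (𝔼-* 0≤p p≤1 vs (ι (2 * (c + u))) (λ S → ⟦ not (accepts s b es S) ⟧))) ⟩
    ι (c + u) ℚ.+ ι (2 * (c + u)) ℚ.* 𝔼 p vs (λ S → ⟦ not (accepts s b es S) ⟧)
      ≤⟨ ℚₚ.+-monoʳ-≤ (ι (c + u)) (*-monoˡ (0≤ι (2 * (c + u))) rarely) ⟩
    ι (c + u) ℚ.+ ι (2 * (c + u)) ℚ.* ½
      ≡⟨ cong (λ z → ι (c + u) ℚ.+ z ℚ.* ½) (ι-* 2 (c + u)) ⟩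
    ι (c + u) ℚ.+ ι 2 ℚ.* ι (c + u) ℚ.* ½
      ≡⟨ doubled (ι (c + u)) ⟩
    ι 2 ℚ.* ι (c + u)
      ≡⟨ ι-* 2 (c + u) ⟨
    ι (2 * (c + u)) ∎
    where
    open ℚₚ.≤-Reasoning
    l = suc (2 * length vs)
    doubled : ∀ x → x ℚ.+ ι 2 ℚ.* x ℚ.* ½ ≡ ι 2 ℚ.* x
    doubled = solve 1 (λ x → x :+ con (ι 2) :* x :* con ½ := con (ι 2) :* x) refl
    attempt-bound : ∀ S → Sample vs S → ι l ℚ.+ (ι (suc (time (separationᵗ s b es S))) ℚ.+
      (if accepts s b es S then Time p (k (just (separator S es , kept S es))) else Time p (sampleSeparator s b f es vs >>=ᴿ k)))
      ℚ.≤ ι (c + u) ℚ.+ ι (2 * (c + u)) ℚ.* ⟦ not (accepts s b es S) ⟧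
    attempt-bound S sample = ℚₚ.≤-trans (ℚₚ.≤-reflexive (trans (sym (ℚₚ.+-assoc (ι l) (ι t) X)) (cong (ℚ._+ X) (sym (ι-+ l t)))))
      (ℚₚ.≤-trans (ℚₚ.+-monoˡ-≤ X (ι-mono (c-bound S sample))) (case (accepts s b es S) refl))
      where
      t = suc (time (separationᵗ s b es S))
      X = if accepts s b es S then Time p (k (just (separator S es , kept S es))) else Time p (sampleSeparator s b f es vs >>=ᴿ k)
      case : ∀ a → accepts s b es S ≡ a → ι c ℚ.+ (if a then Time p (k (just (separator S es , kept S es))) else Time p (sampleSeparator s b f es vs >>=ᴿ k))
        ℚ.≤ ι (c + u) ℚ.+ ι (2 * (c + u)) ℚ.* ⟦ not a ⟧
      case true acc = ℚₚ.≤-trans (ℚₚ.+-monoʳ-≤ (ι c) (found S acc)) (ℚₚ.≤-reflexive (trans (sym (ι-+ c u))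
        (sym (trans (cong (ι (c + u) ℚ.+_) (ℚₚ.*-zeroʳ (ι (2 * (c + u))))) (ℚₚ.+-identityʳ (ι (c + u)))))))
      case false _ = ℚₚ.+-mono-≤ (ι-mono (m≤m+n c u)) (ℚₚ.≤-trans (Time-sampleSeparator c-bound found ended f) (ℚₚ.≤-reflexive (sym (ℚₚ.*-identityʳ (ι (2 * (c + u)))))))

-- Fractions and powers

frac : ℕ → ℕ → ℚ
frac a i = ℤ.+ a ℚ./ suc i

toℚᵘ-frac : ∀ a i → ℚ.toℚᵘ (frac a i) ℚᵘ.≃ ℚᵘ.mkℚᵘ (ℤ.+ a) i
toℚᵘ-frac a i = ℚₚ.toℚᵘ-fromℚᵘ (ℚᵘ.mkℚᵘ (ℤ.+ a) i)

frac-≡ : ∀ a i → frac a i ≡ ι a ℚ.* frac 1 i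
frac-≡ a i = ℚₚ.toℚᵘ-injective (begin
  ℚ.toℚᵘ (frac a i)                        ≈⟨ toℚᵘ-frac a i ⟩
  ℚᵘ.mkℚᵘ (ℤ.+ a) i                        ≈⟨ ℚᵘ.*≡* (cong₂ ℤ._*_ (sym (ℤₚ.*-identityʳ (ℤ.+ a))) (cong ℤ.+_ (ℕₚ.*-identityˡ (suc i)))) ⟩
  ℚᵘ.mkℚᵘ (ℤ.+ a) 0 ℚᵘ.* ℚᵘ.mkℚᵘ (ℤ.+ 1) i ≈⟨ ℚᵘₚ.*-cong (ℚᵘₚ.≃-sym (toℚᵘ-ι a)) (ℚᵘₚ.≃-sym (toℚᵘ-frac 1 i)) ⟩
  ℚ.toℚᵘ (ι a) ℚᵘ.* ℚ.toℚᵘ (frac 1 i)      ≈⟨ ℚᵘₚ.≃-sym (ℚₚ.toℚᵘ-homo-* (ι a) (frac 1 i)) ⟩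
  ℚ.toℚᵘ (ι a ℚ.* frac 1 i)                ∎)
  where open SetoidReasoning ℚᵘₚ.≃-setoid

frac-1 : ∀ i → ι (suc i) ℚ.* frac 1 i ≡ 1ℚ
frac-1 i = trans (sym (frac-≡ (suc i) i)) (ℚₚ.toℚᵘ-injective (begin
  ℚ.toℚᵘ (frac (suc i) i)   ≈⟨ toℚᵘ-frac (suc i) i ⟩
  ℚᵘ.mkℚᵘ (ℤ.+ suc i) i     ≈⟨ ℚᵘ.*≡* (ℤₚ.*-comm (ℤ.+ suc i) (ℤ.+ 1)) ⟩
  ℚᵘ.mkℚᵘ (ℤ.+ 1) 0         ∎))
  where open SetoidReasoning ℚᵘₚ.≃-setoid

0≤frac : ∀ a i → 0ℚ ℚ.≤ frac a i
0≤frac a i = ℚₚ.toℚᵘ-cancel-≤ (ℚᵘₚ.≤-respʳ-≃ (ℚᵘₚ.≃-sym (toℚᵘ-frac a i))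
  (ℚᵘ.*≤* (subst (ℤ.+ 0 ℤ.≤_) (sym (ℤₚ.*-identityʳ (ℤ.+ a))) (ℤ.+≤+ z≤n))))

frac-≤ : ∀ {a i c} → ι a ℚ.≤ ι (suc i) ℚ.* c → frac a i ℚ.≤ c
frac-≤ {a} {i} {c} a≤ = subst₂ ℚ._≤_ (sym (frac-≡ a i)) (trans (lem (ι (suc i)) c (frac 1 i)) (trans (cong (ℚ._* c) (frac-1 i)) (ℚₚ.*-identityˡ c)))
  (*-monoʳ (0≤frac 1 i) a≤)
  where
  lem : ∀ n c u → n ℚ.* c ℚ.* u ≡ n ℚ.* u ℚ.* c
  lem = solve 3 (λ n c u → n :* c :* u := n :* u :* c) refl

≤-frac : ∀ {a i c} → c ℚ.≤ frac a i → ι (suc i) ℚ.* c ℚ.≤ ι a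
≤-frac {a} {i} {c} c≤ = subst (ι (suc i) ℚ.* c ℚ.≤_) (trans (cong (ι (suc i) ℚ.*_) (frac-≡ a i))
  (trans (lem (ι (suc i)) (ι a) (frac 1 i)) (trans (cong (ι a ℚ.*_) (frac-1 i)) (ℚₚ.*-identityʳ (ι a))))) (*-monoˡ (0≤ι (suc i)) c≤)
  where
  lem : ∀ n a u → n ℚ.* (a ℚ.* u) ≡ a ℚ.* (n ℚ.* u)
  lem = solve 3 (λ n a u → n :* (a :* u) := a :* (n :* u)) refl

↑-nonneg : ∀ {x} n → 0ℚ ℚ.≤ x → 0ℚ ℚ.≤ x ↑ n
↑-nonneg zero    0≤x = ℚₚ.<⇒≤ 0<1ℚ
↑-nonneg (suc n) 0≤x = *-nonneg 0≤x (↑-nonneg n 0≤x)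

↑-mono : ∀ {x y} n → 0ℚ ℚ.≤ x → x ℚ.≤ y → x ↑ n ℚ.≤ y ↑ n
↑-mono zero    0≤x x≤y = ℚₚ.≤-refl
↑-mono (suc n) 0≤x x≤y = ℚₚ.≤-trans (*-monoˡ 0≤x (↑-mono n 0≤x x≤y)) (*-monoʳ (↑-nonneg n (ℚₚ.≤-trans 0≤x x≤y)) x≤y)

↑-≤1 : ∀ {x} n → 0ℚ ℚ.≤ x → x ℚ.≤ 1ℚ → x ↑ n ℚ.≤ 1ℚ
↑-≤1 zero    0≤x x≤1 = ℚₚ.≤-refl
↑-≤1 {x} (suc n) 0≤x x≤1 = ℚₚ.≤-trans (*-monoˡ 0≤x (↑-≤1 n 0≤x x≤1)) (subst (ℚ._≤ 1ℚ) (sym (ℚₚ.*-identityʳ x)) x≤1)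

↑-* : ∀ x y n → (x ℚ.* y) ↑ n ≡ x ↑ n ℚ.* y ↑ n
↑-* x y zero    = refl
↑-* x y (suc n) = trans (cong (x ℚ.* y ℚ.*_) (↑-* x y n)) (lem x y (x ↑ n) (y ↑ n))
  where
  lem : ∀ x y a b → x ℚ.* y ℚ.* (a ℚ.* b) ≡ x ℚ.* a ℚ.* (y ℚ.* b)
  lem = solve 4 (λ x y a b → x :* y :* (a :* b) := x :* a :* (y :* b)) refl

1-↑ : ∀ n → 1ℚ ↑ n ≡ 1ℚ
1-↑ zero    = refl
1-↑ (suc n) = trans (ℚₚ.*-identityˡ (1ℚ ↑ n)) (1-↑ n)

ι-↑ : ∀ x n → ι (x ^ n) ≡ ι x ↑ n
ι-↑ x zero    = refl
ι-↑ x (suc n) = trans (ι-* x (x ^ n)) (cong (ι x ℚ.*_) (ι-↑ x n))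

frac-↑ : ∀ a i n → ι (suc i ^ n) ℚ.* frac a i ↑ n ≡ ι (a ^ n)
frac-↑ a i n = begin
  ι (suc i ^ n) ℚ.* frac a i ↑ n              ≡⟨ cong₂ ℚ._*_ (ι-↑ (suc i) n) (trans (cong (_↑ n) (frac-≡ a i)) (↑-* (ι a) (frac 1 i) n)) ⟩
  ι (suc i) ↑ n ℚ.* (ι a ↑ n ℚ.* frac 1 i ↑ n) ≡⟨ lem (ι (suc i) ↑ n) (ι a ↑ n) (frac 1 i ↑ n) ⟩
  ι (suc i) ↑ n ℚ.* frac 1 i ↑ n ℚ.* ι a ↑ n  ≡⟨ cong (ℚ._* ι a ↑ n) (trans (sym (↑-* (ι (suc i)) (frac 1 i) n)) (trans (cong (_↑ n) (frac-1 i)) (1-↑ n))) ⟩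
  1ℚ ℚ.* ι a ↑ n                              ≡⟨ trans (ℚₚ.*-identityˡ (ι a ↑ n)) (sym (ι-↑ a n)) ⟩
  ι (a ^ n)                                   ∎
  where
  open ≡-Reasoning
  lem : ∀ x y z → x ℚ.* (y ℚ.* z) ≡ x ℚ.* z ℚ.* y
  lem = solve 3 (λ x y z → x :* (y :* z) := x :* z :* y) refl

ι-cancel-* : ∀ n .{{_ : NonZero n}} {x y} → ι n ℚ.* x ℚ.≤ ι n ℚ.* y → x ℚ.≤ y
ι-cancel-* n nx≤ny = ℚₚ.*-cancelˡ-≤-pos (ι n) {{ℚ.positive (ℚₚ.<-≤-trans 0<1ℚ (ι-mono (ℕ.>-nonZero⁻¹ n)))}} nx≤ny

-- On the unit interval each of the n factors passes on an error of at most δ. This carries the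
-- precision of a root over to its r-th power.
↑-lipschitz : ∀ n {u v δ} → 0ℚ ℚ.≤ u → u ℚ.≤ 1ℚ → 0ℚ ℚ.≤ v → v ℚ.≤ 1ℚ → 0ℚ ℚ.≤ δ → v ℚ.≤ u ℚ.+ δ → v ↑ n ℚ.≤ u ↑ n ℚ.+ ι n ℚ.* δ
↑-lipschitz zero    {δ = δ} _ _ _ _ 0≤δ _ = ℚₚ.≤-reflexive (sym (trans (cong (1ℚ ℚ.+_) (ℚₚ.*-zeroˡ δ)) (ℚₚ.+-identityʳ 1ℚ)))
↑-lipschitz (suc n) {u} {v} {δ} 0≤u u≤1 0≤v v≤1 0≤δ v≤u+δ = begin
  v ℚ.* v ↑ n                                  ≤⟨ *-monoˡ 0≤v (↑-lipschitz n 0≤u u≤1 0≤v v≤1 0≤δ v≤u+δ) ⟩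
  v ℚ.* (u ↑ n ℚ.+ ι n ℚ.* δ)                  ≡⟨ ℚₚ.*-distribˡ-+ v (u ↑ n) (ι n ℚ.* δ) ⟩
  v ℚ.* u ↑ n ℚ.+ v ℚ.* (ι n ℚ.* δ)            ≤⟨ ℚₚ.+-mono-≤ (*-monoʳ (↑-nonneg n 0≤u) v≤u+δ) (*-monoʳ (*-nonneg (0≤ι n) 0≤δ) v≤1) ⟩
  (u ℚ.+ δ) ℚ.* u ↑ n ℚ.+ 1ℚ ℚ.* (ι n ℚ.* δ)   ≡⟨ lem₁ u δ (u ↑ n) (ι n ℚ.* δ) ⟩
  u ℚ.* u ↑ n ℚ.+ (δ ℚ.* u ↑ n ℚ.+ ι n ℚ.* δ)  ≤⟨ ℚₚ.+-monoʳ-≤ (u ℚ.* u ↑ n) (ℚₚ.+-monoˡ-≤ (ι n ℚ.* δ) (*-monoˡ 0≤δ (↑-≤1 n 0≤u u≤1))) ⟩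
  u ℚ.* u ↑ n ℚ.+ (δ ℚ.* 1ℚ ℚ.+ ι n ℚ.* δ)     ≡⟨ lem₂ (u ℚ.* u ↑ n) δ (ι n) ⟩
  u ℚ.* u ↑ n ℚ.+ (1ℚ ℚ.+ ι n) ℚ.* δ           ≡⟨ cong (λ z → u ℚ.* u ↑ n ℚ.+ z ℚ.* δ) (ι-suc n) ⟨
  u ↑ suc n ℚ.+ ι (suc n) ℚ.* δ                ∎
  where
  open ℚₚ.≤-Reasoning
  lem₁ : ∀ u δ w x → (u ℚ.+ δ) ℚ.* w ℚ.+ 1ℚ ℚ.* x ≡ u ℚ.* w ℚ.+ (δ ℚ.* w ℚ.+ x)
  lem₁ = solve 4 (λ u δ w x → (u :+ δ) :* w :+ con 1ℚ :* x := u :* w :+ (δ :* w :+ x)) refl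
  lem₂ : ∀ a δ n → a ℚ.+ (δ ℚ.* 1ℚ ℚ.+ n ℚ.* δ) ≡ a ℚ.+ (1ℚ ℚ.+ n) ℚ.* δ
  lem₂ = solve 3 (λ a δ n → a :+ (δ :* con 1ℚ :+ n :* δ) := a :+ (con 1ℚ :+ n) :* δ) refl

-- Approximations of 2^(-1/r) and of ε_r

root : ℕ → ℕ → ℕ
root r i = scaledRoot r (suc i) (suc i)

module _ (r′ : ℕ) where

  private
    r : ℕ
    r = suc r′

  -- Strictness matters: the next multiple of 1/(i + 1) is still at most 1, so `↑-lipschitz` applies
  -- to it and differences from 1 are not truncated.
  root-< : ∀ i → root r i < suc i
  root-< i = ℕₚ.≰⇒> λ N≤a → ℕₚ.<-irrefl refl (begin-strict
    suc i ^ r             <⟨ ℕₚ.m<m+n (suc i ^ r) (ℕₚ.m^n>0 (suc i) r) ⟩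
    suc i ^ r + suc i ^ r ≡⟨ cong (suc i ^ r +_) (sym (ℕₚ.+-identityʳ (suc i ^ r))) ⟩
    2 * suc i ^ r         ≤⟨ *-monoʳ-≤ 2 (^-monoˡ-≤ r N≤a) ⟩
    2 * root r i ^ r      ≤⟨ root-lower r′ (suc i) (suc i) ⟩
    suc i ^ r             ∎)
    where open ℕₚ.≤-Reasoning

  approx-nonneg : ∀ i → 0ℚ ℚ.≤ approxRoot r i
  approx-nonneg i = 0≤frac (root r i) i

  frac≤1 : ∀ {a i} → a ≤ suc i → frac a i ℚ.≤ 1ℚ
  frac≤1 {a} {i} a≤ = frac-≤ {a} {i} (ℚₚ.≤-trans (ι-mono a≤) (ℚₚ.≤-reflexive (sym (ℚₚ.*-identityʳ (ι (suc i))))))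

  approx≤1 : ∀ i → approxRoot r i ℚ.≤ 1ℚ
  approx≤1 i = frac≤1 {root r i} {i} (ℕₚ.<⇒≤ (root-< i))

  approx-upper : ∀ i → ι 2 ℚ.* approxRoot r i ↑ r ℚ.≤ 1ℚ
  approx-upper i = ι-cancel-* (suc i ^ r) {{m^n≢0 (suc i) r}} (begin
    ι (suc i ^ r) ℚ.* (ι 2 ℚ.* approxRoot r i ↑ r) ≡⟨ lem (ι (suc i ^ r)) (ι 2) (approxRoot r i ↑ r) ⟩
    ι 2 ℚ.* (ι (suc i ^ r) ℚ.* approxRoot r i ↑ r) ≡⟨ cong (ι 2 ℚ.*_) (frac-↑ (root r i) i r) ⟩
    ι 2 ℚ.* ι (root r i ^ r)                       ≡⟨ ι-* 2 (root r i ^ r) ⟨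
    ι (2 * root r i ^ r)                           ≤⟨ ι-mono (root-lower r′ (suc i) (suc i)) ⟩
    ι (suc i ^ r)                                  ≡⟨ ℚₚ.*-identityʳ (ι (suc i ^ r)) ⟨
    ι (suc i ^ r) ℚ.* 1ℚ                           ∎)
    where
    open ℚₚ.≤-Reasoning
    lem : ∀ x y z → x ℚ.* (y ℚ.* z) ≡ y ℚ.* (x ℚ.* z)
    lem = solve 3 (λ x y z → x :* (y :* z) := y :* (x :* z)) refl

  frac-suc : ∀ a i → frac (suc a) i ≡ frac a i ℚ.+ frac 1 i
  frac-suc a i = begin
    frac (suc a) i                        ≡⟨ trans (frac-≡ (suc a) i) (cong (ℚ._* frac 1 i) (ι-suc a)) ⟩
    (1ℚ ℚ.+ ι a) ℚ.* frac 1 i             ≡⟨ lem (ι a) (frac 1 i) ⟩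
    ι a ℚ.* frac 1 i ℚ.+ frac 1 i         ≡⟨ cong (ℚ._+ frac 1 i) (frac-≡ a i) ⟨
    frac a i ℚ.+ frac 1 i                 ∎
    where
    open ≡-Reasoning
    lem : ∀ a u → (1ℚ ℚ.+ a) ℚ.* u ≡ a ℚ.* u ℚ.+ u
    lem = solve 2 (λ a u → (con 1ℚ :+ a) :* u := a :* u :+ u) refl

  -- By `root-gap` the next multiple of 1/(i + 1) is already too large; stepping back by one unit
  -- costs r/(i + 1) in the r-th power.
  approx-lower : ∀ i → 1ℚ ℚ.≤ ι 2 ℚ.* (approxRoot r i ↑ r ℚ.+ ι r ℚ.* frac 1 i)
  approx-lower i = ℚₚ.≤-trans above (*-monoˡ (0≤ι 2) (↑-lipschitz r (approx-nonneg i) (approx≤1 i)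
    (0≤frac (suc (root r i)) i) (frac≤1 {suc (root r i)} {i} (root-< i)) (0≤frac 1 i) (ℚₚ.≤-reflexive (frac-suc (root r i) i))))
    where
    open ℚₚ.≤-Reasoning
    lem : ∀ x y z → x ℚ.* (y ℚ.* z) ≡ y ℚ.* (x ℚ.* z)
    lem = solve 3 (λ x y z → x :* (y :* z) := y :* (x :* z)) refl
    above : 1ℚ ℚ.≤ ι 2 ℚ.* frac (suc (root r i)) i ↑ r
    above = ι-cancel-* (suc i ^ r) {{m^n≢0 (suc i) r}} (begin
      ι (suc i ^ r) ℚ.* 1ℚ                                  ≡⟨ ℚₚ.*-identityʳ (ι (suc i ^ r)) ⟩
      ι (suc i ^ r)                                         ≤⟨ ι-mono (ℕₚ.<⇒≤ (root-gap r i)) ⟩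
      ι (2 * suc (root r i) ^ r)                            ≡⟨ ι-* 2 (suc (root r i) ^ r) ⟩
      ι 2 ℚ.* ι (suc (root r i) ^ r)                        ≡⟨ cong (ι 2 ℚ.*_) (frac-↑ (suc (root r i)) i r) ⟨
      ι 2 ℚ.* (ι (suc i ^ r) ℚ.* frac (suc (root r i)) i ↑ r) ≡⟨ lem (ι 2) (ι (suc i ^ r)) (frac (suc (root r i)) i ↑ r) ⟩
      ι (suc i ^ r) ℚ.* (ι 2 ℚ.* frac (suc (root r i)) i ↑ r) ∎)

  -- For N = m + 1 and a = ⌊N 2^(-1/r)⌋ we have (N - a - 1) / N ≤ 1 - 2^(-1/r) ≤ (N - a) / N.

  module _ (m : ℕ) where

    private
      a x : ℕ
      a = root r m
      x = suc m ∸ suc a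
      a+1+x : suc a + x ≡ suc m
      a+1+x = ℕₚ.m+[n∸m]≡n (root-< m)
      instance
        Nʳ≢0 : NonZero (suc m ^ r)
        Nʳ≢0 = m^n≢0 (suc m) r

    -- An integer lower bound for ε_r m that is off by O(r).

    εm : ℕ
    εm = m * x ^ r / suc m ^ r

    private
      complement : 1ℚ ℚ.- frac (suc a) m ≡ frac x m
      complement = trans (cong (ℚ._- frac (suc a) m) (sym whole)) (lem (frac (suc a) m) (frac x m))
        where
        whole : frac (suc a) m ℚ.+ frac x m ≡ 1ℚ
        whole = begin
          frac (suc a) m ℚ.+ frac x m                     ≡⟨ cong₂ ℚ._+_ (frac-≡ (suc a) m) (frac-≡ x m) ⟩
          ι (suc a) ℚ.* frac 1 m ℚ.+ ι x ℚ.* frac 1 m     ≡⟨ ℚₚ.*-distribʳ-+ (frac 1 m) (ι (suc a)) (ι x) ⟨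
          (ι (suc a) ℚ.+ ι x) ℚ.* frac 1 m                ≡⟨ cong (ℚ._* frac 1 m) (trans (sym (ι-+ (suc a) x)) (cong ι a+1+x)) ⟩
          ι (suc m) ℚ.* frac 1 m                          ≡⟨ frac-1 m ⟩
          1ℚ                                              ∎
          where open ≡-Reasoning
        lem : ∀ a b → (a ℚ.+ b) ℚ.- a ≡ b
        lem = solve 2 (λ a b → (a :+ b) :- a := b) refl
      lower : ∀ i → frac x m ℚ.≤ 1ℚ ℚ.- approxRoot r i
      lower i = subst (ℚ._≤ 1ℚ ℚ.- approxRoot r i) (complement) (ℚₚ.+-monoʳ-≤ 1ℚ (ℚₚ.neg-antimono-≤
        (ℚₚ.≤-trans (approxRoot-close r′ i m) (ℚₚ.≤-reflexive (sym (frac-suc a m))))))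
      -- One unit 1/N is the distance between the approximations at m and at i, the other comes from
      -- x being measured from a + 1 and not from a.
      upper : ∀ i → m ≤ i → 1ℚ ℚ.- approxRoot r i ℚ.≤ frac x m ℚ.+ ι 2 ℚ.* frac 1 m
      upper i m≤i = subst (λ z → 1ℚ ℚ.- approxRoot r i ℚ.≤ z ℚ.+ ι 2 ℚ.* frac 1 m) (complement)
        (0≤-⇒≤ (subst (0ℚ ℚ.≤_) (trans (cong (λ z → approxRoot r i ℚ.+ frac 1 m ℚ.- z) (drop-one (frac-suc a m))) (lem (approxRoot r i) (frac 1 m) (frac (suc a) m)))
          (≤⇒0≤- (ℚₚ.≤-trans (approxRoot-close r′ m i) (ℚₚ.+-monoʳ-≤ (approxRoot r i) (1/N-mono m≤i))))))
        where
        drop-one : ∀ {x y z} → x ≡ y ℚ.+ z → y ≡ x ℚ.- z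
        drop-one {y = y} {z} refl = sym-lem y z
          where
          sym-lem : ∀ y z → y ≡ y ℚ.+ z ℚ.- z
          sym-lem = solve 2 (λ y z → y := y :+ z :- z) refl
        lem : ∀ p u s → p ℚ.+ u ℚ.- (s ℚ.- u) ≡ 1ℚ ℚ.- s ℚ.+ ι 2 ℚ.* u ℚ.- (1ℚ ℚ.- p)
        lem = solve 3 (λ p u s → p :+ u :- (s :- u) := con 1ℚ :- s :+ con (ι 2) :* u :- (con 1ℚ :- p)) refl
      power : ι (suc m ^ r) ℚ.* (ι m ℚ.* frac x m ↑ r) ≡ ι (m * x ^ r)
      power = trans (lem (ι (suc m ^ r)) (ι m) (frac x m ↑ r)) (trans (cong (ι m ℚ.*_) (frac-↑ x m r)) (sym (ι-* m (x ^ r))))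
        where
        lem : ∀ x y z → x ℚ.* (y ℚ.* z) ≡ y ℚ.* (x ℚ.* z)
        lem = solve 3 (λ x y z → x :* (y :* z) := y :* (x :* z)) refl

    0≤1-approx : ∀ i → 0ℚ ℚ.≤ 1ℚ ℚ.- approxRoot r i
    0≤1-approx i = ≤⇒0≤- (approx≤1 i)

    1-approx≤1 : ∀ i → 1ℚ ℚ.- approxRoot r i ℚ.≤ 1ℚ
    1-approx≤1 i = subst (1ℚ ℚ.- approxRoot r i ℚ.≤_) (ℚₚ.+-identityʳ 1ℚ) (ℚₚ.+-monoʳ-≤ 1ℚ (ℚₚ.neg-antimono-≤ (approx-nonneg i)))

    εm-lower : ∀ i → ι εm ℚ.≤ ι m ℚ.* (1ℚ ℚ.- approxRoot r i) ↑ r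
    εm-lower i = ℚₚ.≤-trans
      (ι-cancel-* (suc m ^ r) (ℚₚ.≤-trans (ℚₚ.≤-reflexive (sym (ι-* (suc m ^ r) εm)))
        (ℚₚ.≤-trans (ι-mono (≤-trans (≤-reflexive (ℕₚ.*-comm (suc m ^ r) εm)) (m/n*n≤m (m * x ^ r) (suc m ^ r)))) (ℚₚ.≤-reflexive (sym power)))))
      (*-monoˡ (0≤ι m) (↑-mono r (0≤frac x m) (lower i)))

    -- The floor accounts for the 1. The error 2/N in the base becomes at most 2 r/N in the power,
    -- hence at most 2 r after multiplication by m < N.
    εm-upper : ∀ i → m ≤ i → ι m ℚ.* (1ℚ ℚ.- approxRoot r i) ↑ r ℚ.≤ ι (εm + (1 + 2 * r))
    εm-upper i m≤i = begin
      ι m ℚ.* (1ℚ ℚ.- approxRoot r i) ↑ r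
        ≤⟨ *-monoˡ (0≤ι m) (↑-lipschitz r (0≤frac x m) (frac≤1 {x} {m} (ℕₚ.m∸n≤m (suc m) (suc a))) (0≤1-approx i) (1-approx≤1 i)
             (*-nonneg (0≤ι 2) (0≤frac 1 m)) (upper i m≤i)) ⟩
      ι m ℚ.* (frac x m ↑ r ℚ.+ ι r ℚ.* (ι 2 ℚ.* frac 1 m))
        ≡⟨ lem (ι m) (frac x m ↑ r) (ι r) (ι 2) (frac 1 m) ⟩
      ι m ℚ.* frac x m ↑ r ℚ.+ ι 2 ℚ.* ι r ℚ.* (ι m ℚ.* frac 1 m)
        ≤⟨ ℚₚ.+-mono-≤ floor (*-monoˡ (*-nonneg (0≤ι 2) (0≤ι r)) (ℚₚ.≤-trans (*-monoʳ (0≤frac 1 m) (ι-mono (n≤1+n m))) (ℚₚ.≤-reflexive (frac-1 m)))) ⟩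
      ι (suc εm) ℚ.+ ι 2 ℚ.* ι r ℚ.* 1ℚ
        ≡⟨ cong (ι (suc εm) ℚ.+_) (trans (ℚₚ.*-identityʳ (ι 2 ℚ.* ι r)) (sym (ι-* 2 r))) ⟩
      ι (suc εm) ℚ.+ ι (2 * r)
        ≡⟨ trans (sym (ι-+ (suc εm) (2 * r))) (cong ι (sym (ℕₚ.+-suc εm (2 * r)))) ⟩
      ι (εm + (1 + 2 * r)) ∎
      where
      open ℚₚ.≤-Reasoning
      lem : ∀ m f r t u → m ℚ.* (f ℚ.+ r ℚ.* (t ℚ.* u)) ≡ m ℚ.* f ℚ.+ t ℚ.* r ℚ.* (m ℚ.* u)
      lem = solve 5 (λ m f r t u → m :* (f :+ r :* (t :* u)) := m :* f :+ t :* r :* (m :* u)) refl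
      floor : ι m ℚ.* frac x m ↑ r ℚ.≤ ι (suc εm)
      floor = ι-cancel-* (suc m ^ r) (ℚₚ.≤-trans (ℚₚ.≤-reflexive power)
        (ℚₚ.≤-trans (ι-mono (≤-trans (≤-reflexive (m≡m%n+[m/n]*n (m * x ^ r) (suc m ^ r)))
          (≤-trans (+-monoˡ-≤ (εm * suc m ^ r) (ℕₚ.<⇒≤ (m%n<n (m * x ^ r) (suc m ^ r))))
            (≤-reflexive (ℕₚ.*-comm (suc εm) (suc m ^ r)))))) (ℚₚ.≤-reflexive (ι-* (suc m ^ r) (suc εm)))))

    -- By `approx-lower` the power falls short of ½ by at most r/(i + 1). Over m hyperedges this is
    -- at most 1 once i ≥ r m, which after doubling is the slack 2 of `inside-lower`.
    near : ∀ i → r * m ≤ i → Near r m εm (approxRoot r i)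
    near i rm≤i = record
      { 0≤p           = approx-nonneg i
      ; p≤1           = approx≤1 i
      ; inside-upper  = ℚₚ.≤-trans (ℚₚ.≤-reflexive (swap (ι 2) (ι m) (P)))
                          (ℚₚ.≤-trans (*-monoˡ (0≤ι m) (approx-upper i)) (ℚₚ.≤-reflexive (ℚₚ.*-identityʳ (ι m))))
      ; inside-lower  = begin
          ι m                                             ≡⟨ ℚₚ.*-identityʳ (ι m) ⟨
          ι m ℚ.* 1ℚ                                      ≤⟨ *-monoˡ (0≤ι m) (approx-lower i) ⟩
          ι m ℚ.* (ι 2 ℚ.* (P ℚ.+ ι r ℚ.* frac 1 i))      ≡⟨ expand (ι m) (ι 2) P (ι r) (frac 1 i) ⟩
          ι 2 ℚ.* (ι m ℚ.* P) ℚ.+ ι 2 ℚ.* (ι r ℚ.* ι m ℚ.* frac 1 i)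
            ≤⟨ ℚₚ.+-monoʳ-≤ (ι 2 ℚ.* (ι m ℚ.* P)) (*-monoˡ (0≤ι 2) (ℚₚ.≤-trans (*-monoʳ (0≤frac 1 i)
                 (ℚₚ.≤-trans (ℚₚ.≤-reflexive (sym (ι-* r m))) (ι-mono (ℕₚ.m≤n⇒m≤1+n rm≤i)))) (ℚₚ.≤-reflexive (frac-1 i)))) ⟩
          ι 2 ℚ.* (ι m ℚ.* P) ℚ.+ ι 2 ℚ.* 1ℚ              ≡⟨ cong (ι 2 ℚ.* (ι m ℚ.* P) ℚ.+_) (ℚₚ.*-identityʳ (ι 2)) ⟩
          ι 2 ℚ.* (ι m ℚ.* P) ℚ.+ ι 2                     ∎
      ; outside-lower = εm-lower i
      }
      where
      open ℚₚ.≤-Reasoning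
      P = approxRoot r i ↑ r
      swap : ∀ x y z → x ℚ.* (y ℚ.* z) ≡ y ℚ.* (x ℚ.* z)
      swap = solve 3 (λ x y z → x :* (y :* z) := y :* (x :* z)) refl
      expand : ∀ m t P r u → m ℚ.* (t ℚ.* (P ℚ.+ r ℚ.* u)) ≡ t ℚ.* (m ℚ.* P) ℚ.+ t ℚ.* (r ℚ.* m ℚ.* u)
      expand = solve 5 (λ m t P r u → m :* (t :* (P :+ r :* u)) := t :* (m :* P) :+ t :* (r :* m :* u)) refl

    -- ε_r ≤ (2/5)² for r ≥ 2, as 2 (3/5)^r ≤ 1.

    6εm≤m : 2 ≤ r → 6 * εm ≤ m
    6εm≤m 2≤r = ℕₚ.*-cancelʳ-≤ (6 * εm) m (suc m ^ r * 5 ^ r) {{m*n≢0 (suc m ^ r) (5 ^ r) {{Nʳ≢0}} {{m^n≢0 5 r}}}} (begin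
      6 * εm * (suc m ^ r * 5 ^ r)       ≡⟨ lem₁ εm (suc m ^ r) (5 ^ r) ⟩
      6 * (εm * suc m ^ r) * 5 ^ r       ≤⟨ *-monoˡ-≤ (5 ^ r) (*-monoʳ-≤ 6 (m/n*n≤m (m * x ^ r) (suc m ^ r))) ⟩
      6 * (m * x ^ r) * 5 ^ r            ≡⟨ lem₂ m (x ^ r) (5 ^ r) ⟩
      6 * m * (5 ^ r * x ^ r)            ≡⟨ cong (6 * m *_) (^-distribʳ-* r 5 x) ⟨
      6 * m * (5 * x) ^ r                ≤⟨ *-monoʳ-≤ (6 * m) (^-monoˡ-≤ r 5x≤2N) ⟩
      6 * m * (2 * suc m) ^ r            ≡⟨ cong (6 * m *_) (^-distribʳ-* r 2 (suc m)) ⟩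
      6 * m * (2 ^ r * suc m ^ r)        ≡⟨ lem₃ m (2 ^ r) (suc m ^ r) ⟩
      m * (suc m ^ r * (6 * 2 ^ r))      ≤⟨ *-monoʳ-≤ m (*-monoʳ-≤ (suc m ^ r) (six r 2≤r)) ⟩
      m * (suc m ^ r * 5 ^ r)            ∎)
      where
      open ℕₚ.≤-Reasoning
      lem₁ : ∀ e N f → 6 * e * (N * f) ≡ 6 * (e * N) * f
      lem₁ = solve-∀
      lem₂ : ∀ m x f → 6 * (m * x) * f ≡ 6 * m * (f * x)
      lem₂ = solve-∀
      lem₃ : ∀ m t N → 6 * m * (t * N) ≡ m * (N * (6 * t))
      lem₃ = solve-∀
      six : ∀ r → 2 ≤ r → 6 * 2 ^ r ≤ 5 ^ r
      six 2 _ = ℕₚ.≤ᵇ⇒≤ 24 25 tt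
      six (suc r@(suc (suc _))) _ = begin
        6 * (2 * 2 ^ r)    ≡⟨ lem₄ (2 ^ r) ⟩
        2 * (6 * 2 ^ r)    ≤⟨ *-mono-≤ (s≤s (s≤s (z≤n {3}))) (six r (s≤s (s≤s z≤n))) ⟩
        5 * 5 ^ r          ∎
        where
        lem₄ : ∀ t → 6 * (2 * t) ≡ 2 * (6 * t)
        lem₄ = solve-∀
      six (suc zero) (s≤s ())
      six zero ()
      two-three : ∀ r → 2 ≤ r → 2 * 3 ^ r ≤ 5 ^ r
      two-three 2 _ = ℕₚ.≤ᵇ⇒≤ 18 25 tt
      two-three (suc r@(suc (suc _))) _ = begin
        2 * (3 * 3 ^ r)    ≡⟨ lem₄ (3 ^ r) ⟩
        3 * (2 * 3 ^ r)    ≤⟨ *-mono-≤ (s≤s (s≤s (s≤s (z≤n {2})))) (two-three r (s≤s (s≤s z≤n))) ⟩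
        5 * 5 ^ r          ∎
        where
        lem₄ : ∀ t → 2 * (3 * t) ≡ 3 * (2 * t)
        lem₄ = solve-∀
      two-three (suc zero) (s≤s ())
      two-three zero ()
      3N≤5a+5 : 3 * suc m ≤ 5 * suc a
      3N≤5a+5 = ℕₚ.≮⇒≥ λ lt → ℕₚ.<-irrefl refl (begin-strict
        5 ^ r * suc m ^ r              <⟨ ℕₚ.*-monoʳ-< (5 ^ r) {{m^n≢0 5 r}} (root-gap r m) ⟩
        5 ^ r * (2 * suc a ^ r)        ≡⟨ lem₅ (5 ^ r) (suc a ^ r) ⟩
        2 * (5 ^ r * suc a ^ r)        ≡⟨ cong (2 *_) (^-distribʳ-* r 5 (suc a)) ⟨
        2 * (5 * suc a) ^ r            ≤⟨ *-monoʳ-≤ 2 (^-monoˡ-≤ r (ℕₚ.<⇒≤ lt)) ⟩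
        2 * (3 * suc m) ^ r            ≡⟨ cong (2 *_) (^-distribʳ-* r 3 (suc m)) ⟩
        2 * (3 ^ r * suc m ^ r)        ≡⟨ ℕₚ.*-assoc 2 (3 ^ r) (suc m ^ r) ⟨
        2 * 3 ^ r * suc m ^ r          ≤⟨ *-monoˡ-≤ (suc m ^ r) (two-three r 2≤r) ⟩
        5 ^ r * suc m ^ r              ∎)
        where
        lem₅ : ∀ f y → f * (2 * y) ≡ 2 * (f * y)
        lem₅ = solve-∀
      5x≤2N : 5 * x ≤ 2 * suc m
      5x≤2N = ℕₚ.+-cancelˡ-≤ (5 * suc a) (5 * x) (2 * suc m) (begin
        5 * suc a + 5 * x        ≡⟨ ℕₚ.*-distribˡ-+ 5 (suc a) x ⟨
        5 * (suc a + x)          ≡⟨ cong (5 *_) a+1+x ⟩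
        5 * suc m                ≡⟨ lem₆ m ⟩
        3 * suc m + 2 * suc m    ≤⟨ +-monoˡ-≤ (2 * suc m) 3N≤5a+5 ⟩
        5 * suc a + 2 * suc m    ∎)
        where
        lem₆ : ∀ m → 5 * suc m ≡ 3 * suc m + 2 * suc m
        lem₆ = solve-∀

-- Powers with a real exponent

seq-^ : ∀ x n i → seq (x ^ᴿ n) i ≡ seq x i ↑ n
seq-^ x zero    i = refl
seq-^ x (suc n) i = cong (seq x i ℚ.*_) (seq-^ x n i)

≤-dense : ∀ {x y} → (∀ δ → 0ℚ ℚ.< δ → x ℚ.≤ y ℚ.+ δ) → x ℚ.≤ y
≤-dense {x} {y} h = ℚₚ.≮⇒≥ λ y<x →
  let δ = ½ ℚ.* (x ℚ.- y)
      0<δ = subst (ℚ._< δ) (ℚₚ.*-zeroʳ ½) (ℚₚ.*-monoʳ-<-pos ½ (subst (ℚ._< x ℚ.- y) (ℚₚ.+-inverseʳ y) (ℚₚ.+-monoˡ-< (ℚ.- y) y<x)))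
  in ℚₚ.<-irrefl refl (ℚₚ.<-≤-trans (subst₂ ℚ._<_ refl (lem x y) (ℚₚ.+-monoʳ-< (y ℚ.+ δ) 0<δ))
       (subst (x ℚ.≤_) (sym (ℚₚ.+-identityʳ (y ℚ.+ δ))) (h δ 0<δ)))
  where
  lem : ∀ x y → y ℚ.+ ½ ℚ.* (x ℚ.- y) ℚ.+ ½ ℚ.* (x ℚ.- y) ≡ x
  lem = solve 2 (λ x y → y :+ con ½ :* (x :- y) :+ con ½ :* (x :- y) := x) refl

-- An integer E between log_d y and x settles the comparison: every fraction a/(b + 1) ≥ x is also ≥
-- E, so y^(b + 1) ≤ d^((b + 1) E) ≤ d^a.
^^-intro : ∀ {y x : ℝ} {d} E N → 1 ≤ d → (∀ i → N ≤ i → 0ℚ ℚ.≤ seq y i) → (∀ i → N ≤ i → seq y i ℚ.≤ ι (d ^ E)) →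
  (∀ i → N ≤ i → ι E ℚ.≤ seq x i) → y ≤ d ^^ x
^^-intro {y} {x} {d@(suc _)} E N 1≤d 0≤y y≤ E≤x a b x≤a/b δ 0<δ = N , λ i N≤i → begin
  seq (y ^ᴿ suc b) i          ≡⟨ seq-^ y (suc b) i ⟩
  seq y i ↑ suc b             ≤⟨ ↑-mono (suc b) (0≤y i N≤i) (y≤ i N≤i) ⟩
  ι (d ^ E) ↑ suc b           ≡⟨ ι-↑ (d ^ E) (suc b) ⟨
  ι ((d ^ E) ^ suc b)         ≡⟨ cong ι (trans (^-*-assoc d E (suc b)) (cong (d ^_) (ℕₚ.*-comm E (suc b)))) ⟩
  ι (d ^ (suc b * E))         ≤⟨ ι-mono (^-monoʳ-≤ d bE≤a) ⟩
  ι (d ^ a)                   ≡⟨ ℚₚ.+-identityʳ (ι (d ^ a)) ⟨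
  ι (d ^ a) ℚ.+ 0ℚ            ≤⟨ ℚₚ.+-monoʳ-≤ (ι (d ^ a)) (ℚₚ.<⇒≤ 0<δ) ⟩
  ι (d ^ a) ℚ.+ δ             ∎
  where
  open ℚₚ.≤-Reasoning
  E≤a/b : ι E ℚ.≤ frac a b
  E≤a/b = ≤-dense λ δ 0<δ → let M , p = x≤a/b δ 0<δ in
    ℚₚ.≤-trans (E≤x (M ℕ.⊔ N) (ℕₚ.m≤n⊔m M N)) (p (M ℕ.⊔ N) (ℕₚ.m≤m⊔n M N))
  bE≤a : suc b * E ≤ a
  bE≤a = ι-cancel (ℚₚ.≤-trans (ℚₚ.≤-reflexive (ι-* (suc b) E)) (≤-frac {a} {b} E≤a/b))

½↑≤frac : ∀ N → ½ ↑ N ℚ.≤ frac 1 N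
½↑≤frac N = ι-cancel-* (suc N) (begin
  ι (suc N) ℚ.* ½ ↑ N      ≤⟨ *-monoʳ (↑-nonneg N (0≤frac 1 1)) (ι-mono (n<2^n N)) ⟩
  ι (2 ^ N) ℚ.* ½ ↑ N      ≡⟨ frac-↑ 1 1 N ⟩
  ι (1 ^ N)                ≡⟨ cong ι (ℕₚ.^-zeroˡ N) ⟩
  1ℚ                       ≡⟨ frac-1 N ⟨
  ι (suc N) ℚ.* frac 1 N   ∎)
  where open ℚₚ.≤-Reasoning

Time-nonneg : ∀ {p} → 0ℚ ℚ.≤ p → p ℚ.≤ 1ℚ → ∀ (c : Rand A) → 0ℚ ℚ.≤ Time p c
Time-nonneg 0≤p p≤1 (done _)    = ℚₚ.≤-refl
Time-nonneg 0≤p p≤1 (steps s c) = +-nonneg (0≤ι s) (Time-nonneg 0≤p p≤1 c)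
Time-nonneg 0≤p p≤1 (toss c)    = +-nonneg (ℚₚ.<⇒≤ 0<1ℚ)
  (+-nonneg (*-nonneg 0≤p (Time-nonneg 0≤p p≤1 (c true))) (*-nonneg (≤⇒0≤- p≤1) (Time-nonneg 0≤p p≤1 (c false))))

-- If D ≤ x, then x² - D² = (x - D)(x + D) ≤ c · 2 x. The error keeps a factor x, later of order m,
-- so that a sublinear c stays sublinear after division by m.
square-≤-+ : ∀ {x D c} → x ≤ D + c → x * x ≤ D * D + 2 * x * c
square-≤-+ {x} {D} {c} x≤ with ℕₚ.≤-total D x
... | inj₂ x≤D = ≤-trans (*-mono-≤ x≤D x≤D) (m≤m+n _ _)
... | inj₁ D≤x = begin
  x * x                          ≤⟨ *-monoʳ-≤ x x≤ ⟩
  x * (D + c)                    ≡⟨ ℕₚ.*-distribˡ-+ x D c ⟩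
  x * D + x * c                  ≤⟨ +-monoˡ-≤ (x * c) (*-monoˡ-≤ D x≤) ⟩
  (D + c) * D + x * c            ≡⟨ lem₁ D c x ⟩
  D * D + c * D + x * c          ≤⟨ +-monoˡ-≤ (x * c) (+-monoʳ-≤ (D * D) (*-monoʳ-≤ c D≤x)) ⟩
  D * D + c * x + x * c          ≡⟨ lem₂ D c x ⟩
  D * D + 2 * x * c              ∎
  where
  open ℕₚ.≤-Reasoning
  lem₁ : ∀ D c x → (D + c) * D + x * c ≡ D * D + c * D + x * c
  lem₁ = solve-∀
  lem₂ : ∀ D c x → D * D + c * x + x * c ≡ D * D + 2 * x * c
  lem₂ = solve-∀

module _ (x : ℝ) (0≤x : ∀ i → 0ℚ ℚ.≤ seq x i) (x≤1 : ∀ i → seq x i ℚ.≤ 1ℚ) where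

  expectedTime-≤ : ∀ (c : Rand A) {y : ℝ} {t} E N → (∀ i → N ≤ i → Time (seq x i) c ℚ.≤ ι t) → t ≤ 2 ^ E →
    (∀ i → N ≤ i → ι E ℚ.≤ seq y i) → expectedTime x c ≤ 2 ^^ y
  expectedTime-≤ c {y} {t} E N time≤ t≤ = ^^-intro {expectedTime x c} {y} E N (s≤s z≤n)
    (λ i _ → subst (0ℚ ℚ.≤_) (sym (seq-expectedTime x c i)) (Time-nonneg (0≤x i) (x≤1 i) c))
    (λ i N≤i → subst (ℚ._≤ ι (2 ^ E)) (sym (seq-expectedTime x c i)) (ℚₚ.≤-trans (time≤ i N≤i) (ι-mono {t} {2 ^ E} t≤)))

  -- Stated for variables, because instantiating expectedTime-≤ at the actual parameters makes Agda unfold the algorithm.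

  expectedTime-CSP-SAT-random-≤ : ∀ r s b f (Ψ : CSP m d n) (y : ℝ) t E N → (∀ i → N ≤ i → Time (seq x i) (CSP-SAT-random r s b f Ψ) ℚ.≤ ι t) → t ≤ 2 ^ E →
    (∀ i → N ≤ i → ι E ℚ.≤ seq y i) → expectedTime x (CSP-SAT-random r s b f Ψ) ≤ 2 ^^ y
  expectedTime-CSP-SAT-random-≤ r s b f Ψ y t E N = expectedTime-≤ (CSP-SAT-random r s b f Ψ) {y} {t} E N

-- Parameters

module Parameters (r′ : ℕ) (k : ℕ → ℕ) where

  r : ℕ
  r = suc r′

  -- The Chebyshev radius.
  radius : ℕ → ℕ
  radius m = 1 + k m * √ (4 * r * m)

  -- `s` is (1/2 - ε_r) m up to rounding plus the slack `C`, which consists of 2 radius + 2 for the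
  -- deviation of the counts and 2 b + 1 for the surplus hyperedges moved into the separator. `c₀`
  -- bounds the excess of 2 ε_r m over m - 2 s, `g₃` that of 2 ε_r² m over the exponent saved by
  -- Chernoff's bound, and `G` collects the errors in the exponent (1 - ε_r) m. The second 2 b + 1
  -- in `G` is the surplus that a random separator may have beyond `s`.
  b C s c₀ g₃ G g a : ℕ → ℕ
  b m = radius m + 1
  C m = 2 * radius m + 2 + (2 * b m + 1)
  s m = ℕ.⌊ m /2⌋ + C m ∸ εm r′ m
  c₀ m = 2 * C m + (2 + 4 * r)
  g₃ m = (3 + 4 * r) * 2 * c₀ m + 1
  -- d ^ a m bounds everything of polynomial size.
  a m = 2 * √ m + k m + (r + 8)
  G m = C m + (2 * b m + 1) + 40 * a m + (2 + 2 * r)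
  g m = G m + g₃ m

  module _ (k∈o : k ∈o[√m]) where

    radius∈o : radius ∈o[m]
    radius∈o = o-+ (o-const 1) (o-*√ (4 * r) k∈o)

    b∈o : b ∈o[m]
    b∈o = o-+ radius∈o (o-const 1)

    2b+1∈o : (λ m → 2 * b m + 1) ∈o[m]
    2b+1∈o = o-+ (o-* 2 b∈o) (o-const 1)

    C∈o : C ∈o[m]
    C∈o = o-+ (o-+ (o-* 2 radius∈o) (o-const 2)) 2b+1∈o

    a∈o : a ∈o[m]
    a∈o = o-+ (o-+ (o-* 2 o-√) (o[√m]⇒o[m] k∈o)) (o-const (r + 8))

    g∈o : g ∈o[m]
    g∈o = o-+ (o-+ (o-+ (o-+ C∈o 2b+1∈o) (o-* 40 a∈o)) (o-const (2 + 2 * r)))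
      (o-+ (o-* ((3 + 4 * r) * 2) (o-+ (o-* 2 C∈o) (o-const (2 + 4 * r)))) (o-const 1))

  module _ (2≤r : 2 ≤ r) (m : ℕ) where

    w h : ℕ
    w = εm r′ m
    h = ℕ.⌊ m /2⌋

    open ℕₚ.≤-Reasoning

    2w≤m : 2 * w ≤ m
    2w≤m = ≤-trans (*-monoˡ-≤ w (s≤s (s≤s (z≤n {4})))) (6εm≤m r′ m 2≤r)

    w≤m : w ≤ m
    w≤m = ≤-trans (m≤m+n w (w + 0)) 2w≤m

    m≤1+2h : m ≤ 1 + 2 * h
    m≤1+2h = ≤-trans (m≤1+⌊m/2⌋+⌊m/2⌋ m) (≤-reflexive (cong (λ z → suc (h + z)) (sym (ℕₚ.+-identityʳ h))))

    w≤h : w ≤ h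
    w≤h = halve-≤ (≤-trans 2w≤m m≤1+2h)

    s+w : s m + w ≡ h + C m
    s+w = m∸n+n≡m (≤-trans w≤h (m≤m+n h (C m)))

    -- A stricter crossing bound, used for existence only: a separator built from it is still within
    -- the search budget `s` after the surplus of at most 2 b + 1 hyperedges is added.
    s₀ : ℕ
    s₀ = h + (2 * radius m + 2) ∸ w

    s₀+w : s₀ + w ≡ h + (2 * radius m + 2)
    s₀+w = m∸n+n≡m (≤-trans w≤h (m≤m+n h _))

    s₀≤s : s₀ + (2 * b m + 1) ≤ s m
    s₀≤s = ℕₚ.+-cancelʳ-≤ w _ _ (≤-reflexive (trans (lem s₀ (2 * b m + 1) w) (trans (cong (_+ (2 * b m + 1)) s₀+w)
      (trans (ℕₚ.+-assoc h (2 * radius m + 2) (2 * b m + 1)) (sym s+w)))))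
      where
      lem : ∀ x y z → x + y + z ≡ x + z + y
      lem = solve-∀

    s+h≤ : s m + h ≤ m ∸ w + C m
    s+h≤ = ℕₚ.+-cancelʳ-≤ w _ _ (begin
      s m + h + w           ≡⟨ lem (s m) h w ⟩
      s m + w + h           ≡⟨ cong (_+ h) s+w ⟩
      h + C m + h           ≡⟨ lem₂ h (C m) ⟩
      2 * h + C m           ≤⟨ +-monoˡ-≤ (C m) (2⌊m/2⌋≤m m) ⟩
      m + C m               ≡⟨ cong (_+ C m) (m∸n+n≡m w≤m) ⟨
      m ∸ w + w + C m       ≡⟨ lem (m ∸ w) w (C m) ⟩
      m ∸ w + C m + w       ∎)
      where
      lem : ∀ x y z → x + y + z ≡ x + z + y
      lem = solve-∀
      lem₂ : ∀ h C → h + C + h ≡ 2 * h + C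
      lem₂ = solve-∀

    T-large : 4 * (m * r * (k m * k m)) ≤ radius m * radius m
    T-large = begin
      4 * (m * r * (k m * k m))                   ≡⟨ lem m r (k m) ⟩
      k m * k m * (4 * r * m)                     ≤⟨ *-monoʳ-≤ (k m * k m) (√-lower (4 * r * m)) ⟩
      k m * k m * (√ (4 * r * m) * √ (4 * r * m)) ≡⟨ ℕₚ.[m*n]*[o*p]≡[m*o]*[n*p] (k m) (k m) (√ (4 * r * m)) (√ (4 * r * m)) ⟩
      k m * √ (4 * r * m) * (k m * √ (4 * r * m)) ≤⟨ *-mono-≤ grow grow ⟩
      radius m * radius m                                   ∎
      where
      grow : k m * √ (4 * r * m) ≤ radius m
      grow = n≤1+n (k m * √ (4 * r * m))
      lem : ∀ m r k → 4 * (m * r * (k * k)) ≡ k * k * (4 * r * m)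
      lem = solve-∀

    module _ .{{m≢0 : NonZero m}} where

      instance
        2m≢0 : NonZero (2 * m)
        2m≢0 = m*n≢0 2 m

      -- D, about 2 ε_r m, is the gap in Chernoff's bound, and v, about 2 ε_r² m, is the exponent
      -- that the bound saves.
      D v : ℕ
      D = m ∸ 2 * s m
      v = D * D / (2 * m)

      2mv≤DD : 2 * m * v ≤ D * D
      2mv≤DD = ≤-trans (≤-reflexive (ℕₚ.*-comm (2 * m) v)) (m/n*n≤m (D * D) (2 * m))

      D≤2w : D ≤ 2 * w
      D≤2w = ℕₚ.m≤n+o⇒m∸n≤o m (2 * s m) (begin
        m                          ≤⟨ m≤1+2h ⟩
        1 + 2 * h                  ≤⟨ m≤m+n _ (3 + (4 * radius m + 4 * b m + 2)) ⟩
        1 + 2 * h + (3 + (4 * radius m + 4 * b m + 2)) ≡⟨ lem h (radius m) (b m) ⟩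
        2 * (h + C m)              ≡⟨ cong (2 *_) s+w ⟨
        2 * (s m + w)              ≡⟨ ℕₚ.*-distribˡ-+ 2 (s m) w ⟩
        2 * s m + 2 * w            ∎)
        where
        lem : ∀ h T b → 1 + 2 * h + (3 + (4 * T + 4 * b + 2)) ≡ 2 * (h + (2 * T + 2 + (2 * b + 1)))
        lem = solve-∀

      -- Solving takes about d^(m - w) and searching about 2^(m - v), so for d = 2 the search
      -- decides the running time.
      v≤w : v ≤ w
      v≤w = ℕₚ.*-cancelˡ-≤ (2 * m) (begin
        2 * m * v           ≤⟨ 2mv≤DD ⟩
        D * D               ≤⟨ *-mono-≤ D≤2w D≤2w ⟩
        2 * w * (2 * w)     ≤⟨ *-monoˡ-≤ (2 * w) 2w≤m ⟩
        m * (2 * w)         ≡⟨ lem m w ⟩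
        2 * m * w           ∎)
        where
        lem : ∀ m w → m * (2 * w) ≡ 2 * m * w
        lem = solve-∀

      -- This is what ε_r ≤ 1/6 gives for Chernoff's bound, whose tilt thereby is at least 3.
      3D≤m : 3 * D ≤ m
      3D≤m = begin
        3 * D         ≤⟨ *-monoʳ-≤ 3 D≤2w ⟩
        3 * (2 * w)   ≡⟨ ℕₚ.*-assoc 3 2 w ⟨
        6 * w         ≤⟨ 6εm≤m r′ m 2≤r ⟩
        m             ∎

      -- For small m the slack in `s` may push 2 s beyond m. Then the truncated D and with it v
      -- vanish, and the trivial bound remains.
      few-subsets : binomialSum m (s m) * 2 ^ v ≤ 2 ^ m
      few-subsets with ℕₚ.≤-total (2 * s m) m
      ... | inj₁ 2s≤m = subst (λ M → binomialSum M (s m) * 2 ^ v ≤ 2 ^ M) D+2s≡m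
        (binomialSum-chernoff D (s m) v (subst (1 ≤_) (sym D+2s≡m) (ℕ.>-nonZero⁻¹ m))
          (subst (3 * D ≤_) (sym D+2s≡m) 3D≤m) (subst (λ M → 2 * M * v ≤ D * D) (sym D+2s≡m) 2mv≤DD))
        where
        D+2s≡m : D + 2 * s m ≡ m
        D+2s≡m = m∸n+n≡m 2s≤m
      ... | inj₂ m≤2s = subst (λ z → binomialSum m (s m) * 2 ^ z ≤ 2 ^ m) (sym v≡0)
        (subst (_≤ 2 ^ m) (sym (ℕₚ.*-identityʳ (binomialSum m (s m)))) (binomialSum≤2^ m (s m)))
        where
        v≡0 : v ≡ 0
        v≡0 = ℕₚ.n≤0⇒n≡0 (ℕₚ.*-cancelˡ-≤ (2 * m) (≤-trans 2mv≤DD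
          (≤-reflexive (trans (cong (λ z → z * z) (ℕₚ.m≤n⇒m∸n≡0 m≤2s)) (sym (ℕₚ.*-zeroʳ (2 * m)))))))

      -- 2 (ε_r m)² ≤ m (v + g₃)
      w-square : 2 * ((w + (1 + 2 * r)) * (w + (1 + 2 * r))) ≤ m * (v + g₃ m)
      w-square = ℕₚ.*-cancelˡ-≤ 2 (begin
        2 * (2 * (w′ * w′))                        ≡⟨ lem₁ w′ ⟩
        2 * w′ * (2 * w′)                          ≤⟨ square-≤-+ {2 * w′} {D} {c₀ m} 2w′≤ ⟩
        D * D + 2 * (2 * w′) * c₀ m                ≤⟨ +-mono-≤ DD≤ (*-monoˡ-≤ (c₀ m) (*-monoʳ-≤ 2 2w′≤m)) ⟩
        2 * m * (v + 1) + 2 * (m * (3 + 4 * r)) * c₀ m ≤⟨ m≤m+n _ (2 * (m * (3 + 4 * r)) * c₀ m) ⟩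
        2 * m * (v + 1) + 2 * (m * (3 + 4 * r)) * c₀ m + 2 * (m * (3 + 4 * r)) * c₀ m ≡⟨ lem₂ m v (3 + 4 * r) (c₀ m) ⟩
        2 * (m * (v + g₃ m))                       ∎)
        where
        w′ = w + (1 + 2 * r)
        lem₁ : ∀ w → 2 * (2 * (w * w)) ≡ 2 * w * (2 * w)
        lem₁ = solve-∀
        lem₂ : ∀ m v q c → 2 * m * (v + 1) + 2 * (m * q) * c + 2 * (m * q) * c ≡ 2 * (m * (v + (q * 2 * c + 1)))
        lem₂ = solve-∀
        DD≤ : D * D ≤ 2 * m * (v + 1)
        DD≤ = begin
          D * D                              ≡⟨ m≡m%n+[m/n]*n (D * D) (2 * m) ⟩
          D * D % (2 * m) + v * (2 * m)      ≤⟨ +-monoˡ-≤ (v * (2 * m)) (ℕₚ.<⇒≤ (m%n<n (D * D) (2 * m))) ⟩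
          2 * m + v * (2 * m)                ≡⟨ lem₃ m v ⟩
          2 * m * (v + 1)                    ∎
          where
          lem₃ : ∀ m v → 2 * m + v * (2 * m) ≡ 2 * m * (v + 1)
          lem₃ = solve-∀
        2w≤D+2C : 2 * w ≤ D + 2 * C m
        2w≤D+2C = ℕₚ.+-cancelˡ-≤ (2 * s m) _ _ (begin
          2 * s m + 2 * w              ≡⟨ ℕₚ.*-distribˡ-+ 2 (s m) w ⟨
          2 * (s m + w)                ≡⟨ cong (2 *_) s+w ⟩
          2 * (h + C m)                ≡⟨ ℕₚ.*-distribˡ-+ 2 h (C m) ⟩
          2 * h + 2 * C m              ≤⟨ +-monoˡ-≤ (2 * C m) (≤-trans (2⌊m/2⌋≤m m) (ℕₚ.m≤n+m∸n m (2 * s m))) ⟩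
          2 * s m + D + 2 * C m        ≡⟨ ℕₚ.+-assoc (2 * s m) D (2 * C m) ⟩
          2 * s m + (D + 2 * C m)      ∎)
        2w′≤ : 2 * w′ ≤ D + c₀ m
        2w′≤ = begin
          2 * w′                           ≡⟨ lem₄ w r ⟩
          2 * w + (2 + 4 * r)              ≤⟨ +-monoˡ-≤ (2 + 4 * r) 2w≤D+2C ⟩
          D + 2 * C m + (2 + 4 * r)        ≡⟨ ℕₚ.+-assoc D (2 * C m) (2 + 4 * r) ⟩
          D + c₀ m                         ∎
          where
          lem₄ : ∀ w r → 2 * (w + (1 + 2 * r)) ≡ 2 * w + (2 + 4 * r)
          lem₄ = solve-∀
        2w′≤m : 2 * w′ ≤ m * (3 + 4 * r)
        2w′≤m = begin
          2 * w′                           ≡⟨ lem₄ w r ⟩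
          2 * w + 1 * (2 + 4 * r)          ≤⟨ +-mono-≤ 2w≤m (*-monoˡ-≤ (2 + 4 * r) (ℕ.>-nonZero⁻¹ m)) ⟩
          m + m * (2 + 4 * r)              ≡⟨ lem₅ m r ⟩
          m * (3 + 4 * r)                  ∎
          where
          lem₄ : ∀ w r → 2 * (w + (1 + 2 * r)) ≡ 2 * w + 1 * (2 + 4 * r)
          lem₄ = solve-∀
          lem₅ : ∀ m r → m + m * (2 + 4 * r) ≡ m * (3 + 4 * r)
          lem₅ = solve-∀

  module _ (2≤r : 2 ≤ r) (1≤k : ∀ m → 1 ≤ k m) where

    private
      e : ℕ → ℚ
      e i = seq (ε r) i

      e≡ : ∀ i → e i ≡ (1ℚ ℚ.- approxRoot r i) ↑ r
      e≡ i = seq-^ (fromℕ 1 -ᴿ 2^-1/ r) r i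

      0≤e : ∀ i → 0ℚ ℚ.≤ e i
      0≤e i = subst (0ℚ ℚ.≤_) (sym (e≡ i)) (↑-nonneg r (0≤1-approx r′ i i))

      me≤ : ∀ m i → m ≤ i → ι m ℚ.* e i ℚ.≤ ι (εm r′ m + (1 + 2 * r))
      me≤ m i m≤i = subst (λ z → ι m ℚ.* z ℚ.≤ ι (εm r′ m + (1 + 2 * r))) (sym (e≡ i)) (εm-upper r′ m i m≤i)

    -- Moving ε_r m to the other side and replacing it by its integer upper bound leaves an
    -- inequality of natural numbers; i ≥ m is the range of that upper bound.
    exponent-linear : ∀ m {E} → E + (εm r′ m + (1 + 2 * r)) ≤ m + g m → ∀ i → m ≤ i →
      ι E ℚ.≤ seq ((fromℕ 1 -ᴿ ε (suc r′)) *ᴿ fromℕ m +ᴿ fromℕ (g m)) i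
    exponent-linear m {E} E≤ i m≤i = 0≤-⇒≤ (subst (0ℚ ℚ.≤_) (lem (ι m) (e i) (ι (g m)) (ι E))
      (≤⇒0≤- (ℚₚ.≤-trans (ℚₚ.+-monoʳ-≤ (ι E) (me≤ m i m≤i)) (ℚₚ.≤-trans (ℚₚ.≤-reflexive (sym (ι-+ E W)))
        (ℚₚ.≤-trans (ι-mono {E + W} {m + g m} E≤) (ℚₚ.≤-reflexive (ι-+ m (g m))))))))
      where
      W : ℕ
      W = εm r′ m + (1 + 2 * r)
      lem : ∀ m e g E → (m ℚ.+ g) ℚ.- (E ℚ.+ m ℚ.* e) ≡ ((1ℚ ℚ.- e) ℚ.* m ℚ.+ g) ℚ.- E
      lem = solve 4 (λ m e g E → (m :+ g) :- (E :+ m :* e) := ((con 1ℚ :- e) :* m :+ g) :- E) refl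

    exponent-square : ∀ m .{{_ : NonZero m}} {E} → E + (v 2≤r m + g₃ m) ≤ m + g m → ∀ i → m ≤ i →
      ι E ℚ.≤ seq ((fromℕ 1 -ᴿ fromℕ 2 *ᴿ ε (suc r′) ^ᴿ 2) *ᴿ fromℕ m +ᴿ fromℕ (g m)) i
    exponent-square m {E} E≤ i m≤i = 0≤-⇒≤ (subst (0ℚ ℚ.≤_) (lem (ι m) (e i) (ι (g m)) (ι E))
      (≤⇒0≤- (ℚₚ.≤-trans (ℚₚ.+-monoʳ-≤ (ι E) 2mee≤) (ℚₚ.≤-trans (ℚₚ.≤-reflexive (sym (ι-+ E W)))
        (ℚₚ.≤-trans (ι-mono {E + W} {m + g m} E≤) (ℚₚ.≤-reflexive (ι-+ m (g m))))))))
      where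
      open ℚₚ.≤-Reasoning
      W : ℕ
      W = v 2≤r m + g₃ m
      lem : ∀ m e g E → (m ℚ.+ g) ℚ.- (E ℚ.+ ι 2 ℚ.* (e ℚ.* (e ℚ.* 1ℚ)) ℚ.* m) ≡ ((1ℚ ℚ.- ι 2 ℚ.* (e ℚ.* (e ℚ.* 1ℚ))) ℚ.* m ℚ.+ g) ℚ.- E
      lem = solve 4 (λ m e g E → (m :+ g) :- (E :+ con (ι 2) :* (e :* (e :* con 1ℚ)) :* m) := ((con 1ℚ :- con (ι 2) :* (e :* (e :* con 1ℚ))) :* m :+ g) :- E) refl
      w′ : ℕ
      w′ = εm r′ m + (1 + 2 * r)
      2mee≤ : ι 2 ℚ.* (e i ℚ.* (e i ℚ.* 1ℚ)) ℚ.* ι m ℚ.≤ ι (v 2≤r m + g₃ m)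
      2mee≤ = ι-cancel-* m (begin
        ι m ℚ.* (ι 2 ℚ.* (e i ℚ.* (e i ℚ.* 1ℚ)) ℚ.* ι m)  ≡⟨ regroup (ι m) (ι 2) (e i) ⟩
        ι 2 ℚ.* ((ι m ℚ.* e i) ℚ.* (ι m ℚ.* e i))         ≤⟨ *-monoˡ (0≤ι 2) (ℚₚ.≤-trans
             (*-monoˡ (*-nonneg (0≤ι m) (0≤e i)) (me≤ m i m≤i)) (*-monoʳ (0≤ι w′) (me≤ m i m≤i))) ⟩
        ι 2 ℚ.* (ι w′ ℚ.* ι w′)                           ≡⟨ trans (ι-* 2 (w′ * w′)) (cong (ι 2 ℚ.*_) (ι-* w′ w′)) ⟨
        ι (2 * (w′ * w′))                                 ≤⟨ ι-mono (w-square 2≤r m) ⟩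
        ι (m * (v 2≤r m + g₃ m))                          ≡⟨ ι-* m (v 2≤r m + g₃ m) ⟩
        ι m ℚ.* ι (v 2≤r m + g₃ m)                        ∎)
        where
        regroup : ∀ m t e → m ℚ.* (t ℚ.* (e ℚ.* (e ℚ.* 1ℚ)) ℚ.* m) ≡ t ℚ.* ((m ℚ.* e) ℚ.* (m ℚ.* e))
        regroup = solve 3 (λ m t e → m :* (t :* (e :* (e :* con 1ℚ)) :* m) := t :* ((m :* e) :* (m :* e))) refl

    -- Both sides are doubled, which clears the ½ and the floor of m/2 together.
    separator-size : ∀ m → fromℕ (s m) ≤ᴿ (fromℚ ½ -ᴿ ε (suc r′)) *ᴿ fromℕ m +ᴿ fromℕ (g m)
    separator-size m δ 0<δ = m , λ i m≤i → ℚₚ.≤-trans (bound-at i m≤i)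
      (subst (ℚ._≤ X i ℚ.+ δ) (ℚₚ.+-identityʳ (X i)) (ℚₚ.+-monoʳ-≤ (X i) (ℚₚ.<⇒≤ 0<δ)))
      where
      X : ℕ → ℚ
      X i = seq ((fromℚ ½ -ᴿ ε (suc r′)) *ᴿ fromℕ m +ᴿ fromℕ (g m)) i
      s≤ : 2 * (s m + (εm r′ m + (1 + 2 * r))) ≤ m + 2 * g m
      s≤ = begin
        2 * (s m + (εm r′ m + (1 + 2 * r)))   ≡⟨ lem₁ (s m) (εm r′ m) r ⟩
        2 * (s m + εm r′ m) + (2 + 4 * r)     ≡⟨ cong (λ z → 2 * z + (2 + 4 * r)) (s+w 2≤r m) ⟩
        2 * (h 2≤r m + C m) + (2 + 4 * r)     ≡⟨ lem₂ (h 2≤r m) (C m) r ⟩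
        2 * h 2≤r m + 2 * (C m + (1 + 2 * r)) ≤⟨ +-mono-≤ (2⌊m/2⌋≤m m) (*-monoʳ-≤ 2 small) ⟩
        m + 2 * g m                           ∎
        where
        open ℕₚ.≤-Reasoning
        lem₁ : ∀ s w r → 2 * (s + (w + (1 + 2 * r))) ≡ 2 * (s + w) + (2 + 4 * r)
        lem₁ = solve-∀
        lem₂ : ∀ h C r → 2 * (h + C) + (2 + 4 * r) ≡ 2 * h + 2 * (C + (1 + 2 * r))
        lem₂ = solve-∀
        small : C m + (1 + 2 * r) ≤ g m
        small = ≤-trans (+-mono-≤ (≤-trans (m≤m+n (C m) (2 * b m + 1)) (m≤m+n _ (40 * a m))) (n≤1+n (1 + 2 * r))) (m≤m+n (G m) (g₃ m))
      bound-at : ∀ i → m ≤ i → ι (s m) ℚ.≤ X i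
      bound-at i m≤i = ι-cancel-* 2 (0≤-⇒≤ (subst (0ℚ ℚ.≤_) (lem (ι m) (e i) (ι (g m)) (ι (s m)))
        (≤⇒0≤- (ℚₚ.≤-trans (*-monoˡ (0≤ι 2) (ℚₚ.≤-trans (ℚₚ.+-monoʳ-≤ (ι (s m)) (me≤ m i m≤i)) (ℚₚ.≤-reflexive (sym (ι-+ (s m) (εm r′ m + (1 + 2 * r)))))))
          (ℚₚ.≤-trans (ℚₚ.≤-reflexive (sym (ι-* 2 (s m + (εm r′ m + (1 + 2 * r)))))) (ℚₚ.≤-trans (ι-mono {2 * (s m + (εm r′ m + (1 + 2 * r)))} {m + 2 * g m} s≤) (ℚₚ.≤-reflexive (trans (ι-+ m (2 * g m)) (cong (ι m ℚ.+_) (ι-* 2 (g m)))))))))))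
        where
        lem : ∀ m e g s → (m ℚ.+ ι 2 ℚ.* g) ℚ.- ι 2 ℚ.* (s ℚ.+ m ℚ.* e) ≡ ι 2 ℚ.* ((½ ℚ.- e) ℚ.* m ℚ.+ g) ℚ.- ι 2 ℚ.* s
        lem = solve 4 (λ m e g s → (m :+ con (ι 2) :* g) :- con (ι 2) :* (s :+ m :* e) := con (ι 2) :* ((con ½ :- e) :* m :+ g) :- con (ι 2) :* s) refl

    -- The algorithm on one instance

    module Instance {m d n : ℕ} (1≤m : 1 ≤ m) (1≤d : 1 ≤ d) (Ψ : CSP m d n) (csp : IsCSP (k m) Ψ) (freq : variableFrequency Ψ ≤ r) where

      a₀ : Fin d
      a₀ = fromℕ< 1≤d

      es : List (PaddedHyperedge m n)
      es = value (padAllᵗ r (value (hypergraphᵗ Ψ)))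

      es≡ : es ≡ padded r Ψ
      es≡ = trans (cong (λ H → value (padAllᵗ r H)) (hypergraph-value Ψ)) (padAll-value r Ψ)

      es-length : length es ≡ m
      es-length = trans (cong length es≡) (padded-length r Ψ)

      es-good : All (GoodPadding r) es
      es-good = subst (All (GoodPadding r)) (sym es≡) (padded-good Ψ freq)

      es-unique : All (λ (_ , us) → Unique.Unique us) es
      es-unique = subst (All (λ (_ , us) → Unique.Unique us)) (sym es≡)
        (Allₚ.map⁺ (All.tabulate λ {x} _ → pad-unique r x (edge-unique Ψ x)))

      es-contains : All Contains es
      es-contains = subst (All Contains) (sym es≡) (padded-contains r Ψ)

      es-degree : ∀ u → degree u es ≤ k m
      es-degree u = subst (λ fs → degree u fs ≤ k m) (sym es≡) (degree≤ r Ψ (1≤k m) csp u)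

      es-hyperedges : map proj₁ es ≡ hypergraph Ψ
      es-hyperedges = trans (cong (map proj₁) es≡) (padded-hyperedges r Ψ)

      near-at : ∀ i → r * m ≤ i → Near r m (εm r′ m) (approxRoot r i)
      near-at i rm≤i = near r′ m i rm≤i

      rarely-rejects : ∀ i → r * m ≤ i → 𝔼 (approxRoot r i) (vertices es) (λ S → ⟦ not (accepts (s m) (b m) es S) ⟧) ℚ.≤ ½
      rarely-rejects i rm≤i = rejects-rarely (near-at i rm≤i) (s≤s z≤n) es es-length {k m} {radius m} {s m} {b m} es-unique
        (All.map proj₁ es-good) es-degree (s≤s z≤n) (T-large 2≤r m) ≤-refl
        (≤-trans (+-monoʳ-≤ (h 2≤r m) (m≤m+n (2 * radius m + 2) (2 * b m + 1))) (≤-reflexive (sym (s+w 2≤r m))))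

      -- Whether a given S is accepted does not depend on p, so a single approximation of 2^(-1/r)
      -- suffices; r m is the first index that `near` allows.
      balanced-exists : ∃ λ S → accepts (s₀ 2≤r m) (b m) es S ≡ true
      balanced-exists = accepted-exists (near-at (r * m) ≤-refl) (s≤s z≤n) es es-length {k m} {radius m} {s₀ 2≤r m} {b m} es-unique
        (All.map proj₁ es-good) es-degree (s≤s z≤n) (T-large 2≤r m) ≤-refl (≤-reflexive (sym (s₀+w 2≤r m)))

      split-of : ∀ S → separator S es ++ kept S es ↭ hypergraph Ψ
      split-of S = ↭-trans (separation-↭ S es) (↭-reflexive es-hyperedges)

      decides-with : ∀ RK → value (searchSeparatorᵗ (s m) (value (hypergraphᵗ Ψ)) ([] , [])) ≡ just RK →
        value (CSP-SAT-deterministic (s m) Ψ) ≡ just (value (solveᵗ Ψ RK))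
      decides-with RK eq rewrite eq = refl

      -- The set S only guarantees that the search succeeds. The separator found may be a different
      -- one, and solving is correct for any splitting of the hyperedges.
      deterministically-decides : DeterministicallyDecides (s m) Ψ
      deterministically-decides =
        let S , acc = balanced-exists
            RK , eq = search-complete (s m) (value (hypergraphᵗ Ψ)) [] [] (separator S es) (kept S es)
                        (↭-trans (↭-reflexive (hypergraph-value Ψ)) (↭-sym (split-of S)))
                        (≤-trans (length-separator {s = s₀ 2≤r m} {b m} {es} S es-length acc) (s₀≤s 2≤r m))
                        (λ K* p → kept-balanced S es-contains K* (↭-trans p (↭-reflexive (Listₚ.++-identityʳ (kept S es)))))
            perm , _ , _ = search-sound (s m) (value (hypergraphᵗ Ψ)) [] [] eq
        in value (solveᵗ Ψ RK) , decides-with RK eq ,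
           solve-correct Ψ (proj₁ RK) (proj₂ RK) (↭-trans perm (↭-reflexive (hypergraph-value Ψ))) a₀

      randomly-decides : RandomlyDecides (suc r′) (s m) (b m) Ψ
      randomly-decides =
        (λ f → AllOutcomes-bind (sampleSeparator (s m) (b m) f es (vertices es)) (sampleSeparator-outcomes (s m) (b m) f es (vertices es)) λ where
          nothing   _   → λ _ ()
          (just RK) eqs → λ { _ refl → correct RK (eqs RK refl) }) ,
        -- The archimedean index itself serves as the cut-off, because ½^f ≤ 1/(f + 1) ≤ η.
        λ η 0<η → let f , 1/f≤η = archimedean η 0<η in f , λ δ 0<δ → r * m , λ i rm≤i → begin
          seq (probability (2^-1/ (suc r′)) is-nothing (CSP-SAT-random (suc r′) (s m) (b m) f Ψ)) i
            ≡⟨ seq-probability (2^-1/ (suc r′)) is-nothing (CSP-SAT-random (suc r′) (s m) (b m) f Ψ) i ⟩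
          Pr (seq (2^-1/ (suc r′)) i) is-nothing (CSP-SAT-random (suc r′) (s m) (b m) f Ψ)
            ≤⟨ Pr-sampleSeparator (approx-nonneg r′ i) (approx≤1 r′ i) {s m} {b m} {es} {vertices es} (rarely-rejects i rm≤i) _ is-nothing (λ _ → ℚₚ.≤-refl) ℚₚ.≤-refl f ⟩
          ½ ↑ f     ≤⟨ ½↑≤frac f ⟩
          frac 1 f  ≤⟨ 1/f≤η ⟩
          η         ≡⟨ ℚₚ.+-identityʳ η ⟨
          η ℚ.+ 0ℚ  ≤⟨ ℚₚ.+-monoʳ-≤ η (ℚₚ.<⇒≤ 0<δ) ⟩
          η ℚ.+ δ   ∎
        where
        open ℚₚ.≤-Reasoning
        correct : ∀ RK → (∃ λ S → RK ≡ (separator S es , kept S es)) → Reflects (Satisfiable Ψ) (value (solveᵗ Ψ RK))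
        correct _ (S , refl) = solve-correct Ψ (separator S es) (kept S es) (split-of S) a₀

      instance
        m≢0 : NonZero m
        m≢0 = ℕ.>-nonZero 1≤m
        d≢0 : NonZero d
        d≢0 = ℕ.>-nonZero 1≤d

      abstract

        -- One number above all sizes: m r + 2 for the constraints and the padded vertices, m for
        -- the hyperedges, k for the arities, r for the padding and d for the alphabet. It is
        -- abstract so that only these bounds are visible.
        Z : ℕ
        Z = 8 + (m * r + 2) + m + k m + r + d

        8≤Z : 8 ≤ Z
        8≤Z = ≤-trans (m≤m+n 8 (m * r + 2)) (≤-trans (m≤m+n _ m) (≤-trans (m≤m+n _ (k m)) (≤-trans (m≤m+n _ r) (m≤m+n _ d))))
        mr+2≤Z : m * r + 2 ≤ Z
        mr+2≤Z = ≤-trans (m≤n+m (m * r + 2) 8) (≤-trans (m≤m+n _ m) (≤-trans (m≤m+n _ (k m)) (≤-trans (m≤m+n _ r) (m≤m+n _ d))))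
        m≤Z : m ≤ Z
        m≤Z = ≤-trans (m≤n+m m (8 + (m * r + 2))) (≤-trans (m≤m+n _ (k m)) (≤-trans (m≤m+n _ r) (m≤m+n _ d)))
        k≤Z : k m ≤ Z
        k≤Z = ≤-trans (m≤n+m (k m) (8 + (m * r + 2) + m)) (≤-trans (m≤m+n _ r) (m≤m+n _ d))
        r≤Z : r ≤ Z
        r≤Z = ≤-trans (m≤n+m r (8 + (m * r + 2) + m + k m)) (m≤m+n _ d)
        d≤Z : d ≤ Z
        d≤Z = m≤n+m d (8 + (m * r + 2) + m + k m + r)
        mr≤Z : m * r ≤ Z
        mr≤Z = ≤-trans (m≤m+n (m * r) 2) mr+2≤Z
        n≤Z : n ≤ Z
        n≤Z = ≤-trans (number-of-constraints Ψ csp freq) mr+2≤Z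
        arity≤Z : VecAll.All (λ c → arity c ≤ Z) Ψ
        arity≤Z = VecAll.map (λ a≤k → ≤-trans a≤k k≤Z) (IsCSP.arity≤k csp)

        -- Each of the six summands is at most X = d^x, and 6 ≤ 8 ≤ d³ accounts for the 3 by which
        -- `a` exceeds x. Square roots replace logarithms: m + 1 ≤ (√m + 1)² ≤ 2^(2 √m), still with
        -- a sublinear exponent. The alphabet size is just d^1.
        Z≤ : 2 ≤ d → Z ≤ d ^ a m
        Z≤ 2≤d = begin
          Z                            ≤⟨ +-mono-≤ (+-mono-≤ (+-mono-≤ (+-mono-≤ (+-mono-≤ 8≤ mr+2≤) m≤) k≤) r≤) d≤ ⟩
          X + X + X + X + X + X        ≤⟨ m≤m+n _ (X + X) ⟩
          X + X + X + X + X + X + (X + X) ≡⟨ lem X ⟩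
          2 ^ 3 * X                    ≤⟨ *-monoˡ-≤ X (^-monoˡ-≤ 3 2≤d) ⟩
          d ^ 3 * X                    ≡⟨ ^-distribˡ-+-* d 3 x ⟨
          d ^ (3 + x)                  ≡⟨ cong (d ^_) (lem₂ (√ m) (k m) r) ⟩
          d ^ a m                      ∎
          where
          open ℕₚ.≤-Reasoning
          x X : ℕ
          x = 2 * √ m + k m + (r + 5)
          X = d ^ x
          lem : ∀ X → X + X + X + X + X + X + (X + X) ≡ 8 * X
          lem = solve-∀
          lem₂ : ∀ q k r → 3 + (2 * q + k + (r + 5)) ≡ 2 * q + k + (r + 8)
          lem₂ = solve-∀
          up : ∀ {t y} → t ≤ 2 ^ y → y ≤ x → t ≤ X
          up {y = y} t≤ y≤x = ≤-trans t≤ (≤-trans (^-monoˡ-≤ y 2≤d) (^-monoʳ-≤ d y≤x))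
          suc-m≤ : suc m ≤ 2 ^ (2 * √ m)
          suc-m≤ = begin
            suc m                          ≤⟨ s≤s (√-lower m) ⟩
            suc (√ m * √ m)                ≤⟨ m≤m+n _ (√ m + √ m) ⟩
            suc (√ m * √ m) + (√ m + √ m)  ≡⟨ lem₃ (√ m) ⟩
            suc (√ m) * suc (√ m)          ≤⟨ *-mono-≤ (n<2^n (√ m)) (n<2^n (√ m)) ⟩
            2 ^ √ m * 2 ^ √ m              ≡⟨ ^-distribˡ-+-* 2 (√ m) (√ m) ⟨
            2 ^ (√ m + √ m)                ≡⟨ cong (λ z → 2 ^ (√ m + z)) (ℕₚ.+-identityʳ (√ m)) ⟨
            2 ^ (2 * √ m)                  ∎
            where
            lem₃ : ∀ q → suc (q * q) + (q + q) ≡ suc q * suc q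
            lem₃ = solve-∀
          8≤ : 8 ≤ X
          8≤ = up {y = 3} ≤-refl (≤-trans (≤-trans (s≤s (s≤s (s≤s z≤n))) (m≤n+m 5 r)) (m≤n+m (r + 5) (2 * √ m + k m)))
          mr+2≤ : m * r + 2 ≤ X
          mr+2≤ = up {y = 2 * √ m + suc r} (begin
            m * r + 2                           ≤⟨ m≤m+n _ (r + m + m) ⟩
            m * r + 2 + (r + m + m)             ≡⟨ lem₄ m r ⟩
            suc m * suc (suc r)                 ≤⟨ *-mono-≤ suc-m≤ (n<2^n (suc r)) ⟩
            2 ^ (2 * √ m) * 2 ^ suc r           ≡⟨ ^-distribˡ-+-* 2 (2 * √ m) (suc r) ⟨
            2 ^ (2 * √ m + suc r)               ∎)
            (≤-trans (+-mono-≤ (m≤m+n (2 * √ m) (k m)) (≤-trans (≤-reflexive (ℕₚ.+-comm 1 r)) (+-monoʳ-≤ r (s≤s z≤n)))) ≤-refl)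
            where
            lem₄ : ∀ m r → m * r + 2 + (r + m + m) ≡ suc m * suc (suc r)
            lem₄ = solve-∀
          m≤ : m ≤ X
          m≤ = up {y = 2 * √ m} (≤-trans (n≤1+n m) suc-m≤) (≤-trans (m≤m+n (2 * √ m) (k m)) (m≤m+n _ (r + 5)))
          k≤ : k m ≤ X
          k≤ = up {y = k m} (ℕₚ.<⇒≤ (n<2^n (k m))) (≤-trans (m≤n+m (k m) (2 * √ m)) (m≤m+n _ (r + 5)))
          r≤ : r ≤ X
          r≤ = up {y = r} (ℕₚ.<⇒≤ (n<2^n r)) (≤-trans (m≤m+n r 5) (m≤n+m (r + 5) (2 * √ m + k m)))
          d≤ : d ≤ X
          d≤ = ≤-trans (≤-reflexive (sym (ℕₚ.^-identityʳ d))) (^-monoʳ-≤ d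
            (≤-trans (≤-trans (s≤s (z≤n {4})) (m≤n+m 5 r)) (m≤n+m (r + 5) (2 * √ m + k m))))

      absorb : ∀ {W j t x} → 2 ≤ d → W ≤ d ^ x → Within Z W j t → t ≤ d ^ (x + j * a m)
      absorb {W} {j} {t} {x} 2≤d W≤ (within t≤) = begin
        t                      ≤⟨ t≤ ⟩
        W * Z ^ j              ≤⟨ *-mono-≤ W≤ (^-monoˡ-≤ j (Z≤ 2≤d)) ⟩
        d ^ x * (d ^ a m) ^ j  ≡⟨ cong (d ^ x *_) (trans (^-*-assoc d (a m) j) (cong (d ^_) (ℕₚ.*-comm (a m) j))) ⟩
        d ^ x * d ^ (j * a m)  ≡⟨ ^-distribˡ-+-* d x (j * a m) ⟨
        d ^ (x + j * a m)      ∎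
        where open ℕₚ.≤-Reasoning

      private
        w₀ h₀ : ℕ
        w₀ = w 2≤r m
        h₀ = h 2≤r m

      solve-exponent : ∀ {c x} → m ∸ w₀ + C m + c ≤ x → d ^ (s m + c) * d ^ h₀ ≤ d ^ x
      solve-exponent {c} {x} ≤x = ≤-trans (≤-reflexive (trans (sym (^-distribˡ-+-* d (s m + c) h₀)) (cong (d ^_) (lem (s m) c h₀))))
        (^-monoʳ-≤ d (≤-trans (+-monoˡ-≤ c (s+h≤ 2≤r m)) ≤x))
        where
        lem : ∀ s c h → s + c + h ≡ s + h + c
        lem = solve-∀

      time-deterministic≤ : 2 ≤ d → ∀ {x} → binomialSum m (s m) ≤ d ^ x → m ∸ w₀ + C m ≤ x →
        time (CSP-SAT-deterministic (s m) Ψ) ≤ d ^ (suc x + 38 * a m)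
      time-deterministic≤ 2≤d {x} F≤ solve≤ = absorb {x = suc x} 2≤d (begin
        binomialSum m (s m) + d ^ s m * d ^ h₀   ≤⟨ +-mono-≤ F≤ (subst (λ z → d ^ z * d ^ h₀ ≤ d ^ x) (ℕₚ.+-identityʳ (s m))
                                                      (solve-exponent {0} (subst (_≤ x) (sym (ℕₚ.+-identityʳ _)) solve≤))) ⟩
        d ^ x + d ^ x                            ≡⟨ cong (d ^ x +_) (sym (ℕₚ.+-identityʳ (d ^ x))) ⟩
        2 * d ^ x                                ≤⟨ *-monoˡ-≤ (d ^ x) 2≤d ⟩
        d ^ suc x                                ∎)
        (deterministic-within 8≤Z m≤Z n≤Z d≤Z Ψ arity≤Z (s m))
        where open ℕₚ.≤-Reasoning

      -- On 3 w of the m factors, 2^3 = 8 ≤ 9 = 3^2 lowers the exponent from 3 w to 2 w. That 3 w ≤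
      -- m follows from ε_r ≤ 1/6.
      2^m≤ : 3 ≤ d → 2 ^ m ≤ d ^ (m ∸ w₀)
      2^m≤ 3≤d = begin
        2 ^ m                      ≡⟨ cong (2 ^_) (sym (ℕₚ.m+[n∸m]≡n 3w≤m)) ⟩
        2 ^ (3 * w₀ + z)           ≡⟨ trans (^-distribˡ-+-* 2 (3 * w₀) z) (cong (_* 2 ^ z) (sym (^-*-assoc 2 3 w₀))) ⟩
        8 ^ w₀ * 2 ^ z             ≤⟨ *-mono-≤ (^-monoˡ-≤ w₀ (n≤1+n 8)) (^-monoˡ-≤ z (n≤1+n 2)) ⟩
        9 ^ w₀ * 3 ^ z             ≡⟨ trans (^-distribˡ-+-* 3 (2 * w₀) z) (cong (_* 3 ^ z) (sym (^-*-assoc 3 2 w₀))) ⟨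
        3 ^ (2 * w₀ + z)           ≤⟨ ^-monoˡ-≤ (2 * w₀ + z) 3≤d ⟩
        d ^ (2 * w₀ + z)           ≡⟨ cong (d ^_) exponent ⟩
        d ^ (m ∸ w₀)               ∎
        where
        open ℕₚ.≤-Reasoning
        3w≤m : 3 * w₀ ≤ m
        3w≤m = ≤-trans (*-monoˡ-≤ w₀ (m≤m+n 3 3)) (6εm≤m r′ m 2≤r)
        z = m ∸ 3 * w₀
        exponent : 2 * w₀ + z ≡ m ∸ w₀
        exponent = sym (trans (cong (_∸ w₀) (sym (trans (lem w₀ z) (ℕₚ.m+[n∸m]≡n 3w≤m)))) (ℕₚ.m+n∸m≡n w₀ (2 * w₀ + z)))
          where
          lem : ∀ w z → w + (2 * w + z) ≡ 3 * w + z
          lem = solve-∀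

      deterministic-time : 3 ≤ d → fromℕ (time (CSP-SAT-deterministic (s m) Ψ)) ≤ d ^^ ((fromℕ 1 -ᴿ ε (suc r′)) *ᴿ fromℕ m +ᴿ fromℕ (g m))
      deterministic-time 3≤d = ^^-intro {fromℕ (time (CSP-SAT-deterministic (s m) Ψ))} {(fromℕ 1 -ᴿ ε (suc r′)) *ᴿ fromℕ m +ᴿ fromℕ (g m)} (suc x + 38 * a m) m 1≤d (λ _ _ → 0≤ι (time (CSP-SAT-deterministic (s m) Ψ)))
        (λ _ _ → ι-mono (time-deterministic≤ (≤-trans (n≤1+n 2) 3≤d) {x}
          (≤-trans (binomialSum≤2^ m (s m)) (≤-trans (2^m≤ 3≤d) (^-monoʳ-≤ d (m≤m+n (m ∸ w₀) (C m))))) ≤-refl))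
        (exponent-linear m {suc x + 38 * a m} (begin
          suc (m ∸ w₀ + C m) + 38 * a m + (w₀ + (1 + 2 * r))     ≡⟨ lem (m ∸ w₀) (C m) (38 * a m) w₀ r ⟩
          m ∸ w₀ + w₀ + (C m + 38 * a m + (2 + 2 * r))           ≡⟨ cong (_+ (C m + 38 * a m + (2 + 2 * r))) (m∸n+n≡m (w≤m 2≤r m)) ⟩
          m + (C m + 38 * a m + (2 + 2 * r))                     ≤⟨ +-monoʳ-≤ m (+-monoˡ-≤ (2 + 2 * r) (+-mono-≤ (m≤m+n (C m) (2 * b m + 1)) (*-monoˡ-≤ (a m) (m≤m+n 38 2)))) ⟩
          m + G m                                                ≤⟨ +-monoʳ-≤ m (m≤m+n (G m) (g₃ m)) ⟩
          m + g m                                                ∎))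
        where
        open ℕₚ.≤-Reasoning
        x = m ∸ w₀ + C m
        lem : ∀ y C a w r → suc (y + C) + a + (w + (1 + 2 * r)) ≡ y + w + (C + a + (2 + 2 * r))
        lem = solve-∀

      deterministic-time₂ : d ≡ 2 → fromℕ (time (CSP-SAT-deterministic (s m) Ψ)) ≤ 2 ^^ ((fromℕ 1 -ᴿ fromℕ 2 *ᴿ ε (suc r′) ^ᴿ 2) *ᴿ fromℕ m +ᴿ fromℕ (g m))
      deterministic-time₂ d≡2 = ^^-intro {fromℕ (time (CSP-SAT-deterministic (s m) Ψ))} {(fromℕ 1 -ᴿ fromℕ 2 *ᴿ ε (suc r′) ^ᴿ 2) *ᴿ fromℕ m +ᴿ fromℕ (g m)} (suc x + 38 * a m) m (s≤s z≤n) (λ _ _ → 0≤ι (time (CSP-SAT-deterministic (s m) Ψ)))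
        (λ _ _ → ι-mono (subst (λ D → time (CSP-SAT-deterministic (s m) Ψ) ≤ D ^ (suc x + 38 * a m)) d≡2
          (time-deterministic≤ (≤-reflexive (sym d≡2)) {x}
            (subst (λ D → binomialSum m (s m) ≤ D ^ x) (sym d≡2) (≤-trans F≤ (^-monoʳ-≤ 2 (m≤m+n (m ∸ v₀) (C m)))))
            (+-monoˡ-≤ (C m) (ℕₚ.∸-monoʳ-≤ m (v≤w 2≤r m))))))
        (exponent-square m {suc x + 38 * a m} (begin
          suc (m ∸ v₀ + C m) + 38 * a m + (v₀ + g₃ m)            ≡⟨ lem (m ∸ v₀) (C m) (38 * a m) v₀ (g₃ m) ⟩
          m ∸ v₀ + v₀ + (C m + 38 * a m + 1 + g₃ m)              ≡⟨ cong (_+ (C m + 38 * a m + 1 + g₃ m)) (m∸n+n≡m v≤m) ⟩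
          m + (C m + 38 * a m + 1 + g₃ m)                        ≤⟨ +-monoʳ-≤ m (+-monoˡ-≤ (g₃ m) (+-mono-≤ (+-mono-≤ (m≤m+n (C m) (2 * b m + 1)) (*-monoˡ-≤ (a m) (m≤m+n 38 2))) (s≤s z≤n))) ⟩
          m + g m                                                ∎))
        where
        open ℕₚ.≤-Reasoning
        v₀ = v 2≤r m
        x = m ∸ v₀ + C m
        v≤m : v₀ ≤ m
        v≤m = ≤-trans (v≤w 2≤r m) (w≤m 2≤r m)
        F≤ : binomialSum m (s m) ≤ 2 ^ (m ∸ v₀)
        F≤ = ℕₚ.*-cancelʳ-≤ _ _ (2 ^ v₀) {{m^n≢0 2 v₀}} (≤-trans (few-subsets 2≤r m)
          (≤-reflexive (trans (cong (2 ^_) (sym (m∸n+n≡m v≤m))) (^-distribˡ-+-* 2 (m ∸ v₀) v₀))))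
        lem : ∀ y C a v g → suc (y + C) + a + (v + g) ≡ y + v + (C + a + 1 + g)
        lem = solve-∀

      private
        q : ℕ
        q = s m + (2 * b m + 1)
        W : ℕ
        W = d ^ q * d ^ h₀
        instance
          W≢0 : NonZero W
          W≢0 = m*n≢0 (d ^ q) (d ^ h₀) {{m^n≢0 d q}} {{m^n≢0 d h₀}}

        solve-random : ∀ S → accepts (s m) (b m) es S ≡ true → Within Z W 34 (time (solveᵗ Ψ (separator S es , kept S es)))
        solve-random S acc = solve-within 8≤Z m≤Z n≤Z d≤Z Ψ arity≤Z (separator S es) (kept S es)
          (length-separator {s = s m} {b m} {es} S es-length acc)
          (≤-trans (m≤m+n _ _) RK≤Z) (≤-trans (m≤n+m _ _) RK≤Z)
          (Allₚ.++⁻ʳ (separator S es) (↭ₚ.All-resp-↭ (↭-sym (split-of S)) (hypergraph-small 8≤Z m≤Z n≤Z Ψ)))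
          (isBalanced⁻ (kept S es) (kept-balanced S es-contains (kept S es) ↭-refl))
          where
          RK≤Z : length (separator S es) + length (kept S es) ≤ Z
          RK≤Z = ≤-trans (≤-reflexive (trans (sym (Listₚ.length-++ (separator S es)))
            (trans (↭ₚ.↭-length (split-of S)) (hypergraph-length 8≤Z m≤Z n≤Z Ψ)))) m≤Z

        vertices≤Z : length (vertices es) ≤ Z
        vertices≤Z = ≤-trans (vertices-length es (All.map proj₁ es-good)) (≤-trans (≤-reflexive (cong (_* r) es-length)) mr≤Z)

        attempt-time : ∀ S → Sample (vertices es) S →
          suc (2 * length (vertices es)) + suc (time (separationᵗ (s m) (b m) es S)) ≤ 1 * Z ^ 34
        attempt-time S (_ , len) = bound (plus 8≤Z
            (step 8≤Z (times 8≤Z (base 8≤Z {t = 2} (≤-trans (m≤m+n 2 6) 8≤Z)) (base 8≤Z vertices≤Z)))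
            (step 8≤Z (separation-within 8≤Z m≤Z n≤Z r≤Z es es-length es-good mr≤Z (s m) (b m) S (≤-trans len vertices≤Z))))

        t₁ t₂ t₃ total-time : ℕ
        t₁ = suc (time (hypergraphᵗ Ψ))
        t₂ = time (padAllᵗ r (value (hypergraphᵗ Ψ)))
        t₃ = time (verticesᵗ es)
        total-time = t₁ + (t₂ + (t₃ + 2 * (1 * Z ^ 34 + W * Z ^ 34)))

        total-within : Within Z W 40 total-time
        total-within = plus 8≤Z {i = 39} {j = 39}
          (relax 8≤Z (scale-by 8≤Z W (step 8≤Z (hypergraph-within 8≤Z m≤Z n≤Z Ψ arity≤Z))))
          (relax 8≤Z (plus 8≤Z {j = 37}
            (scale-by 8≤Z W (padAll-within 8≤Z m≤Z n≤Z r≤Z Ψ))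
            (plus 8≤Z {j = 36}
              (scale-by 8≤Z W (vertices-within 8≤Z m≤Z n≤Z r≤Z es es-length es-good mr≤Z))
              (times 8≤Z (base 8≤Z {t = 2} (≤-trans (m≤m+n 2 6) 8≤Z))
                (plus 8≤Z (scale-by 8≤Z W (within {D = 1} {34} ≤-refl)) (within {D = W} {34} ≤-refl))))))

      expected-time≤ : ∀ f i → r * m ≤ i → Time (seq (2^-1/ (suc r′)) i) (CSP-SAT-random (suc r′) (s m) (b m) f Ψ) ℚ.≤ ι total-time
      expected-time≤ f i rm≤i = ℚₚ.≤-trans
        (ℚₚ.+-monoʳ-≤ (ι t₁) (ℚₚ.+-monoʳ-≤ (ι t₂) (ℚₚ.+-monoʳ-≤ (ι t₃)
          (Time-sampleSeparator (approx-nonneg r′ i) (approx≤1 r′ i) {s m} {b m} {es} {vertices es} (rarely-rejects i rm≤i) _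
            {1 * Z ^ 34} {W * Z ^ 34} attempt-time
            (λ S acc → ℚₚ.≤-trans (ℚₚ.≤-reflexive (ℚₚ.+-identityʳ (ι (time (solveᵗ Ψ (separator S es , kept S es)))))) (ι-mono (bound (solve-random S acc))))
            ℚₚ.≤-refl f))))
        (ℚₚ.≤-reflexive (sym (trans (ι-+ t₁ _) (cong (ι t₁ ℚ.+_) (trans (ι-+ t₂ _) (cong (ι t₂ ℚ.+_) (ι-+ t₃ _)))))))

      random-time : d ≡ 2 → ∀ f → expectedTime (2^-1/ (suc r′)) (CSP-SAT-random (suc r′) (s m) (b m) f Ψ) ≤ 2 ^^ ((fromℕ 1 -ᴿ ε (suc r′)) *ᴿ fromℕ m +ᴿ fromℕ (g m))
      random-time d≡2 f = expectedTime-CSP-SAT-random-≤ (2^-1/ (suc r′)) (approx-nonneg r′) (approx≤1 r′) (suc r′) (s m) (b m) f Ψ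
        ((fromℕ 1 -ᴿ ε (suc r′)) *ᴿ fromℕ m +ᴿ fromℕ (g m)) total-time (x + 40 * a m) (r * m) (expected-time≤ f) total≤ exponent≤′
        where
        open ℕₚ.≤-Reasoning
        x : ℕ
        x = m ∸ w₀ + C m + (2 * b m + 1)
        lem : ∀ y C b a w r → suc (y + C + b + a + (w + (1 + 2 * r))) ≡ y + w + (C + b + a + (2 + 2 * r))
        lem = solve-∀
        total≤ : total-time ≤ 2 ^ (x + 40 * a m)
        total≤ = subst (λ D → total-time ≤ D ^ (x + 40 * a m)) d≡2
          (absorb {x = x} (≤-reflexive (sym d≡2)) (solve-exponent {2 * b m + 1} ≤-refl) total-within)
        exponent≤ : x + 40 * a m + (w₀ + (1 + 2 * r)) ≤ m + g m
        exponent≤ = begin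
          x + 40 * a m + (w₀ + (1 + 2 * r))                              ≤⟨ n≤1+n _ ⟩
          suc (x + 40 * a m + (w₀ + (1 + 2 * r)))                        ≡⟨ lem (m ∸ w₀) (C m) (2 * b m + 1) (40 * a m) w₀ r ⟩
          m ∸ w₀ + w₀ + G m                                              ≡⟨ cong (_+ G m) (m∸n+n≡m (w≤m 2≤r m)) ⟩
          m + G m                                                        ≤⟨ +-monoʳ-≤ m (m≤m+n (G m) (g₃ m)) ⟩
          m + g m                                                        ∎
        exponent≤′ : ∀ i → r * m ≤ i → ι (x + 40 * a m) ℚ.≤ seq ((fromℕ 1 -ᴿ ε (suc r′)) *ᴿ fromℕ m +ᴿ fromℕ (g m)) i
        exponent≤′ i rm≤i = exponent-linear m {x + 40 * a m} exponent≤ i (≤-trans (m≤m+n m (r′ * m)) rm≤i)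

theorem4p2 : (r : ℕ) → 2 ≤ r →
    (k : ℕ → ℕ) → (∀ m → 1 ≤ k m) → k ∈o[√m] →
    ∃ λ (s : ℕ → ℕ) → ∃ λ (b : ℕ → ℕ) → ∃ λ (g : ℕ → ℕ) →
    (b ∈o[m]) × (g ∈o[m]) ×
    (∀ m → fromℕ (s m) ≤ᴿ (fromℚ ½ -ᴿ ε r) *ᴿ fromℕ m +ᴿ fromℕ (g m)) ×
    (∀ (m d n : ℕ) → 1 ≤ m → 1 ≤ d →
    (Ψ : CSP m d n) → IsCSP (k m) Ψ → variableFrequency Ψ ≤ r →
    DeterministicallyDecides (s m) Ψ ×
    RandomlyDecides r (s m) (b m) Ψ ×
    (3 ≤ d →
    fromℕ (time (CSP-SAT-deterministic (s m) Ψ))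
    ≤ d ^^ ((fromℕ 1 -ᴿ ε r) *ᴿ fromℕ m +ᴿ fromℕ (g m))) ×
    (d ≡ 2 →
    (∀ f → expectedTime (2^-1/ r) (CSP-SAT-random r (s m) (b m) f Ψ)
    ≤ 2 ^^ ((fromℕ 1 -ᴿ ε r) *ᴿ fromℕ m +ᴿ fromℕ (g m))) ×
    (fromℕ (time (CSP-SAT-deterministic (s m) Ψ))
    ≤ 2 ^^ ((fromℕ 1 -ᴿ fromℕ 2 *ᴿ ε r ^ᴿ 2) *ᴿ fromℕ m +ᴿ fromℕ (g m)))))
theorem4p2 zero ()
theorem4p2 (suc r′) 2≤r k 1≤k k∈o =
  Parameters.s r′ k , Parameters.b r′ k , Parameters.g r′ k , Parameters.b∈o r′ k k∈o , Parameters.g∈o r′ k k∈o ,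
  Parameters.separator-size r′ k 2≤r 1≤k , λ m d n 1≤m 1≤d Ψ csp freq →
    Parameters.Instance.deterministically-decides r′ k 2≤r 1≤k 1≤m 1≤d Ψ csp freq ,
    Parameters.Instance.randomly-decides r′ k 2≤r 1≤k 1≤m 1≤d Ψ csp freq ,
    Parameters.Instance.deterministic-time r′ k 2≤r 1≤k 1≤m 1≤d Ψ csp freq , λ d≡2 →
    Parameters.Instance.random-time r′ k 2≤r 1≤k 1≤m 1≤d Ψ csp freq d≡2 ,
    Parameters.Instance.deterministic-time₂ r′ k 2≤r 1≤k 1≤m 1≤d Ψ csp freq d≡2
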